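{- There are an absolute constant $C>0$ and a polynomial-time algorithm that, given positive integers $f,k$ and an $n$-node graph $G=(V,E)$ with edge lengths $w:E\to\mathbb{R}_{\ge 0}$, outputs an $f$-edge fault tolerant $(2k-1)$-spanner $H$ of $G$ with $$|E(H)| \le \begin{cases} C\left(k^{5/2} f^{1/2-1/(2k)} n^{1+1/k} + k^2 fn\right) & \text{if } k \text{ is odd},\\ C\left(k^{5/2} f^{1/2} n^{1+1/k} + k^2 fn\right) & \text{if } k \text{ is even}.\end{cases}$$
   Context: Graphs are finite, undirected and simple, with nonnegative edge lengths $w$. For a graph $X$, $d_X(u,v)$ is the shortest-path distance with respect to $w$ (equal to $+\infty$ if $u,v$ are disconnected). A subgraph $H=(V,E')$ of $G=(V,E)$ (with inherited lengths) is an $f$-edge fault tolerant ($f$-EFT) $t$-spanner of $G$ if $d_{H\setminus F}(u,v)\le t\cdot d_{G\setminus F}(u,v)$ for all $u,v\in V$ and all $F\subseteq E$ with $|F|\le f$, where $X\setminus F$ denotes $X$ with the edges in $F$ removed. -}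

module Defs where

open import Level using (0ℓ)
open import Algebra.Bundles using (CommutativeRing; Semiring)
open import Algebra.Structures using (IsCommutativeRing)
import Algebra.Definitions.RawSemiring as RawSemiringDefs
import Algebra.Properties.Ring as RingProperties
open import Data.Bool.Base using (Bool; true; false; T; not; _∧_; if_then_else_)
open import Data.Bool.Properties using (T?)
open import Data.Fin.Base using (Fin; toℕ; fromℕ<)
import Data.Fin.Properties as Fin
open import Data.List.Base
  using (List; []; _∷_; [_]; map; concatMap; allFin; filter; filterᵇ; length;
         head; last; cartesianProduct)
import Data.List.Extrema as Extrema
open import Data.List.Relation.Unary.Linked using (Linked; linked?)
open import Data.List.Relation.Unary.Unique.Propositional using (Unique)
open import Data.List.Relation.Unary.Unique.DecPropositional using (unique?)
open import Data.Maybe.Base using (Maybe; just)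
import Data.Maybe.Properties as Maybe
open import Data.Nat.Base as ℕ using (ℕ; zero; suc; NonZero; _∸_; _≡ᵇ_; _≤ᵇ_; _<ᵇ_)
open import Data.Nat.Logarithm using (⌊log₂_⌋)
import Data.Nat.Properties as ℕ
open import Data.Product.Base using (Σ; ∃; _×_; _,_; proj₁; uncurry)
open import Data.Sum.Base using (inj₁; inj₂)
open import Relation.Binary.Bundles using (DecTotalOrder; TotalOrder)
import Relation.Binary.Construct.Add.Supremum.Equality as Equality⁺
import Relation.Binary.Construct.Add.Supremum.NonStrict as NonStrict⁺
open import Relation.Binary.Core using (Rel)
open import Relation.Binary.PropositionalEquality using (_≡_; refl; sym; cong; cong₂)
open import Relation.Binary.Structures using (IsDecTotalOrder)
open import Relation.Nullary using (¬_; Dec; yes; no; does)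
open import Relation.Nullary.Construct.Add.Supremum using (_⁺; ⊤⁺) renaming ([_] to fin)
open import Relation.Nullary.Decidable using (_×-dec_)

------------------------------------------------------------------------
-- Real numbers
--
-- The reals enter through their second-order characterisation: a
-- totally ordered field in which every inhabited predicate that is
-- bounded above has a least upper bound.  Up to isomorphism this is ℝ;
-- the decidability of the order is classically automatic.

record Reals : Set₁ where
  infix  4 _≈_ _≤_ _<_
  infixl 6 _+_
  infixl 7 _*_
  field
    Carrier           : Set
    _≈_ _≤_           : Rel Carrier 0ℓ
    _+_ _*_           : Carrier → Carrier → Carrier
    -_                : Carrier → Carrier
    0# 1#             : Carrier
    isCommutativeRing : IsCommutativeRing _≈_ _+_ _*_ -_ 0# 1#
    0≉1               : ¬ 0# ≈ 1#
    inverse           : ∀ x → ¬ x ≈ 0# → ∃ λ y → x * y ≈ 1#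
    isDecTotalOrder   : IsDecTotalOrder _≈_ _≤_
    +-monoˡ-≤         : ∀ z {x y} → x ≤ y → x + z ≤ y + z
    *-nonneg          : ∀ {x y} → 0# ≤ x → 0# ≤ y → 0# ≤ x * y

  UpperBound : (Carrier → Set) → Carrier → Set
  UpperBound P b = ∀ x → P x → x ≤ b

  IsSupremum : (Carrier → Set) → Carrier → Set
  IsSupremum P s = UpperBound P s × (∀ b → UpperBound P b → s ≤ b)

  field
    supremum : ∀ P → ∃ P → ∃ (UpperBound P) → ∃ (IsSupremum P)

  commutativeRing : CommutativeRing 0ℓ 0ℓ
  commutativeRing = record { isCommutativeRing = isCommutativeRing }

  decTotalOrder : DecTotalOrder 0ℓ 0ℓ 0ℓ
  decTotalOrder = record { isDecTotalOrder = isDecTotalOrder }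

  open DecTotalOrder decTotalOrder public
    using (_≤?_; total; totalOrder; ≤-resp-≈; ≤-respˡ-≈; ≤-respʳ-≈)
    renaming (refl to ≤-refl; trans to ≤-trans; reflexive to ≤-reflexive)

  private module R = CommutativeRing commutativeRing

  open RawSemiringDefs (Semiring.rawSemiring R.semiring) public using (_^_) renaming (_×_ to _×′_)

  _<_ : Rel Carrier 0ℓ
  x < y = ¬ y ≤ x

  infixl 6 _-_
  _-_ : Carrier → Carrier → Carrier
  x - y = x + (- y)

  fromℕ : ℕ → Carrier
  fromℕ n = n ×′ 1#

  private
    0≤x-y : ∀ {x y} → y ≤ x → 0# ≤ x - y
    0≤x-y {x} {y} y≤x = ≤-respˡ-≈ (R.-‿inverseʳ y) (+-monoˡ-≤ (- y) y≤x)

    y≤x : ∀ {x y} → 0# ≤ x - y → y ≤ x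
    y≤x {x} {y} p = ≤-respˡ-≈ (R.+-identityˡ y)
      (≤-respʳ-≈ (R.trans (R.+-assoc x (- y) y)
                   (R.trans (R.+-congˡ (R.-‿inverseˡ y)) (R.+-identityʳ x)))
        (+-monoˡ-≤ y p))

    open RingProperties R.ring using (-‿distribˡ-*; -‿distribʳ-*; -‿involutive)

    0≤1 : 0# ≤ 1#
    0≤1 with total 0# 1#
    ... | inj₁ p = p
    ... | inj₂ p = ≤-respʳ-≈ -1*-1 (*-nonneg 0≤-1 0≤-1)
      where
      0≤-1 : 0# ≤ - 1#
      0≤-1 = ≤-respʳ-≈ (R.+-identityˡ (- 1#)) (0≤x-y p)
      -1*-1 : (- 1#) * (- 1#) ≈ 1#
      -1*-1 = R.trans (R.sym (-‿distribˡ-* 1# (- 1#)))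
        (R.trans (R.-‿cong (R.*-identityˡ (- 1#))) (-‿involutive 1#))

    *-monoˡ : ∀ {x y z} → 0# ≤ z → x ≤ y → z * x ≤ z * y
    *-monoˡ {x} {y} {z} 0≤z x≤y = y≤x (≤-respʳ-≈ eq (*-nonneg 0≤z (0≤x-y x≤y)))
      where
      eq : z * (y - x) ≈ z * y - z * x
      eq = R.trans (R.distribˡ z y (- x)) (R.+-congˡ (R.sym (-‿distribʳ-* z x)))

    0≤fromℕ : ∀ n → 0# ≤ fromℕ n
    1≤1+fromℕ : ∀ n → 1# ≤ fromℕ (suc n)
    0≤fromℕ zero    = ≤-refl
    0≤fromℕ (suc n) = ≤-trans 0≤1 (1≤1+fromℕ n)
    1≤1+fromℕ n = ≤-respˡ-≈ (R.+-identityˡ 1#)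
      (≤-respʳ-≈ (R.+-comm (fromℕ n) 1#) (+-monoˡ-≤ 1# (0≤fromℕ n)))

    1≤^ : ∀ {y} m → 1# ≤ y → 1# ≤ y ^ m
    y≤^ : ∀ {y} m → 1# ≤ y → y ≤ y ^ suc m
    1≤^ zero    p = ≤-refl
    1≤^ (suc m) p = ≤-trans p (y≤^ m p)
    y≤^ {y} m p = ≤-respˡ-≈ (R.*-identityʳ y)
      (*-monoˡ (≤-trans 0≤1 p) (1≤^ m p))

    fromℕ≤1+ : ∀ n → fromℕ n ≤ fromℕ (suc n)
    fromℕ≤1+ n = ≤-respˡ-≈ (R.+-identityˡ _) (+-monoˡ-≤ (fromℕ n) 0≤1)

    rootBelow : ℕ → ℕ → Carrier → Set
    rootBelow q a y = 0# ≤ y × y ^ q ≤ fromℕ a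

    rootSup : ∀ q .{{_ : NonZero q}} a → ∃ (IsSupremum (rootBelow q a))
    rootSup q@(suc m) a = supremum (rootBelow q a)
      (0# , ≤-refl , ≤-respˡ-≈ (R.sym (R.zeroˡ (0# ^ m))) (0≤fromℕ a))
      (fromℕ (suc a) , bound)
      where
      bound : UpperBound (rootBelow q a) (fromℕ (suc a))
      bound y (_ , y^q≤a) with total y 1#
      ... | inj₁ y≤1 = ≤-trans y≤1 (1≤1+fromℕ a)
      ... | inj₂ 1≤y = ≤-trans (y≤^ m 1≤y) (≤-trans y^q≤a (fromℕ≤1+ a))

  -- The q-th root of a is sup { y ≥ 0 | y ^ q ≤ a }.
  root : ∀ q .{{_ : NonZero q}} → ℕ → Carrier
  root q a = proj₁ (rootSup q a)

  -- a ^[ p / q ] is the real number a^{p/q}.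
  _^[_/_] : ℕ → ℕ → ∀ q .{{_ : NonZero q}} → Carrier
  a ^[ p / q ] = root q a ^ p

------------------------------------------------------------------------
-- Finite simple graphs on the node set Fin n
--
-- A set of edges is represented by the simple graph it spans.

record Graph (n : ℕ) : Set where
  field
    adj         : Fin n → Fin n → Bool
    symmetric   : ∀ u v → adj u v ≡ adj v u
    irreflexive : ∀ u → adj u u ≡ false

  Adj : Rel (Fin n) 0ℓ
  Adj u v = T (adj u v)

open Graph public

module _ {n : ℕ} where

  infix 4 _⊆_
  _⊆_ : Rel (Graph n) 0ℓ
  X ⊆ Y = ∀ u v → Adj X u v → Adj Y u v

  infixl 6 _∖_
  _∖_ : Graph n → Graph n → Graph n
  X ∖ F = record
    { adj         = λ u v → adj X u v ∧ not (adj F u v)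
    ; symmetric   = λ u v → cong₂ (λ a b → a ∧ not b) (symmetric X u v) (symmetric F u v)
    ; irreflexive = λ u → cong (λ a → a ∧ not (adj F u u)) (irreflexive X u)
    }

  ∣E_∣ : Graph n → ℕ
  ∣E X ∣ = length (filterᵇ (uncurry λ u v → (toℕ u <ᵇ toℕ v) ∧ adj X u v)
                           (cartesianProduct (allFin n) (allFin n)))

  record IsPath (X : Graph n) (u v : Fin n) (p : List (Fin n)) : Set where
    constructor isPath
    field
      starts : head p ≡ just u
      ends   : last p ≡ just v
      linked : Linked (Adj X) p
      unique : Unique p

  isPath? : ∀ X u v p → Dec (IsPath X u v p)
  isPath? X u v p
    with Maybe.≡-dec Fin._≟_ (head p) (just u) ×-dec
         Maybe.≡-dec Fin._≟_ (last p) (just v) ×-dec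
         linked? (λ x y → T? (adj X x y)) p ×-dec unique? Fin._≟_ p
  ... | yes (s , e , l , d) = yes (isPath s e l d)
  ... | no  ¬p = no λ (isPath s e l d) → ¬p (s , e , l , d)

  nodeListsUpTo : ℕ → List (List (Fin n))
  nodeListsUpTo zero    = [ [] ]
  nodeListsUpTo (suc m) =
    [] ∷ concatMap (λ x → map (x ∷_) (nodeListsUpTo m)) (allFin n)

  -- This list is exhaustive, since a path does not repeat nodes.
  paths : Graph n → Fin n → Fin n → List (List (Fin n))
  paths X u v = filter (isPath? X u v) (nodeListsUpTo n)

------------------------------------------------------------------------
-- The programming language
--
-- Time is measured on the standard machine for graph algorithms with
-- real edge lengths (the comparison-addition model): a while language
-- over natural and real memory, where every assignment and every
-- evaluation of a test takes one unit of time.  Reals can only be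
-- copied, added, subtracted and compared.  Naturals have no unit-cost
-- multiplication, so that the bit length of the numbers stays bounded
-- by a polynomial in the input length and the running time, and unit
-- cost is polynomially equivalent to bit cost.  Memory consists of
-- numbered, unbounded two-dimensional arrays.

data Expr : Set where
  lit     : ℕ → Expr
  _[_,_]  : ℕ → Expr → Expr → Expr
  _⊕_ _⊖_ : Expr → Expr → Expr

data RealCell : Set where
  _[_,_]ʳ : ℕ → Expr → Expr → RealCell

data RealExpr : Set where
  get       : RealCell → RealExpr
  _⊕ʳ_ _⊖ʳ_ : RealCell → RealCell → RealExpr

data Test : Set where
  _≤ⁿ_ : Expr → Expr → Test
  _≤ʳ_ : RealCell → RealCell → Test
  neg  : Test → Test
  _&_  : Test → Test → Test

infixr 1 _⨾_
infix  2 _[_,_]:=_ _:=ʳ_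
data Program : Set where
  skip           : Program
  _[_,_]:=_      : ℕ → Expr → Expr → Expr → Program
  _:=ʳ_          : RealCell → RealExpr → Program
  _⨾_            : Program → Program → Program
  if_then_else′_ : Test → Program → Program → Program
  while_loop_    : Test → Program → Program

Memory : Set → Set
Memory A = (array row column : ℕ) → A

write : {A : Set} → Memory A → ℕ → ℕ → ℕ → A → Memory A
write M a i j x a′ i′ j′ =
  if (a ≡ᵇ a′) ∧ (i ≡ᵇ i′) ∧ (j ≡ᵇ j′) then x else M a′ i′ j′

-- Extends an n × n matrix to all indices by a default entry.
extend : ∀ {A : Set} {n} → A → (Fin n → Fin n → A) → ℕ → ℕ → A
extend {n = n} default M i j with i ℕ.<? n | j ℕ.<? n
... | yes i<n | yes j<n = M (fromℕ< i<n) (fromℕ< j<n)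
... | _       | _       = default

bit : Bool → ℕ
bit b = if b then 1 else 0

-- The number of nodes plus the bit lengths of f and k; the number of
-- edges is at most the square of this.
inputSize : (f k n : ℕ) → ℕ
inputSize f k n = n ℕ.+ (1 ℕ.+ ⌊log₂ f ⌋) ℕ.+ (1 ℕ.+ ⌊log₂ k ⌋)

module OverReals (ℝ : Reals) where

  open Reals ℝ

  record WeightedGraph (n : ℕ) : Set where
    field
      graph       : Graph n
      weight      : Fin n → Fin n → Carrier
      weight-sym  : ∀ u v → Adj graph u v → weight u v ≈ weight v u
      weight-nonneg : ∀ u v → Adj graph u v → 0# ≤ weight u v

  open WeightedGraph public

  open Equality⁺ _≈_ public using (_≈⁺_)
  open NonStrict⁺ _≤_ public using (_≤⁺_; ≤⁺-isTotalOrder)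

  totalOrder⁺ : TotalOrder 0ℓ 0ℓ 0ℓ
  totalOrder⁺ = record
    { isTotalOrder = ≤⁺-isTotalOrder (TotalOrder.isTotalOrder totalOrder) }

  infixl 7 _*⁺_
  _*⁺_ : Carrier → Carrier ⁺ → Carrier ⁺
  t *⁺ fin x = fin (t * x)
  t *⁺ ⊤⁺    = ⊤⁺

  module _ {n : ℕ} (w : Fin n → Fin n → Carrier) where

    pathLength : List (Fin n) → Carrier
    pathLength []              = 0#
    pathLength (u ∷ [])        = 0#
    pathLength (u ∷ p@(v ∷ _)) = w u v + pathLength p

    dist : Graph n → Fin n → Fin n → Carrier ⁺
    dist X u v = Extrema.min totalOrder⁺ ⊤⁺
      (map (λ p → fin (pathLength p)) (paths X u v))

  record IsEFTSpanner {n} (f : ℕ) (t : Carrier) (G : WeightedGraph n)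
                      (H : Graph n) : Set where
    field
      subgraph : H ⊆ graph G
      spans    : ∀ u v F → F ⊆ graph G → ∣E F ∣ ℕ.≤ f →
                 dist (weight G) (H ∖ F) u v ≤⁺ t *⁺ dist (weight G) (graph G ∖ F) u v

  record State : Set where
    constructor state
    field
      nat  : Memory ℕ
      real : Memory Carrier

  open State public

  ⟦_⟧ : Expr → State → ℕ
  ⟦ lit m ⟧       s = m
  ⟦ a [ i , j ] ⟧ s = nat s a (⟦ i ⟧ s) (⟦ j ⟧ s)
  ⟦ d ⊕ e ⟧       s = ⟦ d ⟧ s ℕ.+ ⟦ e ⟧ s
  ⟦ d ⊖ e ⟧       s = ⟦ d ⟧ s ∸ ⟦ e ⟧ s

  ⟦_⟧ᶜ : RealCell → State → Carrier
  ⟦ a [ i , j ]ʳ ⟧ᶜ s = real s a (⟦ i ⟧ s) (⟦ j ⟧ s)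

  ⟦_⟧ʳ : RealExpr → State → Carrier
  ⟦ get x ⟧ʳ  s = ⟦ x ⟧ᶜ s
  ⟦ x ⊕ʳ y ⟧ʳ s = ⟦ x ⟧ᶜ s + ⟦ y ⟧ᶜ s
  ⟦ x ⊖ʳ y ⟧ʳ s = ⟦ x ⟧ᶜ s - ⟦ y ⟧ᶜ s

  ⟦_⟧ᵗ : Test → State → Bool
  ⟦ d ≤ⁿ e ⟧ᵗ s = ⟦ d ⟧ s ≤ᵇ ⟦ e ⟧ s
  ⟦ x ≤ʳ y ⟧ᵗ s = does (⟦ x ⟧ᶜ s ≤? ⟦ y ⟧ᶜ s)
  ⟦ neg b ⟧ᵗ  s = not (⟦ b ⟧ᵗ s)
  ⟦ b & c ⟧ᵗ  s = ⟦ b ⟧ᵗ s ∧ ⟦ c ⟧ᵗ s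

  -- ⟨ P , s ⟩⇓⟨ s′ , t ⟩: started in state s, the program P halts in
  -- state s′ after t units of time.
  infix 4 ⟨_,_⟩⇓⟨_,_⟩
  data ⟨_,_⟩⇓⟨_,_⟩ : Program → State → State → ℕ → Set where
    skip : ∀ {s} → ⟨ skip , s ⟩⇓⟨ s , 0 ⟩
    assign : ∀ {s a i j e} →
      ⟨ a [ i , j ]:= e , s ⟩⇓⟨ state (write (nat s) a (⟦ i ⟧ s) (⟦ j ⟧ s) (⟦ e ⟧ s)) (real s) , 1 ⟩
    assignʳ : ∀ {s a i j e} →
      ⟨ a [ i , j ]ʳ :=ʳ e , s ⟩⇓⟨ state (nat s) (write (real s) a (⟦ i ⟧ s) (⟦ j ⟧ s) (⟦ e ⟧ʳ s)) , 1 ⟩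
    seq : ∀ {P Q s s′ s″ t t′} →
      ⟨ P , s ⟩⇓⟨ s′ , t ⟩ → ⟨ Q , s′ ⟩⇓⟨ s″ , t′ ⟩ → ⟨ P ⨾ Q , s ⟩⇓⟨ s″ , t ℕ.+ t′ ⟩
    if-true : ∀ {b P Q s s′ t} → ⟦ b ⟧ᵗ s ≡ true →
      ⟨ P , s ⟩⇓⟨ s′ , t ⟩ → ⟨ if b then P else′ Q , s ⟩⇓⟨ s′ , suc t ⟩
    if-false : ∀ {b P Q s s′ t} → ⟦ b ⟧ᵗ s ≡ false →
      ⟨ Q , s ⟩⇓⟨ s′ , t ⟩ → ⟨ if b then P else′ Q , s ⟩⇓⟨ s′ , suc t ⟩
    while-true : ∀ {b P s s′ s″ t t′} → ⟦ b ⟧ᵗ s ≡ true →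
      ⟨ P , s ⟩⇓⟨ s′ , t ⟩ → ⟨ while b loop P , s′ ⟩⇓⟨ s″ , t′ ⟩ →
      ⟨ while b loop P , s ⟩⇓⟨ s″ , suc (t ℕ.+ t′) ⟩
    while-false : ∀ {b P s} → ⟦ b ⟧ᵗ s ≡ false → ⟨ while b loop P , s ⟩⇓⟨ s , 1 ⟩

  -- Initial memory.  Natural arrays 0, 1 and 2 hold n, f and k in their
  -- entry (0 , 0), natural array 3 holds the adjacency matrix and real
  -- array 0 the edge lengths; everything else is zero.
  input : ∀ {n} (f k : ℕ) → WeightedGraph n → State
  input {n} f k G = state natInput realInput
    where
    natInput : Memory ℕ
    natInput 0 0 0 = n
    natInput 1 0 0 = f
    natInput 2 0 0 = k
    natInput 3 i j = extend 0 (λ u v → bit (adj (graph G) u v)) i j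
    natInput _ _ _ = 0

    realInput : Memory Carrier
    realInput 0 i j = extend 0# (λ u v → if adj (graph G) u v then weight G u v else 0#) i j
    realInput _ _ _ = 0#

  -- The output is the adjacency matrix in natural array 4.
  Outputs : ∀ {n} → State → Graph n → Set
  Outputs s H = ∀ u v → nat s 4 (toℕ u) (toℕ v) ≡ bit (adj H u v)

module Submission where

-- If f or k is at least n, then G itself is small enough.  Otherwise the
-- edges (u , v) are scanned by increasing length, and (u , v) is dropped
-- if for every set of f faults some walk from u to v with at most 2k - 1
-- edges of the current spanner survives.  Multiplicative weights decide
-- this up to a constant factor.  As long as some short walk is light,
-- carrying less than a fraction 1/(8f) of the total weight, the weights
-- on it are doubled.  If this goes on for 4f n² rounds, then no 2f
-- directed edges meet all the short walks, since the product of their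
-- weights would be too large.  Otherwise the weights form a fractional
-- cut of the short walks of size 8f, and the edge is added.
--
-- To bound the number m of edges, keep for every edge e the cut found at
-- its insertion, and consider walks of length k that alternately step to
-- one of the next D newer and one of the next D older edges at the
-- current vertex, where D is about m / (k n).  There are about m D^(k-1)
-- of them, and in most of them the edges e carry little weight of each
-- other's cuts.  Among these good walks between two given vertices take
-- one whose latest edge e is as late as possible.  Any other one closes
-- it up to a short closed walk through e, so it must carry much of the
-- cut of e.  Splitting the walks at the edges in that cut, one finds by
-- induction on the length that their number is at most about L^⌊k/2⌋,
-- where L is proportional to k³ f.

open import Defs using (bit)
open import Algebra.Bundles using (CommutativeRing; CommutativeSemiring)
import Algebra.Properties.CommutativeSemiring.Exp as CExp
import Algebra.Properties.Ring as RingProperties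
import Algebra.Properties.Semiring.Exp as Exp
import Algebra.Properties.Semiring.Mult as Mult
open import Data.Bool.Base using (Bool; true; false; T; not; _∧_; if_then_else_)
open import Data.Bool.Properties using (T?; ∧-zeroʳ)
open import Data.Empty using (⊥-elim)
import Data.Empty.Irrelevant as Irrelevant
open import Data.Fin.Base using (Fin; toℕ; fromℕ<; combine)
import Data.Fin.Properties as Fin
open import Data.List.Base
  using (List; []; _∷_; _++_; map; concatMap; allFin; tabulate; length; lookup; filterᵇ; cartesianProduct)
import Data.List.Extrema as Extrema
import Data.List.Membership.DecPropositional as Membership
open import Data.List.Membership.Propositional using (_∈_)
open import Data.List.Membership.Propositional.Properties
  using (∈-allFin; ∈-++⁺ˡ; ∈-++⁺ʳ; ∈-++⁻; ∈-map⁺; ∈-map⁻; ∈-filter⁺; ∈-filter⁻; ∈-concatMap⁺; ∈-lookup; ∈-cartesianProduct⁺)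
open import Data.List.Properties
  using (++-assoc; length-++; length-map; length-tabulate; length-filter)
open import Data.List.Relation.Unary.All as All using (All; []; _∷_)
import Data.List.Relation.Unary.All.Properties as All
open import Data.List.Relation.Unary.AllPairs using ([]; _∷_)
open import Data.List.Relation.Unary.Any as Any using (Any; here; there)
open import Data.List.Relation.Unary.Any.Properties using (lookup-index)
open import Data.List.Relation.Unary.Linked as Linked using (Linked; []; [-]; _∷_)
open import Data.List.Relation.Unary.Unique.Propositional using (Unique)
import Data.List.Relation.Unary.Unique.Propositional.Properties as Unique
open import Data.Nat.Base as ℕ using (ℕ; NonZero; zero; suc; z≤n; s≤s; ⌊_/2⌋; >-nonZero; _∸_; _⊔_; _≡ᵇ_; _<ᵇ_; _≤ᵇ_)
open import Data.Nat.Divisibility using (_∣_; divides)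
open import Data.Nat.DivMod using (m/n*n≤m; m/n≤m; /-monoˡ-≤; m*n/n≡m; m≡m%n+[m/n]*n; m%n<n)
open import Data.Nat.Logarithm using (⌊log₂_⌋)
open import Data.Nat.Properties using (m*n≢0)
import Data.Nat.Properties as ℕ
open import Data.Nat.Tactic.RingSolver using (solve-∀)
open import Data.Product.Base using (Σ; ∃; _×_; _,_; proj₁; proj₂; uncurry; swap)
import Data.Product.Properties as Product
open import Data.Sum.Base using (_⊎_; inj₁; inj₂)
open import Data.Unit.Base using (tt)
open import Function.Base using (_∘_; id)
open import Relation.Binary.Bundles using (TotalOrder; DecTotalOrder)
import Relation.Binary.Construct.Add.Supremum.NonStrict as NonStrict⁺
open import Relation.Binary.Definitions using (tri<; tri≈; tri>)
open import Relation.Binary.PropositionalEquality as ≡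
  using (_≡_; refl; sym; trans; cong; cong₂; subst; subst₂; module ≡-Reasoning)
open import Relation.Nullary using (¬_; Dec; yes; no; does)
open import Relation.Nullary.Construct.Add.Supremum using (⊤⁺) renaming ([_] to fin)
open import Relation.Nullary.Decidable using (_×-dec_; _⊎-dec_)

-- Deciding exactly whether `f` faults meet all short walks is a length-bounded cut problem, which
-- is hard in general. The gap between `2f` directed edges (two per fault) and a fractional cut of
-- size `8f` makes it tractable: dropping an edge relies on the absence of the former, the counting
-- on the presence of the latter.
--
-- Alternating newer and older steps put the latest edge of a walk in an even position. A split
-- there turns the length `l` into an odd `x` and some `y` with `⌊l/2⌋ = 1 + ⌊x/2⌋ + ⌊y/2⌋`, so one
-- factor `L` pays for it; this rounding separates odd `k` from even `k`. The three factors `k` in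
-- `L` pay for the two ends of the subwalk that is split and for the place of a cut edge on a
-- parallel walk; weights `(l+1)²` in the counts make the sum over all splits cost only a constant.
-- As `D` is about `m/(kn)`, the bound `n² L^⌊k/2⌋` on `m D^(k-1)` gives `m` the factor
-- `k · k^(3/2)`. The term `k² f n` covers the case that `D` is below a multiple of `k f`, where too
-- many walks could meet their own cuts.

module Sums where
  open import Data.Fin.Base using (zero; suc)
  open import Data.List.Base using ([_])
  open import Data.Nat.Base using (_+_; _*_; _^_; _≤_; _<_; _/_)
  open import Data.Nat.Properties

  private variable
    A B : Set

  -- Finite sums and indicators

  ∑ : List A → (A → ℕ) → ℕ
  ∑ []       f = 0
  ∑ (x ∷ xs) f = f x + ∑ xs f

  ∑-mono∈ : (xs : List A) {f g : A → ℕ} → (∀ x → x ∈ xs → f x ≤ g x) → ∑ xs f ≤ ∑ xs g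
  ∑-mono∈ []       h = z≤n
  ∑-mono∈ (x ∷ xs) h = +-mono-≤ (h x (here refl)) (∑-mono∈ xs (λ y y∈ → h y (there y∈)))

  ∑-mono : (xs : List A) {f g : A → ℕ} → (∀ x → f x ≤ g x) → ∑ xs f ≤ ∑ xs g
  ∑-mono xs h = ∑-mono∈ xs (λ x _ → h x)

  ∑-cong∈ : (xs : List A) {f g : A → ℕ} → (∀ x → x ∈ xs → f x ≡ g x) → ∑ xs f ≡ ∑ xs g
  ∑-cong∈ []       h = refl
  ∑-cong∈ (x ∷ xs) h = cong₂ _+_ (h x (here refl)) (∑-cong∈ xs (λ y y∈ → h y (there y∈)))

  ∑-cong : (xs : List A) {f g : A → ℕ} → (∀ x → f x ≡ g x) → ∑ xs f ≡ ∑ xs g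
  ∑-cong xs h = ∑-cong∈ xs (λ x _ → h x)

  ∑-++ : (xs ys : List A) {f : A → ℕ} → ∑ (xs ++ ys) f ≡ ∑ xs f + ∑ ys f
  ∑-++ []       ys         = refl
  ∑-++ (x ∷ xs) ys {f} = trans (cong (f x +_) (∑-++ xs ys)) (sym (+-assoc (f x) _ _))

  ∑-map : (h : A → B) (xs : List A) {f : B → ℕ} → ∑ (map h xs) f ≡ ∑ xs (f ∘ h)
  ∑-map h []           = refl
  ∑-map h (x ∷ xs) {f} = cong (f (h x) +_) (∑-map h xs)

  ∑-concatMap : (h : A → List B) (xs : List A) {f : B → ℕ} →
    ∑ (concatMap h xs) f ≡ ∑ xs (λ x → ∑ (h x) f)
  ∑-concatMap h []           = refl
  ∑-concatMap h (x ∷ xs) {f} = trans (∑-++ (h x) (concatMap h xs)) (cong (∑ (h x) f +_) (∑-concatMap h xs))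

  +-interchange : ∀ a b c d → (a + b) + (c + d) ≡ (a + c) + (b + d)
  +-interchange a b c d = begin
    (a + b) + (c + d) ≡⟨ +-assoc a b (c + d) ⟩
    a + (b + (c + d)) ≡⟨ cong (a +_) (sym (+-assoc b c d)) ⟩
    a + ((b + c) + d) ≡⟨ cong (λ z → a + (z + d)) (+-comm b c) ⟩
    a + ((c + b) + d) ≡⟨ cong (a +_) (+-assoc c b d) ⟩
    a + (c + (b + d)) ≡⟨ sym (+-assoc a c (b + d)) ⟩
    (a + c) + (b + d) ∎
    where open ≡-Reasoning

  ∑-+ : (xs : List A) {f g : A → ℕ} → ∑ xs (λ x → f x + g x) ≡ ∑ xs f + ∑ xs g
  ∑-+ []               = refl
  ∑-+ (x ∷ xs) {f} {g} = trans (cong (f x + g x +_) (∑-+ xs)) (+-interchange (f x) (g x) _ _)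

  ∑-*ˡ : (c : ℕ) (xs : List A) {f : A → ℕ} → ∑ xs (λ x → c * f x) ≡ c * ∑ xs f
  ∑-*ˡ c []           = sym (*-zeroʳ c)
  ∑-*ˡ c (x ∷ xs) {f} = trans (cong (c * f x +_) (∑-*ˡ c xs)) (sym (*-distribˡ-+ c (f x) _))

  ∑-*ʳ : (c : ℕ) (xs : List A) {f : A → ℕ} → ∑ xs (λ x → f x * c) ≡ ∑ xs f * c
  ∑-*ʳ c xs {f} = trans (∑-cong xs (λ x → *-comm (f x) c)) (trans (∑-*ˡ c xs) (*-comm c _))

  ∑-zero : (xs : List A) → ∑ xs (λ _ → 0) ≡ 0
  ∑-zero []       = refl
  ∑-zero (x ∷ xs) = ∑-zero xs

  ∑-const : (c : ℕ) (xs : List A) → ∑ xs (λ _ → c) ≡ length xs * c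
  ∑-const c []       = refl
  ∑-const c (x ∷ xs) = cong (c +_) (∑-const c xs)

  ∑-swap : (xs : List A) (ys : List B) {f : A → B → ℕ} →
    ∑ xs (λ x → ∑ ys (f x)) ≡ ∑ ys (λ y → ∑ xs (λ x → f x y))
  ∑-swap []       ys         = sym (∑-zero ys)
  ∑-swap (x ∷ xs) ys {f} = trans (cong (∑ ys (f x) +_) (∑-swap xs ys)) (sym (∑-+ ys))

  ∑-∈ : {xs : List A} {x : A} (f : A → ℕ) → x ∈ xs → f x ≤ ∑ xs f
  ∑-∈ f (here refl) = m≤m+n _ _
  ∑-∈ f (there x∈)  = ≤-trans (∑-∈ f x∈) (m≤n+m _ _)

  bit≤1 : ∀ b → bit b ≤ 1
  bit≤1 true  = ≤-refl
  bit≤1 false = z≤n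

  bit-T : ∀ {b} → T b → bit b ≡ 1
  bit-T {true} _ = refl

  𝟙 : {P : Set} → Dec P → ℕ
  𝟙 d = bit (does d)

  𝟙-yes : {P : Set} (d : Dec P) → P → 𝟙 d ≡ 1
  𝟙-yes (yes _) p = refl
  𝟙-yes (no ¬p) p = ⊥-elim (¬p p)

  𝟙-no : {P : Set} (d : Dec P) → ¬ P → 𝟙 d ≡ 0
  𝟙-no (yes p) ¬p = ⊥-elim (¬p p)
  𝟙-no (no _)  ¬p = refl

  𝟙≤1 : {P : Set} (d : Dec P) → 𝟙 d ≤ 1
  𝟙≤1 d = bit≤1 (does d)

  𝟙≢0 : {P : Set} (d : Dec P) → ¬ 𝟙 d ≡ 0 → P
  𝟙≢0 (yes p) _ = p
  𝟙≢0 (no ¬p) h = ⊥-elim (h refl)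

  *≢0ˡ : ∀ {m n} → ¬ m * n ≡ 0 → ¬ m ≡ 0
  *≢0ˡ h refl = h refl

  *≢0ʳ : ∀ {m n} → ¬ m * n ≡ 0 → ¬ n ≡ 0
  *≢0ʳ {m} h refl = h (*-zeroʳ m)

  -- Lets a bound be proved under the event whose indicator is `c`.
  ≤-support : ∀ {a b c} → (¬ c ≡ 0 → a ≤ b) → c * a ≤ c * b
  ≤-support {c = zero}  h = z≤n
  ≤-support {c = suc c} h = *-monoʳ-≤ (suc c) (h λ ())

  module Words (as : List A) where

    words : ℕ → List (List A)
    words zero    = [] ∷ []
    words (suc l) = concatMap (λ a → map (a ∷_) (words l)) as

    ∑-words-suc : ∀ l {f : List A → ℕ} →
      ∑ (words (suc l)) f ≡ ∑ as (λ a → ∑ (words l) (λ w → f (a ∷ w)))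
    ∑-words-suc l = trans (∑-concatMap _ as) (∑-cong as (λ a → ∑-map (a ∷_) (words l)))

    length-words : ∀ l {w} → w ∈ words l → length w ≡ l
    length-words zero    (here refl) = refl
    length-words (suc l) {w} w∈ = go as w∈
      where
      inner : ∀ a ws → (∀ {v} → v ∈ ws → length v ≡ l) → ∀ {w} → w ∈ map (a ∷_) ws → length w ≡ suc l
      inner a (v ∷ ws) h (here refl) = cong suc (h (here refl))
      inner a (v ∷ ws) h (there w∈)  = inner a ws (h ∘ there) w∈
      split : ∀ (xs ys : List (List A)) {w} → w ∈ xs ++ ys → w ∈ xs ⊎ w ∈ ys
      split []       ys w∈         = inj₂ w∈
      split (x ∷ xs) ys (here e)   = inj₁ (here e)
      split (x ∷ xs) ys (there w∈) with split xs ys w∈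
      ... | inj₁ p = inj₁ (there p)
      ... | inj₂ p = inj₂ p
      go : ∀ bs {w} → w ∈ concatMap (λ a → map (a ∷_) (words l)) bs → length w ≡ suc l
      go (b ∷ bs) w∈ with split (map (b ∷_) (words l)) _ w∈
      ... | inj₁ p = inner b (words l) (length-words l) p
      ... | inj₂ p = go bs p

  -- Sums over the splits of a word

  cuts : List A → (List A → List A → ℕ) → ℕ
  cuts []      f = f [] []
  cuts (a ∷ w) f = f [] (a ∷ w) + cuts w (λ u v → f (a ∷ u) v)

  conv : ℕ → (ℕ → ℕ → ℕ) → ℕ
  conv zero    F = F 0 0
  conv (suc k) F = F 0 (suc k) + conv k (λ x y → F (suc x) y)

  -- heavies p w f sums f u e v over all w = u ++ e ∷ v such that e is in
  -- an even position (counting from 1); the flag tells whether the first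
  -- position counts as even.
  heavies : Bool → List A → (List A → A → List A → ℕ) → ℕ
  heavies p     []      f = 0
  heavies false (a ∷ w) f = heavies true w (λ u → f (a ∷ u))
  heavies true  (e ∷ w) f = f [] e w + heavies false w (λ u → f (e ∷ u))

  -- The counterpart of `conv` for `heavies`: the letter at the split belongs to neither side, so
  -- the two lengths add up to `k - 1`.
  hconv : Bool → ℕ → (ℕ → ℕ → ℕ) → ℕ
  hconv p     zero    F = 0
  hconv false (suc k) F = hconv true k (λ x y → F (suc x) y)
  hconv true  (suc k) F = F 0 k + hconv false k (λ x y → F (suc x) y)

  module _ (as : List A) where
    open Words as

    -- A word together with a split is a pair of words, so the sum can be organised by the two
    -- lengths.
    ∑-cuts : ∀ k {f : List A → List A → ℕ} →
      ∑ (words k) (λ w → cuts w f) ≡ conv k (λ x y → ∑ (words x) (λ u → ∑ (words y) (λ v → f u v)))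
    ∑-cuts zero {f} = trans (+-identityʳ _) (sym (trans (+-identityʳ _) (+-identityʳ _)))
    ∑-cuts (suc k) {f} = begin
      ∑ (words (suc k)) (λ w → cuts w f)
        ≡⟨ ∑-words-suc k ⟩
      ∑ as (λ a → ∑ (words k) (λ w → f [] (a ∷ w) + cuts w (λ u v → f (a ∷ u) v)))
        ≡⟨ ∑-cong as (λ a → ∑-+ (words k)) ⟩
      ∑ as (λ a → ∑ (words k) (λ w → f [] (a ∷ w)) + ∑ (words k) (λ w → cuts w (λ u v → f (a ∷ u) v)))
        ≡⟨ ∑-+ as ⟩
      ∑ as (λ a → ∑ (words k) (λ w → f [] (a ∷ w))) + ∑ as (λ a → ∑ (words k) (λ w → cuts w (λ u v → f (a ∷ u) v)))
        ≡⟨ cong₂ _+_ (trans (sym (∑-words-suc k {f []})) (sym (+-identityʳ _))) (∑-cong as (λ a → ∑-cuts k)) ⟩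
      (∑ (words (suc k)) (f []) + 0) + ∑ as (λ a → conv k (λ x y → ∑ (words x) (λ u → ∑ (words y) (λ v → f (a ∷ u) v))))
        ≡⟨ cong (∑ (words (suc k)) (f []) + 0 +_) (pull k _) ⟩
      (∑ (words (suc k)) (f []) + 0) + conv k (λ x y → ∑ as (λ a → ∑ (words x) (λ u → ∑ (words y) (λ v → f (a ∷ u) v))))
        ≡⟨ cong (∑ (words (suc k)) (f []) + 0 +_) (conv-cong k (λ x y → sym (∑-words-suc x {λ u → ∑ (words y) (f u)}))) ⟩
      conv (suc k) (λ x y → ∑ (words x) (λ u → ∑ (words y) (λ v → f u v))) ∎
      where
      open ≡-Reasoning
      conv-cong : ∀ k {F G : ℕ → ℕ → ℕ} → (∀ x y → F x y ≡ G x y) → conv k F ≡ conv k G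
      conv-cong zero    h = h 0 0
      conv-cong (suc k) h = cong₂ _+_ (h 0 (suc k)) (conv-cong k (λ x y → h (suc x) y))
      pull : ∀ k (F : A → ℕ → ℕ → ℕ) → ∑ as (λ a → conv k (F a)) ≡ conv k (λ x y → ∑ as (λ a → F a x y))
      pull zero    F = refl
      pull (suc k) F = trans (∑-+ as) (cong (∑ as (λ a → F a 0 (suc k)) +_) (pull k (λ a x y → F a (suc x) y)))

    ∑-heavies : ∀ p k {f : List A → A → List A → ℕ} →
      ∑ (words k) (λ w → heavies p w f) ≡
      hconv p k (λ x y → ∑ (words x) (λ u → ∑ as (λ e → ∑ (words y) (λ v → f u e v))))
    ∑-heavies p zero = refl
    ∑-heavies p (suc k) {f} = trans (∑-words-suc k) (go p)
      where
      open ≡-Reasoning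
      H : (List A → A → List A → ℕ) → ℕ → ℕ → ℕ
      H f x y = ∑ (words x) (λ u → ∑ as (λ e → ∑ (words y) (λ v → f u e v)))
      hconv-cong : ∀ p k {F G : ℕ → ℕ → ℕ} → (∀ x y → F x y ≡ G x y) → hconv p k F ≡ hconv p k G
      hconv-cong p     zero    h = refl
      hconv-cong false (suc k) h = hconv-cong true k (λ x y → h (suc x) y)
      hconv-cong true  (suc k) h = cong₂ _+_ (h 0 k) (hconv-cong false k (λ x y → h (suc x) y))
      pull : ∀ p k (F : A → ℕ → ℕ → ℕ) → ∑ as (λ a → hconv p k (F a)) ≡ hconv p k (λ x y → ∑ as (λ a → F a x y))
      pull p     zero    F = ∑-zero as
      pull false (suc k) F = pull true k (λ a x y → F a (suc x) y)
      pull true  (suc k) F = trans (∑-+ as) (cong (∑ as (λ a → F a 0 k) +_) (pull false k (λ a x y → F a (suc x) y)))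
      rest : ∀ q → ∑ as (λ a → ∑ (words k) (λ w → heavies q w (λ u → f (a ∷ u)))) ≡ hconv q k (λ x y → H f (suc x) y)
      rest q = begin
        ∑ as (λ a → ∑ (words k) (λ w → heavies q w (λ u → f (a ∷ u))))
          ≡⟨ ∑-cong as (λ a → ∑-heavies q k) ⟩
        ∑ as (λ a → hconv q k (H (λ u → f (a ∷ u))))
          ≡⟨ pull q k (λ a → H (λ u → f (a ∷ u))) ⟩
        hconv q k (λ x y → ∑ as (λ a → H (λ u → f (a ∷ u)) x y))
          ≡⟨ hconv-cong q k (λ x y → sym (∑-words-suc x {λ u → ∑ as (λ e → ∑ (words y) (f u e))})) ⟩
        hconv q k (λ x y → H f (suc x) y) ∎
      go : ∀ p → ∑ as (λ a → ∑ (words k) (λ w → heavies p (a ∷ w) f)) ≡ hconv p (suc k) (H f)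
      go false = rest true
      go true  = begin
        ∑ as (λ a → ∑ (words k) (λ w → f [] a w + heavies false w (λ u → f (a ∷ u))))
          ≡⟨ ∑-cong as (λ a → ∑-+ (words k)) ⟩
        ∑ as (λ a → ∑ (words k) (λ w → f [] a w) + ∑ (words k) (λ w → heavies false w (λ u → f (a ∷ u))))
          ≡⟨ ∑-+ as ⟩
        ∑ as (λ a → ∑ (words k) (λ w → f [] a w)) + ∑ as (λ a → ∑ (words k) (λ w → heavies false w (λ u → f (a ∷ u))))
          ≡⟨ cong₂ _+_ (sym (+-identityʳ _)) (rest false) ⟩
        hconv true (suc k) (H f) ∎

  cuts-∋ : (f : List A → List A → ℕ) → ∀ u v → f u v ≤ cuts (u ++ v) f
  cuts-∋ f []      []      = ≤-refl
  cuts-∋ f []      (a ∷ v) = m≤m+n _ _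
  cuts-∋ f (a ∷ u) v       = ≤-trans (cuts-∋ (λ u → f (a ∷ u)) u v) (m≤n+m _ _)

  conv-mono : ∀ k {F G : ℕ → ℕ → ℕ} → (∀ x y → x + y ≡ k → F x y ≤ G x y) → conv k F ≤ conv k G
  conv-mono zero    h = h 0 0 refl
  conv-mono (suc k) h = +-mono-≤ (h 0 (suc k) refl) (conv-mono k (λ x y e → h (suc x) y (cong suc e)))

  data Odd : ℕ → Set
  data Even : ℕ → Set
  data Odd where
    suc : ∀ {n} → Even n → Odd (suc n)
  data Even where
    zero : Even zero
    suc  : ∀ {n} → Odd n → Even (suc n)

  Heavy : Bool → ℕ → Set
  Heavy false x = Odd x
  Heavy true  x = Even x

  hconv-mono : ∀ p k {F G : ℕ → ℕ → ℕ} →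
    (∀ x y → suc (x + y) ≡ k → Heavy p x → F x y ≤ G x y) → hconv p k F ≤ hconv p k G
  hconv-mono p     zero    h = z≤n
  hconv-mono false (suc k) h = hconv-mono true k (λ x y e ev → h (suc x) y (cong suc e) (suc ev))
  hconv-mono true  (suc k) h = +-mono-≤ (h 0 k refl zero)
    (hconv-mono false k (λ x y e od → h (suc x) y (cong suc e) (suc od)))

  heavies-mono : ∀ p (w : List A) {f g : List A → A → List A → ℕ} →
    (∀ u e v → w ≡ u ++ e ∷ v → Heavy p (length u) → f u e v ≤ g u e v) → heavies p w f ≤ heavies p w g
  heavies-mono p     []      h = z≤n
  heavies-mono false (a ∷ w) h = heavies-mono true w (λ u e v eq od → h (a ∷ u) e v (cong (a ∷_) eq) (suc od))
  heavies-mono true  (a ∷ w) h = +-mono-≤ (h [] a w refl zero)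
    (heavies-mono false w (λ u e v eq od → h (a ∷ u) e v (cong (a ∷_) eq) (suc od)))

  heavies-∋ : ∀ p (f : List A → A → List A → ℕ) u e v → Heavy p (length u) → f u e v ≤ heavies p (u ++ e ∷ v) f
  heavies-∋ true  f []      e v h        = m≤m+n _ _
  heavies-∋ false f (a ∷ u) e v (suc h)  = heavies-∋ true (λ u → f (a ∷ u)) u e v h
  heavies-∋ true  f (a ∷ u) e v (suc h)  = ≤-trans (heavies-∋ false (λ u → f (a ∷ u)) u e v h) (m≤n+m _ _)

  heavies-≢0 : ∀ p (w : List A) (f : List A → A → List A → ℕ) → ¬ heavies p w f ≡ 0 →
    ∃ λ u → ∃ λ e → ∃ λ v → w ≡ u ++ e ∷ v × Heavy p (length u) × ¬ f u e v ≡ 0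
  heavies-≢0 p     []      f h = ⊥-elim (h refl)
  heavies-≢0 false (a ∷ w) f h with heavies-≢0 true w (λ u → f (a ∷ u)) h
  ... | u , e , v , eq , od , nz = a ∷ u , e , v , cong (a ∷_) eq , suc od , nz
  heavies-≢0 true  (a ∷ w) f h with f [] a w ≟ 0
  ... | no  nz = [] , a , w , refl , zero , nz
  ... | yes z with heavies-≢0 false w (λ u → f (a ∷ u)) (λ z′ → h (cong₂ _+_ z z′))
  ...   | u , e , v , eq , od , nz = a ∷ u , e , v , cong (a ∷_) eq , suc od , nz

  -- The shortest prefix on which `h` does not vanish. Minimality is phrased through `cuts` because
  -- that is the form in which failures of prefixes are added up later.
  cuts-first : (h : List A → ℕ) (w : List A) → ¬ cuts w (λ u _ → h u) ≡ 0 →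
    ∃ λ p → ∃ λ q → w ≡ p ++ q × ¬ h p ≡ 0 × (∀ u e v → p ≡ u ++ e ∷ v → cuts u (λ u′ _ → h u′) ≡ 0)
  cuts-first h [] nz = [] , [] , refl , nz , λ { [] e v () ; (_ ∷ _) e v () }
  cuts-first h (a ∷ w) nz with h [] ≟ 0
  ... | no  nz′ = [] , a ∷ w , refl , nz′ , λ { [] e v () ; (_ ∷ _) e v () }
  ... | yes z with cuts-first (λ u → h (a ∷ u)) w (λ z′ → nz (cong₂ _+_ z z′))
  ...   | p , q , eq , nz′ , min = a ∷ p , q , cong (a ∷_) eq , nz′ , λ
          { []      e v eq′  → z
          ; (b ∷ u) e v refl → cong₂ _+_ z (min u e v refl) }

  cuts-prefix : (h : List A → ℕ) (u v : List A) → cuts u (λ u _ → h u) ≤ cuts (u ++ v) (λ u _ → h u)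
  cuts-prefix h []      []      = ≤-refl
  cuts-prefix h []      (a ∷ v) = m≤m+n _ _
  cuts-prefix h (a ∷ u) v       = +-monoʳ-≤ (h []) (cuts-prefix (λ u → h (a ∷ u)) u v)

  ≤-/ : ∀ m n o .{{_ : NonZero n}} → m * n ≤ o → m ≤ o / n
  ≤-/ m n o h = ≤-trans (≤-reflexive (sym (m*n/n≡m m n))) (/-monoˡ-≤ n h)

  ∑< : ℕ → (ℕ → ℕ) → ℕ
  ∑< zero    f = 0
  ∑< (suc k) f = ∑< k f + f k

  ∑<-front : ∀ k (f : ℕ → ℕ) → ∑< (suc k) f ≡ f 0 + ∑< k (f ∘ suc)
  ∑<-front zero    f = sym (+-identityʳ (f 0))
  ∑<-front (suc k) f = trans (cong (_+ f (suc k)) (∑<-front k f)) (+-assoc (f 0) _ _)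

  -- Telescoping, since 1/(k+1)² + 1/(k+1) ≤ 1/k.
  square-sum : ∀ Z k → ∑< k (λ x → Z / (suc x * suc x)) ≤ 2 * Z
  square-sum Z zero    = z≤n
  square-sum Z (suc k) = ≤-trans (m≤m+n _ (Z / suc k)) (go k)
    where
    step : ∀ k → Z / (suc (suc k) * suc (suc k)) + Z / suc (suc k) ≤ Z / suc k
    step k = ≤-/ (p + q) (suc k) Z (*-cancelʳ-≤ _ _ (m * m) (begin
      (p + q) * suc k * (m * m)                ≡⟨ lem p q k m ⟩
      suc k * (p * (m * m)) + suc k * m * (q * m)
        ≤⟨ +-mono-≤ (*-monoʳ-≤ (suc k) (m/n*n≤m Z (m * m))) (*-monoʳ-≤ (suc k * m) (m/n*n≤m Z m)) ⟩
      suc k * Z + suc k * m * Z                ≤⟨ ≤-trans (m≤m+n _ Z) (≤-reflexive (lem′ k Z)) ⟩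
      Z * (m * m)                              ∎))
      where
      open ≤-Reasoning
      m = suc (suc k)
      p = Z / (m * m)
      q = Z / m
      lem : ∀ p q k m → (p + q) * suc k * (m * m) ≡ suc k * (p * (m * m)) + suc k * m * (q * m)
      lem = solve-∀
      lem′ : ∀ k Z → suc k * Z + suc k * suc (suc k) * Z + Z ≡ Z * (suc (suc k) * suc (suc k))
      lem′ = solve-∀
    go : ∀ k → ∑< (suc k) (λ x → Z / (suc x * suc x)) + Z / suc k ≤ 2 * Z
    go zero    = +-mono-≤ (m/n≤m Z 1) (≤-trans (m/n≤m Z 1) (m≤m+n Z 0))
    go (suc k) = ≤-trans (≤-reflexive (+-assoc (∑< (suc k) _) _ _))
      (≤-trans (+-monoʳ-≤ (∑< (suc k) _) (step k)) (go k))

-- Alternating walks in an abstract edge system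

module EdgeBound where
  open import Data.Fin.Base using (zero; suc)
  open import Data.List.Base using ([_])
  open import Data.Nat.Base using (_+_; _*_; _^_; _≤_; _<_; _/_)
  open import Data.Nat.Properties
  open Sums

  bit-∧ : ∀ a b → bit (a ∧ b) ≡ bit a * bit b
  bit-∧ true  b = sym (+-identityʳ (bit b))
  bit-∧ false b = refl

  bit-≢0 : ∀ {b} → ¬ bit b ≡ 0 → T b
  bit-≢0 {true}  _ = tt
  bit-≢0 {false} h = h refl

  ∑-δ : ∀ {n} (i : Fin n) (f : Fin n → ℕ) → ∑ (allFin n) (λ j → 𝟙 (i Fin.≟ j) * f j) ≡ f i
  ∑-δ {suc n} zero f = trans (cong₂ _+_ (+-identityʳ (f zero)) (others n suc (λ _ ()))) (+-identityʳ (f zero))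
    where
    others : ∀ m (g : Fin m → Fin (suc n)) → (∀ j → ¬ zero ≡ g j) →
      ∑ (tabulate g) (λ j → 𝟙 (zero Fin.≟ j) * f j) ≡ 0
    others zero    g h = refl
    others (suc m) g h = cong₂ _+_ (cong (_* f (g zero)) (𝟙-no (zero Fin.≟ g zero) (h zero))) (others m (g ∘ suc) (h ∘ suc))
  ∑-δ {suc n} (suc i) f = trans (shift n id) (∑-δ i (f ∘ suc))
    where
    shift : ∀ m (g : Fin m → Fin n) → ∑ (tabulate (λ j → suc (g j))) (λ j → 𝟙 (suc i Fin.≟ j) * f j) ≡
      ∑ (tabulate g) (λ j → 𝟙 (i Fin.≟ j) * f (suc j))
    shift zero    g = refl
    shift (suc m) g = cong₂ _+_ (cong (_* f (suc (g zero))) (lem (i Fin.≟ g zero))) (shift m (g ∘ suc))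
      where
      lem : ∀ (d : Dec (i ≡ g zero)) → 𝟙 (suc i Fin.≟ suc (g zero)) ≡ 𝟙 d
      lem (yes p) = 𝟙-yes (suc i Fin.≟ suc (g zero)) (cong suc p)
      lem (no ¬p) = 𝟙-no (suc i Fin.≟ suc (g zero)) (λ { refl → ¬p refl })

  Conn : {A V : Set} (tl hd : A → V) → V → List A → V → Set
  Conn tl hd s []      t = s ≡ t
  Conn tl hd s (a ∷ w) t = tl a ≡ s × Conn tl hd (hd a) w t

  -- For an edge system, "darts" are oriented edges.  idx is the time at
  -- which an edge was inserted, x e is a fractional cut of total weight at
  -- most Φ * S which every short closed walk through e with latest edge e
  -- hits with weight S outside e.  step true a b (step false a b) says that b
  -- follows a in a walk and belongs to the next D later (earlier) darts at
  -- their common vertex.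

  record System : Set₁ where
    field
      n D Φ S K   : ℕ
      A           : Set
      as          : List A
      tl hd       : A → Fin n
      rev         : A → A
      idx         : A → ℕ
      step        : Bool → A → A → Bool
      x           : A → A → ℕ
      S>0         : 0 < S
      tl-rev      : ∀ a → tl (rev a) ≡ hd a
      hd-rev      : ∀ a → hd (rev a) ≡ tl a
      idx-rev     : ∀ a → idx (rev a) ≡ idx a
      step-conn   : ∀ p a b → T (step p a b) → hd a ≡ tl b
      step-up     : ∀ a b → T (step true a b) → idx a < idx b
      step-down   : ∀ a b → T (step false a b) → idx b < idx a
      row         : ∀ p a → ∑ as (λ b → bit (step p a b)) ≤ D
      col         : ∀ p b → ∑ as (λ a → bit (step p a b)) ≤ D
      -- Steps are missing only at one end of the dart orders of the `n` vertices, at most `D²` of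
      -- them at each.
      steps       : ∀ p → length as * D ≤ n * D * D + ∑ as (λ a → ∑ as (λ b → bit (step p a b)))
      simple      : ∀ s t → ∑ as (λ c → 𝟙 (tl c Fin.≟ s) * 𝟙 (hd c Fin.≟ t)) ≤ 1
      x-sum       : ∀ e → ∑ as (x e) ≤ Φ * S
      -- With the full weight `S` on `e` itself, a walk that is light for `e` cannot run through `e`
      -- again.
      x-self      : ∀ e g → idx g ≡ idx e → S ≤ x e g
      x-rev       : ∀ e g → x e (rev g) ≡ x e g

      block       : ∀ e q → Conn tl hd (tl e) q (hd e) → (∀ g → g ∈ q → idx g < idx e) →
                    suc (length q) ≤ 2 * K → S ≤ ∑ q (x e)

  module Dispersion (sys : System) where
    open System sys
    open Words as

    N = length as

    s : Bool → A → A → ℕ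
    s p a b = bit (step p a b)

    -- Indicators that `w` continues `a`, or (for `ch`) is by itself, an alternating walk whose
    -- first step has kind `p`. As numbers they turn walk counts into sums over all words.
    cf : Bool → A → List A → ℕ
    cf p a []      = 1
    cf p a (b ∷ w) = s p a b * cf (not p) b w

    ch : Bool → List A → ℕ
    ch p []      = 1
    ch p (a ∷ w) = cf p a w

    cf-total : ∀ l p a → ∑ (words l) (cf p a) ≤ D ^ l
    cf-total zero    p a = ≤-refl
    cf-total (suc l) p a = begin
      ∑ (words (suc l)) (cf p a)                              ≡⟨ ∑-words-suc l ⟩
      ∑ as (λ b → ∑ (words l) (λ w → s p a b * cf (not p) b w)) ≡⟨ ∑-cong as (λ b → ∑-*ˡ (s p a b) (words l)) ⟩
      ∑ as (λ b → s p a b * ∑ (words l) (cf (not p) b))       ≤⟨ ∑-mono as (λ b → *-monoʳ-≤ (s p a b) (cf-total l (not p) b)) ⟩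
      ∑ as (λ b → s p a b * D ^ l)                            ≡⟨ ∑-*ʳ (D ^ l) as ⟩
      ∑ as (s p a) * D ^ l                                    ≤⟨ *-monoˡ-≤ (D ^ l) (row p a) ⟩
      D * D ^ l                                               ∎
      where open ≤-Reasoning

    cf-ext : ∀ l p a w → ∑ (words l) (λ v → cf p a (w ++ v)) ≤ cf p a w * D ^ l
    cf-ext l p a []      = ≤-trans (cf-total l p a) (≤-reflexive (sym (+-identityʳ _)))
    cf-ext l p a (b ∷ w) = begin
      ∑ (words l) (λ v → s p a b * cf (not p) b (w ++ v))   ≡⟨ ∑-*ˡ (s p a b) (words l) ⟩
      s p a b * ∑ (words l) (λ v → cf (not p) b (w ++ v))   ≤⟨ *-monoʳ-≤ (s p a b) (cf-ext l (not p) b w) ⟩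
      s p a b * (cf (not p) b w * D ^ l)                    ≡⟨ sym (*-assoc (s p a b) _ _) ⟩
      s p a b * cf (not p) b w * D ^ l                      ∎
      where open ≤-Reasoning

    ch-ext : ∀ l p u e v → ∑ (words l) (λ q → ch p ((u ++ e ∷ v) ++ q)) ≤ ch p (u ++ e ∷ v) * D ^ l
    ch-ext l p []      e v = cf-ext l p e v
    ch-ext l p (a ∷ u) e v = cf-ext l p a (u ++ e ∷ v)

    -- A dart has at most `D` predecessors, so forgetting the first dart merges at most `D` walks.
    -- Only the empty rest would merge all darts, and there `h` vanishes.
    strip : ∀ l p (h : List A → ℕ) → h [] ≡ 0 →
      ∑ as (λ a → ∑ (words l) (λ w → cf p a w * h w)) ≤ D * ∑ (words l) (λ w → ch (not p) w * h w)
    strip l p h h[] = begin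
      ∑ as (λ a → ∑ (words l) (λ w → cf p a w * h w))    ≡⟨ ∑-swap as (words l) ⟩
      ∑ (words l) (λ w → ∑ as (λ a → cf p a w * h w))    ≤⟨ ∑-mono (words l) one ⟩
      ∑ (words l) (λ w → D * (ch (not p) w * h w))       ≡⟨ ∑-*ˡ D (words l) ⟩
      D * ∑ (words l) (λ w → ch (not p) w * h w)         ∎
      where
      open ≤-Reasoning
      one : ∀ w → ∑ as (λ a → cf p a w * h w) ≤ D * (ch (not p) w * h w)
      one []      = begin
        ∑ as (λ a → 1 * h []) ≡⟨ ∑-cong as (λ a → cong (1 *_) h[]) ⟩
        ∑ as (λ a → 0)        ≡⟨ ∑-zero as ⟩
        0                     ≤⟨ z≤n ⟩
        D * (1 * h [])        ∎
      one (b ∷ w) = begin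
        ∑ as (λ a → s p a b * cf (not p) b w * h (b ∷ w))   ≡⟨ ∑-cong as (λ a → *-assoc (s p a b) _ _) ⟩
        ∑ as (λ a → s p a b * (cf (not p) b w * h (b ∷ w))) ≡⟨ ∑-*ʳ (cf (not p) b w * h (b ∷ w)) as ⟩
        ∑ as (λ a → s p a b) * (cf (not p) b w * h (b ∷ w)) ≤⟨ *-monoˡ-≤ (cf (not p) b w * h (b ∷ w)) (col p b) ⟩
        D * (cf (not p) b w * h (b ∷ w))                    ∎

    -- At each of the `l` positions a dart occurs in at most `D^(l-1)` walks, by `row` to its right
    -- and `col` to its left; the factor `D` avoids the truncated exponent.
    marks : ∀ l p (f : A → ℕ) → D * ∑ (words l) (λ w → ch p w * ∑ w f) ≤ l * D ^ l * ∑ as f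
    marks zero    p f = ≤-reflexive (*-zeroʳ D)
    marks (suc l) p f = begin
      D * ∑ (words (suc l)) (λ w → ch p w * ∑ w f)
        ≡⟨ cong (D *_) (∑-words-suc l) ⟩
      D * ∑ as (λ a → ∑ (words l) (λ w → cf p a w * (f a + ∑ w f)))
        ≡⟨ cong (D *_) (∑-cong as (λ a → trans (∑-cong (words l) (λ w → *-distribˡ-+ (cf p a w) _ _)) (∑-+ (words l)))) ⟩
      D * ∑ as (λ a → ∑ (words l) (λ w → cf p a w * f a) + ∑ (words l) (λ w → cf p a w * ∑ w f))
        ≡⟨ cong (D *_) (∑-+ as) ⟩
      D * (∑ as (λ a → ∑ (words l) (λ w → cf p a w * f a)) + ∑ as (λ a → ∑ (words l) (λ w → cf p a w * ∑ w f)))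
        ≤⟨ *-monoʳ-≤ D (+-mono-≤ (∑-mono as first) (strip l p (λ w → ∑ w f) refl)) ⟩
      D * (∑ as (λ a → D ^ l * f a) + D * ∑ (words l) (λ w → ch (not p) w * ∑ w f))
        ≡⟨ cong (λ z → D * (z + D * ∑ (words l) (λ w → ch (not p) w * ∑ w f))) (∑-*ˡ (D ^ l) as) ⟩
      D * (D ^ l * ∑ as f + D * ∑ (words l) (λ w → ch (not p) w * ∑ w f))
        ≤⟨ *-monoʳ-≤ D (+-monoʳ-≤ (D ^ l * ∑ as f) (marks l (not p) f)) ⟩
      D * (D ^ l * ∑ as f + l * D ^ l * ∑ as f)
        ≡⟨ lem D (D ^ l) (∑ as f) l ⟩
      suc l * (D * D ^ l) * ∑ as f ∎
      where
      open ≤-Reasoning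
      first : ∀ a → ∑ (words l) (λ w → cf p a w * f a) ≤ D ^ l * f a
      first a = ≤-trans (≤-reflexive (∑-*ʳ (f a) (words l))) (*-monoˡ-≤ (f a) (cf-total l p a))
      lem : ∀ D E F l → D * (E * F + l * E * F) ≡ suc l * (D * E) * F
      lem = solve-∀

    -- Walks are plentiful

    V : Bool → ℕ → ℕ
    V p l = ∑ (words l) (ch p)

    -- A dart `b` has `c ≤ D` predecessors and `R ≤ M = D^l` continuations, and `(D - c)(M - R) ≥ 0`
    -- shows that prepending a dart loses at most `M` for each missing predecessor. By `steps` at
    -- most `n D²` predecessors are missing in all.
    V-step : ∀ l p → D * V (not p) (suc l) ≤ V p (suc (suc l)) + n * D * (D * D ^ l)
    V-step l p = +-cancelʳ-≤ (tot * D ^ l) _ _ (begin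
      D * V (not p) (suc l) + tot * D ^ l
        ≡⟨ cong₂ _+_ (cong (D *_) (∑-words-suc l)) refl ⟩
      D * ∑ as R + tot * D ^ l
        ≡⟨ cong₂ _+_ (sym (∑-*ˡ D as)) (trans (cong (_* D ^ l) (∑-swap as as)) (sym (∑-*ʳ (D ^ l) as))) ⟩
      ∑ as (λ b → D * R b) + ∑ as (λ b → c b * D ^ l)
        ≡⟨ sym (∑-+ as) ⟩
      ∑ as (λ b → D * R b + c b * D ^ l)
        ≤⟨ ∑-mono as (λ b → exchange (col p b) (cf-total l (not p) b)) ⟩
      ∑ as (λ b → c b * R b + D * D ^ l)
        ≡⟨ ∑-+ as ⟩
      ∑ as (λ b → c b * R b) + ∑ as (λ _ → D * D ^ l)
        ≡⟨ cong₂ _+_ (sym V≡) (∑-const (D * D ^ l) as) ⟩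
      V p (suc (suc l)) + N * (D * D ^ l)
        ≡⟨ cong (V p (suc (suc l)) +_) (sym (*-assoc N D _)) ⟩
      V p (suc (suc l)) + N * D * D ^ l
        ≤⟨ +-monoʳ-≤ (V p (suc (suc l))) (*-monoˡ-≤ (D ^ l) (steps p)) ⟩
      V p (suc (suc l)) + (n * D * D + tot) * D ^ l
        ≡⟨ lem (V p (suc (suc l))) (n * D) D tot (D ^ l) ⟩
      V p (suc (suc l)) + n * D * (D * D ^ l) + tot * D ^ l ∎)
      where
      open ≤-Reasoning
      tot = ∑ as (λ a → ∑ as (s p a))
      R : A → ℕ
      R b = ∑ (words l) (cf (not p) b)
      c : A → ℕ
      c b = ∑ as (λ a → s p a b)
      lem : ∀ v m d t e → v + (m * d + t) * e ≡ v + m * (d * e) + t * e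
      lem = solve-∀
      exchange : ∀ {c D R M} → c ≤ D → R ≤ M → D * R + c * M ≤ c * R + D * M
      exchange {c} {D} {R} {M} c≤D R≤M = begin
        D * R + c * M                     ≡⟨ cong₂ (λ d m → d * R + c * m) (sym (m+[n∸m]≡n c≤D)) (sym (m+[n∸m]≡n R≤M)) ⟩
        (c + (D ∸ c)) * R + c * (R + (M ∸ R))
          ≤⟨ m≤m+n _ ((D ∸ c) * (M ∸ R)) ⟩
        (c + (D ∸ c)) * R + c * (R + (M ∸ R)) + (D ∸ c) * (M ∸ R)
          ≡⟨ lem′ c (D ∸ c) R (M ∸ R) ⟩
        c * R + (c + (D ∸ c)) * (R + (M ∸ R))
          ≡⟨ cong₂ (λ d m → c * R + d * m) (m+[n∸m]≡n c≤D) (m+[n∸m]≡n R≤M) ⟩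
        c * R + D * M                     ∎
        where
        lem′ : ∀ c d r m → (c + d) * r + c * (r + m) + d * m ≡ c * r + (c + d) * (r + m)
        lem′ = solve-∀
      V≡ : V p (suc (suc l)) ≡ ∑ as (λ b → c b * R b)
      V≡ = begin-equality
        V p (suc (suc l))                                                   ≡⟨ ∑-words-suc (suc l) ⟩
        ∑ as (λ a → ∑ (words (suc l)) (cf p a))                             ≡⟨ ∑-cong as (λ a → ∑-words-suc l) ⟩
        ∑ as (λ a → ∑ as (λ b → ∑ (words l) (λ w → s p a b * cf (not p) b w))) ≡⟨ ∑-cong as (λ a → ∑-cong as (λ b → ∑-*ˡ (s p a b) (words l))) ⟩
        ∑ as (λ a → ∑ as (λ b → s p a b * R b))                             ≡⟨ ∑-swap as as ⟩
        ∑ as (λ b → ∑ as (λ a → s p a b * R b))                             ≡⟨ ∑-cong as (λ b → ∑-*ʳ (R b) as) ⟩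
        ∑ as (λ b → c b * R b)                                              ∎

    V-lower : ∀ l p → N * D ^ l ≤ V p (suc l) + l * (n * (D * D ^ l))
    V-lower zero    p = ≤-reflexive (trans (sym (∑-const 1 as)) (trans (sym (∑-words-suc 0)) (sym (+-identityʳ _))))
    V-lower (suc l) p = begin
      N * (D * D ^ l)                                           ≡⟨ lem₁ N D (D ^ l) ⟩
      D * (N * D ^ l)                                           ≤⟨ *-monoʳ-≤ D (V-lower l (not p)) ⟩
      D * (V (not p) (suc l) + l * (n * (D * D ^ l)))           ≡⟨ *-distribˡ-+ D (V (not p) (suc l)) _ ⟩
      D * V (not p) (suc l) + D * (l * (n * (D * D ^ l)))       ≤⟨ +-monoˡ-≤ _ (V-step l p) ⟩
      V p (suc (suc l)) + n * D * (D * D ^ l) + D * (l * (n * (D * D ^ l))) ≡⟨ lem₂ (V p (suc (suc l))) n D (D ^ l) l ⟩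
      V p (suc (suc l)) + suc l * (n * (D * (D * D ^ l)))       ∎
      where
      open ≤-Reasoning
      lem₁ : ∀ N D E → N * (D * E) ≡ D * (N * E)
      lem₁ = solve-∀
      lem₂ : ∀ v n D E l → v + n * D * (D * E) + D * (l * (n * (D * E))) ≡ v + suc l * (n * (D * (D * E)))
      lem₂ = solve-∀

    -- Few walks meet their own cuts

    -- Z r p a b counts the walks from a to b with r darts in between.
    Z : ℕ → Bool → A → A → ℕ
    Z zero    p a b = s p a b
    Z (suc r) p a b = ∑ as (λ c → s p a c * Z r (not p) c b)

    -- The dart in between is determined by its two ends, as the graph is simple.
    Z₁≤1 : ∀ p a b → Z 1 p a b ≤ 1
    Z₁≤1 p a b = ≤-trans (∑-mono as term) (simple (hd a) (tl b))
      where
      term : ∀ c → s p a c * s (not p) c b ≤ 𝟙 (tl c Fin.≟ hd a) * 𝟙 (hd c Fin.≟ tl b)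
      term c with step p a c in e₁ | step (not p) c b in e₂
      ... | false | _     = z≤n
      ... | true  | false = z≤n
      ... | true  | true  = ≤-reflexive (sym (cong₂ _*_
        (𝟙-yes (tl c Fin.≟ hd a) (sym (step-conn p a c (subst T (sym e₁) tt))))
        (𝟙-yes (hd c Fin.≟ tl b) (step-conn (not p) c b (subst T (sym e₂) tt)))))

    Z-bound : ∀ r p a b → Z (suc r) p a b ≤ D ^ r
    Z-bound zero    p a b = Z₁≤1 p a b
    Z-bound (suc r) p a b = begin
      ∑ as (λ c → s p a c * Z (suc r) (not p) c b) ≤⟨ ∑-mono as (λ c → *-monoʳ-≤ (s p a c) (Z-bound r (not p) c b)) ⟩
      ∑ as (λ c → s p a c * D ^ r)                 ≡⟨ ∑-*ʳ (D ^ r) as ⟩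
      ∑ as (s p a) * D ^ r                         ≤⟨ *-monoˡ-≤ (D ^ r) (row p a) ⟩
      D * D ^ r                                    ∎
      where open ≤-Reasoning

    -- This is the sum of `D^(y-1-r) * Z r p a b` over `r < y`: it bounds the number of occurrences
    -- of `b` on the walks that continue `a` by `y` darts.
    P : ℕ → Bool → A → A → ℕ
    P zero    p a b = 0
    P (suc y) p a b = D * P y p a b + Z y p a b

    P-front : ∀ y p a b → D ^ y * s p a b + ∑ as (λ c → s p a c * P y (not p) c b) ≡ P (suc y) p a b
    P-front zero p a b = begin
      1 * s p a b + ∑ as (λ c → s p a c * 0) ≡⟨ cong₂ _+_ (*-identityˡ _) (trans (∑-cong as (λ c → *-zeroʳ (s p a c))) (∑-zero as)) ⟩
      s p a b + 0                            ≡⟨ +-comm (s p a b) 0 ⟩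
      0 + s p a b                            ≡⟨ cong (_+ s p a b) (sym (*-zeroʳ D)) ⟩
      D * 0 + s p a b                        ∎
      where open ≡-Reasoning
    P-front (suc y) p a b = begin
      D * D ^ y * s p a b + ∑ as (λ c → s p a c * (D * P y (not p) c b + Z y (not p) c b))
        ≡⟨ cong (D * D ^ y * s p a b +_) (trans (∑-cong as (λ c → lem (s p a c) D _ _)) (∑-+ as)) ⟩
      D * D ^ y * s p a b + (∑ as (λ c → D * (s p a c * P y (not p) c b)) + Z (suc y) p a b)
        ≡⟨ cong (λ z → D * D ^ y * s p a b + (z + Z (suc y) p a b)) (∑-*ˡ D as) ⟩
      D * D ^ y * s p a b + (D * ∑ as (λ c → s p a c * P y (not p) c b) + Z (suc y) p a b)
        ≡⟨ lem′ D (D ^ y) (s p a b) _ _ ⟩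
      D * (D ^ y * s p a b + ∑ as (λ c → s p a c * P y (not p) c b)) + Z (suc y) p a b
        ≡⟨ cong (λ z → D * z + Z (suc y) p a b) (P-front y p a b) ⟩
      P (suc (suc y)) p a b ∎
      where
      open ≡-Reasoning
      lem : ∀ s D P Z → s * (D * P + Z) ≡ D * (s * P) + s * Z
      lem = solve-∀
      lem′ : ∀ D E s t z → D * E * s + (D * t + z) ≡ D * (E * s + t) + z
      lem′ = solve-∀

    -- Only an immediate successor can occur as often as `D^(y-1)` times; each larger gap saves a
    -- factor `D` by `Z₁≤1`. Hence the width has to exceed only a multiple of `K Φ`; the plain count
    -- `y D^(y-1)` would ask for `K² Φ` and lead to a term `k³ f n`.
    P-bound : ∀ y p a b → D * D * P y p a b ≤ D ^ y * (D + y)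
    P-bound zero p a b = ≤-trans (≤-reflexive (*-zeroʳ (D * D))) z≤n
    P-bound (suc zero) p a b = begin
      D * D * (D * 0 + s p a b) ≡⟨ cong (λ z → D * D * (z + s p a b)) (*-zeroʳ D) ⟩
      D * D * s p a b           ≤⟨ *-monoʳ-≤ (D * D) (bit≤1 (step p a b)) ⟩
      D * D * 1                 ≤⟨ m≤m+n _ D ⟩
      D * D * 1 + D             ≡⟨ lem D ⟩
      D * 1 * (D + 1)           ∎
      where
      open ≤-Reasoning
      lem : ∀ D → D * D * 1 + D ≡ D * 1 * (D + 1)
      lem = solve-∀
    P-bound (suc (suc y)) p a b = begin
      D * D * (D * P (suc y) p a b + Z (suc y) p a b)         ≡⟨ lem D (P (suc y) p a b) (Z (suc y) p a b) ⟩
      D * (D * D * P (suc y) p a b) + D * D * Z (suc y) p a b ≤⟨ +-mono-≤ (*-monoʳ-≤ D (P-bound (suc y) p a b)) (*-monoʳ-≤ (D * D) (Z-bound y p a b)) ⟩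
      D * (D * D ^ y * (D + suc y)) + D * D * D ^ y           ≡⟨ lem′ D (D ^ y) y ⟩
      D * (D * D ^ y) * (D + suc (suc y))                     ∎
      where
      open ≤-Reasoning
      lem : ∀ D P Z → D * D * (D * P + Z) ≡ D * (D * D * P) + D * D * Z
      lem = solve-∀
      lem′ : ∀ D E y → D * (D * E * (D + suc y)) + D * D * E ≡ D * (D * E) * (D + suc (suc y))
      lem′ = solve-∀

    -- An occurrence of `b` after `r` darts leaves at most `D^(y-1-r)` ways to go on.
    meets : ∀ y p a (f : A → ℕ) → ∑ (words y) (λ v → cf p a v * ∑ v f) ≤ ∑ as (λ b → P y p a b * f b)
    meets zero    p a f = z≤n
    meets (suc y) p a f = begin
      ∑ (words (suc y)) (λ v → cf p a v * ∑ v f)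
        ≡⟨ ∑-words-suc y ⟩
      ∑ as (λ c → ∑ (words y) (λ v → s p a c * cf (not p) c v * (f c + ∑ v f)))
        ≡⟨ ∑-cong as split ⟩
      ∑ as (λ c → s p a c * (∑ (words y) (cf (not p) c) * f c + ∑ (words y) (λ v → cf (not p) c v * ∑ v f)))
        ≤⟨ ∑-mono as (λ c → *-monoʳ-≤ (s p a c) (+-mono-≤ (*-monoˡ-≤ (f c) (cf-total y (not p) c)) (meets y (not p) c f))) ⟩
      ∑ as (λ c → s p a c * (D ^ y * f c + ∑ as (λ b → P y (not p) c b * f b)))
        ≡⟨ ∑-cong as (λ c → lem (s p a c) (D ^ y) (f c) _) ⟩
      ∑ as (λ c → D ^ y * s p a c * f c + s p a c * ∑ as (λ b → P y (not p) c b * f b))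
        ≡⟨ ∑-+ as ⟩
      ∑ as (λ c → D ^ y * s p a c * f c) + ∑ as (λ c → s p a c * ∑ as (λ b → P y (not p) c b * f b))
        ≡⟨ cong (∑ as (λ c → D ^ y * s p a c * f c) +_) (trans (∑-cong as (λ c → sym (∑-*ˡ (s p a c) as))) (∑-swap as as)) ⟩
      ∑ as (λ c → D ^ y * s p a c * f c) + ∑ as (λ b → ∑ as (λ c → s p a c * (P y (not p) c b * f b)))
        ≡⟨ sym (∑-+ as) ⟩
      ∑ as (λ b → D ^ y * s p a b * f b + ∑ as (λ c → s p a c * (P y (not p) c b * f b)))
        ≡⟨ ∑-cong as (λ b → cong (D ^ y * s p a b * f b +_) (trans (∑-cong as (λ c → sym (*-assoc (s p a c) _ _))) (∑-*ʳ (f b) as))) ⟩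
      ∑ as (λ b → D ^ y * s p a b * f b + ∑ as (λ c → s p a c * P y (not p) c b) * f b)
        ≡⟨ ∑-cong as (λ b → trans (sym (*-distribʳ-+ (f b) (D ^ y * s p a b) _)) (cong (_* f b) (P-front y p a b))) ⟩
      ∑ as (λ b → P (suc y) p a b * f b) ∎
      where
      open ≤-Reasoning
      lem : ∀ s E f t → s * (E * f + t) ≡ E * s * f + s * t
      lem = solve-∀
      split : ∀ c → ∑ (words y) (λ v → s p a c * cf (not p) c v * (f c + ∑ v f)) ≡
        s p a c * (∑ (words y) (cf (not p) c) * f c + ∑ (words y) (λ v → cf (not p) c v * ∑ v f))
      split c = begin-equality
        ∑ (words y) (λ v → s p a c * cf (not p) c v * (f c + ∑ v f))
          ≡⟨ ∑-cong (words y) (λ v → trans (*-assoc (s p a c) _ _) (cong (s p a c *_) (*-distribˡ-+ (cf (not p) c v) _ _))) ⟩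
        ∑ (words y) (λ v → s p a c * (cf (not p) c v * f c + cf (not p) c v * ∑ v f))
          ≡⟨ ∑-*ˡ (s p a c) (words y) ⟩
        s p a c * ∑ (words y) (λ v → cf (not p) c v * f c + cf (not p) c v * ∑ v f)
          ≡⟨ cong (s p a c *_) (trans (∑-+ (words y)) (cong (_+ ∑ (words y) (λ v → cf (not p) c v * ∑ v f)) (∑-*ʳ (f c) (words y)))) ⟩
        s p a c * (∑ (words y) (cf (not p) c) * f c + ∑ (words y) (λ v → cf (not p) c v * ∑ v f)) ∎

    pair : A → A → ℕ
    pair a b = x a b + x b a

    -- The sum over all pairs of positions. If it is small, then every dart of `w` sees little of
    -- its cut on the rest of `w` (`ps-at`).
    ps : List A → ℕ
    ps []      = 0
    ps (a ∷ w) = ∑ w (pair a) + ps w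

    pair-sum : ∑ as (λ a → ∑ as (pair a)) ≤ 2 * (N * (Φ * S))
    pair-sum = begin
      ∑ as (λ a → ∑ as (pair a))                                  ≡⟨ trans (∑-cong as (λ a → ∑-+ as)) (∑-+ as) ⟩
      ∑ as (λ a → ∑ as (x a)) + ∑ as (λ a → ∑ as (λ b → x b a))   ≡⟨ cong (∑ as (λ a → ∑ as (x a)) +_) (∑-swap as as) ⟩
      ∑ as (λ a → ∑ as (x a)) + ∑ as (λ b → ∑ as (x b))           ≤⟨ +-mono-≤ half half ⟩
      N * (Φ * S) + N * (Φ * S)                                   ≡⟨ cong (N * (Φ * S) +_) (sym (+-identityʳ _)) ⟩
      2 * (N * (Φ * S))                                           ∎
      where
      open ≤-Reasoning
      half : ∑ as (λ a → ∑ as (x a)) ≤ N * (Φ * S)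
      half = ≤-trans (∑-mono as x-sum) (≤-reflexive (∑-const (Φ * S) as))

    -- The pairs containing the first dart are counted by `meets`, the others by `strip` and
    -- induction, which contributes the factor `k`.
    ps-total : ∀ k p → D * (D * D * ∑ (words k) (λ w → ch p w * ps w)) ≤ k * (D ^ k * ((D + k) * (2 * (N * (Φ * S)))))
    ps-total zero    p = ≤-reflexive (trans (cong (D *_) (*-zeroʳ (D * D))) (*-zeroʳ D))
    ps-total (suc k) p = begin
      D * (D * D * ∑ (words (suc k)) (λ w → ch p w * ps w))
        ≡⟨ cong (λ z → D * (D * D * z)) (∑-words-suc k) ⟩
      D * (D * D * ∑ as (λ a → ∑ (words k) (λ w → cf p a w * (∑ w (pair a) + ps w))))
        ≡⟨ cong (λ z → D * (D * D * z)) (∑-cong as (λ a → trans (∑-cong (words k) (λ w → *-distribˡ-+ (cf p a w) _ _)) (∑-+ (words k)))) ⟩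
      D * (D * D * ∑ as (λ a → ∑ (words k) (λ w → cf p a w * ∑ w (pair a)) + ∑ (words k) (λ w → cf p a w * ps w)))
        ≡⟨ cong (λ z → D * (D * D * z)) (∑-+ as) ⟩
      D * (D * D * (∑ as (λ a → ∑ (words k) (λ w → cf p a w * ∑ w (pair a))) + ∑ as (λ a → ∑ (words k) (λ w → cf p a w * ps w))))
        ≤⟨ *-monoʳ-≤ D (*-monoʳ-≤ (D * D) (+-mono-≤ (∑-mono as (λ a → meets k p a (pair a))) (strip k p ps refl))) ⟩
      D * (D * D * (PP + D * Π))
        ≡⟨ lem₁ D PP Π ⟩
      D * (D * D * PP) + D * (D * (D * D * Π))
        ≤⟨ +-mono-≤ (*-monoʳ-≤ D firsts) (*-monoʳ-≤ D (ps-total k (not p))) ⟩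
      D * (D ^ k * (D + k) * F) + D * (k * (D ^ k * ((D + k) * F)))
        ≡⟨ lem₂ D (D ^ k) k F ⟩
      suc k * (D * D ^ k * ((D + k) * F))
        ≤⟨ *-monoʳ-≤ (suc k) (*-monoʳ-≤ (D * D ^ k) (*-monoˡ-≤ F (+-monoʳ-≤ D (n≤1+n k)))) ⟩
      suc k * (D * D ^ k * ((D + suc k) * F)) ∎
      where
      open ≤-Reasoning
      F = 2 * (N * (Φ * S))
      PP = ∑ as (λ a → ∑ as (λ b → P k p a b * pair a b))
      Π = ∑ (words k) (λ w → ch (not p) w * ps w)
      lem₁ : ∀ D P Q → D * (D * D * (P + D * Q)) ≡ D * (D * D * P) + D * (D * (D * D * Q))
      lem₁ = solve-∀
      lem₂ : ∀ D E k F → D * (E * (D + k) * F) + D * (k * (E * ((D + k) * F))) ≡ suc k * (D * E * ((D + k) * F))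
      lem₂ = solve-∀
      firsts : D * D * PP ≤ D ^ k * (D + k) * F
      firsts = begin
        D * D * PP
          ≡⟨ sym (trans (∑-cong as (λ a → ∑-*ˡ (D * D) as)) (∑-*ˡ (D * D) as)) ⟩
        ∑ as (λ a → ∑ as (λ b → D * D * (P k p a b * pair a b)))
          ≤⟨ ∑-mono as (λ a → ∑-mono as (λ b → ≤-trans (≤-reflexive (sym (*-assoc (D * D) (P k p a b) _))) (*-monoˡ-≤ (pair a b) (P-bound k p a b)))) ⟩
        ∑ as (λ a → ∑ as (λ b → D ^ k * (D + k) * pair a b))
          ≡⟨ trans (∑-cong as (λ a → ∑-*ˡ (D ^ k * (D + k)) as)) (∑-*ˡ (D ^ k * (D + k)) as) ⟩
        D ^ k * (D + k) * ∑ as (λ a → ∑ as (pair a))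
          ≤⟨ *-monoʳ-≤ (D ^ k * (D + k)) pair-sum ⟩
        D ^ k * (D + k) * F ∎

    ∑-app : (u v : List A) {f : A → ℕ} → ∑ u f ≤ ∑ (u ++ v) f
    ∑-app u v = ≤-trans (m≤m+n _ _) (≤-reflexive (sym (∑-++ u v)))

    ps-prefix : ∀ u v → ps u ≤ ps (u ++ v)
    ps-prefix []      v = z≤n
    ps-prefix (a ∷ u) v = +-mono-≤ (∑-app u v) (ps-prefix u v)

    ps-suffix : ∀ u v → ps v ≤ ps (u ++ v)
    ps-suffix []      v = ≤-refl
    ps-suffix (a ∷ u) v = ≤-trans (ps-suffix u v) (m≤n+m _ _)

    ps-at : ∀ u e v → ∑ u (x e) + ∑ v (x e) ≤ ps (u ++ e ∷ v)
    ps-at []      e v = ≤-trans (∑-mono v (λ g → m≤m+n (x e g) (x g e))) (m≤m+n _ _)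
    ps-at (a ∷ u) e v = begin
      x e a + ∑ u (x e) + ∑ v (x e)           ≡⟨ +-assoc (x e a) _ _ ⟩
      x e a + (∑ u (x e) + ∑ v (x e))         ≤⟨ +-mono-≤ (≤-trans (m≤n+m (x e a) (x a e)) (∑-∈ (pair a) (∈-++⁺ʳ u (here refl)))) (ps-at u e v) ⟩
      ∑ (u ++ e ∷ v) (pair a) + ps (u ++ e ∷ v) ∎
      where open ≤-Reasoning

  argmax : {X : Set} (xs : List X) (c : X → ℕ) (M : X → ℕ) →
    (∀ w → w ∈ xs → c w ≡ 0) ⊎
    ∃ λ w → w ∈ xs × ¬ c w ≡ 0 × (∀ w′ → w′ ∈ xs → ¬ c w′ ≡ 0 → M w′ ≤ M w)
  argmax []       c M = inj₁ λ _ ()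
  argmax (y ∷ xs) c M with c y ≟ 0 | argmax xs c M
  ... | yes z | inj₁ none = inj₁ λ { w (here refl) → z ; w (there w∈) → none w w∈ }
  ... | no nz | inj₁ none = inj₂ (y , here refl , nz , λ
        { w (here refl) _ → ≤-refl ; w (there w∈) nz′ → ⊥-elim (nz′ (none w w∈)) })
  ... | yes z | inj₂ (w , w∈ , nz , max) = inj₂ (w , there w∈ , nz , λ
        { w′ (here refl) nz′ → ⊥-elim (nz′ z) ; w′ (there w′∈) → max w′ w′∈ })
  ... | no nz′ | inj₂ (w , w∈ , nz , max) with ≤-total (M y) (M w)
  ...   | inj₁ le = inj₂ (w , there w∈ , nz , λ { w′ (here refl) _ → le ; w′ (there w′∈) → max w′ w′∈ })
  ...   | inj₂ ge = inj₂ (y , here refl , nz′ , λ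
          { w′ (here refl) _ → ≤-refl ; w′ (there w′∈) nz″ → ≤-trans (max w′ w′∈ nz″) ge })

  -- A split at an even position lowers the exponent of `L` by exactly one for either parity of `y`.
  -- For even `x` and `y` nothing would be gained, hence the restriction to heavy darts.
  half-odd : ∀ {x} → Odd x → ∀ y → ⌊ suc (x + y) /2⌋ ≡ suc (⌊ x /2⌋ + ⌊ y /2⌋)
  half-odd (suc zero)          y = refl
  half-odd (suc (suc {n} od))  y = cong suc (half-odd od y)

  cuts-scale : {A : Set} (c : List A → ℕ) (w : List A) (f : List A → List A → ℕ) →
    c w * cuts w f ≡ cuts w (λ u v → c (u ++ v) * f u v)
  cuts-scale c []      f = refl
  cuts-scale c (a ∷ w) f = trans (*-distribˡ-+ (c (a ∷ w)) _ _) (cong (c (a ∷ w) * f [] (a ∷ w) +_) (cuts-scale (λ u → c (a ∷ u)) w (λ u → f (a ∷ u))))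

  heavies-scale : {A : Set} (c : List A → ℕ) (p : Bool) (w : List A) (f : List A → A → List A → ℕ) →
    c w * heavies p w f ≡ heavies p w (λ u e v → c (u ++ e ∷ v) * f u e v)
  heavies-scale c p     []      f = *-zeroʳ (c [])
  heavies-scale c false (a ∷ w) f = heavies-scale (λ u → c (a ∷ u)) true w (λ u → f (a ∷ u))
  heavies-scale c true  (a ∷ w) f = trans (*-distribˡ-+ (c (a ∷ w)) _ _)
    (cong (c (a ∷ w) * f [] a w +_) (heavies-scale (λ u → c (a ∷ u)) false w (λ u → f (a ∷ u))))

  ∑-heavies-swap : {A B : Set} (xs : List B) (p : Bool) (w : List A) (f : B → List A → A → List A → ℕ) →
    ∑ xs (λ b → heavies p w (f b)) ≡ heavies p w (λ u e v → ∑ xs (λ b → f b u e v))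
  ∑-heavies-swap xs p     []      f = ∑-zero xs
  ∑-heavies-swap xs false (a ∷ w) f = ∑-heavies-swap xs true w (λ b u → f b (a ∷ u))
  ∑-heavies-swap xs true  (a ∷ w) f = trans (∑-+ xs) (cong (∑ xs (λ b → f b [] a w) +_) (∑-heavies-swap xs false w (λ b u → f b (a ∷ u))))

  -- Good walks between two given vertices

  module Counting (sys : System) (L : ℕ) (L>0 : 0 < L) where
    open System sys
    open Words as
    open Dispersion sys

    conn? : ∀ s w t → Dec (Conn tl hd s w t)
    conn? s []      t = s Fin.≟ t
    conn? s (a ∷ w) t = (tl a Fin.≟ s) ×-dec conn? (hd a) w t

    st en : Fin n → List A → Fin n
    st d []      = d
    st d (a ∷ w) = tl a
    en d []      = d
    en d (a ∷ w) = en (hd a) w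

    en-unique : ∀ {s} w {t} → Conn tl hd s w t → t ≡ en s w
    en-unique []      refl       = refl
    en-unique (a ∷ w) (refl , c) = en-unique w c

    vs : List (Fin n)
    vs = allFin n

    ends≤1 : ∀ s w → ∑ vs (λ t → 𝟙 (conn? s w t)) ≤ 1
    ends≤1 s w = ≤-trans (∑-mono vs term) (≤-reflexive (∑-δ (en s w) (λ _ → 1)))
      where
      term : ∀ t → 𝟙 (conn? s w t) ≤ 𝟙 (en s w Fin.≟ t) * 1
      term t with conn? s w t
      ... | no _  = z≤n
      ... | yes c = ≤-reflexive (sym (cong (_* 1) (𝟙-yes (en s w Fin.≟ t) (sym (en-unique w c)))))

    endpoints≤1 : ∀ a w → ∑ vs (λ s → ∑ vs (λ t → 𝟙 (conn? s (a ∷ w) t))) ≤ 1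
    endpoints≤1 a w = ≤-trans (∑-mono vs term) (≤-reflexive (∑-δ (tl a) (λ _ → 1)))
      where
      open ≤-Reasoning
      term : ∀ s → ∑ vs (λ t → 𝟙 (conn? s (a ∷ w) t)) ≤ 𝟙 (tl a Fin.≟ s) * 1
      term s = begin
        ∑ vs (λ t → 𝟙 (conn? s (a ∷ w) t))                    ≡⟨ ∑-cong vs (λ t → bit-∧ (does (tl a Fin.≟ s)) (does (conn? (hd a) w t))) ⟩
        ∑ vs (λ t → 𝟙 (tl a Fin.≟ s) * 𝟙 (conn? (hd a) w t))  ≡⟨ ∑-*ˡ (𝟙 (tl a Fin.≟ s)) vs ⟩
        𝟙 (tl a Fin.≟ s) * ∑ vs (λ t → 𝟙 (conn? (hd a) w t))  ≤⟨ *-monoʳ-≤ (𝟙 (tl a Fin.≟ s)) (ends≤1 (hd a) w) ⟩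
        𝟙 (tl a Fin.≟ s) * 1                                  ∎

    cf-step : ∀ {p a b w} → ¬ cf p a (b ∷ w) ≡ 0 → T (step p a b) × ¬ cf (not p) b w ≡ 0
    cf-step {p} {a} {b} nz = bit-≢0 (*≢0ˡ nz) , *≢0ʳ {s p a b} nz

    cf-split : ∀ p a u e v → ¬ cf p a (u ++ e ∷ v) ≡ 0 →
      Conn tl hd (hd a) u (tl e) × Conn tl hd (hd e) v (en (hd e) v)
    cf-conn : ∀ p a w → ¬ cf p a w ≡ 0 → Conn tl hd (hd a) w (en (hd a) w)
    cf-conn p a []      nz = refl
    cf-conn p a (b ∷ w) nz with cf-step {p} {a} {b} {w} nz
    ... | t , nz′ = sym (step-conn p a b t) , cf-conn (not p) b w nz′
    cf-split p a []      e v nz with cf-step {p} {a} {e} {v} nz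
    ... | t , nz′ = step-conn p a e t , cf-conn (not p) e v nz′
    cf-split p a (b ∷ u) e v nz with cf-step {p} {a} {b} {u ++ e ∷ v} nz
    ... | t , nz′ with cf-split (not p) b u e v nz′
    ...   | c₁ , c₂ = (sym (step-conn p a b t) , c₁) , c₂

    ch-split : ∀ p u e v → ¬ ch p (u ++ e ∷ v) ≡ 0 →
      Conn tl hd (st (tl e) u) u (tl e) × Conn tl hd (hd e) v (en (hd e) v)
    ch-split p []      e v nz = refl , cf-conn p e v nz
    ch-split p (a ∷ u) e v nz with cf-split p a u e v nz
    ... | c₁ , c₂ = (refl , c₁) , c₂

    cf≤ch : ∀ p a w → cf p a w ≤ ch (not p) w
    cf≤ch p a []      = ≤-refl
    cf≤ch p a (b ∷ w) = ≤-trans (*-monoˡ-≤ _ (bit≤1 (step p a b))) (≤-reflexive (+-identityʳ _))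

    ch-∷ : ∀ p a w → ch p (a ∷ w) ≤ ch (not p) w
    ch-∷ p a w = cf≤ch p a w

    -- Around a heavy dart, the chain restarts with the flag true.
    ch-heavy : ∀ p u e v → Heavy (not p) (length u) → ch p (u ++ e ∷ v) ≤ ch p u * ch true v
    ch-heavy false [] e v h = ≤-trans (ch-∷ false e v) (≤-reflexive (sym (+-identityʳ _)))
    ch-heavy p (a ∷ u) e v h = go p a u h
      where
      go : ∀ p a u → Heavy (not p) (suc (length u)) → cf p a (u ++ e ∷ v) ≤ cf p a u * ch true v
      go true  a []      h = ≤-trans (*-monoˡ-≤ _ (bit≤1 (step true a e)))
        (≤-trans (≤-reflexive (+-identityʳ _)) (≤-trans (cf≤ch false e v) (≤-reflexive (sym (+-identityʳ _)))))
      go false a []      (suc ())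
      go true  a (b ∷ u) (suc h) = ≤-trans (*-monoʳ-≤ (s true a b) (go false b u h)) (≤-reflexive (sym (*-assoc (s true a b) _ _)))
      go false a (b ∷ u) (suc h) = ≤-trans (*-monoʳ-≤ (s false a b) (go true b u h)) (≤-reflexive (sym (*-assoc (s false a b) _ _)))

    -- How much of the cut of `e` lies on the walks parallel to a given one, that is, with the same
    -- ends and length.
    J : ℕ → A → Fin n → Fin n → ℕ
    J l e s t = ∑ (words l) (λ w → ch true w * (𝟙 (conn? s w t) * ∑ w (x e)))

    -- The parallel walks carry too much of the cut of `e`. The square is a reserve: its ratio to
    -- the squares belonging to the two sides of a split has a bounded sum over all splits.
    fail : ℕ → A → Fin n → Fin n → Bool
    fail l e s t = 2 * S * L ^ ⌊ l /2⌋ <ᵇ suc l * suc l * J l e s t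

    flt : List A → A → List A → ℕ
    flt u e v = bit (fail (suc (length u + length v)) e (st (tl e) u) (en (hd e) v))

    raw : List A → ℕ
    raw p = heavies false p flt

    β : List A → ℕ
    β w = cuts w (λ p _ → raw p)

    -- Collects the failures in all subwalks that start after an even number of darts. Such a start
    -- preserves the kinds of the steps, so these subwalks are again counted by `ch true`.
    tb : List A → ℕ
    tb []          = 0
    tb (a ∷ [])    = 0
    tb (a ∷ b ∷ w) = β (a ∷ b ∷ w) + tb w

    raw≤tb : ∀ w → raw w ≤ tb w
    raw≤tb []          = ≤-refl
    raw≤tb (a ∷ [])    = ≤-refl
    raw≤tb w@(a ∷ b ∷ w′) = ≤-trans (≤-trans (≤-trans (≤-reflexive refl) (cuts-∋ (λ p _ → raw p) w [])) (≤-reflexive (cong β (++[] w)))) (m≤m+n _ _)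
      where
      ++[] : ∀ (w : List A) → w ++ [] ≡ w
      ++[] []      = refl
      ++[] (a ∷ w) = cong (a ∷_) (++[] w)

    tb-prefix : ∀ u v → tb u ≤ tb (u ++ v)
    tb-prefix []          v = z≤n
    tb-prefix (a ∷ [])    v = z≤n
    tb-prefix (a ∷ b ∷ u) v = +-mono-≤ (cuts-prefix raw (a ∷ b ∷ u) v) (tb-prefix u v)

    tb-suffix : ∀ u v → Even (length u) → tb v ≤ tb (u ++ v)
    tb-suffix []          v ev              = ≤-refl
    tb-suffix (a ∷ [])    v (suc ())
    tb-suffix (a ∷ b ∷ u) v (suc (suc ev))  = ≤-trans (tb-suffix u v ev) (m≤n+m _ _)

    -- Under this condition every dart of `w` sees at most half of the weight `S` on the rest of
    -- `w`.
    FA : List A → Bool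
    FA w = 2 * ps w ≤ᵇ S

    good : List A → ℕ
    good w = bit (FA w) * bit (tb w ≡ᵇ 0)

    good-intro : ∀ {w} → 2 * ps w ≤ S → tb w ≡ 0 → good w ≡ 1
    good-intro fa z = cong₂ _*_ (bit-T (≤⇒≤ᵇ fa)) (bit-T (≡⇒≡ᵇ _ 0 z))

    good-elim : ∀ {w} → ¬ good w ≡ 0 → 2 * ps w ≤ S × tb w ≡ 0
    good-elim {w} nz = ≤ᵇ⇒≤ _ S (bit-≢0 (*≢0ˡ nz)) , ≡ᵇ⇒≡ _ 0 (bit-≢0 (*≢0ʳ {bit (FA w)} nz))

    T# : ℕ → Fin n → Fin n → ℕ
    T# l s t = ∑ (words l) (λ w → ch true w * (𝟙 (conn? s w t) * good w))

    -- Dispersion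

    revw : List A → List A
    revw []      = []
    revw (a ∷ w) = revw w ++ [ rev a ]

    Conn-++ : ∀ {r s t} u v → Conn tl hd r u s → Conn tl hd s v t → Conn tl hd r (u ++ v) t
    Conn-++ []      v refl       c = c
    Conn-++ (a ∷ u) v (eq , c₁)  c = eq , Conn-++ u v c₁ c

    Conn-rev : ∀ {s t} w → Conn tl hd s w t → Conn tl hd t (revw w) s
    Conn-rev []      refl       = refl
    Conn-rev (a ∷ w) (refl , c) = Conn-++ (revw w) _ (Conn-rev w c) (tl-rev a , hd-rev a)

    ∑-revw : ∀ e w → ∑ (revw w) (x e) ≡ ∑ w (x e)
    ∑-revw e []      = refl
    ∑-revw e (a ∷ w) = trans (∑-++ (revw w) _) (trans (cong₂ _+_ (∑-revw e w) (trans (+-identityʳ _) (x-rev e a))) (+-comm _ (x e a)))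

    length-revw : ∀ w → length (revw w) ≡ length w
    length-revw []      = refl
    length-revw (a ∷ w) = trans (length-++ (revw w)) (trans (+-comm _ 1) (cong suc (length-revw w)))

    ∈-revw : ∀ {g} w → g ∈ revw w → ∃ λ a → a ∈ w × idx g ≡ idx a
    ∈-revw (a ∷ w) g∈ with ∈-++⁻ (revw w) g∈
    ... | inj₂ (here refl) = a , here refl , idx-rev a
    ... | inj₁ g∈′ with ∈-revw w g∈′
    ...   | b , b∈ , eq = b , there b∈ , eq

    -- In a walk alternating light and heavy steps the latest edge is heavy.
    latest : ∀ w → 2 ≤ length w → ¬ ch true w ≡ 0 →
      ∃ λ u → ∃ λ e → ∃ λ v → w ≡ u ++ e ∷ v × Odd (length u) × (∀ g → g ∈ w → idx g ≤ idx e)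
    latest (a ∷ []) (s≤s ()) nz
    latest (a ∷ b ∷ []) _ nz = [ a ] , b , [] , refl , suc zero , λ
      { g (here refl) → <⇒≤ (step-up a b (proj₁ (cf-step {true} {a} {b} {[]} nz)))
      ; g (there (here refl)) → ≤-refl }
    latest (a ∷ b ∷ c ∷ []) _ nz with cf-step {true} {a} {b} {c ∷ []} nz
    ... | ab , nz′ = [ a ] , b , [ c ] , refl , suc zero , λ
      { g (here refl) → <⇒≤ (step-up a b ab)
      ; g (there (here refl)) → ≤-refl
      ; g (there (there (here refl))) → <⇒≤ (step-down b c (proj₁ (cf-step {false} {b} {c} {[]} nz′))) }
    latest (a ∷ b ∷ c ∷ d ∷ w′) _ nz = extend (latest (c ∷ d ∷ w′) (s≤s (s≤s z≤n)) rest)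
      where
      w = c ∷ d ∷ w′
      ab = proj₁ (cf-step {true} {a} {b} {w} nz)
      rest : ¬ ch true w ≡ 0
      rest = proj₂ (cf-step {false} {b} {c} {d ∷ w′} (proj₂ (cf-step {true} {a} {b} {w} nz)))
      extend : (∃ λ u → ∃ λ e → ∃ λ v → w ≡ u ++ e ∷ v × Odd (length u) × (∀ g → g ∈ w → idx g ≤ idx e)) →
        ∃ λ u → ∃ λ e → ∃ λ v → a ∷ b ∷ w ≡ u ++ e ∷ v × Odd (length u) × (∀ g → g ∈ a ∷ b ∷ w → idx g ≤ idx e)
      extend (u , e , v , eq , od , max) with ≤-total (idx b) (idx e)
      ... | inj₁ le = a ∷ b ∷ u , e , v , cong (λ z → a ∷ b ∷ z) eq , suc (suc od) , λ
            { g (here refl) → ≤-trans (<⇒≤ (step-up a b ab)) le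
            ; g (there (here refl)) → le
            ; g (there (there g∈)) → max g g∈ }
      ... | inj₂ ge = [ a ] , b , w , refl , suc zero , λ
            { g (here refl) → <⇒≤ (step-up a b ab)
            ; g (there (here refl)) → ≤-refl
            ; g (there (there g∈)) → ≤-trans (max g g∈) ge }

    latest-time : List A → ℕ
    latest-time []      = 0
    latest-time (a ∷ w) = idx a ⊔ latest-time w

    latest-time-≥ : ∀ {g} w → g ∈ w → idx g ≤ latest-time w
    latest-time-≥ (a ∷ w) (here refl) = m≤m⊔n (idx a) _
    latest-time-≥ (a ∷ w) (there g∈)  = ≤-trans (latest-time-≥ w g∈) (m≤n⊔m (idx a) _)

    latest-time-≤ : ∀ w {m} → (∀ g → g ∈ w → idx g ≤ m) → latest-time w ≤ m
    latest-time-≤ []      h = z≤n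
    latest-time-≤ (a ∷ w) h = ⊔-lub (h a (here refl)) (latest-time-≤ w (λ g g∈ → h g (there g∈)))

    module _ (l : ℕ) (l≤K : l ≤ K) (s t : Fin n) where

      count : List A → ℕ
      count w = ch true w * (𝟙 (conn? s w t) * good w)

      module _ (2≤l : 2 ≤ l) (w : List A) (w∈ : w ∈ words l) (nz : ¬ count w ≡ 0)
               (max : ∀ w′ → w′ ∈ words l → ¬ count w′ ≡ 0 → latest-time w′ ≤ latest-time w) where

        private
          cw : Conn tl hd s w t
          cw = 𝟙≢0 (conn? s w t) (*≢0ˡ (*≢0ʳ {ch true w} nz))
          gw = good-elim {w} (*≢0ʳ {𝟙 (conn? s w t)} (*≢0ʳ {ch true w} nz))
          lw = latest w (subst (2 ≤_) (sym (length-words l w∈)) 2≤l) (*≢0ˡ nz)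
          u  = proj₁ lw
          e  = proj₁ (proj₂ lw)
          v  = proj₁ (proj₂ (proj₂ lw))
          eq = proj₁ (proj₂ (proj₂ (proj₂ lw)))
          od = proj₁ (proj₂ (proj₂ (proj₂ (proj₂ lw))))
          mx = proj₂ (proj₂ (proj₂ (proj₂ (proj₂ lw))))

          around : 2 * (∑ u (x e) + ∑ v (x e)) ≤ S
          around = ≤-trans (*-monoʳ-≤ 2 (ps-at u e v)) (subst (λ z → 2 * ps z ≤ S) eq (proj₁ gw))

          Conn-split : ∀ u {e v s t} → Conn tl hd s (u ++ e ∷ v) t →
            Conn tl hd s u (tl e) × Conn tl hd (hd e) v t × s ≡ st (tl e) u × t ≡ en (hd e) v
          Conn-split []      {e} {v} (refl , c) = refl , c , refl , en-unique v c
          Conn-split (a ∷ u) (refl , c) with Conn-split u c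
          ... | c₁ , c₂ , _ , et = (refl , c₁) , c₂ , refl , et

          cs = Conn-split u (subst (λ z → Conn tl hd s z t) eq cw)

          lengths : suc (length u + length v) ≡ l
          lengths = trans (sym (+-suc _ _)) (trans (sym (length-++ u)) (trans (cong length (sym eq)) (length-words l w∈)))

          -- Otherwise `w` would itself be a failing subwalk with respect to its heavy dart `e`,
          -- contrary to `tb w ≡ 0`.
          J-small : suc l * suc l * J l e s t ≤ 2 * S * L ^ ⌊ l /2⌋
          J-small = ≮⇒≥ λ lt → raw≢0 (n≤0⇒n≡0 (≤-trans (heavies-∋ false flt u e v od)
              (≤-trans (≤-reflexive (cong raw (sym eq))) (≤-trans (raw≤tb w) (≤-reflexive (proj₂ gw))))))
              lt
            where
            raw≢0 : flt u e v ≡ 0 → 2 * S * L ^ ⌊ l /2⌋ < suc l * suc l * J l e s t → _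
            raw≢0 z lt with trans (sym z) (trans (cong bit (cong₃ (λ a b c → fail a e b c) lengths (sym (proj₁ (proj₂ (proj₂ cs)))) (sym (proj₂ (proj₂ (proj₂ cs)))))) (bit-T (<⇒<ᵇ lt)))
              where
              cong₃ : ∀ {X Y Z W : Set} (f : X → Y → Z → W) {a a′ b b′ c c′} → a ≡ a′ → b ≡ b′ → c ≡ c′ → f a b c ≡ f a′ b′ c′
              cong₃ f refl refl refl = refl
            ... | ()

          -- u and v avoid e, for otherwise they would carry weight S.
          earlier : ∀ g → g ∈ u ++ v → idx g < idx e
          earlier g g∈ = ≤∧≢⇒< (mx g (subst (g ∈_) (sym eq) g∈w)) λ i≡ →
              <⇒≱ S>0 (+-cancelˡ-≤ S _ _ (≤-trans (≤-trans (≤-reflexive (cong (S +_) (sym (+-identityʳ S))))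
                (*-monoʳ-≤ 2 (≤-trans (x-self e g i≡) (heavy (∈-++⁻ u g∈))))) (≤-trans around (≤-reflexive (sym (+-identityʳ S))))))
            where
            g∈w : g ∈ u ++ e ∷ v
            g∈w with ∈-++⁻ u g∈
            ... | inj₁ g∈u = ∈-++⁺ˡ g∈u
            ... | inj₂ g∈v = ∈-++⁺ʳ u (there g∈v)
            heavy : g ∈ u ⊎ g ∈ v → x e g ≤ ∑ u (x e) + ∑ v (x e)
            heavy (inj₁ g∈u) = ≤-trans (∑-∈ (x e) g∈u) (m≤m+n _ _)
            heavy (inj₂ g∈v) = ≤-trans (∑-∈ (x e) g∈v) (m≤n+m _ _)

          -- Back along `u`, over along `w′` and back along `v` leads from the tail of `e` to its
          -- head through earlier darts. This walk carries weight at least `S`, of which `u` and `v`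
          -- provide at most half.
          closed : ∀ w′ → w′ ∈ words l → Conn tl hd s w′ t → (∀ g → g ∈ w′ → idx g < idx e) → S ≤ 2 * ∑ w′ (x e)
          closed w′ w′∈ c′ lt = +-cancelˡ-≤ S _ _ (begin
            S + S                                                   ≡⟨ cong (S +_) (sym (+-identityʳ S)) ⟩
            2 * S                                                   ≤⟨ *-monoʳ-≤ 2 (block e q conn-q earlier-q short) ⟩
            2 * ∑ q (x e)                                           ≡⟨ cong (2 *_) weight-q ⟩
            2 * (∑ u (x e) + (∑ w′ (x e) + ∑ v (x e)))              ≡⟨ lem (∑ u (x e)) (∑ w′ (x e)) (∑ v (x e)) ⟩
            2 * (∑ u (x e) + ∑ v (x e)) + 2 * ∑ w′ (x e)            ≤⟨ +-monoˡ-≤ _ around ⟩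
            S + 2 * ∑ w′ (x e)                                      ∎)
            where
            open ≤-Reasoning
            lem : ∀ a b c → 2 * (a + (b + c)) ≡ 2 * (a + c) + 2 * b
            lem = solve-∀
            q : List A
            q = revw u ++ (w′ ++ revw v)
            conn-q : Conn tl hd (tl e) q (hd e)
            conn-q = Conn-++ (revw u) _ (Conn-rev u (proj₁ cs)) (Conn-++ w′ _ c′ (Conn-rev v (proj₁ (proj₂ cs))))
            weight-q : ∑ q (x e) ≡ ∑ u (x e) + (∑ w′ (x e) + ∑ v (x e))
            weight-q = trans (∑-++ (revw u) _) (cong₂ _+_ (∑-revw e u) (trans (∑-++ w′ _) (cong (∑ w′ (x e) +_) (∑-revw e v))))
            earlier-q : ∀ g → g ∈ q → idx g < idx e
            earlier-q g g∈ with ∈-++⁻ (revw u) g∈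
            ... | inj₁ g∈u with ∈-revw u g∈u
            ...   | a , a∈ , i≡ = subst (_< idx e) (sym i≡) (earlier a (∈-++⁺ˡ a∈))
            earlier-q g g∈ | inj₂ g∈′ with ∈-++⁻ w′ g∈′
            ... | inj₁ g∈w = lt g g∈w
            ... | inj₂ g∈v with ∈-revw v g∈v
            ...   | a , a∈ , i≡ = subst (_< idx e) (sym i≡) (earlier a (∈-++⁺ʳ u a∈))
            short : suc (length q) ≤ 2 * K
            short = begin
              suc (length q)                                ≡⟨ cong suc (trans (length-++ (revw u)) (cong₂ _+_ (length-revw u) (trans (length-++ w′) (cong₂ _+_ (length-words l w′∈) (length-revw v))))) ⟩
              suc (length u + (l + length v))               ≡⟨ lem′ (length u) l (length v) ⟩
              l + suc (length u + length v)                 ≡⟨ cong (l +_) lengths ⟩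
              l + l                                         ≤⟨ +-mono-≤ l≤K l≤K ⟩
              K + K                                         ≡⟨ cong (K +_) (sym (+-identityʳ K)) ⟩
              2 * K                                         ∎
              where
              lem′ : ∀ a l b → suc (a + (l + b)) ≡ l + suc (a + b)
              lem′ = solve-∀

          hit : ∀ w′ → w′ ∈ words l → ¬ count w′ ≡ 0 → S ≤ 2 * ∑ w′ (x e)
          hit w′ w′∈ nz′ with any-late w′
            where
            any-late : ∀ q → (∃ λ g → g ∈ q × idx e ≤ idx g) ⊎ (∀ g → g ∈ q → idx g < idx e)
            any-late [] = inj₂ λ _ ()
            any-late (a ∷ q) with idx e ≤? idx a | any-late q
            ... | yes le | _                   = inj₁ (a , here refl , le)
            ... | no  _  | inj₁ (g , g∈ , le)  = inj₁ (g , there g∈ , le)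
            ... | no ¬le | inj₂ all            = inj₂ λ { g (here refl) → ≰⇒> ¬le ; g (there g∈) → all g g∈ }
          ... | inj₂ lt = closed w′ w′∈ (𝟙≢0 (conn? s w′ t) (*≢0ˡ (*≢0ʳ {ch true w′} nz′))) lt
          -- By the choice of `w` no dart of `w′` is later than `e`; one of the same time has weight
          -- `S` by `x-self`.
          ... | inj₁ (g , g∈ , le) = ≤-trans (x-self e g (≤-antisym upper le)) (≤-trans (∑-∈ (x e) g∈) (m≤m+n _ _))
            where
            upper : idx g ≤ idx e
            upper = ≤-trans (latest-time-≥ w′ g∈) (≤-trans (max w′ w′∈ nz′) (latest-time-≤ w mx))

        -- Double counting of the cut of `e`: every good walk from `s` to `t` carries at least `S/2`
        -- of it, and together they carry at most `J`, which is small.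
        T#-latest : T# l s t * (suc l * suc l) ≤ 4 * L ^ ⌊ l /2⌋
        T#-latest = *-cancelʳ-≤ _ _ S {{>-nonZero S>0}} (begin
          T# l s t * (suc l * suc l) * S          ≡⟨ lem (T# l s t) (suc l * suc l) S ⟩
          suc l * suc l * (T# l s t * S)          ≤⟨ *-monoʳ-≤ (suc l * suc l) T·S≤2J ⟩
          suc l * suc l * (2 * J l e s t)         ≡⟨ lem′ (suc l * suc l) (J l e s t) ⟩
          2 * (suc l * suc l * J l e s t)         ≤⟨ *-monoʳ-≤ 2 J-small ⟩
          2 * (2 * S * L ^ ⌊ l /2⌋)               ≡⟨ lem″ S (L ^ ⌊ l /2⌋) ⟩
          4 * L ^ ⌊ l /2⌋ * S                     ∎)
          where
          open ≤-Reasoning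
          lem : ∀ a b c → a * b * c ≡ b * (a * c)
          lem = solve-∀
          lem′ : ∀ a b → a * (2 * b) ≡ 2 * (a * b)
          lem′ = solve-∀
          lem″ : ∀ a b → 2 * (2 * a * b) ≡ 4 * b * a
          lem″ = solve-∀
          term : ∀ w′ → w′ ∈ words l → count w′ * S ≤ 2 * (ch true w′ * (𝟙 (conn? s w′ t) * ∑ w′ (x e)))
          term w′ w′∈ = begin
            count w′ * S                                                    ≤⟨ ≤-support {c = count w′} (hit w′ w′∈) ⟩
            count w′ * (2 * ∑ w′ (x e))                                     ≤⟨ *-monoˡ-≤ _ (*-monoʳ-≤ (ch true w′) (≤-trans (*-monoʳ-≤ (𝟙 (conn? s w′ t)) (*-mono-≤ (bit≤1 (FA w′)) (bit≤1 (tb w′ ≡ᵇ 0)))) (≤-reflexive (*-identityʳ _)))) ⟩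
            ch true w′ * 𝟙 (conn? s w′ t) * (2 * ∑ w′ (x e))                ≡⟨ lem₃ (ch true w′) _ _ ⟩
            2 * (ch true w′ * (𝟙 (conn? s w′ t) * ∑ w′ (x e)))              ∎
            where
            lem₃ : ∀ a b c → a * b * (2 * c) ≡ 2 * (a * (b * c))
            lem₃ = solve-∀
          T·S≤2J : T# l s t * S ≤ 2 * J l e s t
          T·S≤2J = begin
            T# l s t * S                                    ≡⟨ sym (∑-*ʳ S (words l)) ⟩
            ∑ (words l) (λ w′ → count w′ * S)               ≤⟨ ∑-mono∈ (words l) term ⟩
            ∑ (words l) (λ w′ → 2 * (ch true w′ * (𝟙 (conn? s w′ t) * ∑ w′ (x e)))) ≡⟨ ∑-*ˡ 2 (words l) ⟩
            2 * J l e s t                                   ∎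

    -- Walks with fewer than two darts have no heavy dart and are counted directly; for a single
    -- dart this is `simple`. For longer ones, a good walk whose latest time is maximal is chosen.
    dispersion : ∀ l → l ≤ K → ∀ s t → T# l s t * (suc l * suc l) ≤ 4 * L ^ ⌊ l /2⌋
    dispersion zero _ s t = begin
      T# 0 s t * 1         ≡⟨ *-identityʳ _ ⟩
      T# 0 s t             ≡⟨ +-identityʳ _ ⟩
      1 * (𝟙 (conn? s [] t) * good [])  ≤⟨ *-monoʳ-≤ 1 (*-mono-≤ (𝟙≤1 (conn? s [] t)) (*-mono-≤ (bit≤1 (FA [])) (bit≤1 (tb [] ≡ᵇ 0)))) ⟩
      1                    ≤⟨ s≤s z≤n ⟩
      4                    ∎
      where open ≤-Reasoning
    dispersion (suc zero) _ s t = ≤-trans (*-monoˡ-≤ 4 T₁≤1) (≤-reflexive refl)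
      where
      open ≤-Reasoning
      T₁≤1 : T# 1 s t ≤ 1
      T₁≤1 = begin
        T# 1 s t                                                          ≡⟨ trans (∑-words-suc 0) (∑-cong as (λ a → +-identityʳ _)) ⟩
        ∑ as (λ a → 1 * (𝟙 (conn? s (a ∷ []) t) * good (a ∷ [])))        ≤⟨ ∑-mono as (λ a → ≤-trans (≤-reflexive (+-identityʳ _)) (≤-trans (*-monoʳ-≤ (𝟙 (conn? s (a ∷ []) t)) (*-mono-≤ (bit≤1 (FA (a ∷ []))) (bit≤1 (tb (a ∷ []) ≡ᵇ 0)))) (≤-reflexive (*-identityʳ _)))) ⟩
        ∑ as (λ a → 𝟙 (conn? s (a ∷ []) t))                              ≡⟨ ∑-cong as (λ a → bit-∧ (does (tl a Fin.≟ s)) (does (hd a Fin.≟ t))) ⟩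
        ∑ as (λ a → 𝟙 (tl a Fin.≟ s) * 𝟙 (hd a Fin.≟ t))                 ≤⟨ simple s t ⟩
        1                                                                 ∎
    dispersion l@(suc (suc _)) l≤K s t with argmax (words l) (count l l≤K s t) latest-time
    ... | inj₁ none = ≤-trans (≤-reflexive (cong (_* (suc l * suc l)) (trans (∑-cong∈ (words l) none) (∑-zero (words l))))) z≤n
    ... | inj₂ (w , w∈ , nz , max) = T#-latest l l≤K s t (s≤s (s≤s z≤n)) w w∈ nz max

  -- Splitting bad walks at a heavy dart

  rectangle : {U W X Y : Set} (us : List U) (ws : List W) (ss : List X) (ts : List Y)
    {g : X → Y → ℕ} {a : U → X → ℕ} {b : W → Y → ℕ} →
    ∑ us (λ u → ∑ ws (λ v → ∑ ss (λ s → ∑ ts (λ t → g s t * (a u s * b v t))))) ≡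
    ∑ ss (λ s → ∑ ts (λ t → g s t * (∑ us (λ u → a u s) * ∑ ws (λ v → b v t))))
  rectangle us ws ss ts {g} {a} {b} = begin
    ∑ us (λ u → ∑ ws (λ v → ∑ ss (λ s → ∑ ts (λ t → g s t * (a u s * b v t)))))
      ≡⟨ ∑-cong us (λ u → ∑-swap ws ss) ⟩
    ∑ us (λ u → ∑ ss (λ s → ∑ ws (λ v → ∑ ts (λ t → g s t * (a u s * b v t)))))
      ≡⟨ ∑-swap us ss ⟩
    ∑ ss (λ s → ∑ us (λ u → ∑ ws (λ v → ∑ ts (λ t → g s t * (a u s * b v t)))))
      ≡⟨ ∑-cong ss (λ s → ∑-cong us (λ u → ∑-swap ws ts)) ⟩
    ∑ ss (λ s → ∑ us (λ u → ∑ ts (λ t → ∑ ws (λ v → g s t * (a u s * b v t)))))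
      ≡⟨ ∑-cong ss (λ s → ∑-swap us ts) ⟩
    ∑ ss (λ s → ∑ ts (λ t → ∑ us (λ u → ∑ ws (λ v → g s t * (a u s * b v t)))))
      ≡⟨ ∑-cong ss (λ s → ∑-cong ts (λ t → one s t)) ⟩
    ∑ ss (λ s → ∑ ts (λ t → g s t * (∑ us (λ u → a u s) * ∑ ws (λ v → b v t)))) ∎
    where
    open ≡-Reasoning
    one : ∀ s t → ∑ us (λ u → ∑ ws (λ v → g s t * (a u s * b v t))) ≡ g s t * (∑ us (λ u → a u s) * ∑ ws (λ v → b v t))
    one s t = begin
      ∑ us (λ u → ∑ ws (λ v → g s t * (a u s * b v t)))    ≡⟨ ∑-cong us (λ u → trans (∑-*ˡ (g s t) ws) (cong (g s t *_) (∑-*ˡ (a u s) ws))) ⟩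
      ∑ us (λ u → g s t * (a u s * ∑ ws (λ v → b v t)))    ≡⟨ ∑-*ˡ (g s t) us ⟩
      g s t * ∑ us (λ u → a u s * ∑ ws (λ v → b v t))      ≡⟨ cong (g s t *_) (∑-*ʳ (∑ ws (λ v → b v t)) us) ⟩
      g s t * (∑ us (λ u → a u s) * ∑ ws (λ v → b v t))    ∎

  module BadCount (sys : System) (L : ℕ) (L>0 : 0 < L) where
    open System sys
    open Words as
    open Dispersion sys
    open Counting sys L L>0

    -- Both sides of the failing split are required to be good, so that `dispersion` applies to each
    -- of them.
    bad : List A → A → List A → ℕ
    bad u e v = flt u e v * (good u * good v)

    Bad : ℕ → ℕ → ℕ
    Bad x y = ∑ (words x) (λ u → ∑ as (λ e → ∑ (words y) (λ v → ch true (u ++ e ∷ v) * bad u e v)))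

    -- A nonempty walk has just one pair of ends, so summing over `s` and `t` restores the sum over
    -- all walks, to which `marks` applies.
    J-total : ∀ l → D * ∑ as (λ e → ∑ vs (λ s → ∑ vs (λ t → J (suc l) e s t))) ≤ suc l * D ^ suc l * (N * (Φ * S))
    J-total l = begin
      D * ∑ as (λ e → ∑ vs (λ s → ∑ vs (λ t → J (suc l) e s t)))
        ≤⟨ *-monoʳ-≤ D (∑-mono as per-edge) ⟩
      D * ∑ as (λ e → ∑ (words (suc l)) (λ w → ch true w * ∑ w (x e)))
        ≡⟨ sym (∑-*ˡ D as) ⟩
      ∑ as (λ e → D * ∑ (words (suc l)) (λ w → ch true w * ∑ w (x e)))
        ≤⟨ ∑-mono as (λ e → ≤-trans (marks (suc l) true (x e)) (*-monoʳ-≤ (suc l * D ^ suc l) (x-sum e))) ⟩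
      ∑ as (λ e → suc l * D ^ suc l * (Φ * S))
        ≡⟨ trans (∑-const _ as) (lem N (suc l * D ^ suc l) (Φ * S)) ⟩
      suc l * D ^ suc l * (N * (Φ * S)) ∎
      where
      open ≤-Reasoning
      lem : ∀ N a b → N * (a * b) ≡ a * (N * b)
      lem = solve-∀
      per-word : ∀ e w → ∑ vs (λ s → ∑ vs (λ t → ch true w * (𝟙 (conn? s w t) * ∑ w (x e)))) ≤ ch true w * ∑ w (x e)
      per-word e [] = ≤-reflexive (trans (∑-cong vs (λ s → trans (∑-cong vs (λ t → lem₀ (𝟙 (conn? s [] t)))) (∑-zero vs))) (∑-zero vs))
        where
        lem₀ : ∀ a → 1 * (a * 0) ≡ 0
        lem₀ = solve-∀
      per-word e w@(a ∷ w′) = begin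
        ∑ vs (λ s → ∑ vs (λ t → ch true w * (𝟙 (conn? s w t) * ∑ w (x e))))
          ≡⟨ ∑-cong vs (λ s → ∑-cong vs (λ t → lem₁ (ch true w) (𝟙 (conn? s w t)) (∑ w (x e)))) ⟩
        ∑ vs (λ s → ∑ vs (λ t → ch true w * ∑ w (x e) * 𝟙 (conn? s w t)))
          ≡⟨ trans (∑-cong vs (λ s → ∑-*ˡ (ch true w * ∑ w (x e)) vs)) (∑-*ˡ (ch true w * ∑ w (x e)) vs) ⟩
        ch true w * ∑ w (x e) * ∑ vs (λ s → ∑ vs (λ t → 𝟙 (conn? s w t)))
          ≤⟨ *-monoʳ-≤ (ch true w * ∑ w (x e)) (endpoints≤1 a w′) ⟩
        ch true w * ∑ w (x e) * 1
          ≡⟨ *-identityʳ _ ⟩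
        ch true w * ∑ w (x e) ∎
        where
        lem₁ : ∀ a b c → a * (b * c) ≡ a * c * b
        lem₁ = solve-∀
      per-edge : ∀ e → ∑ vs (λ s → ∑ vs (λ t → J (suc l) e s t)) ≤ ∑ (words (suc l)) (λ w → ch true w * ∑ w (x e))
      per-edge e = begin
        ∑ vs (λ s → ∑ vs (λ t → J (suc l) e s t))
          ≡⟨ trans (∑-cong vs (λ s → ∑-swap vs (words (suc l)))) (∑-swap vs (words (suc l))) ⟩
        ∑ (words (suc l)) (λ w → ∑ vs (λ s → ∑ vs (λ t → ch true w * (𝟙 (conn? s w t) * ∑ w (x e)))))
          ≤⟨ ∑-mono (words (suc l)) (per-word e) ⟩
        ∑ (words (suc l)) (λ w → ch true w * ∑ w (x e)) ∎

    ∑³ : (A → Fin n → Fin n → ℕ) → ℕ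
    ∑³ F = ∑ as (λ e → ∑ vs (λ s → ∑ vs (λ t → F e s t)))

    ∑³-mono : ∀ F G → (∀ e s t → F e s t ≤ G e s t) → ∑³ F ≤ ∑³ G
    ∑³-mono F G h = ∑-mono as (λ e → ∑-mono vs (λ s → ∑-mono vs (λ t → h e s t)))

    ∑³-*ˡ : ∀ c F → ∑³ (λ e s t → c * F e s t) ≡ c * ∑³ F
    ∑³-*ˡ c F = trans (∑-cong as (λ e → trans (∑-cong vs (λ s → ∑-*ˡ c vs {F e s})) (∑-*ˡ c vs {λ s → ∑ vs (F e s)}))) (∑-*ˡ c as {λ e → ∑ vs (λ s → ∑ vs (F e s))})

    module _ (x′ y : ℕ) (od : Odd x′) where

      private
        l c M : ℕ
        l = suc (x′ + y)
        c = 2 * S * L ^ ⌊ l /2⌋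
        M = suc l * suc l
        tu : A → List A → Fin n → ℕ
        tu e u s = ch true u * (𝟙 (conn? s u (tl e)) * good u)
        tv : A → List A → Fin n → ℕ
        tv e v t = ch true v * (𝟙 (conn? (hd e) v t) * good v)

        -- The summand of the actual ends of `u` and `v` alone suffices: there `fail` exchanges `c`
        -- for `M * J`, and both sides are good walks that end at `e`. Summing over all ends lets
        -- the two sides be counted independently.
        pointwise : ∀ u → u ∈ words x′ → ∀ e v → v ∈ words y → ch true (u ++ e ∷ v) * bad u e v * c ≤
          ∑ vs (λ s → ∑ vs (λ t → M * J l e s t * (tu e u s * tv e v t)))
        pointwise u u∈ e v v∈ = begin
          ch true (u ++ e ∷ v) * bad u e v * c                          ≤⟨ ≤-support (λ nz → small (*≢0ʳ {ch true (u ++ e ∷ v)} nz)) ⟩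
          ch true (u ++ e ∷ v) * bad u e v * (M * J l e s₀ t₀)          ≤⟨ *-monoˡ-≤ (M * J l e s₀ t₀) product ⟩
          tu e u s₀ * tv e v t₀ * (M * J l e s₀ t₀)                     ≡⟨ *-comm _ (M * J l e s₀ t₀) ⟩
          M * J l e s₀ t₀ * (tu e u s₀ * tv e v t₀)                     ≤⟨ ∑-∈ (λ t → M * J l e s₀ t * (tu e u s₀ * tv e v t)) (∈-allFin t₀) ⟩
          ∑ vs (λ t → M * J l e s₀ t * (tu e u s₀ * tv e v t))          ≤⟨ ∑-∈ (λ s → ∑ vs (λ t → M * J l e s t * (tu e u s * tv e v t))) (∈-allFin s₀) ⟩
          ∑ vs (λ s → ∑ vs (λ t → M * J l e s t * (tu e u s * tv e v t))) ∎
          where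
          open ≤-Reasoning
          s₀ = st (tl e) u
          t₀ = en (hd e) v
          small : ¬ bad u e v ≡ 0 → c ≤ M * J l e s₀ t₀
          small nz = subst (λ k → 2 * S * L ^ ⌊ k /2⌋ ≤ suc k * suc k * J k e s₀ t₀)
            (cong suc (cong₂ _+_ (length-words x′ u∈) (length-words y v∈)))
            (<⇒≤ (<ᵇ⇒< _ _ (bit-≢0 (*≢0ˡ {flt u e v} nz))))
          product : ch true (u ++ e ∷ v) * bad u e v ≤ tu e u s₀ * tv e v t₀
          product with ch true (u ++ e ∷ v) ≟ 0
          ... | yes z = ≤-trans (≤-reflexive (cong (_* bad u e v) z)) z≤n
          ... | no nz = begin
            ch true (u ++ e ∷ v) * bad u e v
              ≤⟨ *-mono-≤ (ch-heavy true u e v (subst Odd (sym (length-words x′ u∈)) od))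
                   (≤-trans (*-monoˡ-≤ (good u * good v) (bit≤1 (fail (suc (length u + length v)) e s₀ t₀))) (≤-reflexive (+-identityʳ _))) ⟩
            ch true u * ch true v * (good u * good v)
              ≡⟨ lem (ch true u) (ch true v) (good u) (good v) ⟩
            ch true u * (1 * good u) * (ch true v * (1 * good v))
              ≡⟨ cong₂ (λ a b → ch true u * (a * good u) * (ch true v * (b * good v)))
                   (sym (𝟙-yes (conn? s₀ u (tl e)) (proj₁ conns))) (sym (𝟙-yes (conn? (hd e) v t₀) (proj₂ conns))) ⟩
            tu e u s₀ * tv e v t₀ ∎
            where
            conns = ch-split true u e v nz
            lem : ∀ a b g h → a * b * (g * h) ≡ a * (1 * g) * (b * (1 * h))
            lem = solve-∀

        TT : A → Fin n → Fin n → ℕ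
        TT e s t = M * J l e s t * (T# x′ s (tl e) * T# y (hd e) t)

        pointwise-sum : A → List A → List A → ℕ
        pointwise-sum e u v = ∑ vs (λ s → ∑ vs (λ t → M * J l e s t * (tu e u s * tv e v t)))

        via-T : Bad x′ y * c ≤ ∑³ TT
        via-T = begin
          Bad x′ y * c
            ≡⟨ sym (∑-*ʳ c (words x′) {λ u → ∑ as (λ e → ∑ (words y) (λ v → ch true (u ++ e ∷ v) * bad u e v))}) ⟩
          ∑ (words x′) (λ u → ∑ as (λ e → ∑ (words y) (λ v → ch true (u ++ e ∷ v) * bad u e v)) * c)
            ≤⟨ ∑-mono∈ (words x′) per-u ⟩
          ∑ (words x′) (λ u → ∑ as (λ e → ∑ (words y) (λ v → pointwise-sum e u v)))
            ≡⟨ ∑-swap (words x′) as {λ u e → ∑ (words y) (λ v → pointwise-sum e u v)} ⟩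
          ∑ as (λ e → ∑ (words x′) (λ u → ∑ (words y) (λ v → pointwise-sum e u v)))
            ≡⟨ ∑-cong as (λ e → rectangle (words x′) (words y) vs vs {λ s t → M * J l e s t} {tu e} {tv e}) ⟩
          ∑³ TT ∎
          where
          open ≤-Reasoning
          per-e : ∀ u → u ∈ words x′ → ∀ e → ∑ (words y) (λ v → ch true (u ++ e ∷ v) * bad u e v) * c ≤ ∑ (words y) (λ v → pointwise-sum e u v)
          per-e u u∈ e = ≤-trans (≤-reflexive (sym (∑-*ʳ c (words y) {λ v → ch true (u ++ e ∷ v) * bad u e v})))
            (∑-mono∈ (words y) (λ v v∈ → pointwise u u∈ e v v∈))
          per-u : ∀ u → u ∈ words x′ → ∑ as (λ e → ∑ (words y) (λ v → ch true (u ++ e ∷ v) * bad u e v)) * c ≤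
            ∑ as (λ e → ∑ (words y) (λ v → pointwise-sum e u v))
          per-u u u∈ = ≤-trans (≤-reflexive (sym (∑-*ʳ c as {λ e → ∑ (words y) (λ v → ch true (u ++ e ∷ v) * bad u e v)})))
            (∑-mono as (per-e u u∈))

        X Y : ℕ
        X = suc x′ * suc x′
        Y = suc y * suc y

      -- The exponents of L leave one factor L for the latest edge.
      Bad-bound : l ≤ K → D * (L * (X * Y * Bad x′ y)) ≤ 8 * (M * (K * D ^ l * (N * Φ)))
      Bad-bound l≤K = *-cancelʳ-≤ _ _ (2 * S * Lxy) {{>-nonZero (*-mono-≤ (*-mono-≤ (s≤s (z≤n {1})) S>0) (m^n>0 L {{>-nonZero L>0}} (⌊ x′ /2⌋ + ⌊ y /2⌋)))}} (begin
        D * (L * (X * Y * Bad x′ y)) * (2 * S * Lxy)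
          ≡⟨ lem₁ D L (X * Y) (Bad x′ y) S Lxy ⟩
        D * (X * Y * (Bad x′ y * (2 * S * (L * Lxy))))
          ≡⟨ cong (λ h → D * (X * Y * (Bad x′ y * (2 * S * L ^ h)))) (sym (half-odd od y)) ⟩
        D * (X * Y * (Bad x′ y * c))
          ≤⟨ *-monoʳ-≤ D (*-monoʳ-≤ (X * Y) via-T) ⟩
        D * (X * Y * ∑³ TT)
          ≡⟨ cong (D *_) (sym (∑³-*ˡ (X * Y) TT)) ⟩
        D * ∑³ (λ e s t → X * Y * TT e s t)
          ≤⟨ *-monoʳ-≤ D (∑³-mono (λ e s t → X * Y * TT e s t) (λ e s t → M * (16 * Lxy) * J l e s t) term) ⟩
        D * ∑³ (λ e s t → M * (16 * Lxy) * J l e s t)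
          ≡⟨ cong (D *_) (∑³-*ˡ (M * (16 * Lxy)) (J l)) ⟩
        D * (M * (16 * Lxy) * ∑³ (J l))
          ≡⟨ lem₂ D (M * (16 * Lxy)) (∑³ (J l)) ⟩
        M * (16 * Lxy) * (D * ∑³ (J l))
          ≤⟨ *-monoʳ-≤ (M * (16 * Lxy)) (≤-trans (J-total (x′ + y)) (*-monoˡ-≤ _ (*-monoˡ-≤ (D ^ l) l≤K))) ⟩
        M * (16 * Lxy) * (K * D ^ l * (N * (Φ * S)))
          ≡⟨ lem₃ M Lxy (K * D ^ l) N Φ S ⟩
        8 * (M * (K * D ^ l * (N * Φ))) * (2 * S * Lxy) ∎)
        where
        open ≤-Reasoning
        Lxy = L ^ (⌊ x′ /2⌋ + ⌊ y /2⌋)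
        lem₁ : ∀ D L X B S E → D * (L * (X * B)) * (2 * S * E) ≡ D * (X * (B * (2 * S * (L * E))))
        lem₁ = solve-∀
        lem₂ : ∀ a b c → a * (b * c) ≡ b * (a * c)
        lem₂ = solve-∀
        lem₃ : ∀ M E K N Φ S → M * (16 * E) * (K * (N * (Φ * S))) ≡ 8 * (M * (K * (N * Φ))) * (2 * S * E)
        lem₃ = solve-∀
        term : ∀ e s t → X * Y * TT e s t ≤ M * (16 * Lxy) * J l e s t
        term e s t = begin
          X * Y * (M * J l e s t * (T# x′ s (tl e) * T# y (hd e) t))
            ≡⟨ lem₄ X Y M (J l e s t) (T# x′ s (tl e)) (T# y (hd e) t) ⟩
          M * J l e s t * (T# x′ s (tl e) * X * (T# y (hd e) t * Y))
            ≤⟨ *-monoʳ-≤ (M * J l e s t) (*-mono-≤ (dispersion x′ (≤-trans (m≤m+n x′ y) (≤-trans (n≤1+n _) l≤K)) s (tl e)) (dispersion y (≤-trans (m≤n+m y x′) (≤-trans (n≤1+n _) l≤K)) (hd e) t)) ⟩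
          M * J l e s t * (4 * L ^ ⌊ x′ /2⌋ * (4 * L ^ ⌊ y /2⌋))
            ≡⟨ lem₅ M (J l e s t) (L ^ ⌊ x′ /2⌋) (L ^ ⌊ y /2⌋) ⟩
          M * (16 * (L ^ ⌊ x′ /2⌋ * L ^ ⌊ y /2⌋)) * J l e s t
            ≡⟨ cong (λ z → M * (16 * z) * J l e s t) (sym (^-distribˡ-+-* L ⌊ x′ /2⌋ ⌊ y /2⌋)) ⟩
          M * (16 * Lxy) * J l e s t ∎
          where
          lem₄ : ∀ X Y M J T U → X * Y * (M * J * (T * U)) ≡ M * J * (T * X * (U * Y))
          lem₄ = solve-∀
          lem₅ : ∀ M J a b → M * J * (4 * a * (4 * b)) ≡ M * (16 * (a * b)) * J
          lem₅ = solve-∀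

  -- Most walks are good

  conv-*ˡ : ∀ c k (F : ℕ → ℕ → ℕ) → c * conv k F ≡ conv k (λ x y → c * F x y)
  conv-*ˡ c zero    F = refl
  conv-*ˡ c (suc k) F = trans (*-distribˡ-+ c _ _) (cong (c * F 0 (suc k) +_) (conv-*ˡ c k (λ x y → F (suc x) y)))

  conv-const : ∀ c k → conv k (λ _ _ → c) ≡ suc k * c
  conv-const c zero    = sym (+-identityʳ c)
  conv-const c (suc k) = cong (c +_) (conv-const c k)

  hconv-*ˡ : ∀ c p k (F : ℕ → ℕ → ℕ) → c * hconv p k F ≡ hconv p k (λ x y → c * F x y)
  hconv-*ˡ c p     zero    F = *-zeroʳ c
  hconv-*ˡ c false (suc k) F = hconv-*ˡ c true k (λ x y → F (suc x) y)
  hconv-*ˡ c true  (suc k) F = trans (*-distribˡ-+ c _ _) (cong (c * F 0 k +_) (hconv-*ˡ c false k (λ x y → F (suc x) y)))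

  hconv-+ : ∀ p k (F G : ℕ → ℕ → ℕ) → hconv p k (λ x y → F x y + G x y) ≡ hconv p k F + hconv p k G
  hconv-+ p     zero    F G = refl
  hconv-+ false (suc k) F G = hconv-+ true k (λ x y → F (suc x) y) (λ x y → G (suc x) y)
  hconv-+ true  (suc k) F G = trans (cong (F 0 k + G 0 k +_) (hconv-+ false k (λ x y → F (suc x) y) (λ x y → G (suc x) y))) (+-interchange (F 0 k) (G 0 k) _ _)

  hconv-left : ∀ p k (f : ℕ → ℕ) → hconv p k (λ x y → f x) ≤ ∑< k f
  hconv-left p     zero    f = z≤n
  hconv-left false (suc k) f = ≤-trans (hconv-left true k (f ∘ suc)) (≤-trans (m≤n+m _ (f 0)) (≤-reflexive (sym (∑<-front k f))))
  hconv-left true  (suc k) f = ≤-trans (+-monoʳ-≤ (f 0) (hconv-left false k (f ∘ suc))) (≤-reflexive (sym (∑<-front k f)))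

  hconv-right : ∀ p k (f : ℕ → ℕ) → hconv p k (λ x y → f y) ≤ ∑< k f
  hconv-right p     zero    f = z≤n
  hconv-right false (suc k) f = ≤-trans (hconv-right true k f) (m≤m+n _ _)
  hconv-right true  (suc k) f = ≤-trans (+-monoʳ-≤ (f k) (hconv-right false k f)) (≤-reflexive (+-comm (f k) _))

  module WalkBound (sys : System) (L : ℕ) (L>0 : 0 < L) where
    open System sys
    open Words as
    open Dispersion sys
    open Counting sys L L>0
    open BadCount sys L L>0

    badw : List A → ℕ
    badw w = bit (FA w) * bit (not (tb w ≡ᵇ 0))

    nb : ℕ → ℕ
    nb j = ∑ (words j) (λ w → ch true w * badw w)

    badw≤1 : ∀ w → badw w ≤ 1
    badw≤1 w = *-mono-≤ (bit≤1 (FA w)) (bit≤1 (not (tb w ≡ᵇ 0)))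

    badw-intro : ∀ {w} → 2 * ps w ≤ S → ¬ tb w ≡ 0 → badw w ≡ 1
    badw-intro {w} fa nz = cong₂ _*_ (bit-T (≤⇒≤ᵇ fa)) (lem (tb w) nz)
      where
      lem : ∀ m → ¬ m ≡ 0 → bit (not (m ≡ᵇ 0)) ≡ 1
      lem zero    h = ⊥-elim (h refl)
      lem (suc m) h = refl

    badw-elim : ∀ {w} → ¬ badw w ≡ 0 → 2 * ps w ≤ S × ¬ tb w ≡ 0
    badw-elim {w} nz = ≤ᵇ⇒≤ _ S (bit-≢0 (*≢0ˡ nz)) , λ z → *≢0ʳ {bit (FA w)} nz (cong (λ m → bit (not (m ≡ᵇ 0))) z)

    -- If `w` has no failure, the shortest failing prefix is split at its failing dart `e`. The
    -- prefixes of the left side are shorter, hence do not fail; all other subwalks of the two sides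
    -- that count for `tb` lie within `w`, because `e` is in an even position.
    split-bad : ∀ a b w → badw (a ∷ b ∷ w) ≤ badw w + cuts (a ∷ b ∷ w) (λ p _ → heavies false p bad)
    split-bad a b w with badw (a ∷ b ∷ w) ≟ 0
    ... | yes z = ≤-trans (≤-reflexive z) z≤n
    ... | no nz with tb w ≟ 0
    ...   | no nz′ = ≤-trans (badw≤1 (a ∷ b ∷ w)) (≤-trans (≤-reflexive (sym (badw-intro {w} fa-w nz′))) (m≤m+n _ _))
      where
      fa-w : 2 * ps w ≤ S
      fa-w = ≤-trans (*-monoʳ-≤ 2 (ps-suffix (a ∷ b ∷ []) w)) (proj₁ (badw-elim {a ∷ b ∷ w} nz))
    ...   | yes z with cuts-first raw (a ∷ b ∷ w) (λ z′ → proj₂ (badw-elim {a ∷ b ∷ w} nz) (cong₂ _+_ z′ z))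
    ...     | p , q , eq , nzp , min with heavies-≢0 false p flt nzp
    ...       | u , e , v , eqp , od , nzf = ≤-trans (badw≤1 (a ∷ b ∷ w)) (≤-trans one (m≤n+m _ (badw w)))
      where
      fa = proj₁ (badw-elim {a ∷ b ∷ w} nz)
      eqw : a ∷ b ∷ w ≡ u ++ e ∷ (v ++ q)
      eqw = trans eq (trans (cong (_++ q) eqp) (++-assoc u (e ∷ v) q))
      fa-whole : 2 * ps (u ++ e ∷ (v ++ q)) ≤ S
      fa-whole = subst (λ z → 2 * ps z ≤ S) eqw fa
      good-u : ∀ u → a ∷ b ∷ w ≡ u ++ e ∷ (v ++ q) → β u ≡ 0 → tb u ≡ 0
      good-u []           _    _ = refl
      good-u (_ ∷ [])     _    _ = refl
      good-u (_ ∷ _ ∷ u′) refl h = cong₂ _+_ h (n≤0⇒n≡0 (≤-trans (tb-prefix u′ (e ∷ (v ++ q))) (≤-reflexive z)))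
      tail-zero : ∀ u → Odd (length u) → a ∷ b ∷ w ≡ u ++ e ∷ (v ++ q) → tb (v ++ q) ≡ 0
      tail-zero (_ ∷ [])     _               refl = z
      tail-zero (_ ∷ _ ∷ u′) (suc (suc od′)) refl = n≤0⇒n≡0 (≤-trans (tb-suffix (u′ ++ e ∷ []) (v ++ q) (even {u′} od′))
          (≤-reflexive (trans (cong tb (++-assoc u′ (e ∷ []) (v ++ q))) z)))
        where
        even : ∀ {u′} → Odd (length u′) → Even (length (u′ ++ e ∷ []))
        even {u′} h = subst Even (sym (trans (length-++ u′) (+-comm _ 1))) (suc h)
      bad≡1 : 1 ≤ bad u e v
      bad≡1 = *-mono-≤ (n≢0⇒n>0 nzf) (*-mono-≤ {1} {good u} {1} {good v}
        (≤-reflexive (sym (good-intro {u} (≤-trans (*-monoʳ-≤ 2 (ps-prefix u _)) fa-whole) (good-u u eqw (min u e v eqp)))))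
        (≤-reflexive (sym (good-intro {v}
          (≤-trans (*-monoʳ-≤ 2 (≤-trans (≤-trans (ps-prefix v q) (m≤n+m _ _)) (ps-suffix u (e ∷ (v ++ q))))) fa-whole)
          (n≤0⇒n≡0 (≤-trans (tb-prefix v q) (≤-reflexive (tail-zero u od eqw))))))))
      one : 1 ≤ cuts (a ∷ b ∷ w) (λ p _ → heavies false p bad)
      one = ≤-trans bad≡1 (≤-trans (heavies-∋ false bad u e v od) (≤-trans (≤-reflexive (cong (λ p → heavies false p bad) (sym eqp)))
        (≤-trans (cuts-∋ (λ p _ → heavies false p bad) p q) (≤-reflexive (cong (λ w → cuts w (λ p _ → heavies false p bad)) (sym eq))))))

    -- A failing prefix has at most `D^z` continuations by `z` darts, so only the prefix has to be
    -- counted.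
    prefix-sum : ∀ k → ∑ (words k) (λ w → ch true w * cuts w (λ p _ → heavies false p bad)) ≤
      conv k (λ l z → hconv false l (λ x y → Bad x y * D ^ z))
    prefix-sum k = begin
      ∑ (words k) (λ w → ch true w * cuts w (λ p _ → heavies false p bad))
        ≡⟨ ∑-cong (words k) (λ w → cuts-scale (ch true) w (λ p _ → heavies false p bad)) ⟩
      ∑ (words k) (λ w → cuts w (λ p q → ch true (p ++ q) * heavies false p bad))
        ≡⟨ ∑-cuts as k {λ p q → ch true (p ++ q) * heavies false p bad} ⟩
      conv k (λ l z → ∑ (words l) (λ p → ∑ (words z) (λ q → ch true (p ++ q) * heavies false p bad)))
        ≤⟨ conv-mono k (λ l z _ → fixed l z) ⟩
      conv k (λ l z → hconv false l (λ x y → Bad x y * D ^ z)) ∎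
      where
      open ≤-Reasoning
      per-prefix : ∀ z p → ∑ (words z) (λ q → ch true (p ++ q) * heavies false p bad) ≤
        heavies false p (λ u e v → ch true (u ++ e ∷ v) * bad u e v * D ^ z)
      per-prefix z p = begin
        ∑ (words z) (λ q → ch true (p ++ q) * heavies false p bad)
          ≡⟨ ∑-cong (words z) (λ q → heavies-scale (λ p → ch true (p ++ q)) false p bad) ⟩
        ∑ (words z) (λ q → heavies false p (λ u e v → ch true ((u ++ e ∷ v) ++ q) * bad u e v))
          ≡⟨ ∑-heavies-swap (words z) false p (λ q u e v → ch true ((u ++ e ∷ v) ++ q) * bad u e v) ⟩
        heavies false p (λ u e v → ∑ (words z) (λ q → ch true ((u ++ e ∷ v) ++ q) * bad u e v))
          ≤⟨ heavies-mono false p (λ u e v _ _ → step′ u e v) ⟩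
        heavies false p (λ u e v → ch true (u ++ e ∷ v) * bad u e v * D ^ z) ∎
        where
        lem : ∀ a b c → a * b * c ≡ a * c * b
        lem = solve-∀
        step′ : ∀ u e v → ∑ (words z) (λ q → ch true ((u ++ e ∷ v) ++ q) * bad u e v) ≤ ch true (u ++ e ∷ v) * bad u e v * D ^ z
        step′ u e v = begin
          ∑ (words z) (λ q → ch true ((u ++ e ∷ v) ++ q) * bad u e v) ≡⟨ ∑-*ʳ (bad u e v) (words z) ⟩
          ∑ (words z) (λ q → ch true ((u ++ e ∷ v) ++ q)) * bad u e v ≤⟨ *-monoˡ-≤ (bad u e v) (ch-ext z true u e v) ⟩
          ch true (u ++ e ∷ v) * D ^ z * bad u e v                    ≡⟨ lem (ch true (u ++ e ∷ v)) (D ^ z) (bad u e v) ⟩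
          ch true (u ++ e ∷ v) * bad u e v * D ^ z                    ∎
      fixed : ∀ l z → ∑ (words l) (λ p → ∑ (words z) (λ q → ch true (p ++ q) * heavies false p bad)) ≤
        hconv false l (λ x y → Bad x y * D ^ z)
      fixed l z = begin
        ∑ (words l) (λ p → ∑ (words z) (λ q → ch true (p ++ q) * heavies false p bad))
          ≤⟨ ∑-mono (words l) (per-prefix z) ⟩
        ∑ (words l) (λ p → heavies false p (λ u e v → ch true (u ++ e ∷ v) * bad u e v * D ^ z))
          ≡⟨ ∑-heavies as false l {λ u e v → ch true (u ++ e ∷ v) * bad u e v * D ^ z} ⟩
        hconv false l (λ x y → ∑ (words x) (λ u → ∑ as (λ e → ∑ (words y) (λ v → ch true (u ++ e ∷ v) * bad u e v * D ^ z))))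
          ≤⟨ hconv-mono false l (λ x y _ _ → ≤-reflexive (scale x y)) ⟩
        hconv false l (λ x y → Bad x y * D ^ z) ∎
        where
        scale : ∀ x y → ∑ (words x) (λ u → ∑ as (λ e → ∑ (words y) (λ v → ch true (u ++ e ∷ v) * bad u e v * D ^ z))) ≡ Bad x y * D ^ z
        scale x y = trans (∑-cong (words x) (λ u → trans (∑-cong as (λ e → ∑-*ʳ (D ^ z) (words y) {λ v → ch true (u ++ e ∷ v) * bad u e v}))
          (∑-*ʳ (D ^ z) as {λ e → ∑ (words y) (λ v → ch true (u ++ e ∷ v) * bad u e v)})))
          (∑-*ʳ (D ^ z) (words x) {λ u → ∑ as (λ e → ∑ (words y) (λ v → ch true (u ++ e ∷ v) * bad u e v))})

    private
      dropbad : List A → ℕ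
      dropbad []      = 0
      dropbad (b ∷ w) = badw w
      badw-[] : badw [] ≡ 0
      badw-[] = *-zeroʳ (bit (FA []))

    nb-step : ∀ j → nb (suc (suc j)) ≤ D * (D * nb j) + conv (suc (suc j)) (λ l z → hconv false l (λ x y → Bad x y * D ^ z))
    nb-step j = begin
      nb (suc (suc j))
        ≡⟨ ∑-words-suc (suc j) ⟩
      ∑ as (λ a → ∑ (words (suc j)) (λ w → cf true a w * badw (a ∷ w)))
        ≤⟨ ∑-mono as (λ a → ∑-mono∈ (words (suc j)) (λ w w∈ → pointwise a w (length-words (suc j) w∈))) ⟩
      ∑ as (λ a → ∑ (words (suc j)) (λ w → cf true a w * dropbad w + cf true a w * C (a ∷ w)))
        ≡⟨ trans (∑-cong as (λ a → ∑-+ (words (suc j)))) (∑-+ as) ⟩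
      ∑ as (λ a → ∑ (words (suc j)) (λ w → cf true a w * dropbad w)) + ∑ as (λ a → ∑ (words (suc j)) (λ w → cf true a w * C (a ∷ w)))
        ≤⟨ +-mono-≤ (strip (suc j) true dropbad refl) (≤-trans (≤-reflexive (sym (∑-words-suc (suc j)))) (prefix-sum (suc (suc j)))) ⟩
      D * ∑ (words (suc j)) (λ w → ch false w * dropbad w) + rest
        ≡⟨ cong (λ z → D * z + rest) (∑-words-suc j) ⟩
      D * ∑ as (λ b → ∑ (words j) (λ w → cf false b w * badw w)) + rest
        ≤⟨ +-monoˡ-≤ rest (*-monoʳ-≤ D (strip j false badw badw-[])) ⟩
      D * (D * nb j) + rest ∎
      where
      open ≤-Reasoning
      C : List A → ℕ
      C w = cuts w (λ p _ → heavies false p bad)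
      rest = conv (suc (suc j)) (λ l z → hconv false l (λ x y → Bad x y * D ^ z))
      pointwise : ∀ a w → length w ≡ suc j → cf true a w * badw (a ∷ w) ≤ cf true a w * dropbad w + cf true a w * C (a ∷ w)
      pointwise a (b ∷ w) _ = ≤-trans (*-monoʳ-≤ (cf true a (b ∷ w)) (split-bad a b w)) (≤-reflexive (*-distribˡ-+ (cf true a (b ∷ w)) _ _))

    -- The longer side has at least half of the length, so its square absorbs `(l+1)²` up to a
    -- factor four. What remains is the inverse square of the shorter side.
    share : ∀ l z x′ y → suc (x′ + y) ≡ l → l ≤ K → Odd x′ →
      let C = 32 * (K * (D ^ (l + z) * (N * Φ))) in
      D * L * (Bad x′ y * D ^ z) ≤ C / (suc x′ * suc x′) + C / (suc y * suc y)
    share l z x′ y refl l≤K od with ≤-total x′ y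
    ... | inj₁ x≤y = ≤-trans (≤-/ _ X C (*-cancelʳ-≤ _ _ Y bound)) (m≤m+n _ _)
      where
      open ≤-Reasoning
      X = suc x′ * suc x′
      Y = suc y * suc y
      C = 32 * (K * (D ^ (l + z) * (N * Φ)))
      bound : D * L * (Bad x′ y * D ^ z) * X * Y ≤ C * Y
      bound = begin
        D * L * (Bad x′ y * D ^ z) * X * Y            ≡⟨ lem₁ D L (Bad x′ y) (D ^ z) X Y ⟩
        D * (L * (X * Y * Bad x′ y)) * D ^ z          ≤⟨ *-monoˡ-≤ (D ^ z) (Bad-bound x′ y od l≤K) ⟩
        8 * (suc l * suc l * (K * D ^ l * (N * Φ))) * D ^ z
          ≤⟨ *-monoˡ-≤ (D ^ z) (*-monoʳ-≤ 8 (*-monoˡ-≤ (K * D ^ l * (N * Φ)) (*-mono-≤ l≤2y l≤2y))) ⟩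
        8 * ((2 * suc y) * (2 * suc y) * (K * D ^ l * (N * Φ))) * D ^ z ≡⟨ lem₂ (suc y) K (D ^ l) (N * Φ) (D ^ z) ⟩
        32 * (K * (D ^ l * D ^ z * (N * Φ))) * Y      ≡⟨ cong (λ d → 32 * (K * (d * (N * Φ))) * Y) (sym (^-distribˡ-+-* D l z)) ⟩
        C * Y                                         ∎
        where
        lem₁ : ∀ D L B E X Y → D * L * (B * E) * X * Y ≡ D * (L * (X * Y * B)) * E
        lem₁ = solve-∀
        lem₂ : ∀ y K D F E → 8 * ((2 * y) * (2 * y) * (K * D * F)) * E ≡ 32 * (K * (D * E * F)) * (y * y)
        lem₂ = solve-∀
        l≤2y : suc l ≤ 2 * suc y
        l≤2y = ≤-trans (s≤s (s≤s (+-monoˡ-≤ y x≤y))) (≤-reflexive (lem₃ y))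
          where
          lem₃ : ∀ y → suc (suc (y + y)) ≡ 2 * suc y
          lem₃ = solve-∀
    ... | inj₂ y≤x = ≤-trans (≤-/ _ Y C (*-cancelʳ-≤ _ _ X bound)) (m≤n+m _ _)
      where
      open ≤-Reasoning
      X = suc x′ * suc x′
      Y = suc y * suc y
      C = 32 * (K * (D ^ (l + z) * (N * Φ)))
      bound : D * L * (Bad x′ y * D ^ z) * Y * X ≤ C * X
      bound = begin
        D * L * (Bad x′ y * D ^ z) * Y * X            ≡⟨ lem₁ D L (Bad x′ y) (D ^ z) X Y ⟩
        D * (L * (X * Y * Bad x′ y)) * D ^ z          ≤⟨ *-monoˡ-≤ (D ^ z) (Bad-bound x′ y od l≤K) ⟩
        8 * (suc l * suc l * (K * D ^ l * (N * Φ))) * D ^ z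
          ≤⟨ *-monoˡ-≤ (D ^ z) (*-monoʳ-≤ 8 (*-monoˡ-≤ (K * D ^ l * (N * Φ)) (*-mono-≤ l≤2x l≤2x))) ⟩
        8 * ((2 * suc x′) * (2 * suc x′) * (K * D ^ l * (N * Φ))) * D ^ z ≡⟨ lem₂ (suc x′) K (D ^ l) (N * Φ) (D ^ z) ⟩
        32 * (K * (D ^ l * D ^ z * (N * Φ))) * X      ≡⟨ cong (λ d → 32 * (K * (d * (N * Φ))) * X) (sym (^-distribˡ-+-* D l z)) ⟩
        C * X                                         ∎
        where
        lem₁ : ∀ D L B E X Y → D * L * (B * E) * Y * X ≡ D * (L * (X * Y * B)) * E
        lem₁ = solve-∀
        lem₂ : ∀ y K D F E → 8 * ((2 * y) * (2 * y) * (K * D * F)) * E ≡ 32 * (K * (D * E * F)) * (y * y)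
        lem₂ = solve-∀
        l≤2x : suc l ≤ 2 * suc x′
        l≤2x = ≤-trans (s≤s (s≤s (+-monoʳ-≤ x′ y≤x))) (≤-reflexive (lem₃ x′))
          where
          lem₃ : ∀ y → suc (suc (y + y)) ≡ 2 * suc y
          lem₃ = solve-∀

    -- By `square-sum`, the splits of a prefix cost a constant independent of its length; only the
    -- `k + 1` lengths of prefixes contribute a factor.
    new-bad : ∀ k → k ≤ K → D * L * conv k (λ l z → hconv false l (λ x y → Bad x y * D ^ z)) ≤
      suc k * (4 * (32 * (K * (D ^ k * (N * Φ)))))
    new-bad k k≤K = begin
      D * L * conv k (λ l z → hconv false l (λ x y → Bad x y * D ^ z))
        ≡⟨ conv-*ˡ (D * L) k (λ l z → hconv false l (λ x y → Bad x y * D ^ z)) ⟩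
      conv k (λ l z → D * L * hconv false l (λ x y → Bad x y * D ^ z))
        ≤⟨ conv-mono k inner ⟩
      conv k (λ _ _ → 4 * C)
        ≡⟨ conv-const (4 * C) k ⟩
      suc k * (4 * C) ∎
      where
      open ≤-Reasoning
      C = 32 * (K * (D ^ k * (N * Φ)))
      q : ℕ → ℕ
      q x = C / (suc x * suc x)
      inner : ∀ l z → l + z ≡ k → D * L * hconv false l (λ x y → Bad x y * D ^ z) ≤ 4 * C
      inner l z refl = begin
        D * L * hconv false l (λ x y → Bad x y * D ^ z)
          ≡⟨ hconv-*ˡ (D * L) false l (λ x y → Bad x y * D ^ z) ⟩
        hconv false l (λ x y → D * L * (Bad x y * D ^ z))
          ≤⟨ hconv-mono false l (λ x y e od → share l z x y e (≤-trans (m≤m+n l z) k≤K) od) ⟩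
        hconv false l (λ x y → q x + q y)
          ≡⟨ hconv-+ false l (λ x y → q x) (λ x y → q y) ⟩
        hconv false l (λ x y → q x) + hconv false l (λ x y → q y)
          ≤⟨ +-mono-≤ (≤-trans (hconv-left false l q) (square-sum C l)) (≤-trans (hconv-right false l q) (square-sum C l)) ⟩
        2 * C + 2 * C
          ≡⟨ lem C ⟩
        4 * C ∎
        where
        lem : ∀ C → 2 * C + 2 * C ≡ 4 * C
        lem = solve-∀

    -- Walks with at most one dart have no failure, and every two further darts add one batch of
    -- failing prefixes.
    nb-bound : ∀ j → j ≤ K → D * L * nb j ≤ j * (suc K * (4 * (32 * (K * (D ^ j * (N * Φ))))))
    nb-bound zero          _ = ≤-trans (≤-reflexive (trans (cong (λ z → D * L * (z + 0)) (trans (+-identityʳ _) badw-[])) (*-zeroʳ (D * L)))) z≤n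
    nb-bound (suc zero)    _ = ≤-trans (≤-reflexive (trans (cong (D * L *_) none) (*-zeroʳ (D * L)))) z≤n
      where
      none : nb 1 ≡ 0
      none = trans (∑-words-suc 0) (trans (∑-cong as (λ a → trans (+-identityʳ _) (trans (+-identityʳ _) (*-zeroʳ (bit (FA (a ∷ []))))))) (∑-zero as))
    nb-bound (suc (suc j)) j≤K = begin
      D * L * nb (suc (suc j))
        ≤⟨ *-monoʳ-≤ (D * L) (nb-step j) ⟩
      D * L * (D * (D * nb j) + R)
        ≡⟨ lem₁ D L (nb j) R ⟩
      D * D * (D * L * nb j) + D * L * R
        ≤⟨ +-mono-≤ (*-monoʳ-≤ (D * D) (nb-bound j (≤-trans (≤-trans (n≤1+n j) (n≤1+n _)) j≤K)))
             (≤-trans (new-bad (suc (suc j)) j≤K) (*-monoˡ-≤ _ (s≤s j≤K))) ⟩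
      D * D * (j * (suc K * (4 * (32 * (K * (D ^ j * (N * Φ))))))) + suc K * (4 * (32 * (K * (D * (D * D ^ j) * (N * Φ)))))
        -- The new failures are charged once per dart instead of once per two darts, which makes the
        -- bound linear in `j`.
        ≤⟨ m≤m+n _ _ ⟩
      D * D * (j * (suc K * (4 * (32 * (K * (D ^ j * (N * Φ))))))) + suc K * (4 * (32 * (K * (D * (D * D ^ j) * (N * Φ)))))
        + suc K * (4 * (32 * (K * (D * (D * D ^ j) * (N * Φ)))))
        ≡⟨ lem₂ D j (suc K) K (D ^ j) (N * Φ) ⟩
      suc (suc j) * (suc K * (4 * (32 * (K * (D * (D * D ^ j) * (N * Φ)))))) ∎
      where
      open ≤-Reasoning
      R = conv (suc (suc j)) (λ l z → hconv false l (λ x y → Bad x y * D ^ z))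
      lem₁ : ∀ D L n R → D * L * (D * (D * n) + R) ≡ D * D * (D * L * n) + D * L * R
      lem₁ = solve-∀
      lem₂ : ∀ D j k K E F → D * D * (j * (k * (4 * (32 * (K * (E * F)))))) + k * (4 * (32 * (K * (D * (D * E) * F))))
        + k * (4 * (32 * (K * (D * (D * E) * F)))) ≡ suc (suc j) * (k * (4 * (32 * (K * (D * (D * E) * F)))))
      lem₂ = solve-∀

    nf : ℕ → ℕ
    nf k = ∑ (words k) (λ w → ch true w * bit (not (FA w)))

    -- Markov's inequality for `ps` over all walks.
    nf-bound : ∀ k → D * (D * D * nf k) ≤ 4 * (k * (D ^ k * ((D + k) * (N * Φ))))
    nf-bound k = *-cancelʳ-≤ _ _ S {{>-nonZero S>0}} (begin
      D * (D * D * nf k) * S                                       ≡⟨ lem₁ D (nf k) S ⟩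
      D * (D * D * (S * nf k))                                     ≤⟨ *-monoʳ-≤ D (*-monoʳ-≤ (D * D) markov) ⟩
      D * (D * D * (2 * ∑ (words k) (λ w → ch true w * ps w)))     ≡⟨ lem₂ D (∑ (words k) (λ w → ch true w * ps w)) ⟩
      2 * (D * (D * D * ∑ (words k) (λ w → ch true w * ps w)))     ≤⟨ *-monoʳ-≤ 2 (ps-total k true) ⟩
      2 * (k * (D ^ k * ((D + k) * (2 * (N * (Φ * S))))))          ≡⟨ lem₃ k (D ^ k) (D + k) N Φ S ⟩
      4 * (k * (D ^ k * ((D + k) * (N * Φ)))) * S                  ∎)
      where
      open ≤-Reasoning
      lem₁ : ∀ D n S → D * (D * D * n) * S ≡ D * (D * D * (S * n))
      lem₁ = solve-∀
      lem₂ : ∀ D p → D * (D * D * (2 * p)) ≡ 2 * (D * (D * D * p))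
      lem₂ = solve-∀
      lem₃ : ∀ k E d N Φ S → 2 * (k * (E * (d * (2 * (N * (Φ * S)))))) ≡ 4 * (k * (E * (d * (N * Φ)))) * S
      lem₃ = solve-∀
      pointwise : ∀ w → S * (ch true w * bit (not (FA w))) ≤ 2 * (ch true w * ps w)
      pointwise w with FA w in eq
      ... | true  = ≤-trans (≤-reflexive (trans (cong (S *_) (*-zeroʳ (ch true w))) (*-zeroʳ S))) z≤n
      ... | false = ≤-trans (≤-reflexive (trans (cong (S *_) (*-identityʳ (ch true w))) (*-comm S (ch true w))))
        (≤-trans (*-monoʳ-≤ (ch true w) (<⇒≤ (≰⇒> (λ le → subst T eq (≤⇒≤ᵇ le))))) (≤-reflexive (lem₄ (ch true w) (ps w))))
        where
        lem₄ : ∀ a b → a * (2 * b) ≡ 2 * (a * b)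
        lem₄ = solve-∀
      markov : S * nf k ≤ 2 * ∑ (words k) (λ w → ch true w * ps w)
      markov = begin
        S * nf k                                                ≡⟨ sym (∑-*ˡ S (words k)) ⟩
        ∑ (words k) (λ w → S * (ch true w * bit (not (FA w))))  ≤⟨ ∑-mono (words k) pointwise ⟩
        ∑ (words k) (λ w → 2 * (ch true w * ps w))              ≡⟨ ∑-*ˡ 2 (words k) ⟩
        2 * ∑ (words k) (λ w → ch true w * ps w)                ∎

    ng : ℕ → ℕ
    ng k = ∑ (words k) (λ w → ch true w * good w)

    V-split : ∀ k → V true k ≡ nf k + nb k + ng k
    V-split k = trans (∑-cong (words k) pointwise) (trans (∑-+ (words k)) (cong (_+ ng k) (∑-+ (words k))))
      where
      lem : ∀ c a b → bit (not a) + bit a * bit (not b) + bit a * bit b ≡ 1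
      lem c true  true  = refl
      lem c true  false = refl
      lem c false b     = refl
      pointwise : ∀ w → ch true w ≡ ch true w * bit (not (FA w)) + ch true w * badw w + ch true w * good w
      pointwise w = trans (sym (*-identityʳ _)) (trans (cong (ch true w *_) (sym (lem (ch true w) (FA w) (tb w ≡ᵇ 0))))
        (trans (*-distribˡ-+ (ch true w) (bit (not (FA w)) + badw w) (good w))
          (cong (_+ ch true w * good w) (*-distribˡ-+ (ch true w) (bit (not (FA w))) (badw w)))))

    ng-bound : ∀ k → suc k ≤ K → ng (suc k) ≤ n * (n * (4 * L ^ ⌊ suc k /2⌋))
    ng-bound k k≤K = begin
      ng (suc k)                                          ≤⟨ ∑-mono∈ (words (suc k)) (λ w w∈ → pointwise w (length-words (suc k) w∈)) ⟩
      ∑ (words (suc k)) (λ w → ∑ vs (λ s → ∑ vs (λ t → ch true w * (𝟙 (conn? s w t) * good w))))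
        ≡⟨ trans (∑-swap (words (suc k)) vs) (∑-cong vs (λ s → ∑-swap (words (suc k)) vs)) ⟩
      ∑ vs (λ s → ∑ vs (λ t → T# (suc k) s t))            ≤⟨ ∑-mono vs (λ s → ∑-mono vs (λ t → ≤-trans (≤-reflexive (sym (*-identityʳ (T# (suc k) s t))))
                                                               (≤-trans (*-monoʳ-≤ (T# (suc k) s t) {1} {suc (suc k) * suc (suc k)} (s≤s z≤n)) (dispersion (suc k) k≤K s t)))) ⟩
      ∑ vs (λ s → ∑ vs (λ t → 4 * L ^ ⌊ suc k /2⌋))       ≡⟨ trans (∑-cong vs (λ s → ∑-const _ vs)) (∑-const _ vs) ⟩
      length vs * (length vs * (4 * L ^ ⌊ suc k /2⌋))     ≡⟨ cong (λ m → m * (m * (4 * L ^ ⌊ suc k /2⌋))) {x = length vs} {y = n} (length-tabulate id) ⟩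
      n * (n * (4 * L ^ ⌊ suc k /2⌋))                     ∎
      where
      open ≤-Reasoning
      pointwise : ∀ w → length w ≡ suc k → ch true w * good w ≤ ∑ vs (λ s → ∑ vs (λ t → ch true w * (𝟙 (conn? s w t) * good w)))
      pointwise w@(a ∷ w′) _ with ch true w ≟ 0
      ... | yes z = ≤-trans (≤-reflexive (cong (_* good w) z)) z≤n
      ... | no nz = ≤-trans (≤-reflexive (cong (ch true w *_) (trans (sym (*-identityˡ (good w)))
          (cong (_* good w) (sym (𝟙-yes (conn? (tl a) w (en (hd a) w′)) (refl , cf-conn true a w′ nz)))))))
        (≤-trans (∑-∈ (λ t → ch true w * (𝟙 (conn? (tl a) w t) * good w)) (∈-allFin (en (hd a) w′)))
          (∑-∈ (λ s → ∑ vs (λ t → ch true w * (𝟙 (conn? s w t) * good w))) (∈-allFin (tl a))))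

  -- In eighths of `N * D ^ κ`: the walks that meet their own cuts take at most one since `D` is
  -- large, the bad walks at most one by the choice of `L`, and the shortfall in `V-lower` at most
  -- four. The good walks make up the remaining two.
  walk-bound : (sys : System) → let open System sys; N = length as; L = 1024 * (K * (suc K * (K * Φ))) in
    0 < Φ → 64 * (K * Φ) ≤ D → 2 * (K * (n * D)) ≤ N → ∀ κ → K ≡ suc κ →
    N * D ^ κ ≤ 16 * (n * (n * L ^ ⌊ K /2⌋))
  walk-bound sys Φ>0 hD hN κ refl = *-cancelˡ-≤ 2 (+-cancelʳ-≤ (6 * (N * D ^ κ)) _ _ (begin
    2 * (N * D ^ κ) + 6 * (N * D ^ κ)             ≡⟨ lem₀ (N * D ^ κ) ⟩
    8 * (N * D ^ κ)                               ≤⟨ *-monoʳ-≤ 8 (V-lower κ true) ⟩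
    8 * (V true K + κ * (n * (D * D ^ κ)))        ≡⟨ trans (*-distribˡ-+ 8 (V true K) (κ * (n * (D * D ^ κ)))) (cong (λ v → 8 * v + 8 * (κ * (n * (D * D ^ κ)))) (V-split K)) ⟩
    8 * (nf K + nb K + ng K) + 8 * (κ * (n * (D * D ^ κ)))
      ≡⟨ lem₁ (nf K) (nb K) (ng K) κ n D (D ^ κ) ⟩
    8 * nf K + 8 * nb K + 8 * ng K + 4 * (2 * (κ * (n * D)) * D ^ κ)
      ≤⟨ +-mono-≤ (+-mono-≤ (+-mono-≤ few-f few-b) (*-monoʳ-≤ 8 (ng-bound κ ≤-refl)))
           (*-monoʳ-≤ 4 (*-monoˡ-≤ (D ^ κ) (≤-trans (*-monoʳ-≤ 2 (*-monoˡ-≤ (n * D) (n≤1+n κ))) hN))) ⟩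
    N * D ^ κ + N * D ^ κ + 8 * (n * (n * (4 * L ^ ⌊ K /2⌋))) + 4 * (N * D ^ κ)
      ≡⟨ lem₂ (N * D ^ κ) n (L ^ ⌊ K /2⌋) ⟩
    2 * (16 * (n * (n * L ^ ⌊ K /2⌋))) + 6 * (N * D ^ κ) ∎))
    where
    open System sys
    open ≤-Reasoning
    N L : ℕ
    N = length as
    L = 1024 * (K * (suc K * (K * Φ)))
    L>0 : 0 < L
    L>0 = *-mono-≤ (s≤s (z≤n {1023})) (*-mono-≤ (s≤s (z≤n {κ})) (*-mono-≤ (s≤s (z≤n {K})) (*-mono-≤ (s≤s (z≤n {κ})) Φ>0)))
    open Dispersion sys using (V; V-lower)
    open WalkBound sys L L>0
    D>0 : 0 < D
    D>0 = ≤-trans (*-mono-≤ (s≤s (z≤n {63})) (*-mono-≤ (s≤s (z≤n {κ})) Φ>0)) hD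
    lem₀ : ∀ a → 2 * a + 6 * a ≡ 8 * a
    lem₀ = solve-∀
    lem₁ : ∀ f b g κ n D E → 8 * (f + b + g) + 8 * (κ * (n * (D * E))) ≡ 8 * f + 8 * b + 8 * g + 4 * (2 * (κ * (n * D)) * E)
    lem₁ = solve-∀
    lem₂ : ∀ a n l → a + a + 8 * (n * (n * (4 * l))) + 4 * a ≡ 2 * (16 * (n * (n * l))) + 6 * a
    lem₂ = solve-∀
    few-b : 8 * nb K ≤ N * D ^ κ
    few-b = *-cancelʳ-≤ _ _ (D * (128 * (K * (suc K * (K * Φ))))) {{>-nonZero (*-mono-≤ D>0 (*-mono-≤ (s≤s (z≤n {127})) (*-mono-≤ (s≤s (z≤n {κ})) (*-mono-≤ (s≤s (z≤n {K})) (*-mono-≤ (s≤s (z≤n {κ})) Φ>0)))))}} (begin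
      8 * nb K * (D * (128 * (K * (suc K * (K * Φ)))))   ≡⟨ lem₃ (nb K) D K (suc K) Φ ⟩
      D * L * nb K                                       ≤⟨ nb-bound K ≤-refl ⟩
      K * (suc K * (4 * (32 * (K * (D * D ^ κ * (N * Φ)))))) ≡⟨ lem₄ K (suc K) D (D ^ κ) N Φ ⟩
      N * D ^ κ * (D * (128 * (K * (suc K * (K * Φ))))) ∎)
      where
      lem₃ : ∀ b D K k Φ → 8 * b * (D * (128 * (K * (k * (K * Φ))))) ≡ D * (1024 * (K * (k * (K * Φ)))) * b
      lem₃ = solve-∀
      lem₄ : ∀ K k D E N Φ → K * (k * (4 * (32 * (K * (D * E * (N * Φ)))))) ≡ N * E * (D * (128 * (K * (k * (K * Φ)))))
      lem₄ = solve-∀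
    K≤D : K ≤ D
    K≤D = ≤-trans (≤-trans (≤-reflexive (sym (*-identityʳ K))) (≤-trans (*-monoʳ-≤ K Φ>0) (m≤m+n _ _))) hD
    few-f : 8 * nf K ≤ N * D ^ κ
    few-f = *-cancelʳ-≤ _ _ (D * (D * D)) {{>-nonZero (*-mono-≤ D>0 (*-mono-≤ D>0 D>0))}} (begin
      8 * nf K * (D * (D * D))                           ≡⟨ lem₅ (nf K) D ⟩
      8 * (D * (D * D * nf K))                           ≤⟨ *-monoʳ-≤ 8 (nf-bound K) ⟩
      8 * (4 * (K * (D * D ^ κ * ((D + K) * (N * Φ)))))  ≤⟨ *-monoʳ-≤ 8 (*-monoʳ-≤ 4 (*-monoʳ-≤ K (*-monoʳ-≤ (D * D ^ κ) (*-monoˡ-≤ (N * Φ) (+-monoʳ-≤ D K≤D))))) ⟩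
      8 * (4 * (K * (D * D ^ κ * ((D + D) * (N * Φ)))))  ≡⟨ lem₆ K D (D ^ κ) N Φ ⟩
      64 * (K * Φ) * (D * D * (D ^ κ * N))               ≤⟨ *-monoˡ-≤ _ hD ⟩
      D * (D * D * (D ^ κ * N))                          ≡⟨ lem₇ D (D ^ κ) N ⟩
      N * D ^ κ * (D * (D * D))                          ∎)
      where
      lem₅ : ∀ f D → 8 * f * (D * (D * D)) ≡ 8 * (D * (D * D * f))
      lem₅ = solve-∀
      lem₆ : ∀ K D E N Φ → 8 * (4 * (K * (D * E * ((D + D) * (N * Φ))))) ≡ 64 * (K * Φ) * (D * D * (E * N))
      lem₆ = solve-∀
      lem₇ : ∀ D E N → D * (D * D * (E * N)) ≡ N * E * (D * (D * D))
      lem₇ = solve-∀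

  -- The edge system of an edge list

  Edge : ℕ → Set
  Edge n = Fin n × Fin n

  total : ∀ {n} → (Fin n → Fin n → ℕ) → ℕ
  total {n} Y = ∑ (allFin n) (λ a → ∑ (allFin n) (Y a))

  _joins_ : ∀ {n} → List (Edge n) → Edge n → Set
  es joins d = d ∈ es ⊎ swap d ∈ es

  Cut : ∀ {n} (K B : ℕ) → List (Edge n) → (u v : Fin n) → (Fin n → Fin n → ℕ) → Set
  Cut K B es u v Y = ∀ q → Conn proj₁ proj₂ u q v → (∀ d → d ∈ q → es joins d) →
    suc (length q) ≤ 2 * K → total Y ≤ B * ∑ q (uncurry Y)

  -- Edge lists with the newest edge first.  When an edge is added, the
  -- short walks between its ends admit a fractional cut of weight B.
  data Built {n} (K B : ℕ) : List (Edge n) → Set where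
    []  : Built K B []
    add : ∀ {es u v} → Built K B es → ¬ u ≡ v → ¬ es joins (u , v) →
          (Y : Fin n → Fin n → ℕ) → 0 < total Y → Cut K B es u v Y → Built K B ((u , v) ∷ es)

  Dart : ℕ → Set
  Dart m = Fin m × Bool

  older : ∀ {m} → Dart m → Dart (suc m)
  older (i , o) = suc i , o

  darts : ∀ m → List (Dart m)
  darts zero    = []
  darts (suc m) = (zero , true) ∷ (zero , false) ∷ map older (darts m)

  rev : ∀ {m} → Dart m → Dart m
  rev (i , o) = i , not o

  ∑-darts : ∀ m (f : Dart (suc m) → ℕ) →
    ∑ (darts (suc m)) f ≡ f (zero , true) + (f (zero , false) + ∑ (darts m) (f ∘ older))
  ∑-darts m f = cong (λ z → f (zero , true) + (f (zero , false) + z)) (∑-map older (darts m))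

  ∑-rev : ∀ m (f : Dart m → ℕ) → ∑ (darts m) (f ∘ rev) ≡ ∑ (darts m) f
  ∑-rev zero    f = refl
  ∑-rev (suc m) f = begin
    ∑ (darts (suc m)) (f ∘ rev)                                                ≡⟨ ∑-darts m (f ∘ rev) ⟩
    f (zero , false) + (f (zero , true) + ∑ (darts m) (f ∘ older ∘ rev))       ≡⟨ cong (λ z → f (zero , false) + (f (zero , true) + z)) (∑-rev m (f ∘ older)) ⟩
    f (zero , false) + (f (zero , true) + ∑ (darts m) (f ∘ older))             ≡⟨ lem (f (zero , false)) (f (zero , true)) _ ⟩
    f (zero , true) + (f (zero , false) + ∑ (darts m) (f ∘ older))             ≡⟨ sym (∑-darts m f) ⟩
    ∑ (darts (suc m)) f                                                        ∎
    where
    open ≡-Reasoning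
    lem : ∀ a b c → a + (b + c) ≡ b + (a + c)
    lem = solve-∀

  length-darts : ∀ m → length (darts m) ≡ 2 * m
  length-darts zero    = refl
  length-darts (suc m) = trans (cong (λ z → suc (suc z)) (trans (length-map older (darts m)) (length-darts m))) (lem m)
    where
    lem : ∀ m → suc (suc (2 * m)) ≡ 2 * suc m
    lem = solve-∀

  -- The time of insertion, counted from the old end of the list and therefore unchanged by later
  -- insertions.
  age : ∀ {m} → Fin m → ℕ
  age {suc m} zero    = m
  age {suc m} (suc i) = age i

  age< : ∀ {m} (i : Fin m) → age i < m
  age< {suc m} zero    = ≤-refl
  age< {suc m} (suc i) = m<n⇒m<1+n (age< i)

  bit-F : ∀ {b} → ¬ T b → bit b ≡ 0
  bit-F {true}  h = ⊥-elim (h tt)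
  bit-F {false} h = refl

  bit-cong : ∀ {a b} → (T a → T b) → (T b → T a) → bit a ≡ bit b
  bit-cong {true}  f g = sym (bit-T (f tt))
  bit-cong {false} f g = sym (bit-F g)

  bit-<-suc : ∀ c d → bit (c <ᵇ suc d) ≡ 𝟙 (d ≟ c) + bit (c <ᵇ d)
  bit-<-suc c d = go (d ≟ c)
    where
    go : Dec (d ≡ c) → bit (c <ᵇ suc d) ≡ 𝟙 (d ≟ c) + bit (c <ᵇ d)
    go (yes refl) = trans (bit-T (<⇒<ᵇ (≤-refl {suc c})))
      (sym (cong₂ _+_ (𝟙-yes (c ≟ c) refl) (bit-F {c <ᵇ c} (λ t → <-irrefl refl (<ᵇ⇒< c c t)))))
    go (no d≢c) = trans (bit-cong {c <ᵇ suc d} {c <ᵇ d} (λ t → <⇒<ᵇ (≤∧≢⇒< (≤-pred (<ᵇ⇒< c (suc d) t)) (d≢c ∘ sym)))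
      (λ t → <⇒<ᵇ (m<n⇒m<1+n (<ᵇ⇒< c d t)))) (cong (_+ bit (c <ᵇ d)) (sym (𝟙-no (d ≟ c) d≢c)))

  +≢0 : ∀ {a b} → ¬ a + b ≡ 0 → ¬ a ≡ 0 ⊎ ¬ b ≡ 0
  +≢0 {zero}  h = inj₂ h
  +≢0 {suc a} h = inj₁ λ ()

  module Incidence {n : ℕ} where

    tl hd : (es : List (Edge n)) → Dart (length es) → Fin n
    tl es (i , true)  = proj₁ (lookup es i)
    tl es (i , false) = proj₂ (lookup es i)
    hd es (i , true)  = proj₂ (lookup es i)
    hd es (i , false) = proj₁ (lookup es i)

    tl-rev : ∀ es a → tl es (rev a) ≡ hd es a
    tl-rev es (i , true)  = refl
    tl-rev es (i , false) = refl

    hd-rev : ∀ es a → hd es (rev a) ≡ tl es a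
    hd-rev es (i , true)  = refl
    hd-rev es (i , false) = refl

    deg : List (Edge n) → Fin n → ℕ
    deg []             v = 0
    deg ((a , b) ∷ es) v = 𝟙 (a Fin.≟ v) + 𝟙 (b Fin.≟ v) + deg es v

    -- The rank of an edge at `v`: how many older edges are incident with `v`.
    pos : (es : List (Edge n)) → Fin n → Fin (length es) → ℕ
    pos (e ∷ es) v zero    = deg es v
    pos (e ∷ es) v (suc i) = pos es v i

    pos≤deg : ∀ es v i → pos es v i ≤ deg es v
    pos≤deg (e ∷ es) v zero    = m≤n+m _ _
    pos≤deg (e ∷ es) v (suc i) = ≤-trans (pos≤deg es v i) (m≤n+m _ _)

    pos-mono : ∀ es v i j → age j ≤ age i → pos es v j ≤ pos es v i
    pos-mono (e ∷ es) v zero    zero    h = ≤-refl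
    pos-mono (e ∷ es) v zero    (suc j) h = pos≤deg es v j
    pos-mono (e ∷ es) v (suc i) zero    h = ⊥-elim (<⇒≱ (age< i) h)
    pos-mono (e ∷ es) v (suc i) (suc j) h = pos-mono es v i j h

    data Simple : List (Edge n) → Set where
      []  : Simple []
      _∷_ : ∀ {es u v} → ¬ u ≡ v × ¬ es joins (u , v) → Simple es → Simple ((u , v) ∷ es)

    at : (es : List (Edge n)) → Fin n → ℕ → Dart (length es) → ℕ
    at es v c d = 𝟙 (hd es d Fin.≟ v) * 𝟙 (pos es v (proj₁ d) ≟ c)

    -- Each rank below the degree belongs to exactly one dart into `v`; a loop would take its rank
    -- twice.
    positions : ∀ es → Simple es → ∀ v c → ∑ (darts (length es)) (at es v c) ≡ bit (c <ᵇ deg es v)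
    positions []             _                v c = refl
    positions ((a , b) ∷ es) ((a≢b , _) ∷ si) v c = begin
      ∑ (darts (suc (length es))) (at ((a , b) ∷ es) v c)
        ≡⟨ ∑-darts (length es) (at ((a , b) ∷ es) v c) ⟩
      𝟙 (b Fin.≟ v) * δ + (𝟙 (a Fin.≟ v) * δ + ∑ (darts (length es)) (at ((a , b) ∷ es) v c ∘ older))
        ≡⟨ cong (λ z → 𝟙 (b Fin.≟ v) * δ + (𝟙 (a Fin.≟ v) * δ + z)) (trans (∑-cong (darts (length es)) (λ { (i , true) → refl ; (i , false) → refl })) (positions es si v c)) ⟩
      𝟙 (b Fin.≟ v) * δ + (𝟙 (a Fin.≟ v) * δ + bit (c <ᵇ deg es v))
        ≡⟨ case (a Fin.≟ v) (b Fin.≟ v) ⟩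
      bit (c <ᵇ deg ((a , b) ∷ es) v) ∎
      where
      open ≡-Reasoning
      δ = 𝟙 (deg es v ≟ c)
      case : (p : Dec (a ≡ v)) (q : Dec (b ≡ v)) → 𝟙 q * δ + (𝟙 p * δ + bit (c <ᵇ deg es v)) ≡ bit (c <ᵇ 𝟙 p + 𝟙 q + deg es v)
      case (yes refl) (yes refl) = ⊥-elim (a≢b refl)
      case (yes _) (no _) = trans (cong (_+ bit (c <ᵇ deg es v)) (+-identityʳ δ)) (sym (bit-<-suc c (deg es v)))
      case (no _) (yes _) = trans (cong (_+ bit (c <ᵇ deg es v)) (+-identityʳ δ)) (sym (bit-<-suc c (deg es v)))
      case (no _) (no _)  = refl

    at≤1 : ∀ es → Simple es → ∀ v c → ∑ (darts (length es)) (at es v c) ≤ 1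
    at≤1 es si v c = ≤-trans (≤-reflexive (positions es si v c)) (bit≤1 (c <ᵇ deg es v))

    between : (es : List (Edge n)) → Edge n → Dart (length es) → ℕ
    between es (s , t) d = 𝟙 (tl es d Fin.≟ s) * 𝟙 (hd es d Fin.≟ t)

    between-joins : ∀ es s t → ¬ ∑ (darts (length es)) (between es (s , t)) ≡ 0 → es joins (s , t)
    between-joins [] s t h = ⊥-elim (h refl)
    between-joins ((a , b) ∷ es) s t h with +≢0 {𝟙 (a Fin.≟ s) * 𝟙 (b Fin.≟ t)} (h ∘ trans (∑-darts (length es) (between ((a , b) ∷ es) (s , t))))
    ... | inj₁ nz with 𝟙≢0 (a Fin.≟ s) (*≢0ˡ nz) | 𝟙≢0 (b Fin.≟ t) (*≢0ʳ {𝟙 (a Fin.≟ s)} nz)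
    ...   | refl | refl = inj₁ (here refl)
    between-joins ((a , b) ∷ es) s t h | inj₂ h′ with +≢0 {𝟙 (b Fin.≟ s) * 𝟙 (a Fin.≟ t)} h′
    ... | inj₁ nz with 𝟙≢0 (b Fin.≟ s) (*≢0ˡ nz) | 𝟙≢0 (a Fin.≟ t) (*≢0ʳ {𝟙 (b Fin.≟ s)} nz)
    ...   | refl | refl = inj₂ (here refl)
    between-joins ((a , b) ∷ es) s t h | inj₂ h′ | inj₂ nz with between-joins es s t (nz ∘ trans (∑-cong (darts (length es)) (λ { (i , true) → refl ; (i , false) → refl })))
    ... | inj₁ x = inj₁ (there x)
    ... | inj₂ x = inj₂ (there x)

    between≤1 : ∀ es → Simple es → ∀ s t → ∑ (darts (length es)) (between es (s , t)) ≤ 1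
    between≤1 [] _ s t = z≤n
    between≤1 ((a , b) ∷ es) ((a≢b , new) ∷ si) s t = ≤-trans (≤-reflexive (trans (∑-darts (length es) (between ((a , b) ∷ es) (s , t)))
        (cong (λ z → p + (q + z)) (∑-cong (darts (length es)) (λ { (i , true) → refl ; (i , false) → refl }))))) (go (p ≟ 0) (q ≟ 0))
      where
      p = 𝟙 (a Fin.≟ s) * 𝟙 (b Fin.≟ t)
      q = 𝟙 (b Fin.≟ s) * 𝟙 (a Fin.≟ t)
      r = ∑ (darts (length es)) (between es (s , t))
      p≤1 : p ≤ 1
      p≤1 = *-mono-≤ (𝟙≤1 (a Fin.≟ s)) (𝟙≤1 (b Fin.≟ t))
      q≤1 : q ≤ 1
      q≤1 = *-mono-≤ (𝟙≤1 (b Fin.≟ s)) (𝟙≤1 (a Fin.≟ t))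
      as : ¬ p ≡ 0 → a ≡ s × b ≡ t
      as nz = 𝟙≢0 (a Fin.≟ s) (*≢0ˡ nz) , 𝟙≢0 (b Fin.≟ t) (*≢0ʳ {𝟙 (a Fin.≟ s)} nz)
      bs : ¬ q ≡ 0 → b ≡ s × a ≡ t
      bs nz = 𝟙≢0 (b Fin.≟ s) (*≢0ˡ nz) , 𝟙≢0 (a Fin.≟ t) (*≢0ʳ {𝟙 (b Fin.≟ s)} nz)
      none : ¬ es joins (s , t) → r ≡ 0
      none h with r ≟ 0
      ... | yes z = z
      ... | no nz = ⊥-elim (h (between-joins es s t nz))
      go : Dec (p ≡ 0) → Dec (q ≡ 0) → p + (q + r) ≤ 1
      go (yes p0) (yes q0) = ≤-trans (≤-reflexive (cong₂ _+_ p0 (cong (_+ r) q0))) (between≤1 es si s t)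
      go (no p≢0) (no q≢0) = ⊥-elim (a≢b (trans (proj₁ (as p≢0)) (sym (proj₁ (bs q≢0)))))
      go (no p≢0) (yes q0) = +-mono-≤ p≤1 (≤-reflexive (cong₂ _+_ q0 (none (λ j → new (subst₂ (λ x y → es joins (x , y)) (sym (proj₁ (as p≢0))) (sym (proj₂ (as p≢0))) j)))))
      go (yes p0) (no q≢0) = ≤-trans (≤-reflexive (cong (_+ (q + r)) p0)) (+-mono-≤ q≤1 (≤-reflexive (none (λ j → new (flip (subst₂ (λ x y → es joins (x , y)) (sym (proj₁ (bs q≢0))) (sym (proj₂ (bs q≢0))) j))))))
        where
        flip : ∀ {d} → es joins d → es joins swap d
        flip (inj₁ x) = inj₂ x
        flip (inj₂ x) = inj₁ x

    ages≤2 : ∀ m c → ∑ (darts m) (λ d → 𝟙 (age (proj₁ d) ≟ c)) ≤ 2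
    ages≤2 zero    c = z≤n
    ages≤2 (suc m) c = ≤-trans (≤-reflexive (∑-darts m (λ d → 𝟙 (age (proj₁ d) ≟ c)))) (go (m ≟ c))
      where
      old : ∀ m c → m ≤ c → ∑ (darts m) (λ d → 𝟙 (age (proj₁ d) ≟ c)) ≡ 0
      old m c m≤c = trans (∑-cong (darts m) (λ d → 𝟙-no (age (proj₁ d) ≟ c) (λ eq → <⇒≱ (age< (proj₁ d)) (≤-trans m≤c (≤-reflexive (sym eq)))))) (∑-zero (darts m))
      go : Dec (m ≡ c) → 𝟙 (m ≟ c) + (𝟙 (m ≟ c) + ∑ (darts m) (λ d → 𝟙 (age (proj₁ d) ≟ c))) ≤ 2
      go (yes refl) = +-mono-≤ (𝟙≤1 (m ≟ m)) (+-mono-≤ (𝟙≤1 (m ≟ m)) (≤-reflexive (old m m ≤-refl)))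
      go (no m≢c) = ≤-trans (≤-reflexive (cong (λ z → z + (z + ∑ (darts m) (λ d → 𝟙 (age (proj₁ d) ≟ c)))) (𝟙-no (m ≟ c) m≢c))) (ages≤2 m c)

    ∑-ends : ∀ es → Simple es → (Y : Fin n → Fin n → ℕ) → ∑ (darts (length es)) (λ d → Y (tl es d) (hd es d)) ≤ total Y
    ∑-ends es si Y = begin
      ∑ ds (λ d → Y (tl es d) (hd es d))
        ≡⟨ ∑-cong ds (λ d → sym (trans (∑-δ (tl es d) (λ s → ∑ (allFin n) (λ t → 𝟙 (hd es d Fin.≟ t) * Y s t))) (∑-δ (hd es d) (Y (tl es d))))) ⟩
      ∑ ds (λ d → ∑ (allFin n) (λ s → 𝟙 (tl es d Fin.≟ s) * ∑ (allFin n) (λ t → 𝟙 (hd es d Fin.≟ t) * Y s t)))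
        ≡⟨ ∑-swap ds (allFin n) ⟩
      ∑ (allFin n) (λ s → ∑ ds (λ d → 𝟙 (tl es d Fin.≟ s) * ∑ (allFin n) (λ t → 𝟙 (hd es d Fin.≟ t) * Y s t)))
        ≡⟨ ∑-cong (allFin n) (λ s → trans (∑-cong ds (λ d → sym (∑-*ˡ (𝟙 (tl es d Fin.≟ s)) (allFin n)))) (∑-swap ds (allFin n))) ⟩
      ∑ (allFin n) (λ s → ∑ (allFin n) (λ t → ∑ ds (λ d → 𝟙 (tl es d Fin.≟ s) * (𝟙 (hd es d Fin.≟ t) * Y s t))))
        ≤⟨ ∑-mono (allFin n) (λ s → ∑-mono (allFin n) (λ t → once s t)) ⟩
      total Y ∎
      where
      open ≤-Reasoning
      ds = darts (length es)
      once : ∀ s t → ∑ ds (λ d → 𝟙 (tl es d Fin.≟ s) * (𝟙 (hd es d Fin.≟ t) * Y s t)) ≤ Y s t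
      once s t = begin
        ∑ ds (λ d → 𝟙 (tl es d Fin.≟ s) * (𝟙 (hd es d Fin.≟ t) * Y s t)) ≡⟨ ∑-cong ds (λ d → sym (*-assoc (𝟙 (tl es d Fin.≟ s)) _ _)) ⟩
        ∑ ds (λ d → between es (s , t) d * Y s t)                      ≡⟨ ∑-*ʳ (Y s t) ds ⟩
        ∑ ds (between es (s , t)) * Y s t                              ≤⟨ *-monoˡ-≤ (Y s t) (between≤1 es si s t) ⟩
        1 * Y s t                                                      ≡⟨ *-identityˡ _ ⟩
        Y s t                                                          ∎

    module Steps (es : List (Edge n)) (si : Simple es) where

      m = length es
      ds = darts m

      up : ℕ → Dart m → Dart m → Bool
      up D d d′ = does (hd es d Fin.≟ tl es d′) ∧
        (pos es (hd es d) (proj₁ d) <ᵇ pos es (hd es d) (proj₁ d′)) ∧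
        (pos es (hd es d) (proj₁ d′) ≤ᵇ D + pos es (hd es d) (proj₁ d))

      Up : ℕ → Dart m → Dart m → Set
      Up D d d′ = hd es d ≡ tl es d′ × pos es (hd es d) (proj₁ d) < pos es (hd es d) (proj₁ d′) ×
        pos es (hd es d) (proj₁ d′) ≤ D + pos es (hd es d) (proj₁ d)

      up-elim : ∀ D d d′ → T (up D d d′) → Up D d d′
      up-elim D d d′ t with hd es d Fin.≟ tl es d′
      ... | yes eq with pos es (hd es d) (proj₁ d) <ᵇ pos es (hd es d) (proj₁ d′) in lt
      ...   | true = eq , <ᵇ⇒< _ _ (subst T (sym lt) tt) , ≤ᵇ⇒≤ _ _ t

      up-intro : ∀ D d d′ → Up D d d′ → T (up D d d′)
      up-intro D d d′ (eq , lt , le) with hd es d Fin.≟ tl es d′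
      ... | no ¬eq = ⊥-elim (¬eq eq)
      ... | yes _ with pos es (hd es d) (proj₁ d) <ᵇ pos es (hd es d) (proj₁ d′) in e
      ...   | false = ⊥-elim (subst T e (<⇒<ᵇ lt))
      ...   | true = ≤⇒≤ᵇ le

      up-idx : ∀ D d d′ → T (up D d d′) → age (proj₁ d) < age (proj₁ d′)
      up-idx D d d′ t = ≰⇒> λ le → <⇒≱ (proj₁ (proj₂ (up-elim D d d′ t))) (pos-mono es (hd es d) (proj₁ d) (proj₁ d′) le)

      up-suc : ∀ D d d′ → T (up (suc D) d d′) → T (up D d d′) ⊎
        (hd es d ≡ tl es d′ × pos es (hd es d) (proj₁ d′) ≡ suc D + pos es (hd es d) (proj₁ d))
      up-suc D d d′ t with up-elim (suc D) d d′ t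
      ... | eq , lt , le with m≤n⇒m<n∨m≡n le
      ...   | inj₁ lt′ = inj₁ (up-intro D d d′ (eq , lt , ≤-pred lt′))
      ...   | inj₂ e   = inj₂ (eq , e)

      up-zero : ∀ d d′ → bit (up 0 d d′) ≡ 0
      up-zero d d′ = bit-F λ t → let (_ , lt , le) = up-elim 0 d d′ t in <⇒≱ lt le

      atᵗ : Fin n → ℕ → Dart m → ℕ
      atᵗ v c d = 𝟙 (tl es d Fin.≟ v) * 𝟙 (pos es v (proj₁ d) ≟ c)

      ∑-atᵗ : ∀ v c → ∑ ds (atᵗ v c) ≡ ∑ ds (at es v c)
      ∑-atᵗ v c = trans (∑-cong ds (λ d → cong (λ z → 𝟙 (z Fin.≟ v) * 𝟙 (pos es v (proj₁ d) ≟ c)) (sym (hd-rev es d)))) (∑-rev m (at es v c))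

      up-row : ∀ D d → ∑ ds (λ d′ → bit (up D d d′)) ≤ D
      up-row zero    d = ≤-reflexive (trans (∑-cong ds (up-zero d)) (∑-zero ds))
      up-row (suc D) d = begin
        ∑ ds (λ d′ → bit (up (suc D) d d′))                                   ≤⟨ ∑-mono ds pointwise ⟩
        ∑ ds (λ d′ → bit (up D d d′) + atᵗ v c d′)                            ≡⟨ ∑-+ ds ⟩
        ∑ ds (λ d′ → bit (up D d d′)) + ∑ ds (atᵗ v c)                        ≤⟨ +-mono-≤ (up-row D d) (≤-trans (≤-reflexive (∑-atᵗ v c)) (at≤1 es si v c)) ⟩
        D + 1                                                                 ≡⟨ +-comm D 1 ⟩
        suc D                                                                 ∎
        where
        open ≤-Reasoning
        v = hd es d
        c = suc D + pos es v (proj₁ d)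
        pointwise : ∀ d′ → bit (up (suc D) d d′) ≤ bit (up D d d′) + atᵗ v c d′
        pointwise d′ with up (suc D) d d′ in e
        ... | false = z≤n
        ... | true with up-suc D d d′ (subst T (sym e) tt)
        ...   | inj₁ t         = ≤-trans (≤-reflexive (sym (bit-T t))) (m≤m+n _ _)
        ...   | inj₂ (eq , eq′) = ≤-trans (≤-reflexive (sym (cong₂ _*_ (𝟙-yes (tl es d′ Fin.≟ v) (sym eq)) (𝟙-yes (pos es v (proj₁ d′) ≟ c) eq′)))) (m≤n+m _ (bit (up D d d′)))

      up-col : ∀ D d′ → ∑ ds (λ d → bit (up D d d′)) ≤ D
      up-col zero    d′ = ≤-reflexive (trans (∑-cong ds (λ d → up-zero d d′)) (∑-zero ds))
      up-col (suc D) d′ = begin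
        ∑ ds (λ d → bit (up (suc D) d d′))                                    ≤⟨ ∑-mono ds pointwise ⟩
        ∑ ds (λ d → bit (up D d d′) + at es v c d)                            ≡⟨ ∑-+ ds ⟩
        ∑ ds (λ d → bit (up D d d′)) + ∑ ds (at es v c)                       ≤⟨ +-mono-≤ (up-col D d′) (at≤1 es si v c) ⟩
        D + 1                                                                 ≡⟨ +-comm D 1 ⟩
        suc D                                                                 ∎
        where
        open ≤-Reasoning
        v = tl es d′
        c = pos es v (proj₁ d′) ∸ suc D
        pointwise : ∀ d → bit (up (suc D) d d′) ≤ bit (up D d d′) + at es v c d
        pointwise d with up (suc D) d d′ in e
        ... | false = z≤n
        ... | true with up-suc D d d′ (subst T (sym e) tt)
        ...   | inj₁ t         = ≤-trans (≤-reflexive (sym (bit-T t))) (m≤m+n _ _)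
        ...   | inj₂ (eq , eq′) = ≤-trans (≤-reflexive (sym (cong₂ _*_ (𝟙-yes (hd es d Fin.≟ v) eq) (𝟙-yes (pos es v (proj₁ d) ≟ c) (pc eq eq′))))) (m≤n+m _ (bit (up D d d′)))
          where
          pc : ∀ {w} → w ≡ v → pos es w (proj₁ d′) ≡ suc D + pos es w (proj₁ d) → pos es v (proj₁ d) ≡ c
          pc refl eq = sym (trans (cong (_∸ suc D) eq) (m+n∸m≡n (suc D) _))

      -- Every dart has one tail, and each of the `n` vertices assigns each rank at most once.
      low : ∀ c → ∑ ds (λ d → bit (pos es (tl es d) (proj₁ d) <ᵇ c)) ≤ n * c
      low zero    = ≤-trans (≤-reflexive (trans (∑-cong ds (λ d → refl)) (∑-zero ds))) z≤n
      low (suc c) = begin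
        ∑ ds (λ d → bit (p d <ᵇ suc c))                            ≡⟨ trans (∑-cong ds (λ d → bit-<-suc (p d) c)) (∑-+ ds) ⟩
        ∑ ds (λ d → 𝟙 (c ≟ p d)) + ∑ ds (λ d → bit (p d <ᵇ c))     ≤⟨ +-mono-≤ exact (low c) ⟩
        n + n * c                                                  ≡⟨ sym (*-suc n c) ⟩
        n * suc c                                                  ∎
        where
        open ≤-Reasoning
        p : Dart m → ℕ
        p d = pos es (tl es d) (proj₁ d)
        exact : ∑ ds (λ d → 𝟙 (c ≟ p d)) ≤ n
        exact = begin
          ∑ ds (λ d → 𝟙 (c ≟ p d))
            ≤⟨ ∑-mono ds (λ d → ≤-trans (≤-reflexive (trans (bit-cong (sym-T c (p d)) (sym-T (p d) c)) (sym (∑-δ (tl es d) (λ v → 𝟙 (pos es v (proj₁ d) ≟ c)))))) ≤-refl) ⟩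
          ∑ ds (λ d → ∑ (allFin n) (λ v → atᵗ v c d))
            ≡⟨ ∑-swap ds (allFin n) ⟩
          ∑ (allFin n) (λ v → ∑ ds (atᵗ v c))
            ≤⟨ ∑-mono (allFin n) (λ v → ≤-trans (≤-reflexive (∑-atᵗ v c)) (at≤1 es si v c)) ⟩
          ∑ (allFin n) (λ _ → 1)
            ≡⟨ trans (∑-const 1 (allFin n)) (trans (*-identityʳ _) (length-tabulate {n = n} (λ i → i))) ⟩
          n ∎
          where
          sym-T : ∀ a b → T (a ≡ᵇ b) → T (b ≡ᵇ a)
          sym-T a b t = ≡⇒≡ᵇ b a (sym (≡ᵇ⇒≡ a b t))

      -- By induction on `D`: widening the window by one provides a new predecessor for every dart
      -- whose rank at its tail exceeds `D`, and by `low` at most `n * suc D` darts have a smaller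
      -- rank.
      up-total : ∀ D → length ds * D ≤ n * D * D + ∑ ds (λ d → ∑ ds (λ d′ → bit (up D d d′)))
      up-total zero    = ≤-trans (≤-reflexive (*-zeroʳ (length ds))) z≤n
      up-total (suc D) = begin
        length ds * suc D                                               ≡⟨ *-suc (length ds) D ⟩
        length ds + length ds * D                                       ≤⟨ +-mono-≤ many (up-total D) ⟩
        H + n * suc D + (n * D * D + ∑ ds (λ d → ∑ ds (λ d′ → bit (up D d d′))))
          ≡⟨ cong (λ z → H + n * suc D + (n * D * D + z)) (∑-swap ds ds) ⟩
        H + n * suc D + (n * D * D + W D)                               ≡⟨ lem H n D (W D) ⟩
        n * D * D + n * suc D + (W D + H)                               ≤⟨ +-mono-≤ (≤-trans (m≤m+n _ (n * D)) (≤-reflexive (lem′ n D))) grow ⟩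
        n * suc D * suc D + W (suc D)                                   ≡⟨ cong (n * suc D * suc D +_) (∑-swap ds ds) ⟩
        n * suc D * suc D + ∑ ds (λ d → ∑ ds (λ d′ → bit (up (suc D) d d′))) ∎
        where
        open ≤-Reasoning
        p : Dart m → ℕ
        p d = pos es (tl es d) (proj₁ d)
        H = ∑ ds (λ d′ → bit (D <ᵇ p d′))
        W : ℕ → ℕ
        W D = ∑ ds (λ d′ → ∑ ds (λ d → bit (up D d d′)))
        lem : ∀ H n D W → H + n * suc D + (n * D * D + W) ≡ n * D * D + n * suc D + (W + H)
        lem = solve-∀
        lem′ : ∀ n D → n * D * D + n * suc D + n * D ≡ n * suc D * suc D
        lem′ = solve-∀
        cover : ∀ a b → 1 ≤ bit (a <ᵇ b) + bit (b <ᵇ suc a)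
        cover a b with <-≤-connex a b
        ... | inj₁ a<b = ≤-trans (≤-reflexive (sym (bit-T (<⇒<ᵇ a<b)))) (m≤m+n _ _)
        ... | inj₂ b≤a = ≤-trans (≤-reflexive (sym (bit-T (<⇒<ᵇ (s≤s b≤a))))) (m≤n+m _ (bit (a <ᵇ b)))
        many : length ds ≤ H + n * suc D
        many = begin
          length ds                                           ≡⟨ sym (trans (∑-const 1 ds) (*-identityʳ _)) ⟩
          ∑ ds (λ _ → 1)                                      ≤⟨ ∑-mono ds (λ d → cover D (p d)) ⟩
          ∑ ds (λ d → bit (D <ᵇ p d) + bit (p d <ᵇ suc D))    ≡⟨ ∑-+ ds ⟩
          H + ∑ ds (λ d → bit (p d <ᵇ suc D))                 ≤⟨ +-monoʳ-≤ H (low (suc D)) ⟩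
          H + n * suc D                                       ∎
        grow : W D + H ≤ W (suc D)
        grow = ≤-trans (≤-reflexive (sym (∑-+ ds))) (∑-mono ds column)
          where
          column : ∀ d′ → ∑ ds (λ d → bit (up D d d′)) + bit (D <ᵇ p d′) ≤ ∑ ds (λ d → bit (up (suc D) d d′))
          column d′ with D <ᵇ p d′ in e
          ... | false = ≤-trans (≤-reflexive (+-identityʳ _)) (∑-mono ds (λ d → mono d))
            where
            mono : ∀ d → bit (up D d d′) ≤ bit (up (suc D) d d′)
            mono d with up D d d′ in e′
            ... | false = z≤n
            ... | true = let (q , lt , le) = up-elim D d d′ (subst T (sym e′) tt) in
              ≤-reflexive (sym (bit-T (up-intro (suc D) d d′ (q , lt , m≤n⇒m≤1+n le))))
          ... | true = begin
            ∑ ds (λ d → bit (up D d d′)) + 1                             ≡⟨ cong (∑ ds (λ d → bit (up D d d′)) +_) (sym (trans (positions es si v c) (bit-T (<⇒<ᵇ c<deg)))) ⟩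
            ∑ ds (λ d → bit (up D d d′)) + ∑ ds (at es v c)              ≡⟨ sym (∑-+ ds) ⟩
            ∑ ds (λ d → bit (up D d d′) + at es v c d)                   ≤⟨ ∑-mono ds pointwise ⟩
            ∑ ds (λ d → bit (up (suc D) d d′))                           ∎
            where
            v = tl es d′
            c = p d′ ∸ suc D
            D<p : suc D ≤ p d′
            D<p = <ᵇ⇒< D (p d′) (subst T (sym e) tt)
            c<p : c < p d′
            c<p = ∸-monoʳ-< {p d′} {suc D} {0} (s≤s z≤n) D<p
            c<deg : c < deg es v
            c<deg = ≤-trans c<p (pos≤deg es v (proj₁ d′))
            pointwise : ∀ d → bit (up D d d′) + at es v c d ≤ bit (up (suc D) d d′)
            pointwise d with at es v c d ≟ 0
            ... | yes z = ≤-trans (≤-reflexive (trans (cong (bit (up D d d′) +_) z) (+-identityʳ _))) mono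
              where
              mono : bit (up D d d′) ≤ bit (up (suc D) d d′)
              mono with up D d d′ in e′
              ... | false = z≤n
              ... | true = let (q , lt , le) = up-elim D d d′ (subst T (sym e′) tt) in
                ≤-reflexive (sym (bit-T (up-intro (suc D) d d′ (q , lt , m≤n⇒m≤1+n le))))
            ... | no nz = ≤-trans (+-mono-≤ (≤-reflexive (bit-F not-D)) at≤) (≤-reflexive (sym (bit-T (up-intro (suc D) d d′ suc-D))))
              where
              hd≡ : hd es d ≡ v
              hd≡ = 𝟙≢0 (hd es d Fin.≟ v) (*≢0ˡ nz)
              pos≡ : pos es v (proj₁ d) ≡ c
              pos≡ = 𝟙≢0 (pos es v (proj₁ d) ≟ c) (*≢0ʳ {𝟙 (hd es d Fin.≟ v)} nz)
              at≤ : at es v c d ≤ 1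
              at≤ = *-mono-≤ (𝟙≤1 (hd es d Fin.≟ v)) (𝟙≤1 (pos es v (proj₁ d) ≟ c))
              p≡ : p d′ ≡ suc D + pos es v (proj₁ d)
              p≡ = trans (sym (m+[n∸m]≡n D<p)) (cong (suc D +_) (sym pos≡))
              not-D : ¬ T (up D d d′)
              not-D t with up-elim D d d′ t
              ... | _ , _ , le = <⇒≱ (≤-reflexive (sym p≡)) (subst (λ w → pos es w (proj₁ d′) ≤ D + pos es w (proj₁ d)) hd≡ le)
              suc-D : Up (suc D) d d′
              suc-D = hd≡ , subst (λ w → pos es w (proj₁ d) < pos es w (proj₁ d′)) (sym hd≡) (≤-trans (s≤s (m≤n+m _ D)) (≤-reflexive (sym p≡)))
                    , subst (λ w → pos es w (proj₁ d′) ≤ suc D + pos es w (proj₁ d)) (sym hd≡) (≤-reflexive p≡)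

  module _ {n K B : ℕ} where
    open Incidence {n}

    Built⇒Simple : ∀ {es} → Built K B es → Simple es
    Built⇒Simple []                    = []
    Built⇒Simple (add b u≢v new _ _ _) = (u≢v , new) ∷ Built⇒Simple b

    before : (es : List (Edge n)) → Fin (length es) → List (Edge n)
    before (e ∷ es) zero    = es
    before (e ∷ es) (suc i) = before es i

    before-∈ : ∀ es i j → age j < age i → lookup es j ∈ before es i
    before-∈ (e ∷ es) zero    zero    h = ⊥-elim (<-irrefl refl h)
    before-∈ (e ∷ es) zero    (suc j) h = lookup-∈ es j
      where
      lookup-∈ : ∀ es j → lookup es j ∈ es
      lookup-∈ (e ∷ es) zero    = here refl
      lookup-∈ (e ∷ es) (suc j) = there (lookup-∈ es j)
    before-∈ (e ∷ es) (suc i) zero    h = ⊥-elim (<⇒≱ (age< i) (<⇒≤ h))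
    before-∈ (e ∷ es) (suc i) (suc j) h = before-∈ es i j h

    total-* : ∀ c (Y : Fin n → Fin n → ℕ) → total (λ a b → c * Y a b) ≡ c * total Y
    total-* c Y = trans (∑-cong (allFin n) (λ a → ∑-*ˡ c (allFin n))) (∑-*ˡ c (allFin n))

    -- The cuts of all edges, scaled to a common weight.
    record Cuts (es : List (Edge n)) : Set where
      field
        S      : ℕ
        S>0    : 0 < S
        Y      : Fin (length es) → Fin n → Fin n → ℕ
        weight : ∀ i → total (Y i) ≡ S
        cut    : ∀ i → Cut K B (before es i) (proj₁ (lookup es i)) (proj₂ (lookup es i)) (Y i)

    cuts-of : ∀ {es} → Built K B es → Cuts es
    cuts-of [] = record { S = 1 ; S>0 = s≤s z≤n ; Y = λ () ; weight = λ () ; cut = λ () }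
    cuts-of (add {es} {u} {v} b _ _ Y₀ Y₀>0 cut₀) = record
      -- The product of all totals serves as a common denominator of the fractional cuts.
      { S      = τ * S
      ; S>0    = *-mono-≤ Y₀>0 S>0
      ; Y      = Y′
      ; weight = λ { zero → trans (total-* S Y₀) (*-comm S τ) ; (suc i) → trans (total-* τ (Y i)) (cong (τ *_) (weight i)) }
      ; cut    = λ { zero → scale S es u v Y₀ cut₀ ; (suc i) → scale τ (before es i) _ _ (Y i) (cut i) }
      }
      where
      open Cuts (cuts-of b)
      τ = total Y₀
      Y′ : Fin (suc (length es)) → Fin n → Fin n → ℕ
      Y′ zero    a c = S * Y₀ a c
      Y′ (suc i) a c = τ * Y i a c
      scale : ∀ c fs x y (Y : Fin n → Fin n → ℕ) → Cut K B fs x y Y → Cut K B fs x y (λ a b → c * Y a b)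
      scale c fs x y Y h q conn q∈ len = begin
        total (λ a b → c * Y a b)              ≡⟨ total-* c Y ⟩
        c * total Y                            ≤⟨ *-monoʳ-≤ c (h q conn q∈ len) ⟩
        c * (B * ∑ q (uncurry Y))              ≡⟨ lem c B (∑ q (uncurry Y)) ⟩
        B * (c * ∑ q (uncurry Y))              ≡⟨ cong (B *_) (sym (∑-*ˡ c q)) ⟩
        B * ∑ q (λ d → c * uncurry Y d)        ∎
        where
        open ≤-Reasoning
        lem : ∀ a b c → a * (b * c) ≡ b * (a * c)
        lem = solve-∀

    module _ {es : List (Edge n)} (built : Built K B es) (D : ℕ) where
      private
        si = Built⇒Simple built
      open Cuts (cuts-of built)
      open Steps es si

      private
        ix : Dart m → Fin m
        ix = proj₁

        -- Both directions are added because a system needs weights that ignore orientation. This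
        -- doubles the size `B` of a cut, and the weight `S` on the two darts of the edge itself
        -- adds two more, whence `Φ = 2 * B + 2`.
        sum₂ : Dart m → Dart m → ℕ
        sum₂ e g = Y (ix e) (tl es g) (hd es g) + Y (ix e) (hd es g) (tl es g)

        xw : Dart m → Dart m → ℕ
        xw e g = B * sum₂ e g + 𝟙 (age (ix g) ≟ age (ix e)) * S

        stp : Bool → Dart m → Dart m → Bool
        stp true  d d′ = up D d d′
        -- A step to an older dart is a step to a newer one traversed backwards.
        stp false d d′ = up D (rev d′) (rev d)

        stp-conn : ∀ p a b → T (stp p a b) → hd es a ≡ tl es b
        stp-conn true  a b t = proj₁ (up-elim D a b t)
        stp-conn false a b t = sym (trans (sym (hd-rev es b)) (trans (proj₁ (up-elim D (rev b) (rev a) t)) (tl-rev es a)))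

        stp-row : ∀ p a → ∑ ds (λ b → bit (stp p a b)) ≤ D
        stp-row true  a = up-row D a
        stp-row false a = ≤-trans (≤-reflexive (∑-rev m (λ b → bit (up D b (rev a))))) (up-col D (rev a))

        stp-col : ∀ p b → ∑ ds (λ a → bit (stp p a b)) ≤ D
        stp-col true  b = up-col D b
        stp-col false b = ≤-trans (≤-reflexive (∑-rev m (λ a → bit (up D (rev b) a)))) (up-row D (rev b))

        stp-total : ∀ p → length ds * D ≤ n * D * D + ∑ ds (λ a → ∑ ds (λ b → bit (stp p a b)))
        stp-total true  = up-total D
        stp-total false = ≤-trans (up-total D) (≤-reflexive (cong (n * D * D +_) (trans (∑-swap ds ds) (sym
          (trans (∑-cong ds (λ a → ∑-rev m (λ b → bit (up D b (rev a))))) (∑-rev m (λ a → ∑ ds (λ b → bit (up D b a)))))))))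

        age-rev : ∀ (a : Dart m) → age (ix (rev a)) ≡ age (ix a)
        age-rev (i , o) = refl

        sum₂-rev : ∀ e g → sum₂ e (rev g) ≡ sum₂ e g
        sum₂-rev e (i , true)  = +-comm (Y (ix e) (proj₂ (lookup es i)) (proj₁ (lookup es i))) _
        sum₂-rev e (i , false) = +-comm (Y (ix e) (proj₁ (lookup es i)) (proj₂ (lookup es i))) _

        xw-rev : ∀ e g → xw e (rev g) ≡ xw e g
        xw-rev e (i , o) = cong (λ z → B * z + 𝟙 (age i ≟ age (ix e)) * S) (sum₂-rev e (i , o))

        xw-sum : ∀ e → ∑ ds (xw e) ≤ (2 * B + 2) * S
        xw-sum e = begin
          ∑ ds (xw e)
            ≡⟨ trans (∑-+ ds) (cong₂ _+_ (trans (∑-*ˡ B ds) (cong (B *_) (∑-+ ds))) (∑-*ʳ S ds)) ⟩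
          B * (∑ ds (λ g → Y (ix e) (tl es g) (hd es g)) + ∑ ds (λ g → Y (ix e) (hd es g) (tl es g)))
            + ∑ ds (λ g → 𝟙 (age (ix g) ≟ age (ix e))) * S
            ≤⟨ +-mono-≤ (*-monoʳ-≤ B (+-mono-≤ forward backward)) (*-monoˡ-≤ S (ages≤2 m (age (ix e)))) ⟩
          B * (S + S) + 2 * S
            ≡⟨ lem B S ⟩
          (2 * B + 2) * S ∎
          where
          open ≤-Reasoning
          lem : ∀ B S → B * (S + S) + 2 * S ≡ (2 * B + 2) * S
          lem = solve-∀
          forward : ∑ ds (λ g → Y (ix e) (tl es g) (hd es g)) ≤ S
          forward = ≤-trans (∑-ends es si (Y (ix e))) (≤-reflexive (weight (ix e)))
          backward : ∑ ds (λ g → Y (ix e) (hd es g) (tl es g)) ≤ S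
          backward = ≤-trans (≤-reflexive (trans (∑-cong ds (λ g → sym (cong₂ (Y (ix e)) (tl-rev es g) (hd-rev es g))))
            (∑-rev m (λ g → Y (ix e) (tl es g) (hd es g))))) forward

        xw-self : ∀ e g → age (ix g) ≡ age (ix e) → S ≤ xw e g
        xw-self e g eq = ≤-trans (≤-trans (≤-reflexive (sym (+-identityʳ S))) (≤-reflexive (cong (_* S) (sym (𝟙-yes (age (ix g) ≟ age (ix e)) eq))))) (m≤n+m _ _)

        ends : Dart m → Edge n
        ends g = tl es g , hd es g

        joins-ends : ∀ i g → age (ix g) < age i → before es i joins ends g
        joins-ends i (j , true)  h = inj₁ (before-∈ es i j h)
        joins-ends i (j , false) h = inj₂ (before-∈ es i j h)

        Conn-map : ∀ {s t} q → Conn (tl es) (hd es) s q t → Conn proj₁ proj₂ s (map ends q) t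
        Conn-map []      refl     = refl
        Conn-map (g ∷ q) (eq , c) = eq , Conn-map q c

        backwards : List (Dart m) → List (Edge n)
        backwards []      = []
        backwards (g ∷ q) = backwards q ++ [ swap (ends g) ]

        Conn-snoc : ∀ {r s t} (q : List (Edge n)) (e : Edge n) → Conn proj₁ proj₂ r q s → proj₁ e ≡ s → proj₂ e ≡ t → Conn proj₁ proj₂ r (q ++ [ e ]) t
        Conn-snoc []      e refl     eq eq′ = eq , eq′
        Conn-snoc (d ∷ q) e (c₀ , c) eq eq′ = c₀ , Conn-snoc q e c eq eq′

        Conn-backwards : ∀ {s t} q → Conn (tl es) (hd es) s q t → Conn proj₁ proj₂ t (backwards q) s
        Conn-backwards []      refl        = refl
        Conn-backwards (g ∷ q) (eq , c) = Conn-snoc (backwards q) (swap (ends g)) (Conn-backwards q c) refl eq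

        ∈-backwards : ∀ {d} q → d ∈ backwards q → ∃ λ g → g ∈ q × d ≡ swap (ends g)
        ∈-backwards (g ∷ q) d∈ with ∈-++⁻ (backwards q) d∈
        ... | inj₂ (here refl) = g , here refl , refl
        ... | inj₁ d∈′ with ∈-backwards q d∈′
        ...   | h , h∈ , eq = h , there h∈ , eq

        ∈-ends : ∀ {d} q → d ∈ map ends q → ∃ λ g → g ∈ q × d ≡ ends g
        ∈-ends (g ∷ q) (here refl) = g , here refl , refl
        ∈-ends (g ∷ q) (there d∈) with ∈-ends q d∈
        ... | h , h∈ , eq = h , there h∈ , eq

        joins-swap : ∀ {fs : List (Edge n)} d → fs joins d → fs joins swap d
        joins-swap d (inj₁ x) = inj₂ x
        joins-swap d (inj₂ x) = inj₁ x

        ∑-backwards : ∀ q (f : Edge n → ℕ) → ∑ (backwards q) f ≡ ∑ q (λ g → f (swap (ends g)))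
        ∑-backwards []      f = refl
        ∑-backwards (g ∷ q) f = trans (∑-++ (backwards q) [ swap (ends g) ]) (trans (cong₂ _+_ (∑-backwards q f) (+-identityʳ _)) (+-comm _ (f (swap (ends g)))))

        length-backwards : ∀ q → length (backwards q) ≡ length q
        length-backwards []      = refl
        length-backwards (g ∷ q) = trans (length-++ (backwards q)) (trans (+-comm _ 1) (cong (λ z → suc z) (length-backwards q)))

        -- The stored cut blocks only walks in the direction in which the edge was inserted; for the
        -- opposite dart the walk is reversed.
        xw-block : ∀ e q → Conn (tl es) (hd es) (tl es e) q (hd es e) → (∀ g → g ∈ q → age (ix g) < age (ix e)) →
          suc (length q) ≤ 2 * K → S ≤ ∑ q (xw e)
        xw-block e@(i , true) q c lt len = begin
          S                                                    ≡⟨ sym (weight i) ⟩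
          total (Y i)                                          ≤⟨ cut i (map ends q) (Conn-map q c) mem (subst (λ l → suc l ≤ 2 * K) (sym (length-map ends q)) len) ⟩
          B * ∑ (map ends q) (uncurry (Y i))                   ≡⟨ cong (B *_) (∑-map ends q) ⟩
          B * ∑ q (λ g → Y i (tl es g) (hd es g))              ≡⟨ sym (∑-*ˡ B q) ⟩
          ∑ q (λ g → B * Y i (tl es g) (hd es g))              ≤⟨ ∑-mono q (λ g → ≤-trans (*-monoʳ-≤ B (m≤m+n _ _)) (m≤m+n _ _)) ⟩
          ∑ q (xw e)                                           ∎
          where
          open ≤-Reasoning
          mem : ∀ d → d ∈ map ends q → before es i joins d
          mem d d∈ with ∈-ends q d∈
          ... | g , g∈ , refl = joins-ends i g (lt g g∈)
        xw-block e@(i , false) q c lt len = begin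
          S                                                    ≡⟨ sym (weight i) ⟩
          total (Y i)                                          ≤⟨ cut i (backwards q) (Conn-backwards q c) mem (subst (λ l → suc l ≤ 2 * K) (sym (length-backwards q)) len) ⟩
          B * ∑ (backwards q) (uncurry (Y i))                  ≡⟨ cong (B *_) (∑-backwards q (uncurry (Y i))) ⟩
          B * ∑ q (λ g → Y i (hd es g) (tl es g))              ≡⟨ sym (∑-*ˡ B q) ⟩
          ∑ q (λ g → B * Y i (hd es g) (tl es g))              ≤⟨ ∑-mono q (λ g → ≤-trans (*-monoʳ-≤ B (m≤n+m _ _)) (m≤m+n _ _)) ⟩
          ∑ q (xw e)                                           ∎
          where
          open ≤-Reasoning
          mem : ∀ d → d ∈ backwards q → before es i joins d
          mem d d∈ with ∈-backwards q d∈
          ... | g , g∈ , refl = joins-swap {before es i} (ends g) (joins-ends i g (lt g g∈))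

      system : System
      system = record
        { n = n ; D = D ; Φ = 2 * B + 2 ; S = S ; K = K ; A = Dart m ; as = ds
        ; tl = tl es ; hd = hd es ; rev = rev ; idx = λ a → age (ix a) ; step = stp ; x = xw
        ; S>0 = S>0 ; tl-rev = tl-rev es ; hd-rev = hd-rev es ; idx-rev = age-rev
        ; step-conn = stp-conn
        ; step-up = up-idx D
        ; step-down = λ a b t → subst₂ _<_ (age-rev b) (age-rev a) (up-idx D (rev b) (rev a) t)
        ; row = stp-row ; col = stp-col ; steps = stp-total
        ; simple = λ s t → between≤1 es si s t
        ; x-sum = xw-sum ; x-self = xw-self ; x-rev = xw-rev ; block = xw-block
        }

  -- The proof counts the walks of length K with steps of width D.
  built-bound : ∀ {n κ B} {es : List (Edge n)} → Built (suc κ) B es →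
    let K = suc κ; m = length es; Φ = 2 * B + 2 in
    (D : ℕ) → 64 * (K * Φ) ≤ D → K * (n * D) ≤ m →
    2 * m * D ^ κ ≤ 16 * (n * (n * (1024 * (K * (suc K * (K * Φ)))) ^ ⌊ K /2⌋))
  built-bound {n} {κ} {B} {es} built D hD hm =
    subst (λ N → N * D ^ κ ≤ 16 * (n * (n * (1024 * (suc κ * (suc (suc κ) * (suc κ * (2 * B + 2))))) ^ ⌊ suc κ /2⌋)))
      (length-darts (length es))
      (walk-bound (system built D) (≤-trans (s≤s z≤n) (m≤n+m 2 (2 * B))) hD
        (≤-trans (*-monoʳ-≤ 2 hm) (≤-reflexive (sym (length-darts (length es))))) κ refl)

  -- From the number of walks to the number of edges

  module _ {n κ f : ℕ} (f>0 : 0 < f) (n>0 : 0 < n) {es : List (Edge n)} (built : Built (suc κ) (8 * f) es) where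

    private
      K m D Φ : ℕ
      K = suc κ
      m = length es
      Φ = 2 * (8 * f) + 2
      instance
        Kn≢0 : NonZero (K * n)
        Kn≢0 = >-nonZero (*-mono-≤ (s≤s (z≤n {κ})) n>0)
      -- The largest width with `K * (n * D) ≤ m`, as `built-bound` requires.
      D = m / (K * n)

      Φ≤ : Φ ≤ 18 * f
      Φ≤ = ≤-trans (+-monoʳ-≤ (2 * (8 * f)) (*-monoʳ-≤ 2 f>0)) (≤-reflexive (lem f))
        where
        lem : ∀ f → 2 * (8 * f) + 2 * f ≡ 18 * f
        lem = solve-∀

      m<D+1 : m ≤ suc D * (K * n)
      m<D+1 = ≤-trans (≤-reflexive (m≡m%n+[m/n]*n m (K * n))) (+-monoˡ-≤ (D * (K * n)) (<⇒≤ (m%n<n m (K * n))))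

      -- By maximality of `D`, few edges are left below the threshold; `1152 = 64 * 18`.
      sparse : D < 64 * (K * Φ) → m ≤ 1152 * (K ^ 2 * f * n)
      sparse D< = begin
        m                                ≤⟨ m<D+1 ⟩
        suc D * (K * n)                  ≤⟨ *-monoˡ-≤ (K * n) D< ⟩
        64 * (K * Φ) * (K * n)           ≤⟨ *-monoˡ-≤ (K * n) (*-monoʳ-≤ 64 (*-monoʳ-≤ K Φ≤)) ⟩
        64 * (K * (18 * f)) * (K * n)    ≡⟨ lem K f n ⟩
        1152 * (K * (K * 1) * f * n)     ∎
        where
        open ≤-Reasoning
        lem : ∀ K f n → 64 * (K * (18 * f)) * (K * n) ≡ 1152 * (K * (K * 1) * f * n)
        lem = solve-∀

      L : ℕ
      L = 1024 * (K * (suc K * (K * Φ)))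

      -- The constant is `1024 * 2 * 18 = 192²`, the factor two coming from `K + 1 ≤ 2K`.
      L≤ : L ≤ 192 * 192 * (K ^ 3 * f)
      L≤ = begin
        1024 * (K * (suc K * (K * Φ)))            ≤⟨ *-monoʳ-≤ 1024 (*-monoʳ-≤ K (*-mono-≤ (+-monoˡ-≤ K (s≤s (z≤n {κ}))) (*-monoʳ-≤ K Φ≤))) ⟩
        1024 * (K * ((K + K) * (K * (18 * f))))   ≡⟨ lem K f ⟩
        192 * 192 * (K * (K * (K * 1)) * f)       ∎
        where
        open ≤-Reasoning
        lem : ∀ K f → 1024 * (K * ((K + K) * (K * (18 * f)))) ≡ 192 * 192 * (K * (K * (K * 1)) * f)
        lem = solve-∀

      -- Since `D` is positive, rounding loses at most a factor two and `m ≤ D * (2 * (K * n))`;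
      -- this exchanges `D ^ κ` for `m ^ κ`.
      dense : 64 * (K * Φ) ≤ D → m ^ K ≤ 8 * (n * n * (2 * (K * n)) ^ κ * L ^ ⌊ K /2⌋)
      dense hD = *-cancelˡ-≤ 2 (begin
        2 * (m * m ^ κ)
          ≡⟨ sym (*-assoc 2 m _) ⟩
        2 * m * m ^ κ
          ≤⟨ *-monoʳ-≤ (2 * m) (≤-trans (^-monoˡ-≤ κ m≤) (≤-reflexive (^-distribʳ-* κ D (2 * (K * n))))) ⟩
        2 * m * (D ^ κ * (2 * (K * n)) ^ κ)
          ≡⟨ sym (*-assoc (2 * m) _ _) ⟩
        2 * m * D ^ κ * (2 * (K * n)) ^ κ
          ≤⟨ *-monoˡ-≤ ((2 * (K * n)) ^ κ) (built-bound built D hD (≤-trans (≤-reflexive (trans (sym (*-assoc K n D)) (*-comm (K * n) D))) (m/n*n≤m m (K * n)))) ⟩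
        16 * (n * (n * L ^ ⌊ K /2⌋)) * (2 * (K * n)) ^ κ
          ≡⟨ lem n (L ^ ⌊ K /2⌋) ((2 * (K * n)) ^ κ) ⟩
        2 * (8 * (n * n * (2 * (K * n)) ^ κ * L ^ ⌊ K /2⌋)) ∎)
        where
        open ≤-Reasoning
        ^-distribʳ-* : ∀ k a b → (a * b) ^ k ≡ a ^ k * b ^ k
        ^-distribʳ-* zero    a b = refl
        ^-distribʳ-* (suc k) a b = trans (cong (a * b *_) (^-distribʳ-* k a b)) (lem′ a b (a ^ k) (b ^ k))
          where
          lem′ : ∀ a b c d → a * b * (c * d) ≡ a * c * (b * d)
          lem′ = solve-∀
        1≤D : 1 ≤ D
        1≤D = ≤-trans (*-mono-≤ (s≤s (z≤n {63})) (*-mono-≤ (s≤s (z≤n {κ})) (≤-trans (s≤s z≤n) (m≤n+m 2 (2 * (8 * f)))))) hD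
        m≤ : m ≤ D * (2 * (K * n))
        m≤ = ≤-trans m<D+1 (≤-trans (*-monoˡ-≤ (K * n) (+-monoˡ-≤ D 1≤D)) (≤-reflexive (lem″ D (K * n))))
          where
          lem″ : ∀ D k → (D + D) * k ≡ D * (2 * k)
          lem″ = solve-∀
        lem : ∀ n l w → 16 * (n * (n * l)) * w ≡ 2 * (8 * (n * n * w * l))
        lem = solve-∀

      ^-* : ∀ k a b → (a * b) ^ k ≡ a ^ k * b ^ k
      ^-* zero    a b = refl
      ^-* (suc k) a b = trans (cong (a * b *_) (^-* k a b)) (lem a b (a ^ k) (b ^ k))
        where
        lem : ∀ a b c d → a * b * (c * d) ≡ a * c * (b * d)
        lem = solve-∀

      -- Squaring removes the rounding in the exponent ⌊ K /2⌋.
      squared : ∀ j → 2 * ⌊ K /2⌋ ≡ j → j ≤ K → 64 * (K * Φ) ≤ D →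
        m ^ (2 * K) ≤ 3072 ^ (2 * K) * (K ^ (5 * K) * f ^ j * n ^ (2 * suc K))
      squared j eq j≤K hD = begin
        m ^ (2 * K)
          ≡⟨ trans (cong (m ^_) (*-comm 2 K)) (sym (^-*-assoc m K 2)) ⟩
        (m ^ K) ^ 2
          ≤⟨ ^-monoˡ-≤ 2 (dense hD) ⟩
        (8 * (n * n * (2 * (K * n)) ^ κ * L ^ ⌊ K /2⌋)) ^ 2
          ≡⟨ lem₁ n ((2 * (K * n)) ^ κ) (L ^ ⌊ K /2⌋) ⟩
        64 * (n ^ 4 * ((2 * (K * n)) ^ κ) ^ 2 * (L ^ ⌊ K /2⌋) ^ 2)
          ≡⟨ cong₂ (λ p q → 64 * (n ^ 4 * p * q)) (trans (^-*-assoc (2 * (K * n)) κ 2) (cong ((2 * (K * n)) ^_) (*-comm κ 2)))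
               (trans (^-*-assoc L ⌊ K /2⌋ 2) (cong (L ^_) (trans (*-comm ⌊ K /2⌋ 2) eq))) ⟩
        64 * (n ^ 4 * (2 * (K * n)) ^ (2 * κ) * L ^ j)
          ≤⟨ *-monoʳ-≤ 64 (*-monoʳ-≤ (n ^ 4 * (2 * (K * n)) ^ (2 * κ)) L^j≤) ⟩
        64 * (n ^ 4 * (2 * (K * n)) ^ (2 * κ) * ((192 * 192) ^ K * (K ^ (3 * K) * f ^ j)))
          ≡⟨ cong (λ p → 64 * (n ^ 4 * p * ((192 * 192) ^ K * (K ^ (3 * K) * f ^ j)))) (trans (^-* (2 * κ) 2 (K * n)) (cong (2 ^ (2 * κ) *_) (^-* (2 * κ) K n))) ⟩
        64 * (n ^ 4 * (2 ^ (2 * κ) * (K ^ (2 * κ) * n ^ (2 * κ))) * ((192 * 192) ^ K * (K ^ (3 * K) * f ^ j)))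
          ≡⟨ lem₂ (n ^ 4) (2 ^ (2 * κ)) (K ^ (2 * κ)) (n ^ (2 * κ)) ((192 * 192) ^ K) (K ^ (3 * K)) (f ^ j) ⟩
        64 * 2 ^ (2 * κ) * (192 * 192) ^ K * (K ^ (2 * κ) * K ^ (3 * K) * f ^ j * (n ^ 4 * n ^ (2 * κ)))
          ≤⟨ *-mono-≤ constants (*-mono-≤ (*-monoˡ-≤ (f ^ j) K-powers) (≤-reflexive n-powers)) ⟩
        3072 ^ (2 * K) * (K ^ (5 * K) * f ^ j * n ^ (2 * suc K)) ∎
        where
        open ≤-Reasoning
        lem₁ : ∀ n w l → (8 * (n * n * w * l)) * ((8 * (n * n * w * l)) * 1) ≡ 64 * (n * (n * (n * (n * 1))) * (w * (w * 1)) * (l * (l * 1)))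
        lem₁ = solve-∀
        lem₂ : ∀ a b c d e g h → 64 * (a * (b * (c * d)) * (e * (g * h))) ≡ 64 * b * e * (c * g * h * (a * d))
        lem₂ = solve-∀
        L^j≤ : L ^ j ≤ (192 * 192) ^ K * (K ^ (3 * K) * f ^ j)
        L^j≤ = begin
          L ^ j                                        ≤⟨ ^-monoˡ-≤ j L≤ ⟩
          (192 * 192 * (K ^ 3 * f)) ^ j                ≡⟨ trans (^-* j (192 * 192) (K ^ 3 * f)) (cong ((192 * 192) ^ j *_) (trans (^-* j (K ^ 3) f) (cong (_* f ^ j) (^-*-assoc K 3 j)))) ⟩
          (192 * 192) ^ j * (K ^ (3 * j) * f ^ j)      ≤⟨ *-mono-≤ (^-monoʳ-≤ (192 * 192) j≤K) (*-monoˡ-≤ (f ^ j) (^-monoʳ-≤ K (*-monoʳ-≤ 3 j≤K))) ⟩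
          (192 * 192) ^ K * (K ^ (3 * K) * f ^ j)      ∎
        constants : 64 * 2 ^ (2 * κ) * (192 * 192) ^ K ≤ 3072 ^ (2 * K)
        constants = begin
          64 * 2 ^ (2 * κ) * (192 * 192) ^ K           ≡⟨ cong (λ z → 64 * z * (192 * 192) ^ K) (sym (^-*-assoc 2 2 κ)) ⟩
          64 * 4 ^ κ * (192 * 192) ^ K                 ≤⟨ *-monoˡ-≤ ((192 * 192) ^ K) (*-monoʳ-≤ 64 (^-monoˡ-≤ κ {4} {64} (s≤s (s≤s (s≤s (s≤s z≤n)))))) ⟩
          64 ^ K * (192 * 192) ^ K                     ≡⟨ sym (^-* K 64 (192 * 192)) ⟩
          (64 * (192 * 192)) ^ K                       ≤⟨ ^-monoˡ-≤ K {64 * (192 * 192)} {3072 * 3072} (≤ᵇ⇒≤ _ _ _) ⟩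
          (3072 * 3072) ^ K                            ≡⟨ cong (_^ K) {3072 * 3072} {3072 ^ 2} refl ⟩
          (3072 ^ 2) ^ K                               ≡⟨ ^-*-assoc 3072 2 K ⟩
          3072 ^ (2 * K)                               ∎
        K-powers : K ^ (2 * κ) * K ^ (3 * K) ≤ K ^ (5 * K)
        K-powers = ≤-trans (≤-reflexive (sym (^-distribˡ-+-* K (2 * κ) (3 * K)))) (^-monoʳ-≤ K
          (≤-trans (+-monoˡ-≤ (3 * K) (*-monoʳ-≤ 2 (n≤1+n κ))) (≤-reflexive (lem₃ K))))
          where
          lem₃ : ∀ K → 2 * K + 3 * K ≡ 5 * K
          lem₃ = solve-∀
        n-powers : n ^ 4 * n ^ (2 * κ) ≡ n ^ (2 * suc K)
        n-powers = trans (sym (^-distribˡ-+-* n 4 (2 * κ))) (cong (n ^_) (lem₄ κ))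
          where
          lem₄ : ∀ κ → 4 + 2 * κ ≡ 2 * suc (suc κ)
          lem₄ = solve-∀

    -- The exponent `j` of `f` is `K` for even `K` and `K - 1` for odd `K`; a root of order `2K`
    -- makes them `1/2` and `1/2 - 1/(2K)`.
    size : m ≤ 1152 * (K ^ 2 * f * n) ⊎
      (∀ j → 2 * ⌊ K /2⌋ ≡ j → j ≤ K → m ^ (2 * K) ≤ 3072 ^ (2 * K) * (K ^ (5 * K) * f ^ j * n ^ (2 * suc K)))
    size with 64 * (K * Φ) ≤? D
    ... | yes hD = inj₂ λ j eq j≤K → squared j eq j≤K hD
    ... | no  hD = inj₁ (sparse (≰⇒> hD))

  half-even : ∀ k → 2 ∣ k → 2 * ⌊ k /2⌋ ≡ k
  half-even k (divides q eq) = subst (λ k → 2 * ⌊ k /2⌋ ≡ k) (trans (*-comm 2 q) (sym eq)) (cong (2 *_) (lem q))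
    where
    lem : ∀ q → ⌊ 2 * q /2⌋ ≡ q
    lem zero    = refl
    lem (suc q) = trans (cong ⌊_/2⌋ (*-distribˡ-+ 2 1 q)) (cong suc (lem q))

  half-odd′ : ∀ κ → ¬ 2 ∣ suc κ → 2 * ⌊ suc κ /2⌋ ≡ κ
  half-odd′ zero          h = refl
  half-odd′ (suc zero)    h with () ← h (divides 1 refl)
  half-odd′ (suc (suc κ)) h = trans (*-distribˡ-+ 2 1 ⌊ suc κ /2⌋) (cong (2 +_) (half-odd′ κ (λ { (divides q eq) → h (divides (suc q) (cong (2 +_) eq)) })))

open import Defs

-- Ordered field arithmetic and roots

module Distances where

  module RealProperties (ℝ : Reals) where
    open Reals ℝ
    private
      module R = CommutativeRing commutativeRing
      module O = DecTotalOrder decTotalOrder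
    open RingProperties R.ring using (-‿distribˡ-*; -‿distribʳ-*; -‿involutive)
    open Exp R.semiring using (^-congˡ; ^-assocʳ; ^-homo-*)
    open CExp R.commutativeSemiring using (^-distrib-*)
    open Mult R.semiring using (×1-homo-*; ×-homo-+)

    +-mono : ∀ {x x′ y y′} → x ≤ x′ → y ≤ y′ → x + y ≤ x′ + y′
    +-mono {x} {x′} {y} {y′} p q = ≤-trans (+-monoˡ-≤ y p)
      (≤-respˡ-≈ (R.+-comm y x′) (≤-respʳ-≈ (R.+-comm y′ x′) (+-monoˡ-≤ x′ q)))

    0≤y-x : ∀ {x y} → x ≤ y → 0# ≤ y - x
    0≤y-x {x} {y} p = ≤-respˡ-≈ (R.-‿inverseʳ x) (+-monoˡ-≤ (- x) p)

    y-x+x : ∀ x y → y - x + x R.≈ y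
    y-x+x x y = R.trans (R.+-assoc y (- x) x) (R.trans (R.+-congˡ (R.-‿inverseˡ x)) (R.+-identityʳ y))

    x≤y : ∀ {x y} → 0# ≤ y - x → x ≤ y
    x≤y {x} {y} p = ≤-respˡ-≈ (R.+-identityˡ x) (≤-respʳ-≈ (y-x+x x y) (+-monoˡ-≤ x p))

    *-distrib-minus : ∀ z x y → z * (y - x) R.≈ z * y - z * x
    *-distrib-minus z x y = R.trans (R.distribˡ z y (- x)) (R.+-congˡ (R.sym (-‿distribʳ-* z x)))

    *-monoʳ : ∀ {z x y} → 0# ≤ z → x ≤ y → z * x ≤ z * y
    *-monoʳ {z} {x} {y} 0≤z p = x≤y (≤-respʳ-≈ (*-distrib-minus z x y) (*-nonneg 0≤z (0≤y-x p)))

    *-mono : ∀ {x x′ y y′} → 0# ≤ x → x ≤ x′ → 0# ≤ y′ → y ≤ y′ → x * y ≤ x′ * y′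
    *-mono {x} {x′} {y} {y′} 0≤x p 0≤y′ q = ≤-trans (*-monoʳ 0≤x q)
      (≤-respˡ-≈ (R.*-comm y′ x) (≤-respʳ-≈ (R.*-comm y′ x′) (*-monoʳ 0≤y′ p)))

    0≤1 : 0# ≤ 1#
    0≤1 with total 0# 1#
    ... | inj₁ p = p
    ... | inj₂ p = ≤-respʳ-≈ (R.trans (R.sym (-‿distribˡ-* 1# (- 1#))) (R.trans (R.-‿cong (R.*-identityˡ (- 1#))) (-‿involutive 1#)))
        (*-nonneg q q)
      where
      q : 0# ≤ - 1#
      q = ≤-respʳ-≈ (R.+-identityˡ (- 1#)) (0≤y-x p)

    0<1 : 0# < 1#
    0<1 p = 0≉1 (O.antisym 0≤1 p)

    *-cancel : ∀ {c x y} → 0# ≤ c → 0# < c → c * x ≤ c * y → x ≤ y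
    *-cancel {c} {x} {y} 0≤c 0<c p with total x y
    ... | inj₁ q = q
    ... | inj₂ q = ≤-reflexive (x≈y (R.trans (R.sym (R.*-identityˡ (x - y))) (R.trans (R.*-congʳ (R.sym (R.trans (R.*-comm d c) cd≈1)))
        (R.trans (R.*-assoc d c (x - y)) (R.trans (R.*-congˡ c[x-y]≈0) (R.zeroʳ d))))))
      where
      d = proj₁ (inverse c (λ e → 0<c (≤-reflexive e)))
      cd≈1 = proj₂ (inverse c (λ e → 0<c (≤-reflexive e)))
      x≈y : x - y R.≈ 0# → x R.≈ y
      x≈y e = R.trans (R.sym (y-x+x y x)) (R.trans (R.+-congʳ e) (R.+-identityˡ y))
      c[x-y]≈0 : c * (x - y) R.≈ 0#
      c[x-y]≈0 = O.antisym (≤-respˡ-≈ (R.sym (*-distrib-minus c y x)) (≤-respʳ-≈ (R.-‿inverseʳ (c * y)) (+-monoˡ-≤ (- (c * y)) p)))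
        (*-nonneg 0≤c (0≤y-x q))

    0≤^ : ∀ {x} k → 0# ≤ x → 0# ≤ x ^ k
    0≤^ zero    p = 0≤1
    0≤^ (suc k) p = *-nonneg p (0≤^ k p)

    ^-mono : ∀ {x y} k → 0# ≤ x → x ≤ y → x ^ k ≤ y ^ k
    ^-mono zero    p q = ≤-refl
    ^-mono (suc k) p q = *-mono p q (0≤^ k (≤-trans p q)) (^-mono k p q)

    0<^ : ∀ {x} k → 0# ≤ x → 0# < x → 0# < x ^ k
    0<^ zero    p q = 0<1
    0<^ {x} (suc k) p q r = 0<^ k p q (*-cancel p q (≤-respʳ-≈ (R.sym (R.zeroʳ x)) r))

    ^-cancel : ∀ {x y} k → 0# ≤ x → 0# ≤ y → y ^ suc k ≤ x ^ suc k → y ≤ x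
    ^-cancel {x} {y} k 0≤x 0≤y p with total y x | y ≤? 0#
    ... | inj₁ q | _       = q
    ... | inj₂ q | yes y≤0 = ≤-trans y≤0 0≤x
    ... | inj₂ q | no y>0  = *-cancel (0≤^ k 0≤y) (0<^ k 0≤y y>0)
      (≤-respˡ-≈ (R.*-comm y (y ^ k)) (≤-respʳ-≈ (R.*-comm x (y ^ k)) (≤-trans p (*-monoʳ 0≤x (^-mono k 0≤x q)))))

    0≤fromℕ : ∀ k → 0# ≤ fromℕ k
    0≤fromℕ zero    = ≤-refl
    0≤fromℕ (suc k) = ≤-respˡ-≈ (R.+-identityˡ 0#) (+-mono 0≤1 (0≤fromℕ k))

    fromℕ-mono : ∀ {j k} → j ℕ.≤ k → fromℕ j ≤ fromℕ k
    fromℕ-mono {k = k} ℕ.z≤n = 0≤fromℕ k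
    fromℕ-mono (ℕ.s≤s p) = +-mono ≤-refl (fromℕ-mono p)

    0<fromℕ : ∀ k → 0# < fromℕ (suc k)
    0<fromℕ k p = 0<1 (≤-trans (≤-respˡ-≈ (R.+-identityʳ 1#) (+-mono ≤-refl (0≤fromℕ k))) p)

    fromℕ-* : ∀ j k → fromℕ (j ℕ.* k) R.≈ fromℕ j * fromℕ k
    fromℕ-* = ×1-homo-*

    fromℕ-^ : ∀ j k → fromℕ (j ℕ.^ k) R.≈ fromℕ j ^ k
    fromℕ-^ j zero    = R.+-identityʳ 1#
    fromℕ-^ j (suc k) = R.trans (fromℕ-* j (j ℕ.^ k)) (R.*-congˡ (fromℕ-^ j k))

    -- Roots

    -- A quantitative form of the continuity of powers at `r` from above, by induction on the
    -- exponent.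
    linear-growth : ∀ {r} q → 0# ≤ r → ∃ λ M → 0# ≤ M × (∀ ε → 0# ≤ ε → ε ≤ 1# → (r + ε) ^ q ≤ r ^ q + ε * M)
    linear-growth zero 0≤r = 0# , ≤-refl , λ ε _ _ → ≤-reflexive (R.sym (R.trans (R.+-congˡ (R.zeroʳ ε)) (R.+-identityʳ 1#)))
    linear-growth {r} (suc q) 0≤r with linear-growth q 0≤r
    ... | M , 0≤M , h = r * M + r ^ q + M , 0≤M′ , step
      where
      0≤M′ : 0# ≤ r * M + r ^ q + M
      0≤M′ = ≤-respˡ-≈ (R.trans (R.+-congʳ (R.+-identityʳ 0#)) (R.+-identityʳ 0#)) (+-mono (+-mono (*-nonneg 0≤r 0≤M) (0≤^ q 0≤r)) 0≤M)
      step : ∀ ε → 0# ≤ ε → ε ≤ 1# → (r + ε) * (r + ε) ^ q ≤ r * r ^ q + ε * (r * M + r ^ q + M)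
      step ε 0≤ε ε≤1 = ≤-trans (*-monoʳ 0≤r+ε (h ε 0≤ε ε≤1)) (≤-trans (≤-reflexive expand)
        (+-mono ≤-refl (*-monoʳ 0≤ε (+-mono ≤-refl (≤-respʳ-≈ (R.*-identityˡ M) (*-mono 0≤ε ε≤1 0≤M ≤-refl))))))
        where
        0≤r+ε : 0# ≤ r + ε
        0≤r+ε = ≤-respˡ-≈ (R.+-identityʳ 0#) (+-mono 0≤r 0≤ε)
        open import Relation.Binary.Reasoning.Setoid R.setoid
        expand : (r + ε) * (r ^ q + ε * M) R.≈ r * r ^ q + ε * (r * M + r ^ q + ε * M)
        expand = begin
          (r + ε) * (r ^ q + ε * M)                               ≈⟨ R.distribʳ _ r ε ⟩
          r * (r ^ q + ε * M) + ε * (r ^ q + ε * M)               ≈⟨ R.+-congʳ (R.distribˡ r _ _) ⟩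
          r * r ^ q + r * (ε * M) + ε * (r ^ q + ε * M)           ≈⟨ R.+-assoc _ _ _ ⟩
          r * r ^ q + (r * (ε * M) + ε * (r ^ q + ε * M))         ≈⟨ R.+-congˡ (R.+-congʳ (R.trans (R.sym (R.*-assoc r ε M)) (R.trans (R.*-congʳ (R.*-comm r ε)) (R.*-assoc ε r M)))) ⟩
          r * r ^ q + (ε * (r * M) + ε * (r ^ q + ε * M))         ≈⟨ R.+-congˡ (R.sym (R.distribˡ ε _ _)) ⟩
          r * r ^ q + ε * (r * M + (r ^ q + ε * M))               ≈⟨ R.+-congˡ (R.*-congˡ (R.sym (R.+-assoc _ _ _))) ⟩
          r * r ^ q + ε * (r * M + r ^ q + ε * M)                 ∎

    sup-property : ∀ P e b → IsSupremum P (proj₁ (supremum P e b))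
    sup-property P e b = proj₂ (supremum P e b)

    root-sup : ∀ q a → IsSupremum (λ y → 0# ≤ y × y ^ suc q ≤ fromℕ a) (root (suc q) a)
    root-sup q a = sup-property _ _ _

    0≤root : ∀ q a → 0# ≤ root (suc q) a
    0≤root q a = proj₁ (root-sup q a) 0# (≤-refl , ≤-respˡ-≈ (R.sym (R.zeroˡ (0# ^ q))) (0≤fromℕ a))

    -- If `r ^ suc q` stayed below `c` by `δ`, then `r + ε` with `ε` the smaller of `1` and
    -- `δ/(M+1)` would still belong to the set and exceed its supremum.
    sup-power-≥ : ∀ q c r → 0# ≤ r → IsSupremum (λ y → 0# ≤ y × y ^ suc q ≤ c) r → c ≤ r ^ suc q
    sup-power-≥ q c r 0≤r sup with c ≤? r ^ suc q
    ... | yes p = p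
    ... | no ¬p = ⊥-elim (positive (+-cancel (proj₁ sup (r + ε) (0≤r+ε , small))))
      where
      lin = linear-growth (suc q) 0≤r
      M = proj₁ lin
      0≤M = proj₁ (proj₂ lin)
      r^q≤a : r ^ suc q ≤ c
      r^q≤a with total (r ^ suc q) c
      ... | inj₁ h = h
      ... | inj₂ h = ⊥-elim (¬p h)
      δ = c - r ^ suc q
      0≤δ : 0# ≤ δ
      0≤δ = 0≤y-x r^q≤a
      0<δ : 0# < δ
      0<δ h = ¬p (≤-respˡ-≈ (y-x+x (r ^ suc q) c) (≤-respʳ-≈ (R.+-identityˡ _) (+-monoˡ-≤ (r ^ suc q) h)))
      0≤M+1 : 0# ≤ M + 1#
      0≤M+1 = ≤-respˡ-≈ (R.+-identityʳ 0#) (+-mono 0≤M 0≤1)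
      0<M+1 : 0# < M + 1#
      0<M+1 h = 0<1 (≤-trans (≤-respˡ-≈ (R.+-identityˡ 1#) (+-mono 0≤M ≤-refl)) h)
      inv = inverse (M + 1#) (λ e → 0<M+1 (≤-reflexive e))
      i = proj₁ inv
      0≤i : 0# ≤ i
      0≤i = *-cancel 0≤M+1 0<M+1 (≤-respˡ-≈ (R.sym (R.zeroʳ (M + 1#))) (≤-respʳ-≈ (R.sym (proj₂ inv)) 0≤1))
      M≤M+1 : M ≤ M + 1#
      M≤M+1 = ≤-respˡ-≈ (R.+-identityʳ M) (+-mono ≤-refl 0≤1)
      δi[M+1] : (δ * i) * (M + 1#) R.≈ δ
      δi[M+1] = R.trans (R.*-assoc δ i (M + 1#)) (R.trans (R.*-congˡ (R.trans (R.*-comm i (M + 1#)) (proj₂ inv))) (R.*-identityʳ δ))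
      0<δi : 0# < δ * i
      0<δi h = 0<δ (≤-respˡ-≈ (R.trans (R.*-comm (M + 1#) (δ * i)) δi[M+1]) (≤-respʳ-≈ (R.zeroʳ (M + 1#)) (*-monoʳ 0≤M+1 h)))
      choice : ∃ λ ε → 0# ≤ ε × 0# < ε × ε ≤ 1# × ε * M ≤ δ
      choice with total (δ * i) 1#
      ... | inj₁ h = δ * i , *-nonneg 0≤δ 0≤i , 0<δi , h , ≤-respʳ-≈ δi[M+1] (*-monoʳ (*-nonneg 0≤δ 0≤i) M≤M+1)
      ... | inj₂ h = 1# , 0≤1 , 0<1 , ≤-refl , ≤-respˡ-≈ (R.sym (R.*-identityˡ M)) (≤-trans M≤M+1
          (≤-respˡ-≈ (R.*-identityˡ (M + 1#)) (≤-respʳ-≈ δi[M+1] (*-mono 0≤1 h 0≤M+1 ≤-refl))))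
      ε = proj₁ choice
      positive : 0# < ε
      positive = proj₁ (proj₂ (proj₂ choice))
      0≤r+ε : 0# ≤ r + ε
      0≤r+ε = ≤-respˡ-≈ (R.+-identityʳ 0#) (+-mono 0≤r (proj₁ (proj₂ choice)))
      small : (r + ε) ^ suc q ≤ c
      small = ≤-trans (proj₂ (proj₂ lin) ε (proj₁ (proj₂ choice)) (proj₁ (proj₂ (proj₂ (proj₂ choice)))))
        (≤-trans (+-mono ≤-refl (proj₂ (proj₂ (proj₂ (proj₂ choice))))) (≤-reflexive (R.trans (R.+-comm _ δ) (y-x+x (r ^ suc q) c))))
      +-cancel : r + ε ≤ r → ε ≤ 0#
      +-cancel h = ≤-respˡ-≈ (R.trans (R.+-congʳ (R.+-comm r ε)) (R.trans (R.+-assoc ε r (- r)) (R.trans (R.+-congˡ (R.-‿inverseʳ r)) (R.+-identityʳ ε))))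
        (≤-respʳ-≈ (R.-‿inverseʳ r) (+-monoˡ-≤ (- r) h))

    root-≥ : ∀ q a → fromℕ a ≤ root (suc q) a ^ suc q
    root-≥ q a = sup-power-≥ q (fromℕ a) (root (suc q) a) (0≤root q a) (root-sup q a)

    -- With `d` a root of order `q`, the fractional power `p/q` is compared after raising to the
    -- `r`-th power, where `q j = p r` makes the exponents integral.
    power-≥ : ∀ d c q p r j → 0# ≤ c → c ≤ d ^ q → q ℕ.* j ≡ p ℕ.* r → c ^ j ≤ (d ^ p) ^ r
    power-≥ d c q p r j 0≤c h eq = ≤-respʳ-≈ same (^-mono j 0≤c h)
      where
      same : (d ^ q) ^ j R.≈ (d ^ p) ^ r
      same = R.trans (^-assocʳ d q j) (R.trans (R.reflexive (≡.cong (d ^_) eq)) (R.sym (^-assocʳ d p r)))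

    product-power-≥ : ∀ q M C A B E X Y Z → 0# ≤ M → 0# ≤ C → 0# ≤ A → 0# ≤ B → 0# ≤ X → 0# ≤ Y → 0# ≤ Z →
      M ^ suc q ≤ C ^ suc q * (A * B * E) → A ≤ X ^ suc q → B ≤ Y ^ suc q → E ≤ Z ^ suc q → M ≤ C * (X * Y * Z)
    product-power-≥ q M C A B E X Y Z 0≤M 0≤C 0≤A 0≤B 0≤X 0≤Y 0≤Z h hA hB hE =
      ^-cancel q (*-nonneg 0≤C (*-nonneg (*-nonneg 0≤X 0≤Y) 0≤Z)) 0≤M (≤-trans h (≤-respʳ-≈ (R.sym distrib)
        (*-monoʳ (0≤^ (suc q) 0≤C) (*-mono (*-nonneg 0≤A 0≤B) (*-mono 0≤A hA (0≤^ (suc q) 0≤Y) hB) (0≤^ (suc q) 0≤Z) hE))))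
      where
      distrib : (C * (X * Y * Z)) ^ suc q R.≈ C ^ suc q * (X ^ suc q * Y ^ suc q * Z ^ suc q)
      distrib = R.trans (^-distrib-* C (X * Y * Z) (suc q)) (R.*-congˡ (R.trans (^-distrib-* (X * Y) Z (suc q)) (R.*-congʳ (^-distrib-* X Y (suc q)))))

    fromℕ-product : ∀ C a b c → fromℕ (C ℕ.* (a ℕ.* b ℕ.* c)) R.≈ fromℕ C * (fromℕ a * fromℕ b * fromℕ c)
    fromℕ-product C a b c = R.trans (fromℕ-* C (a ℕ.* b ℕ.* c)) (R.*-congˡ (R.trans (fromℕ-* (a ℕ.* b) c) (R.*-congʳ (fromℕ-* a b))))

  -- Walks, paths and stretched distances

  infixr 5 _∷_
  data Walk {n} (X : Graph n) : Fin n → Fin n → Set where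
    []  : ∀ {u} → Walk X u u
    _∷_ : ∀ {u x v} → Adj X u x → Walk X x v → Walk X u v

  _++ʷ_ : ∀ {n} {X : Graph n} {u v w} → Walk X u v → Walk X v w → Walk X u w
  []      ++ʷ q = q
  (e ∷ p) ++ʷ q = e ∷ (p ++ʷ q)

  lookup-injective : {A : Set} {xs : List A} → Unique xs → ∀ i j → lookup xs i ≡ lookup xs j → i ≡ j
  lookup-injective (x≢ ∷ u) Fin.zero    Fin.zero    eq = refl
  lookup-injective (x≢ ∷ u) Fin.zero    (Fin.suc j) eq = ⊥-elim (All.lookup x≢ (∈-lookup j) eq)
  lookup-injective (x≢ ∷ u) (Fin.suc i) Fin.zero    eq = ⊥-elim (All.lookup x≢ (∈-lookup i) (sym eq))
  lookup-injective (x≢ ∷ u) (Fin.suc i) (Fin.suc j) eq = cong Fin.suc (lookup-injective u i j eq)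

  unique-length : ∀ {n} (p : List (Fin n)) → Unique p → length p ℕ.≤ n
  unique-length p u = Fin.injective⇒≤ {f = lookup p} (λ {i} {j} → lookup-injective u i j)

  ∈-nodeLists : ∀ {n} m (p : List (Fin n)) → length p ℕ.≤ m → p ∈ nodeListsUpTo m
  ∈-nodeLists zero    []      h       = here refl
  ∈-nodeLists (suc m) []      h       = here refl
  ∈-nodeLists (suc m) (x ∷ p) (s≤s h) = there (∈-concatMap⁺ (λ x → map (x ∷_) (nodeListsUpTo m))
    (Any.map (λ { refl → ∈-map⁺ (x ∷_) (∈-nodeLists m p h) }) (∈-allFin x)))

  ∈-paths : ∀ {n} (X : Graph n) u v {p} → IsPath X u v p → p ∈ paths X u v
  ∈-paths {n} X u v {p} ip = ∈-filter⁺ (isPath? X u v) (∈-nodeLists n p (unique-length p (IsPath.unique ip))) ip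

  paths-∈ : ∀ {n} (X : Graph n) u v {p} → p ∈ paths X u v → IsPath X u v p
  paths-∈ {n} X u v p∈ = proj₂ (∈-filter⁻ (isPath? X u v) {xs = nodeListsUpTo n} p∈)

  module Stretch (ℝ : Reals) where
    open Reals ℝ
    open OverReals ℝ
    open RealProperties ℝ
    private
      module R = CommutativeRing commutativeRing
      module O = DecTotalOrder decTotalOrder

    module _ {n} (w : Fin n → Fin n → Carrier) where

      cost : ∀ {X : Graph n} {u v} → Walk X u v → Carrier
      cost []                        = 0#
      cost (_∷_ {u} {x} e p) = w u x + cost p

      cost-++ : ∀ {X : Graph n} {u v y} (p : Walk X u v) (q : Walk X v y) → cost (p ++ʷ q) R.≈ cost p + cost q
      cost-++ []                q = R.sym (R.+-identityˡ _)
      cost-++ (_∷_ {u} {x} e p) q = R.trans (R.+-congˡ (cost-++ p q)) (R.sym (R.+-assoc (w u x) _ _))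

      module _ (X : Graph n) (w≥0 : ∀ u v → Adj X u v → 0# ≤ w u v) where

        suffix : ∀ {u x v} (p : List (Fin n)) → IsPath X x v p → u ∈ p →
          ∃ λ q → IsPath X u v q × pathLength w q ≤ pathLength w p
        suffix (y ∷ p) ip (here refl) = y ∷ p , isPath refl (IsPath.ends ip) (IsPath.linked ip) (IsPath.unique ip) , ≤-refl
        suffix (y ∷ z ∷ p) (isPath s e (a ∷ l) (_ ∷ un)) (there u∈) with suffix (z ∷ p) (isPath refl e l un) u∈
        ... | q , iq , le = q , iq , ≤-trans le (≤-respˡ-≈ (R.+-identityˡ _) (+-mono (w≥0 y z a) ≤-refl))

        -- If the new first node already lies on the path built so far, the path is cut back to
        -- start there; lengths being nonnegative, this does not make it longer.
        simplify : ∀ {u v} (p : Walk X u v) → ∃ λ q → IsPath X u v q × pathLength w q ≤ cost p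
        simplify {u} [] = u ∷ [] , isPath refl refl [-] ([] ∷ []) , ≤-refl
        simplify {u} {v} (_∷_ {x = x} e p) with simplify p
        ... | q , iq , le with Membership._∈?_ Fin._≟_ u q
        ...   | yes u∈ = let (q′ , iq′ , le′) = suffix q iq u∈ in
                q′ , iq′ , ≤-trans le′ (≤-trans le (≤-respˡ-≈ (R.+-identityˡ _) (+-mono (w≥0 u x e) ≤-refl)))
        simplify {u} {v} (_∷_ {x = x} e p) | (y ∷ q) , isPath refl en l un , le | no u∉ =
          u ∷ y ∷ q , isPath refl en (e ∷ l) (All.¬Any⇒All¬ _ u∉ ∷ un) , +-mono ≤-refl le

        dist-≤ : ∀ {u v} (p : Walk X u v) → dist w X u v ≤⁺ fin (cost p)
        dist-≤ {u} {v} p with simplify p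
        ... | q , iq , le = TotalOrder.trans totalOrder⁺
          (All.lookup (Extrema.min≤xs totalOrder⁺ ⊤⁺ (map (λ p → fin (pathLength w p)) (paths X u v)))
            (∈-map⁺ (λ p → fin (pathLength w p)) (∈-paths X u v iq))) NonStrict⁺.[ le ]

      path-walk : ∀ {X : Graph n} {u v} p → IsPath X u v p → Σ (Walk X u v) λ q → cost q ≡ pathLength w p
      path-walk (u ∷ [])    (isPath refl refl l un)            = [] , refl
      path-walk (u ∷ x ∷ p) (isPath refl e (a ∷ l) (_ ∷ un)) with path-walk (x ∷ p) (isPath refl e l un)
      ... | q , eq = a ∷ q , cong (w u x +_) eq

      module _ (G H : Graph n) (wH : ∀ u v → Adj H u v → 0# ≤ w u v) (t : Carrier)
               (edge : ∀ u v → Adj G u v → Σ (Walk H u v) λ q → cost q ≤ t * w u v) where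

        stretch-walk : ∀ {u v} (p : Walk G u v) → Σ (Walk H u v) λ q → cost q ≤ t * cost p
        stretch-walk [] = [] , ≤-reflexive (R.sym (R.zeroʳ t))
        stretch-walk (_∷_ {u} {x} e p) with edge u x e | stretch-walk p
        ... | q , le | q′ , le′ = q ++ʷ q′ , ≤-respˡ-≈ (R.sym (cost-++ q q′)) (≤-respʳ-≈ (R.sym (R.distribˡ t (w u x) (cost p))) (+-mono le le′))

        -- It suffices to stretch single edges, because detours can be concatenated along a shortest
        -- path.
        stretch : ∀ u v → dist w H u v ≤⁺ t *⁺ dist w G u v
        stretch u v with Extrema.argmin-sel totalOrder⁺ (λ x → x) ⊤⁺ (map (λ p → fin (pathLength w p)) (paths G u v))
        -- The minimum is its default `⊤⁺`, which bounds everything.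
        ... | inj₁ eq = subst (λ d → dist w H u v ≤⁺ t *⁺ d) (sym eq) (_ NonStrict⁺.≤⊤⁺)
        ... | inj₂ d∈ with ∈-map⁻ (λ p → fin (pathLength w p)) d∈
        ...   | p , p∈ , eq with path-walk p (paths-∈ G u v p∈)
        ...     | q , cq with stretch-walk q
        ...       | q′ , le = subst (λ d → dist w H u v ≤⁺ t *⁺ d) (sym eq)
                    (TotalOrder.trans totalOrder⁺ (dist-≤ H wH q′) NonStrict⁺.[ subst (λ c → cost q′ ≤ t * c) cq le ])

-- Polynomial time bounds and a logic for programs

module Algorithm where
  open import Data.Nat.Base hiding (parity)
  open import Data.Nat.Properties
  open Sums
  open EdgeBound
  open Distances

  infixl 6 _⊞_
  infixl 7 _⊠_
  -- Syntax for running times: such bounds compose along programs, are monotone, and lie below a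
  -- single monomial.
  data Poly : Set where
    con     : ℕ → Poly
    var     : Poly
    _⊞_ _⊠_ : Poly → Poly → Poly

  eval : Poly → ℕ → ℕ
  eval (con c) z = c
  eval var     z = z
  eval (p ⊞ q) z = eval p z + eval q z
  eval (p ⊠ q) z = eval p z * eval q z

  poly-bound : ∀ p → Σ ℕ λ c → Σ ℕ λ d → ∀ z → 1 ≤ z → eval p z ≤ c * z ^ d
  poly-bound (con c) = c , 0 , λ z _ → ≤-reflexive (sym (*-identityʳ c))
  poly-bound var     = 1 , 1 , λ z _ → ≤-reflexive (sym (trans (+-identityʳ _) (*-identityʳ z)))
  poly-bound (p ⊞ q) with poly-bound p | poly-bound q
  ... | c , d , h | c′ , d′ , h′ = c + c′ , d + d′ , λ z 1≤z → ≤-trans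
    (+-mono-≤ (≤-trans (h z 1≤z) (*-monoʳ-≤ c (^-monoʳ-≤ z {{>-nonZero 1≤z}} (m≤m+n d d′))))
              (≤-trans (h′ z 1≤z) (*-monoʳ-≤ c′ (^-monoʳ-≤ z {{>-nonZero 1≤z}} (m≤n+m d′ d)))))
    (≤-reflexive (sym (*-distribʳ-+ (z ^ (d + d′)) c c′)))
  poly-bound (p ⊠ q) with poly-bound p | poly-bound q
  ... | c , d , h | c′ , d′ , h′ = c * c′ , d + d′ , λ z 1≤z → ≤-trans (*-mono-≤ (h z 1≤z) (h′ z 1≤z))
    (≤-reflexive (trans (lem c (z ^ d) c′ (z ^ d′)) (cong (c * c′ *_) (sym (^-distribˡ-+-* z d d′)))))
    where
    lem : ∀ a b c d → a * b * (c * d) ≡ a * c * (b * d)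
    lem = solve-∀

  -- A loop costs one unit each for the initialisation and the last test, and two per pass for the
  -- test and the counter.
  repeated : Poly → Poly → Poly
  repeated b t = con 2 ⊞ b ⊠ (t ⊞ con 2)

  cell : ℕ → Expr
  cell c = c [ lit 0 , lit 0 ]

  infix 2 _≔_
  _≔_ : ℕ → Expr → Program
  c ≔ e = c [ lit 0 , lit 0 ]:= e

  for_below_run_ : ℕ → Expr → Program → Program
  for c below e run P = (c ≔ lit 0) ⨾ (while (cell c ⊕ lit 1) ≤ⁿ e loop (P ⨾ (c ≔ cell c ⊕ lit 1)))

  T⇒true : ∀ {b} → T b → b ≡ true
  T⇒true {true} _ = refl

  ¬T⇒false : ∀ {b} → ¬ T b → b ≡ false
  ¬T⇒false {true}  h = ⊥-elim (h tt)
  ¬T⇒false {false} h = refl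

  ≡ᵇ-refl : ∀ a → (a ≡ᵇ a) ≡ true
  ≡ᵇ-refl a = T⇒true (≡⇒≡ᵇ a a refl)

  ≡ᵇ-≢ : ∀ {a b} → ¬ a ≡ b → (a ≡ᵇ b) ≡ false
  ≡ᵇ-≢ {a} {b} h = ¬T⇒false λ t → h (≡ᵇ⇒≡ a b t)

  write-same : ∀ {A : Set} (M : Memory A) a i j x → write M a i j x a i j ≡ x
  write-same M a i j x rewrite ≡ᵇ-refl a | ≡ᵇ-refl i | ≡ᵇ-refl j = refl

  write-array : ∀ {A : Set} (M : Memory A) a i j x a′ i′ j′ → ¬ a ≡ a′ → write M a i j x a′ i′ j′ ≡ M a′ i′ j′
  write-array M a i j x a′ i′ j′ h rewrite ≡ᵇ-≢ {a} {a′} h = refl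

  write-entry : ∀ {A : Set} (M : Memory A) a i j x i′ j′ → ¬ (i ≡ i′ × j ≡ j′) → write M a i j x a i′ j′ ≡ M a i′ j′
  write-entry M a i j x i′ j′ h with i ≟ i′
  ... | no i≢ rewrite ≡ᵇ-≢ {i} {i′} i≢ | ∧-zeroʳ (a ≡ᵇ a) = refl
  ... | yes i≡ rewrite ≡ᵇ-≢ {j} {j′} (λ j≡ → h (i≡ , j≡)) | ∧-zeroʳ (i ≡ᵇ i′) | ∧-zeroʳ (a ≡ᵇ a) = refl

  module Logic (ℝ : Reals) where
    open Reals ℝ using (Carrier)
    open OverReals ℝ

    put : ℕ → ℕ → ℕ → ℕ → State → State
    put a i j x s = state (write (nat s) a i j x) (real s)

    Run : Program → State → ℕ → (State → Set) → Set
    Run P s t Q = Σ State λ s′ → Σ ℕ λ τ → ⟨ P , s ⟩⇓⟨ s′ , τ ⟩ × τ ≤ t × Q s′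

    run-skip : ∀ {s Q} → Q s → Run skip s 0 Q
    run-skip q = _ , 0 , skip , z≤n , q

    run-put : ∀ {s a i j e Q} → Q (put a (⟦ i ⟧ s) (⟦ j ⟧ s) (⟦ e ⟧ s) s) → Run (a [ i , j ]:= e) s 1 Q
    run-put q = _ , 1 , assign , ≤-refl , q

    run-seq : ∀ {P P′ s t t′ Q} → Run P s t (λ s′ → Run P′ s′ t′ Q) → Run (P ⨾ P′) s (t + t′) Q
    run-seq (s₁ , τ , d , τ≤ , (s₂ , τ′ , d′ , τ′≤ , q)) = s₂ , τ + τ′ , seq d d′ , +-mono-≤ τ≤ τ′≤ , q

    run-if : ∀ {b P P′ s t t′ Q} → (⟦ b ⟧ᵗ s ≡ true → Run P s t Q) → (⟦ b ⟧ᵗ s ≡ false → Run P′ s t′ Q) →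
      Run (if b then P else′ P′) s (1 + t + t′) Q
    run-if {b} {s = s} {t} {t′} h h′ with ⟦ b ⟧ᵗ s in eq
    ... | true  = let (s₁ , τ , d , τ≤ , q) = h refl in s₁ , suc τ , if-true eq d , s≤s (≤-trans τ≤ (m≤m+n t t′)) , q
    ... | false = let (s₁ , τ , d , τ≤ , q) = h′ refl in s₁ , suc τ , if-false eq d , s≤s (≤-trans τ≤ (m≤n+m t′ t)) , q

    run-map : ∀ {P s t Q Q′} → (∀ s′ → Q s′ → Q′ s′) → Run P s t Q → Run P s t Q′
    run-map h (s₁ , τ , d , τ≤ , q) = s₁ , τ , d , τ≤ , h s₁ q

    run-time : ∀ {P s t t′ Q} → t ≤ t′ → Run P s t Q → Run P s t′ Q
    run-time h (s₁ , τ , d , τ≤ , q) = s₁ , τ , d , ≤-trans τ≤ h , q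

    -- Loops whose invariant does not look at the loop counter.
    module _ (c : ℕ) (e : Expr) (P : Program) (b t : ℕ) (Inv : ℕ → State → Set)
      (stable : ∀ j s x → Inv j s → Inv j (put c 0 0 x s))
      (bound  : ∀ j s → Inv j s → ⟦ e ⟧ s ≡ b)
      (step   : ∀ j s → j < b → Inv j s → nat s c 0 0 ≡ j →
                Run P s t (λ s′ → nat s′ c 0 0 ≡ j × Inv (suc j) s′)) where

      private
        body : Program
        body = P ⨾ (c ≔ cell c ⊕ lit 1)

        go : ∀ r j s → j + r ≡ b → Inv j s → nat s c 0 0 ≡ j →
          Run (while (cell c ⊕ lit 1) ≤ⁿ e loop body) s (r * (t + 2) + 1) (Inv b)
        go zero j s eq inv ctr = s , 1 , while-false (¬T⇒false not-below) , ≤-refl , subst (λ i → Inv i s) j≡b inv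
          where
          j≡b : j ≡ b
          j≡b = trans (sym (+-identityʳ j)) eq
          not-below : ¬ T (nat s c 0 0 + 1 ≤ᵇ ⟦ e ⟧ s)
          not-below h = <-irrefl refl (subst₂ _≤_ (trans (+-comm _ 1) (cong suc (trans ctr j≡b))) (bound j s inv) (≤ᵇ⇒≤ _ _ h))
        go (suc r) j s eq inv ctr with step j s j<b inv ctr
          where
          j<b : j < b
          j<b = ≤-trans (m≤m+n (suc j) r) (≤-reflexive (trans (sym (+-suc j r)) eq))
        ... | s₁ , τ , d , τ≤ , ctr₁ , inv₁ with go r (suc j) (put c 0 0 (nat s₁ c 0 0 + 1) s₁) (trans (sym (+-suc j r)) eq) (stable (suc j) s₁ _ inv₁)
                (trans (write-same (nat s₁) c 0 0 _) (trans (+-comm _ 1) (cong suc ctr₁)))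
        ...   | s₂ , τ₂ , d₂ , τ₂≤ , inv₂ = s₂ , suc ((τ + 1) + τ₂) , while-true (T⇒true below) (seq d assign) d₂ , time , inv₂
          where
          below : T (nat s c 0 0 + 1 ≤ᵇ ⟦ e ⟧ s)
          below = ≤⇒≤ᵇ (≤-trans (≤-reflexive (trans (+-comm _ 1) (cong suc ctr)))
            (≤-trans (m≤m+n (suc j) r) (≤-reflexive (trans (trans (sym (+-suc j r)) eq) (sym (bound j s inv))))))
          time : suc ((τ + 1) + τ₂) ≤ suc r * (t + 2) + 1
          time = ≤-trans (s≤s (+-mono-≤ (+-monoˡ-≤ 1 τ≤) τ₂≤)) (≤-reflexive (lem t (r * (t + 2))))
            where
            lem : ∀ t x → suc ((t + 1) + (x + 1)) ≡ t + 2 + x + 1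
            lem = solve-∀

      -- Passes are charged at an upper bound `b̂` of their number, so that loops up to `f` or
      -- `2k - 1` get times in terms of `n`.
      run-for : ∀ s b̂ → b ≤ b̂ → Inv 0 s → Run (for c below e run P) s (2 + b̂ * (t + 2)) (Inv b)
      run-for s b̂ b≤ inv = run-time (≤-trans (≤-reflexive (cong suc (+-comm (b * (t + 2)) 1))) (+-monoʳ-≤ 2 (*-monoˡ-≤ (t + 2) b≤)))
        (run-seq (run-put (go b 0 _ refl (stable 0 s 0 inv) (write-same (nat s) c 0 0 0))))

    -- Inner subprograms use arrays of higher number, so one threshold describes what a subprogram
    -- leaves alone. The real memory is never changed.
    Frame : ℕ → State → State → Set
    Frame L s s′ = (∀ a i j → a < L → nat s′ a i j ≡ nat s a i j) × real s′ ≡ real s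

    frame-refl : ∀ {L s} → Frame L s s
    frame-refl = (λ _ _ _ _ → refl) , refl

    frame-trans : ∀ {L s s′ s″} → Frame L s s′ → Frame L s′ s″ → Frame L s s″
    frame-trans (h , r) (h′ , r′) = (λ a i j lt → trans (h′ a i j lt) (h a i j lt)) , trans r′ r

    frame-weaken : ∀ {L L′ s s′} → L′ ≤ L → Frame L s s′ → Frame L′ s s′
    frame-weaken le (h , r) = (λ a i j lt → h a i j (≤-trans lt le)) , r

    frame-put : ∀ {L s s′} a i j x → {T (L ≤ᵇ a)} → Frame L s s′ → Frame L s (put a i j x s′)
    frame-put {L} {s} {s′} a i j x {p} (h , r) = (λ a′ i′ j′ lt → trans (write-array (nat s′) a i j x a′ i′ j′ (λ { refl → <⇒≱ lt (≤ᵇ⇒≤ L a p) })) (h a′ i′ j′ lt)) , r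

    -- Reads an unchanged array, the comparison being checked by evaluation.
    frame : ∀ {L s s′} → Frame L s s′ → ∀ a i j → {T (a <ᵇ L)} → nat s′ a i j ≡ nat s a i j
    frame {L} (h , _) a i j {p} = h a i j (<ᵇ⇒< a L p)

    module _ (n c c′ : ℕ) (c≢c′ : ¬ c ≡ c′) (e : Expr) (P : Program) (t : ℕ) (Inv : ℕ → State → Set)
      (stable  : ∀ r s x → Inv r s → Inv r (put c 0 0 x s))
      (stable′ : ∀ r s x → Inv r s → Inv r (put c′ 0 0 x s))
      (bound   : ∀ r s → Inv r s → ⟦ e ⟧ s ≡ n)
      (step    : ∀ (a b : Fin n) s → Inv (toℕ (combine a b)) s → nat s c 0 0 ≡ toℕ a → nat s c′ 0 0 ≡ toℕ b →
                 Run P s t (λ s′ → nat s′ c 0 0 ≡ toℕ a × nat s′ c′ 0 0 ≡ toℕ b × Inv (suc (toℕ (combine a b))) s′)) where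

      -- Numbering the pairs by `combine` gives two nested loops an invariant with a single counter.
      run-pairs : ∀ s → Inv 0 s → Run (for c below e run (for c′ below e run P)) s (2 + n * ((2 + n * (t + 2)) + 2)) (Inv (n * n))
      run-pairs s inv = run-for c e _ n _ (λ i → Inv (n * i)) (λ i → stable (n * i)) (λ i → bound (n * i)) outer s n ≤-refl (subst (λ r → Inv r s) (sym (*-zeroʳ n)) inv)
        where
        outer : ∀ i s → i < n → Inv (n * i) s → nat s c 0 0 ≡ i →
          Run (for c′ below e run P) s (2 + n * (t + 2)) (λ s′ → nat s′ c 0 0 ≡ i × Inv (n * suc i) s′)
        outer i s i<n inv ctr = run-map (λ s′ (ctr , inv) → ctr , subst (λ r → Inv r s′) (trans (+-comm (n * i) n) (sym (*-suc n i))) inv)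
          (run-for c′ e P n t (λ j s → nat s c 0 0 ≡ i × Inv (n * i + j) s)
            (λ j s x (ctr , inv) → trans (write-array (nat s) c′ 0 0 x c 0 0 (λ eq → c≢c′ (sym eq))) ctr , stable′ _ s x inv)
            (λ j s (ctr , inv) → bound _ s inv)
            inner s n ≤-refl (ctr , subst (λ r → Inv r s) (sym (+-identityʳ (n * i))) inv))
          where
          a = fromℕ< i<n
          inner : ∀ j s → j < n → nat s c 0 0 ≡ i × Inv (n * i + j) s → nat s c′ 0 0 ≡ j →
            Run P s t (λ s′ → nat s′ c′ 0 0 ≡ j × nat s′ c 0 0 ≡ i × Inv (n * i + suc j) s′)
          inner j s j<n (ctr , inv) ctr′ = run-map
            (λ s′ (h , h′ , inv′) → trans h′ (Fin.toℕ-fromℕ< j<n) , trans h (Fin.toℕ-fromℕ< i<n) , subst (λ r → Inv r s′) (trans (cong suc index) (sym (+-suc (n * i) j))) inv′)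
            (step a b s (subst (λ r → Inv r s) (sym index) inv) (trans ctr (sym (Fin.toℕ-fromℕ< i<n))) (trans ctr′ (sym (Fin.toℕ-fromℕ< j<n))))
            where
            b = fromℕ< j<n
            index : toℕ (combine a b) ≡ n * i + j
            index = trans (Fin.toℕ-combine a b) (cong₂ (λ x y → n * x + y) (Fin.toℕ-fromℕ< i<n) (Fin.toℕ-fromℕ< j<n))

  -- Sums over ordered pairs of nodes

  total-δ : ∀ {n} (p c : Fin n) (x : ℕ) → total (λ a b → 𝟙 (p Fin.≟ a) * (𝟙 (c Fin.≟ b) * x)) ≡ x
  total-δ {n} p c x = trans (∑-cong (allFin n) (λ a → ∑-*ˡ (𝟙 (p Fin.≟ a)) (allFin n)))
    (trans (∑-δ p (λ _ → ∑ (allFin n) (λ b → 𝟙 (c Fin.≟ b) * x))) (∑-δ c (λ _ → x)))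

  total-+ : ∀ {n} (f g : Fin n → Fin n → ℕ) → total (λ a b → f a b + g a b) ≡ total f + total g
  total-+ {n} f g = trans (∑-cong (allFin n) (λ a → ∑-+ (allFin n))) (∑-+ (allFin n))

  total-cong : ∀ {n} {f g : Fin n → Fin n → ℕ} → (∀ a b → f a b ≡ g a b) → total f ≡ total g
  total-cong {n} h = ∑-cong (allFin n) (λ a → ∑-cong (allFin n) (h a))

  total-one : ∀ n → total {n} (λ a b → 1) ≡ n * n
  total-one n = trans (∑-cong (allFin n) (λ a → ∑-const 1 (allFin n))) (trans (∑-const (length (allFin n) * 1) (allFin n))
    (cong₂ _*_ (length-tabulate (λ (i : Fin n) → i)) (trans (*-identityʳ _) (length-tabulate (λ (i : Fin n) → i)))))

  total-∈ : ∀ {n} (f : Fin n → Fin n → ℕ) a b → f a b ≤ total f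
  total-∈ {n} f a b = ≤-trans (∑-∈ (f a) (∈-allFin b))
    (∑-∈ (λ a → ∑ (allFin n) (f a)) (∈-allFin a))

  -- Written without differences, as subtraction of naturals truncates.
  total-update : ∀ {n} (f g : Fin n → Fin n → ℕ) p c → (∀ a b → ¬ (a ≡ p × b ≡ c) → g a b ≡ f a b) →
    total g + f p c ≡ total f + g p c
  total-update f g p c h = begin
    total g + f p c                          ≡⟨ cong (total g +_) (sym (total-δ p c (f p c))) ⟩
    total g + total (at (f p c))             ≡⟨ sym (total-+ g (at (f p c))) ⟩
    total (λ a b → g a b + at (f p c) a b)   ≡⟨ total-cong pointwise ⟩
    total (λ a b → f a b + at (g p c) a b)   ≡⟨ total-+ f (at (g p c)) ⟩
    total f + total (at (g p c))             ≡⟨ cong (total f +_) (total-δ p c (g p c)) ⟩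
    total f + g p c                          ∎
    where
    open ≡-Reasoning
    at : ℕ → _ → _ → ℕ
    at x a b = 𝟙 (p Fin.≟ a) * (𝟙 (c Fin.≟ b) * x)
    at-yes : ∀ x → at x p c ≡ x
    at-yes x = trans (cong₂ (λ i j → i * (j * x)) (𝟙-yes (p Fin.≟ p) refl) (𝟙-yes (c Fin.≟ c) refl)) (trans (+-identityʳ _) (+-identityʳ x))
    at-no : ∀ x a b → ¬ (a ≡ p × b ≡ c) → at x a b ≡ 0
    at-no x a b h with p Fin.≟ a
    ... | no _ = refl
    ... | yes refl = trans (+-identityʳ _) (cong (_* x) (𝟙-no (c Fin.≟ b) (λ { refl → h (refl , refl) })))
    pointwise : ∀ a b → g a b + at (f p c) a b ≡ f a b + at (g p c) a b
    pointwise a b with (a Fin.≟ p) ×-dec (b Fin.≟ c)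
    ... | yes (refl , refl) = trans (cong (g p c +_) (at-yes (f p c))) (trans (+-comm (g p c) (f p c)) (cong (f p c +_) (sym (at-yes (g p c)))))
    ... | no ¬eq = cong₂ _+_ (h a b ¬eq) (trans (at-no (f p c) a b ¬eq) (sym (at-no (g p c) a b ¬eq)))

  combine-≢ : ∀ {n} {a b p c : Fin n} → ¬ (a ≡ p × b ≡ c) → ¬ toℕ (combine a b) ≡ toℕ (combine p c)
  combine-≢ {a = a} {b} {p} {c} h eq = h (Fin.combine-injective a b p c (Fin.toℕ-injective eq))

  toℕ-≢ : ∀ {n} {a b p c : Fin n} → ¬ (a ≡ p × b ≡ c) → ¬ (toℕ p ≡ toℕ a × toℕ c ≡ toℕ b)
  toℕ-≢ h (e , e′) = h (Fin.toℕ-injective (sym e) , Fin.toℕ-injective (sym e′))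

  <-suc-≢ : ∀ {i j} → i < suc j → ¬ i ≡ j → i < j
  <-suc-≢ (s≤s i≤j) i≢j = ≤∧≢⇒< i≤j i≢j

  -- One round of the search for a light walk.  Array 18 holds the current
  -- edge weights, 19 a copy of them, 20 their sum; row h of array 23 holds
  -- the least weights of walks from u with at most h hops (capped by the
  -- sum) and row h of array 24 the last but one nodes of such walks.

  N F Kexp : Expr
  N    = cell 0
  F    = cell 1
  Kexp = (cell 2 ⊕ cell 2) ⊖ lit 1

  sumP initP relaxP rowP dpP : Program
  sumP = (20 ≔ lit 0) ⨾ for 21 below N run (for 22 below N run
    ((19 [ cell 21 , cell 22 ]:= 18 [ cell 21 , cell 22 ]) ⨾ (20 ≔ cell 20 ⊕ (18 [ cell 21 , cell 22 ]))))

  initP = (for 26 below N run (23 [ lit 0 , cell 26 ]:= cell 20)) ⨾ (23 [ lit 0 , cell 9 ]:= lit 0)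

  relaxP = if (lit 1 ≤ⁿ (4 [ cell 27 , cell 26 ])) & ((((23 [ cell 25 , cell 27 ]) ⊕ (19 [ cell 27 , cell 26 ])) ⊕ lit 1) ≤ⁿ (23 [ cell 25 ⊕ lit 1 , cell 26 ]))
    then (23 [ cell 25 ⊕ lit 1 , cell 26 ]:= (23 [ cell 25 , cell 27 ]) ⊕ (19 [ cell 27 , cell 26 ])) ⨾ (24 [ cell 25 ⊕ lit 1 , cell 26 ]:= cell 27)
    else′ skip

  rowP = (23 [ cell 25 ⊕ lit 1 , cell 26 ]:= 23 [ cell 25 , cell 26 ]) ⨾ (24 [ cell 25 ⊕ lit 1 , cell 26 ]:= cell 26) ⨾
    for 27 below N run relaxP

  dpP = for 25 below Kexp run (for 26 below N run rowP)

  pairs : Poly → Poly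
  pairs t = repeated var (repeated var t)

  sumT initT relaxT rowT dpT : Poly
  sumT   = con 1 ⊞ pairs (con 2)
  initT  = repeated var (con 1) ⊞ con 1
  relaxT = con 3
  rowT   = con 1 ⊞ (con 1 ⊞ repeated var relaxT)
  dpT    = repeated (con 2 ⊠ var) (repeated var rowT)

  module Round (ℝ : Reals) {n f k : ℕ} (H : Fin n → Fin n → Bool) (u v : Fin n) (f≤n : f ≤ n) (k≤n : k ≤ n) where
    open Reals ℝ using (Carrier)
    open OverReals ℝ
    open Logic ℝ

    K̂ : ℕ
    K̂ = k + k ∸ 1

    record Ctx (s : State) : Set where
      field
        n≡ : nat s 0 0 0 ≡ n
        f≡ : nat s 1 0 0 ≡ f
        k≡ : nat s 2 0 0 ≡ k
        H≡ : ∀ a b → nat s 4 (toℕ a) (toℕ b) ≡ bit (H a b)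
        u≡ : nat s 9 0 0 ≡ toℕ u
        v≡ : nat s 10 0 0 ≡ toℕ v
    open Ctx

    ctx-frame : ∀ {L s s′} → {T (11 ≤ᵇ L)} → Frame L s s′ → Ctx s → Ctx s′
    ctx-frame {L} {s} {s′} {p} fr c = record
      { n≡ = trans (fr′ 0 0 0) (n≡ c) ; f≡ = trans (fr′ 1 0 0) (f≡ c) ; k≡ = trans (fr′ 2 0 0) (k≡ c)
      ; H≡ = λ a b → trans (fr′ 4 (toℕ a) (toℕ b)) (H≡ c a b) ; u≡ = trans (fr′ 9 0 0) (u≡ c) ; v≡ = trans (fr′ 10 0 0) (v≡ c) }
      where
      fr′ : ∀ a i j → {T (a <ᵇ 11)} → nat s′ a i j ≡ nat s a i j
      fr′ a i j {q} = frame {11} {s} {s′} (frame-weaken (≤ᵇ⇒≤ 11 L p) fr) a i j {q}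

    view : ℕ → State → Fin n → Fin n → ℕ
    view m s a b = nat s m (toℕ a) (toℕ b)

    run-sum : ∀ s → Ctx s → Run sumP s (eval sumT n) λ s′ →
      Frame 19 s s′ × (∀ a b → view 19 s′ a b ≡ view 18 s a b) × nat s′ 20 0 0 ≡ total (view 18 s)
    run-sum s₀ ctx = run-seq (run-put (run-map finish (run-pairs n 21 22 (λ ()) N _ 2 Inv
        (λ r s x (fr , cp , su) → frame-put 21 0 0 x fr , cp , su)
        (λ r s x (fr , cp , su) → frame-put 22 0 0 x fr , cp , su)
        (λ r s (fr , _) → trans (frame fr 0 0 0) (n≡ ctx))
        step _ (frame-put 20 0 0 0 frame-refl , (λ a b ()) , sym start))))
      where
      Y : Fin n → Fin n → ℕ
      Y = view 18 s₀
      part : ℕ → Fin n → Fin n → ℕ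
      part r a b = bit (toℕ (combine a b) <ᵇ r) * Y a b
      Inv : ℕ → State → Set
      Inv r s = Frame 19 s₀ s × (∀ a b → toℕ (combine a b) < r → view 19 s a b ≡ Y a b) × nat s 20 0 0 ≡ total (part r)
      start : total (part 0) ≡ 0
      start = trans (∑-cong (allFin n) (λ a → ∑-zero (allFin n))) (∑-zero (allFin n))
      part-suc : ∀ p c → total (part (suc (toℕ (combine p c)))) ≡ total (part (toℕ (combine p c))) + Y p c
      part-suc p c = begin
        total (part (suc r))                 ≡⟨ sym (+-identityʳ _) ⟩
        total (part (suc r)) + 0             ≡⟨ cong (total (part (suc r)) +_) (sym (cong (_* Y p c) (bit-F {r <ᵇ r} (λ t → <-irrefl refl (<ᵇ⇒< r r t))))) ⟩
        total (part (suc r)) + part r p c    ≡⟨ total-update (part r) (part (suc r)) p c same ⟩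
        total (part r) + part (suc r) p c    ≡⟨ cong (total (part r) +_) (trans (cong (_* Y p c) (bit-T (<⇒<ᵇ (≤-refl {suc r})))) (+-identityʳ _)) ⟩
        total (part r) + Y p c               ∎
        where
        open ≡-Reasoning
        r = toℕ (combine p c)
        same : ∀ a b → ¬ (a ≡ p × b ≡ c) → part (suc r) a b ≡ part r a b
        same a b h = cong (_* Y a b) (bit-cong {toℕ (combine a b) <ᵇ suc r} {toℕ (combine a b) <ᵇ r}
          (λ t → <⇒<ᵇ (<-suc-≢ (<ᵇ⇒< (toℕ (combine a b)) (suc r) t) (combine-≢ h))) (λ t → <⇒<ᵇ (m<n⇒m<1+n (<ᵇ⇒< (toℕ (combine a b)) r t))))
      step : ∀ a b s → Inv (toℕ (combine a b)) s → nat s 21 0 0 ≡ toℕ a → nat s 22 0 0 ≡ toℕ b →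
        Run _ s 2 λ s′ → nat s′ 21 0 0 ≡ toℕ a × nat s′ 22 0 0 ≡ toℕ b × Inv (suc (toℕ (combine a b))) s′
      step p c s (fr , cp , su) i≡ j≡ = run-seq (run-put (run-put (i≡ , j≡ ,
          frame-put 20 0 0 (nat s 20 0 0 + write (nat s) 19 (nat s 21 0 0) (nat s 22 0 0) (nat s 18 (nat s 21 0 0) (nat s 22 0 0)) 18 (nat s 21 0 0) (nat s 22 0 0)) (frame-put 19 (nat s 21 0 0) (nat s 22 0 0) (nat s 18 (nat s 21 0 0) (nat s 22 0 0)) fr) , copied , trans (cong₂ _+_ su val) (sym (part-suc p c)))))
        where
        val : nat s 18 (nat s 21 0 0) (nat s 22 0 0) ≡ Y p c
        val = trans (cong₂ (nat s 18) i≡ j≡) (frame fr 18 (toℕ p) (toℕ c))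
        copied : ∀ a b → toℕ (combine a b) < suc (toℕ (combine p c)) →
          write (nat s) 19 (nat s 21 0 0) (nat s 22 0 0) (nat s 18 (nat s 21 0 0) (nat s 22 0 0)) 19 (toℕ a) (toℕ b) ≡ Y a b
        copied a b lt with (a Fin.≟ p) ×-dec (b Fin.≟ c)
        ... | yes (refl , refl) = trans (cong₂ (λ i j → write (nat s) 19 i j (nat s 18 (nat s 21 0 0) (nat s 22 0 0)) 19 (toℕ a) (toℕ b)) i≡ j≡)
                (trans (write-same (nat s) 19 (toℕ a) (toℕ b) _) val)
        ... | no h = trans (cong₂ (λ i j → write (nat s) 19 i j (nat s 18 (nat s 21 0 0) (nat s 22 0 0)) 19 (toℕ a) (toℕ b)) i≡ j≡)
                (trans (write-entry (nat s) 19 (toℕ p) (toℕ c) _ (toℕ a) (toℕ b) (toℕ-≢ h)) (cp a b (<-suc-≢ lt (combine-≢ h))))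
      finish : ∀ s′ → Inv (n * n) s′ → _
      finish s′ (fr , cp , su) = fr , (λ a b → cp a b (Fin.toℕ<n (combine a b))) ,
        trans su (total-cong (λ a b → trans (cong (_* Y a b) (bit-T (<⇒<ᵇ (Fin.toℕ<n (combine a b))))) (+-identityʳ _)))

    d π : State → ℕ → Fin n → ℕ
    d s h x = nat s 23 h (toℕ x)
    π s h x = nat s 24 h (toℕ x)

    record Relaxed (s : State) (h : ℕ) (x : Fin n) (j : ℕ) : Set where
      field
        stay  : d s (suc h) x ≤ d s h x
        relax : ∀ z → toℕ z < j → T (H z x) → d s (suc h) x ≤ d s h z + view 19 s z x
        from  : (π s (suc h) x ≡ toℕ x × d s (suc h) x ≡ d s h x) ⊎
                (∃ λ z → π s (suc h) x ≡ toℕ z × T (H z x) × d s (suc h) x ≡ d s h z + view 19 s z x)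
    open Relaxed

    relaxed-cong : ∀ {s s′ h x j} → (∀ z → d s′ h z ≡ d s h z) → d s′ (suc h) x ≡ d s (suc h) x →
      π s′ (suc h) x ≡ π s (suc h) x → (∀ a b → view 19 s′ a b ≡ view 19 s a b) → Relaxed s h x j → Relaxed s′ h x j
    relaxed-cong {x = x} e₀ e₁ e₂ e₃ r = record
      { stay  = subst₂ _≤_ (sym e₁) (sym (e₀ _)) (stay r)
      ; relax = λ z lt t → subst₂ _≤_ (sym e₁) (sym (cong₂ _+_ (e₀ z) (e₃ z _))) (relax r z lt t)
      ; from  = case (from r)
      }
      where
      case : _ → _
      case (inj₁ (p , q)) = inj₁ (trans e₂ p , trans e₁ (trans q (sym (e₀ _))))
      case (inj₂ (z , p , t , q)) = inj₂ (z , trans e₂ p , t , trans e₁ (trans q (sym (cong₂ _+_ (e₀ z) (e₃ z _)))))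

    Only : ℕ → ℕ → State → State → Set
    Only i j s s′ = Frame 23 s s′ × (∀ a b → ¬ (i ≡ a × j ≡ b) → nat s′ 23 a b ≡ nat s 23 a b × nat s′ 24 a b ≡ nat s 24 a b)

    run-init : ∀ s → Ctx s → Run initP s (eval initT n) λ s′ → Frame 23 s s′ × d s′ 0 u ≡ 0 × (∀ x → ¬ x ≡ u → d s′ 0 x ≡ nat s 20 0 0)
    run-init s₀ ctx = run-seq (run-map finish (run-for 26 N _ n 1 Inv
        (λ j s x (fr , h) → frame-put 26 0 0 x fr , h)
        (λ j s (fr , _) → trans (frame fr 0 0 0) (n≡ ctx))
        step s₀ n ≤-refl (frame-refl , λ x ())))
      where
      Inv : ℕ → State → Set
      Inv j s = Frame 23 s₀ s × (∀ x → toℕ x < j → d s 0 x ≡ nat s₀ 20 0 0)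
      step : ∀ j s → j < n → Inv j s → nat s 26 0 0 ≡ j → Run _ s 1 λ s′ → nat s′ 26 0 0 ≡ j × Inv (suc j) s′
      step j s j<n (fr , h) ctr = run-put (ctr , frame-put 23 0 (nat s 26 0 0) (nat s 20 0 0) fr , entries)
        where
        entries : ∀ x → toℕ x < suc j → write (nat s) 23 0 (nat s 26 0 0) (nat s 20 0 0) 23 0 (toℕ x) ≡ nat s₀ 20 0 0
        entries x lt with toℕ x ≟ nat s 26 0 0
        ... | yes eq = trans (cong (λ j → write (nat s) 23 0 (nat s 26 0 0) (nat s 20 0 0) 23 0 j) eq) (trans (write-same (nat s) 23 0 (nat s 26 0 0) _) (frame fr 20 0 0))
        ... | no neq = trans (write-entry (nat s) 23 0 (nat s 26 0 0) _ 0 (toℕ x) (λ (_ , e) → neq (sym e))) (h x (<-suc-≢ lt (λ e → neq (trans e (sym ctr)))))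
      finish : ∀ s → Inv n s → Run (23 [ lit 0 , cell 9 ]:= lit 0) s 1 _
      finish s (fr , h) = run-put (frame-put 23 0 (nat s 9 0 0) 0 fr ,
        trans (cong (λ j → write (nat s) 23 0 j 0 23 0 (toℕ u)) u≡′) (write-same (nat s) 23 0 (toℕ u) 0) ,
        λ x x≢u → trans (write-entry (nat s) 23 0 (nat s 9 0 0) 0 0 (toℕ x) (λ (_ , e) → x≢u (Fin.toℕ-injective (trans (sym e) u≡′)))) (h x (Fin.toℕ<n x)))
        where
        u≡′ : nat s 9 0 0 ≡ toℕ u
        u≡′ = trans (frame fr 9 0 0) (u≡ ctx)

    &-true : ∀ {a b} → a ∧ b ≡ true → T a × T b
    &-true {true} {true} _ = tt , tt

    &-false : ∀ {a b} → a ∧ b ≡ false → T a → ¬ T b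
    &-false {true} {false} _ _ ()

    run-relax : ∀ s h x z → Ctx s → nat s 25 0 0 ≡ h → nat s 26 0 0 ≡ toℕ x → nat s 27 0 0 ≡ toℕ z → Relaxed s h x (toℕ z) →
      Run relaxP s 3 λ s′ → Only (suc h) (toℕ x) s s′ × nat s′ 25 0 0 ≡ h × nat s′ 26 0 0 ≡ toℕ x × nat s′ 27 0 0 ≡ toℕ z × Relaxed s′ h x (suc (toℕ z))
    run-relax s h x z ctx h≡ x≡ z≡ r = run-if {t = 2} {t′ = 0} yes-case no-case
      where
      new = nat s 23 (nat s 25 0 0) (nat s 27 0 0) + nat s 19 (nat s 27 0 0) (nat s 26 0 0)
      old = nat s 23 (nat s 25 0 0 + 1) (nat s 26 0 0)
      new≡ : new ≡ d s h z + view 19 s z x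
      new≡ = cong₂ _+_ (cong₂ (nat s 23) h≡ z≡) (cong₂ (nat s 19) z≡ x≡)
      h+1≡ : nat s 25 0 0 + 1 ≡ suc h
      h+1≡ = trans (+-comm _ 1) (cong suc h≡)
      old≡ : old ≡ d s (suc h) x
      old≡ = cong₂ (nat s 23) h+1≡ x≡
      H≡′ : nat s 4 (nat s 27 0 0) (nat s 26 0 0) ≡ bit (H z x)
      H≡′ = trans (cong₂ (nat s 4) z≡ x≡) (H≡ ctx z x)
      test₁ = 1 ≤ᵇ nat s 4 (nat s 27 0 0) (nat s 26 0 0)
      test₂ = new + 1 ≤ᵇ old
      adj-T : T test₁ → T (H z x)
      adj-T t = bit-≢0 λ e → 1+n≢0 (n≤0⇒n≡0 (≤-trans (≤ᵇ⇒≤ 1 _ t) (≤-reflexive (trans H≡′ e))))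
      T-adj : T (H z x) → T test₁
      T-adj t = ≤⇒≤ᵇ (≤-reflexive (sym (trans H≡′ (bit-T t))))
      no-case : test₁ ∧ test₂ ≡ false → _
      no-case e = run-skip ((frame-refl , λ a b _ → refl , refl) , h≡ , x≡ , z≡ , record
        { stay = stay r ; from = from r ; relax = grown })
        where
        grown : ∀ y → toℕ y < suc (toℕ z) → T (H y x) → d s (suc h) x ≤ d s h y + view 19 s y x
        grown y lt t with y Fin.≟ z
        ... | no y≢z = relax r y (<-suc-≢ lt (λ e → y≢z (Fin.toℕ-injective e))) t
        ... | yes refl = subst₂ _≤_ old≡ new≡ (≮⇒≥ λ lt′ → &-false e (T-adj t) (≤⇒≤ᵇ (≤-trans (≤-reflexive (+-comm new 1)) lt′)))
      yes-case : test₁ ∧ test₂ ≡ true → _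
      yes-case e = run-seq (run-put (run-put (only , h≡ , x≡ , z≡ , record
          { stay  = ≤-trans (≤-trans (≤-reflexive d′≡) smaller) (≤-trans (stay r) (≤-reflexive (sym (row-h x))))
          ; relax = grown
          ; from  = inj₂ (z , trans (cong₂ (λ i j → write M₁ 24 i j (nat s 27 0 0) 24 (suc h) (toℕ x)) h+1≡ x≡) (trans (write-same M₁ 24 (suc h) (toℕ x) _) z≡)
                     , adj-T (proj₁ (&-true e)) , trans d′≡ (cong (_+ view 19 s z x) (sym (row-h z)))) })))
        where
        M₁ : Memory ℕ
        M₁ = write (nat s) 23 (nat s 25 0 0 + 1) (nat s 26 0 0) new
        only : Only (suc h) (toℕ x) s (put 24 (nat s 25 0 0 + 1) (nat s 26 0 0) (nat s 27 0 0) (put 23 (nat s 25 0 0 + 1) (nat s 26 0 0) new s))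
        only = frame-put 24 (nat s 25 0 0 + 1) (nat s 26 0 0) (nat s 27 0 0) (frame-put 23 (nat s 25 0 0 + 1) (nat s 26 0 0) new frame-refl) , λ a b ¬e →
          write-entry (nat s) 23 (nat s 25 0 0 + 1) (nat s 26 0 0) new a b (λ (p , q) → ¬e (trans (sym h+1≡) p , trans (sym x≡) q)) ,
          write-entry M₁ 24 (nat s 25 0 0 + 1) (nat s 26 0 0) (nat s 27 0 0) a b (λ (p , q) → ¬e (trans (sym h+1≡) p , trans (sym x≡) q))
        row-h : ∀ y → M₁ 23 h (toℕ y) ≡ d s h y
        row-h y = proj₁ (proj₂ only h (toℕ y) (λ (p , _) → 1+n≢n p))
        d′≡ : M₁ 23 (suc h) (toℕ x) ≡ d s h z + view 19 s z x
        d′≡ = trans (cong₂ (λ i j → write (nat s) 23 i j new 23 (suc h) (toℕ x)) h+1≡ x≡) (trans (write-same (nat s) 23 (suc h) (toℕ x) new) new≡)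
        smaller : d s h z + view 19 s z x ≤ d s (suc h) x
        smaller = subst₂ _≤_ new≡ old≡ (≤-trans (m≤m+n new 1) (≤ᵇ⇒≤ (new + 1) old (proj₂ (&-true {test₁} e))))
        grown : ∀ y → toℕ y < suc (toℕ z) → T (H y x) → M₁ 23 (suc h) (toℕ x) ≤ M₁ 23 h (toℕ y) + view 19 s y x
        grown y lt t with y Fin.≟ z
        ... | yes refl = ≤-reflexive (trans d′≡ (cong (_+ view 19 s y x) (sym (row-h y))))
        ... | no y≢z = ≤-trans (≤-reflexive d′≡) (≤-trans smaller (≤-trans (relax r y (<-suc-≢ lt (λ e → y≢z (Fin.toℕ-injective e))) t) (≤-reflexive (cong (_+ view 19 s y x) (sym (row-h y))))))

  -- Finding a light walk and doubling its weights

  prodP traceP roundP : Program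
  -- The language has no product, so `8 f d` is obtained by `f` additions of `8 d`.
  prodP = (28 ≔ lit 0) ⨾ for 29 below F run (28 ≔ cell 28 ⊕ (x₄ ⊕ x₄))
    where
    x₁ x₂ x₄ : Expr
    x₁ = 23 [ Kexp , cell 10 ]
    x₂ = x₁ ⊕ x₁
    x₄ = x₂ ⊕ x₂

  -- New weights are computed from the copy in array 19, so an edge that occurs twice on the walk is
  -- still doubled only once.
  traceP = (30 ≔ cell 10) ⨾ for 31 below Kexp run (
    (32 ≔ 24 [ Kexp ⊖ cell 31 , cell 30 ]) ⨾
    (if neg ((cell 32 ≤ⁿ cell 30) & (cell 30 ≤ⁿ cell 32))
      then (18 [ cell 32 , cell 30 ]:= (19 [ cell 32 , cell 30 ]) ⊕ (19 [ cell 32 , cell 30 ]))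
      else′ skip) ⨾
    (30 ≔ cell 32))

  roundP = sumP ⨾ initP ⨾ dpP ⨾ prodP ⨾ (if cell 20 ≤ⁿ cell 28 then (17 ≔ lit 0) else′ traceP)

  prodT traceT roundT : Poly
  prodT = con 1 ⊞ repeated var (con 1)
  traceT = con 1 ⊞ repeated (con 2 ⊠ var) (con 4)
  roundT = sumT ⊞ (initT ⊞ (dpT ⊞ (prodT ⊞ (con 2 ⊞ traceT))))

  module Round′ (ℝ : Reals) {n f k : ℕ} (H : Fin n → Fin n → Bool) (irr : ∀ x → ¬ T (H x x)) (u v : Fin n) (f≤n : f ≤ n) (k≤n : k ≤ n) where
    open Reals ℝ using (Carrier)
    open OverReals ℝ
    open Logic ℝ
    open Round ℝ {n} {f} {k} H u v f≤n k≤n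
    open Ctx
    open Relaxed

    only-trans : ∀ {i j s s′ s″} → Only i j s s′ → Only i j s′ s″ → Only i j s s″
    only-trans (fr , e) (fr′ , e′) = frame-trans fr fr′ , λ a b h → trans (proj₁ (e′ a b h)) (proj₁ (e a b h)) , trans (proj₂ (e′ a b h)) (proj₂ (e a b h))

    relaxed-put : ∀ {s h x j} c y → {T (25 ≤ᵇ c)} → Relaxed s h x j → Relaxed (put c 0 0 y s) h x j
    relaxed-put {s} {h} {x} {j} c y {p} = relaxed-cong (λ z → keep 23 _ _) (keep 23 _ _) (keep 24 _ _) (λ a b → keep 19 _ _)
      where
      keep : ∀ m i j → {T (m <ᵇ 25)} → nat (put c 0 0 y s) m i j ≡ nat s m i j
      keep m i j {q} = write-array (nat s) c 0 0 y m i j (λ { refl → <⇒≱ (<ᵇ⇒< m 25 q) (≤ᵇ⇒≤ 25 c p) })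

    run-row : ∀ s h x → Ctx s → nat s 25 0 0 ≡ h → nat s 26 0 0 ≡ toℕ x → Run rowP s (eval rowT n) λ s′ →
      Only (suc h) (toℕ x) s s′ × nat s′ 25 0 0 ≡ h × nat s′ 26 0 0 ≡ toℕ x × Relaxed s′ h x n
    run-row s h x ctx h≡ x≡ = run-seq (run-put (run-seq (run-put (run-for 27 N _ n 3 Inv
        (λ { j s y ((fr , e) , p , q , r) → (frame-put 27 0 0 y fr , e) , p , q , relaxed-put {s} {h} {x} {j} 27 y r })
        (λ { j s ((fr , _) , _) → trans (frame fr 0 0 0) (n≡ ctx) })
        step s₂ n ≤-refl (only₂ , h≡ , x≡ , relaxed₂)))))
      where
      M₁ : Memory ℕ
      M₁ = write (nat s) 23 (nat s 25 0 0 + 1) (nat s 26 0 0) (nat s 23 (nat s 25 0 0) (nat s 26 0 0))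
      s₂ : State
      s₂ = put 24 (nat s 25 0 0 + 1) (nat s 26 0 0) (nat s 26 0 0) (put 23 (nat s 25 0 0 + 1) (nat s 26 0 0) (nat s 23 (nat s 25 0 0) (nat s 26 0 0)) s)
      h+1≡ : nat s 25 0 0 + 1 ≡ suc h
      h+1≡ = trans (+-comm _ 1) (cong suc h≡)
      only₂ : Only (suc h) (toℕ x) s s₂
      only₂ = frame-put 24 (nat s 25 0 0 + 1) (nat s 26 0 0) (nat s 26 0 0) (frame-put 23 (nat s 25 0 0 + 1) (nat s 26 0 0) (nat s 23 (nat s 25 0 0) (nat s 26 0 0)) frame-refl) , λ a b ¬e →
          write-entry (nat s) 23 (nat s 25 0 0 + 1) (nat s 26 0 0) _ a b (λ (p , q) → ¬e (trans (sym h+1≡) p , trans (sym x≡) q)) ,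
          write-entry M₁ 24 (nat s 25 0 0 + 1) (nat s 26 0 0) (nat s 26 0 0) a b (λ (p , q) → ¬e (trans (sym h+1≡) p , trans (sym x≡) q))
      same : d s₂ (suc h) x ≡ d s₂ h x
      same = trans (trans (cong₂ (λ i j → write (nat s) 23 i j (nat s 23 (nat s 25 0 0) (nat s 26 0 0)) 23 (suc h) (toℕ x)) h+1≡ x≡) (trans (write-same (nat s) 23 (suc h) (toℕ x) _) (cong₂ (nat s 23) h≡ x≡)))
        (sym (proj₁ (proj₂ only₂ h (toℕ x) (λ (p , _) → 1+n≢n p))))
      relaxed₂ : Relaxed s₂ h x 0
      relaxed₂ = record { stay = ≤-reflexive same ; relax = λ z () ; from = inj₁ (trans (cong₂ (λ i j → write M₁ 24 i j (nat s 26 0 0) 24 (suc h) (toℕ x)) h+1≡ x≡) (trans (write-same M₁ 24 (suc h) (toℕ x) _) x≡) , same) }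
      Inv : ℕ → State → Set
      Inv j s′ = Only (suc h) (toℕ x) s s′ × nat s′ 25 0 0 ≡ h × nat s′ 26 0 0 ≡ toℕ x × Relaxed s′ h x j
      step : ∀ j s′ → j < n → Inv j s′ → nat s′ 27 0 0 ≡ j → Run relaxP s′ 3 λ s″ → nat s″ 27 0 0 ≡ j × Inv (suc j) s″
      step j s′ j<n (on , h≡ , x≡ , r) ctr = run-map
        (λ { s″ (on′ , h≡ , x≡ , z≡ , r′) → trans z≡ z≡j , only-trans on on′ , h≡ , x≡ , subst (λ i → Relaxed s″ h x (suc i)) z≡j r′ })
        (run-relax s′ h x z (ctx-frame (proj₁ on) ctx) h≡ x≡ (trans ctr (sym z≡j)) (subst (Relaxed s′ h x) (sym z≡j) r))
        where
        z = fromℕ< j<n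
        z≡j : toℕ z ≡ j
        z≡j = Fin.toℕ-fromℕ< j<n

    -- The total weight `D` replaces infinity in row 0: a walk counts as light only if it weighs
    -- less than `D`.
    Table : ℕ → State → ℕ → Set
    Table D s j = d s 0 u ≡ 0 × (∀ x → ¬ x ≡ u → d s 0 x ≡ D) × (∀ h x → h < j → Relaxed s h x n)

    Kexp≡ : ∀ {s} → Ctx s → ⟦ Kexp ⟧ s ≡ K̂
    Kexp≡ ctx = cong (λ k → k + k ∸ 1) (k≡ ctx)

    K̂≤ : K̂ ≤ 2 * n
    K̂≤ = ≤-trans (m∸n≤m (k + k) 1) (≤-trans (+-mono-≤ k≤n k≤n) (≤-reflexive (cong (n +_) (sym (+-identityʳ n)))))

    run-dp : ∀ s → Ctx s → Table (nat s 20 0 0) s 0 → Run dpP s (eval dpT n) λ s′ → Frame 23 s s′ × Table (nat s 20 0 0) s′ K̂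
    run-dp s₀ ctx table = run-for 25 Kexp _ K̂ _ Inv
        (λ { j s y (fr , p , q , r) → frame-put 25 0 0 y fr , p , q , λ h x lt → relaxed-put {s} {h} {x} {n} 25 y (r h x lt) })
        (λ { j s (fr , _) → Kexp≡ (ctx-frame fr ctx) })
        step s₀ (2 * n) K̂≤ (frame-refl , table)
      where
      D = nat s₀ 20 0 0
      Inv : ℕ → State → Set
      Inv j s = Frame 23 s₀ s × Table D s j
      step : ∀ h s → h < K̂ → Inv h s → nat s 25 0 0 ≡ h → Run (for 26 below N run rowP) s (2 + n * (eval rowT n + 2)) λ s′ → nat s′ 25 0 0 ≡ h × Inv (suc h) s′
      step h s h<K (fr , tab) ctr = run-map
        (λ { s′ (fr′ , h≡ , (p , q , r) , new) → h≡ , fr′ , p , q , λ h′ x lt → all-rows s′ r new h′ x (m≤n⇒m<n∨m≡n (≤-pred lt)) })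
        (run-for 26 N rowP n (eval rowT n) Inv′
          (λ { j s y (fr , e , (p , q , r) , new) → frame-put 26 0 0 y fr , e , (p , q , λ h x lt → relaxed-put {s} {h} {x} {n} 26 y (r h x lt)) , λ x lt → relaxed-put {s} {h} {x} {n} 26 y (new x lt) })
          (λ { j s (fr , _) → trans (frame fr 0 0 0) (n≡ ctx) })
          step′ s n ≤-refl (fr , ctr , tab , λ x ()))
        where
        all-rows : ∀ s′ → (∀ h′ x → h′ < h → Relaxed s′ h′ x n) → (∀ x → toℕ x < n → Relaxed s′ h x n) → ∀ h′ x → (h′ < h ⊎ h′ ≡ h) → Relaxed s′ h′ x n
        all-rows s′ r new h′ x (inj₁ lt)   = r h′ x lt
        all-rows s′ r new h′ x (inj₂ refl) = new x (Fin.toℕ<n x)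
        Inv′ : ℕ → State → Set
        Inv′ j s = Frame 23 s₀ s × nat s 25 0 0 ≡ h × Table D s h × (∀ x → toℕ x < j → Relaxed s h x n)
        step′ : ∀ j s → j < n → Inv′ j s → nat s 26 0 0 ≡ j → Run rowP s (eval rowT n) λ s′ → nat s′ 26 0 0 ≡ j × Inv′ (suc j) s′
        step′ j s j<n (fr , h≡ , (p , q , r) , new) ctr = run-map post
            (run-row s h x (ctx-frame fr ctx) h≡ (trans ctr (sym x≡j)))
          where
          x = fromℕ< j<n
          x≡j : toℕ x ≡ j
          x≡j = Fin.toℕ-fromℕ< j<n
          post : ∀ s′ → Only (suc h) (toℕ x) s s′ × nat s′ 25 0 0 ≡ h × nat s′ 26 0 0 ≡ toℕ x × Relaxed s′ h x n → nat s′ 26 0 0 ≡ j × Inv′ (suc j) s′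
          post s′ ((fr′ , e) , h≡ , x≡ , rx) = trans x≡ x≡j , frame-trans fr fr′ , h≡ ,
              (trans (proj₁ (row 0 u 0≤h)) p , (λ y y≢u → trans (proj₁ (row 0 y 0≤h)) (q y y≢u)) ,
               λ h′ y lt → relaxed-cong (λ z → proj₁ (row h′ z (<⇒≤ lt))) (proj₁ (row (suc h′) y lt)) (proj₂ (row (suc h′) y lt)) (λ a b → frame fr′ 19 _ _) (r h′ y lt)) ,
              news
            where
            0≤h : 0 ≤ h
            0≤h = z≤n
            row : ∀ h′ y → h′ ≤ h → d s′ h′ y ≡ d s h′ y × π s′ h′ y ≡ π s h′ y
            row h′ y le = e h′ (toℕ y) (λ (eq , _) → <⇒≱ (≤-reflexive eq) le)
            news : ∀ y → toℕ y < suc j → Relaxed s′ h y n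
            news y lt with y Fin.≟ x
            ... | yes refl = rx
            ... | no y≢x = relaxed-cong (λ z → proj₁ (row h z ≤-refl)) (proj₁ other) (proj₂ other) (λ a b → frame fr′ 19 _ _)
                  (new y (<-suc-≢ lt (λ eq → y≢x (Fin.toℕ-injective (trans eq (sym x≡j))))))
              where
              other = e (suc h) (toℕ y) (λ (_ , eq) → y≢x (Fin.toℕ-injective (sym eq)))

    In : List (Edge n) → Set
    In q = ∀ e → e ∈ q → T (uncurry H e)

    -- Induction along the walk; hops left over at its end are spent by staying.
    lower : ∀ {D s} → Table D s K̂ → ∀ j h y x q → Conn proj₁ proj₂ y q x → In q → length q ≤ j → h + j ≤ K̂ →
      d s (h + j) x ≤ d s h y + ∑ q (uncurry (view 19 s))
    lower {D} {s} tab zero h y x [] refl q∈ _ le = ≤-reflexive (trans (cong (λ i → d s i x) (+-identityʳ h)) (sym (+-identityʳ _)))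
    lower {D} {s} tab (suc j) h y x [] refl q∈ _ le = ≤-trans (≤-reflexive (cong (λ i → d s i x) (+-suc h j)))
      (≤-trans (lower tab j (suc h) y x [] refl q∈ z≤n (≤-trans (≤-reflexive (sym (+-suc h j))) le))
        (+-monoˡ-≤ 0 (stay (proj₂ (proj₂ tab) h y (≤-trans (≤-trans (s≤s (m≤m+n h j)) (≤-reflexive (sym (+-suc h j)))) le)))))
    lower {D} {s} tab (suc j) h y x ((a , z) ∷ q) (refl , c) q∈ (s≤s len) le = ≤-trans (≤-reflexive (cong (λ i → d s i x) (+-suc h j)))
      (≤-trans (lower tab j (suc h) z x q c (λ e e∈ → q∈ e (there e∈)) len (≤-trans (≤-reflexive (sym (+-suc h j))) le))
        (≤-trans (+-monoˡ-≤ _ (relax (proj₂ (proj₂ tab) h z (≤-trans (≤-trans (s≤s (m≤m+n h j)) (≤-reflexive (sym (+-suc h j)))) le)) a (Fin.toℕ<n a) (q∈ (a , z) (here refl))))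
          (≤-reflexive (+-assoc (d s h a) _ _))))

    run-prod : ∀ s → Ctx s → Run prodP s (eval prodT n) λ s′ → Frame 28 s s′ × nat s′ 28 0 0 ≡ f * (8 * d s K̂ v)
    run-prod s₀ ctx = run-seq (run-put (run-for 29 F _ f 1 Inv
        (λ j s y (fr , e) → frame-put 29 0 0 y fr , e)
        (λ j s (fr , _) → trans (frame fr 1 0 0) (f≡ ctx))
        (λ j s j<f (fr , e) ctr → run-put (ctr , frame-put 28 0 0 _ fr , trans (cong₂ _+_ e (eight s fr)) (+-comm (j * (8 * d s₀ K̂ v)) _)))
        _ n f≤n (frame-put 28 0 0 0 frame-refl , refl)))
      where
      Inv : ℕ → State → Set
      Inv j s = Frame 28 s₀ s × nat s 28 0 0 ≡ j * (8 * d s₀ K̂ v)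
      lem : ∀ x → ((x + x) + (x + x)) + ((x + x) + (x + x)) ≡ 8 * x
      lem = solve-∀
      eight : ∀ s → Frame 28 s₀ s → _
      eight s fr = trans (lem (nat s 23 (⟦ Kexp ⟧ s) (nat s 10 0 0))) (cong (8 *_) (trans (cong₂ (nat s 23) (Kexp≡ (ctx-frame fr ctx)) (trans (frame fr 10 0 0) (v≡ ctx))) (frame fr 23 K̂ (toℕ v))))

    record Doubled (Y Y′ : Fin n → Fin n → ℕ) : Set where
      field
        q       : List (Edge n)
        conn    : Conn proj₁ proj₂ u q v
        inH     : In q
        short   : length q ≤ K̂
        light   : 8 * f * ∑ q (uncurry Y) < total Y
        sum     : total Y′ ≤ total Y + ∑ q (uncurry Y)
        grows   : ∀ a b → Y a b ≤ Y′ a b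
        doubles : ∀ a b → (a , b) ∈ q → 2 * Y a b ≤ Y′ a b

    run-trace : ∀ s → Ctx s → Table (nat s 20 0 0) s K̂ → (∀ a b → view 19 s a b ≡ view 18 s a b) → nat s 20 0 0 ≡ total (view 18 s) →
      0 < f → 8 * f * d s K̂ v < total (view 18 s) → Run traceP s (eval traceT n) λ s′ → Frame 18 s s′ × Doubled (view 18 s) (view 18 s′)
    run-trace s₀ ctx tab copy sum≡ f>0 cheap = run-seq (run-put (run-map finish (run-for 31 Kexp _ K̂ 4 Inv
        (λ { j s y (fr , rest) → frame-put 31 0 0 y fr , rest })
        (λ { j s (fr , _) → Kexp≡ (ctx-frame fr ctx) })
        step _ (2 * n) K̂≤ start)))
      where
      Y W : Fin n → Fin n → ℕ
      Y = view 18 s₀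
      W = view 19 s₀
      Keep : State → Set
      Keep s = (∀ i j → nat s 19 i j ≡ nat s₀ 19 i j) × (∀ i j → nat s 24 i j ≡ nat s₀ 24 i j)
      Path : ℕ → State → Fin n → Set
      Path i s cur = ∃ λ q → Conn proj₁ proj₂ cur q v × In q × length q ≤ i × d s₀ K̂ v ≡ d s₀ (K̂ ∸ i) cur + ∑ q (uncurry Y) ×
        total (view 18 s) ≤ total Y + ∑ q (uncurry Y) × (∀ a b → Y a b ≤ view 18 s a b) × (∀ a b → (a , b) ∈ q → 2 * Y a b ≤ view 18 s a b)
      Inv : ℕ → State → Set
      Inv i s = Frame 18 s₀ s × Keep s × ∃ λ cur → nat s 30 0 0 ≡ toℕ cur × Path i s cur
      start : Inv 0 (put 30 0 0 (nat s₀ 10 0 0) s₀)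
      start = frame-put 30 0 0 (nat s₀ 10 0 0) frame-refl , ((λ i j → refl) , λ i j → refl) , v , v≡ ctx ,
        [] , refl , (λ e ()) , z≤n , sym (+-identityʳ _) , ≤-reflexive (sym (+-identityʳ _)) , (λ a b → ≤-refl) , λ a b ()
      step : ∀ i s → i < K̂ → Inv i s → nat s 31 0 0 ≡ i → Run _ s 4 λ s′ → nat s′ 31 0 0 ≡ i × Inv (suc i) s′
      step i s i<K (fr , (k19 , k24) , cur , cur≡ , q , cq , q∈ , len , dq , tot , gr , dbl) ctr =
          run-seq {t = 1} {t′ = 3} (run-put (run-seq {t = 2} {t′ = 1} (run-if {t = 1} {t′ = 0} differ agree)))
        where
        h = K̂ ∸ suc i
        level : K̂ ∸ i ≡ suc h
        level = sym (trans (cong suc (sym (pred[m∸n]≡m∸[1+n] K̂ i))) (suc-pred (K̂ ∸ i) {{>-nonZero (m<n⇒0<n∸m i<K)}}))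
        ptr = nat s 24 (⟦ Kexp ⟧ s ∸ nat s 31 0 0) (nat s 30 0 0)
        ptr≡ : ptr ≡ π s₀ (suc h) cur
        ptr≡ = trans (cong₂ (nat s 24) (trans (cong₂ _∸_ (Kexp≡ (ctx-frame fr ctx)) ctr) level) cur≡) (k24 (suc h) (toℕ cur))
        rel : Relaxed s₀ h cur n
        rel = proj₂ (proj₂ tab) h cur (≤-trans (≤-reflexive (sym level)) (m∸n≤m K̂ i))
        s₁ : State
        s₁ = put 32 0 0 ptr s
        agree : not ((ptr ≤ᵇ nat s 30 0 0) ∧ (nat s 30 0 0 ≤ᵇ ptr)) ≡ false → _
        agree e = run-skip (run-put (ctr , frame-put 30 0 0 ptr (frame-put 32 0 0 ptr fr) , (k19 , k24) , cur , trans same cur≡ , stay-path (from rel)))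
          where
          both : T (ptr ≤ᵇ nat s 30 0 0) × T (nat s 30 0 0 ≤ᵇ ptr)
          both = &-true (not-false e)
            where
            not-false : ∀ {b} → not b ≡ false → b ≡ true
            not-false {true} _ = refl
          same : ptr ≡ nat s 30 0 0
          same = ≤-antisym (≤ᵇ⇒≤ _ _ (proj₁ both)) (≤ᵇ⇒≤ _ _ (proj₂ both))
          stay-path : _ → Path (suc i) (put 30 0 0 ptr s₁) cur
          stay-path (inj₁ (_ , d≡)) = q , cq , q∈ , m≤n⇒m≤1+n len , trans dq (cong (_+ ∑ q (uncurry Y)) (trans (cong (λ h → d s₀ h cur) level) d≡)) , tot , gr , dbl
          -- A proper predecessor equal to the node would be a loop.
          stay-path (inj₂ (z , p≡ , t , _)) = ⊥-elim (irr cur (subst (λ y → T (H y cur)) (Fin.toℕ-injective (trans (sym p≡) (trans (sym ptr≡) (trans same cur≡)))) t))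
        differ : not ((ptr ≤ᵇ nat s 30 0 0) ∧ (nat s 30 0 0 ≤ᵇ ptr)) ≡ true → _
        differ e = run-put (run-put (ctr , frame-put 30 0 0 ptr (frame-put 18 ptr (nat s 30 0 0) new (frame-put 32 0 0 ptr fr)) , (k19 , k24) , move (from rel)))
          where
          new = nat s 19 ptr (nat s 30 0 0) + nat s 19 ptr (nat s 30 0 0)
          s₃ : State
          s₃ = put 30 0 0 ptr (put 18 ptr (nat s 30 0 0) new s₁)
          not-same : ¬ ptr ≡ nat s 30 0 0
          not-same eq = contra (≤ᵇ-refl ptr (nat s 30 0 0) eq) (≤ᵇ-refl (nat s 30 0 0) ptr (sym eq)) e
            where
            ≤ᵇ-refl : ∀ a b → a ≡ b → (a ≤ᵇ b) ≡ true
            ≤ᵇ-refl a b refl = T⇒true (≤⇒≤ᵇ (≤-refl {a}))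
            contra : ∀ {a b} → a ≡ true → b ≡ true → ¬ not (a ∧ b) ≡ true
            contra refl refl ()
          move : _ → ∃ λ cur → nat s₃ 30 0 0 ≡ toℕ cur × Path (suc i) s₃ cur
          move (inj₁ (p≡ , _)) = ⊥-elim (not-same (trans ptr≡ (trans p≡ (sym cur≡))))
          move (inj₂ (z , p≡ , t , d≡)) = z , trans ptr≡ p≡ , (z , cur) ∷ q , (refl , cq) , (λ { e (here refl) → t ; e (there e∈) → q∈ e e∈ }) , s≤s len ,
              trans dq (trans (cong (_+ ∑ q (uncurry Y)) (trans (cong (λ h → d s₀ h cur) level) (trans d≡ (cong (d s₀ h z +_) (copy z cur))))) (+-assoc (d s₀ h z) _ _)) ,
              tot′ , gr′ , dbl′
            where
            ptr≡z : ptr ≡ toℕ z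
            ptr≡z = trans ptr≡ p≡
            new≡ : new ≡ 2 * Y z cur
            new≡ = trans (cong (λ y → y + y) (trans (cong₂ (nat s 19) ptr≡z cur≡) (trans (k19 (toℕ z) (toℕ cur)) (copy z cur)))) (cong (Y z cur +_) (sym (+-identityʳ _)))
            at-edge : view 18 s₃ z cur ≡ 2 * Y z cur
            at-edge = trans (cong₂ (λ i j → write (nat s₁) 18 i j new 18 (toℕ z) (toℕ cur)) ptr≡z cur≡) (trans (write-same (nat s₁) 18 (toℕ z) (toℕ cur) new) new≡)
            elsewhere : ∀ a b → ¬ (a ≡ z × b ≡ cur) → view 18 s₃ a b ≡ view 18 s a b
            elsewhere a b h = write-entry (nat s₁) 18 ptr (nat s 30 0 0) new (toℕ a) (toℕ b) (λ (p , q) → h (Fin.toℕ-injective (trans (sym p) ptr≡z) , Fin.toℕ-injective (trans (sym q) cur≡)))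
            gr′ : ∀ a b → Y a b ≤ view 18 s₃ a b
            gr′ a b with (a Fin.≟ z) ×-dec (b Fin.≟ cur)
            ... | yes (refl , refl) = ≤-trans (m≤m+n _ _) (≤-reflexive (sym at-edge))
            ... | no h = ≤-trans (gr a b) (≤-reflexive (sym (elsewhere a b h)))
            dbl′ : ∀ a b → (a , b) ∈ (z , cur) ∷ q → 2 * Y a b ≤ view 18 s₃ a b
            dbl′ a b (here refl) = ≤-reflexive (sym at-edge)
            dbl′ a b (there ab∈) with (a Fin.≟ z) ×-dec (b Fin.≟ cur)
            ... | yes (refl , refl) = ≤-reflexive (sym at-edge)
            ... | no h = ≤-trans (dbl a b ab∈) (≤-reflexive (sym (elsewhere a b h)))
            -- The new entry exceeds the old one by at most `Y z cur`, because the old one is at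
            -- least `Y z cur` whether or not it has been doubled before.
            tot′ : total (view 18 s₃) ≤ total Y + (Y z cur + ∑ q (uncurry Y))
            tot′ = +-cancelʳ-≤ (view 18 s z cur) _ _ (begin
              total (view 18 s₃) + view 18 s z cur          ≡⟨ total-update (view 18 s) (view 18 s₃) z cur elsewhere ⟩
              total (view 18 s) + view 18 s₃ z cur          ≤⟨ +-mono-≤ tot (≤-trans (≤-reflexive at-edge) (+-monoʳ-≤ (Y z cur) (≤-trans (≤-reflexive (+-identityʳ _)) (gr z cur)))) ⟩
              total Y + ∑ q (uncurry Y) + (Y z cur + view 18 s z cur) ≡⟨ lem (total Y) (∑ q (uncurry Y)) (Y z cur) (view 18 s z cur) ⟩
              total Y + (Y z cur + ∑ q (uncurry Y)) + view 18 s z cur ∎)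
              where
              open ≤-Reasoning
              lem : ∀ a b c d → a + b + (c + d) ≡ a + (c + b) + d
              lem = solve-∀
      finish : ∀ s′ → Inv K̂ s′ → Frame 18 s₀ s′ × Doubled Y (view 18 s′)
      finish s′ (fr , _ , cur , _ , q , cq , q∈ , len , dq , tot , gr , dbl) = fr , record
        { q = q ; conn = subst (λ y → Conn proj₁ proj₂ y q v) cur≡u cq ; inH = q∈ ; short = len
        ; light = ≤-<-trans (*-monoʳ-≤ (8 * f) (≤-trans (m≤n+m _ _) (≤-reflexive (sym dq)))) cheap
        ; sum = tot ; grows = gr ; doubles = dbl }
        where
        cur≡u : cur ≡ u
        cur≡u with cur Fin.≟ u
        ... | yes eq = eq
        -- A trace ending elsewhere than at `u` starts from the cap, which would make `d s₀ K̂ v` at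
        -- least the total weight.
        ... | no neq = ⊥-elim (<⇒≱ cheap (begin
          total Y                                       ≡⟨ sym sum≡ ⟩
          nat s₀ 20 0 0                                 ≡⟨ sym (proj₁ (proj₂ tab) cur neq) ⟩
          d s₀ 0 cur                                    ≡⟨ cong (λ h → d s₀ h cur) (sym (n∸n≡0 K̂)) ⟩
          d s₀ (K̂ ∸ K̂) cur                              ≤⟨ m≤m+n _ _ ⟩
          d s₀ (K̂ ∸ K̂) cur + ∑ q (uncurry Y)            ≡⟨ sym dq ⟩
          d s₀ K̂ v                                      ≡⟨ sym (+-identityʳ _) ⟩
          1 * d s₀ K̂ v                                  ≤⟨ *-monoˡ-≤ (d s₀ K̂ v) (*-mono-≤ (s≤s (z≤n {7})) f>0) ⟩
          8 * f * d s₀ K̂ v                              ∎))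
          where open ≤-Reasoning

    NoLight : (Fin n → Fin n → ℕ) → Set
    NoLight Y = ∀ q → Conn proj₁ proj₂ u q v → In q → length q ≤ K̂ → total Y ≤ 8 * f * ∑ q (uncurry Y)

    run-round : ∀ s → Ctx s → 0 < f → nat s 17 0 0 ≡ 1 → Run roundP s (eval roundT n) λ s′ → Frame 17 s s′ ×
      ((nat s′ 17 0 0 ≡ 0 × NoLight (view 18 s)) ⊎ (nat s′ 17 0 0 ≡ 1 × Doubled (view 18 s) (view 18 s′)))
    run-round s₀ ctx f>0 flag = run-seq (run-map after-sum (run-sum s₀ ctx))
      where
      Y = view 18 s₀
      Out : State → Set
      Out s′ = Frame 17 s₀ s′ × ((nat s′ 17 0 0 ≡ 0 × NoLight Y) ⊎ (nat s′ 17 0 0 ≡ 1 × Doubled Y (view 18 s′)))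
      after-sum : ∀ s₁ → Frame 19 s₀ s₁ × (∀ a b → view 19 s₁ a b ≡ Y a b) × nat s₁ 20 0 0 ≡ total Y → Run _ s₁ _ Out
      after-sum s₁ (fr₁ , copy₁ , sum₁) = run-seq (run-map after-init (run-init s₁ (ctx-frame fr₁ ctx)))
        where
        D = nat s₁ 20 0 0
        after-init : ∀ s₂ → Frame 23 s₁ s₂ × d s₂ 0 u ≡ 0 × (∀ x → ¬ x ≡ u → d s₂ 0 x ≡ D) → Run _ s₂ _ Out
        after-init s₂ (fr₂ , du , dx) = run-seq (run-map after-dp (run-dp s₂ (ctx-frame fr₂ (ctx-frame fr₁ ctx))
            (du , (λ x h → trans (dx x h) (sym (frame fr₂ 20 0 0))) , λ h x ())))
          where
          after-dp : ∀ s₃ → Frame 23 s₂ s₃ × Table (nat s₂ 20 0 0) s₃ K̂ → Run _ s₃ _ Out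
          after-dp s₃ (fr₃ , tab) = run-seq (run-map after-prod (run-prod s₃ (ctx-frame fr₃ (ctx-frame fr₂ (ctx-frame fr₁ ctx)))))
            where
            fr₀₃ : Frame 19 s₀ s₃
            fr₀₃ = frame-trans fr₁ (frame-trans (frame-weaken (≤ᵇ⇒≤ 19 23 tt) fr₂) (frame-weaken (≤ᵇ⇒≤ 19 23 tt) fr₃))
            copy₃ : ∀ a b → view 19 s₃ a b ≡ Y a b
            copy₃ a b = trans (frame fr₃ 19 (toℕ a) (toℕ b)) (trans (frame fr₂ 19 (toℕ a) (toℕ b)) (copy₁ a b))
            D₃ : nat s₃ 20 0 0 ≡ total Y
            D₃ = trans (frame fr₃ 20 0 0) (trans (frame fr₂ 20 0 0) sum₁)
            after-prod : ∀ s₄ → Frame 28 s₃ s₄ × nat s₄ 28 0 0 ≡ f * (8 * d s₃ K̂ v) → Run (if cell 20 ≤ⁿ cell 28 then (17 ≔ lit 0) else′ traceP) s₄ (1 + 1 + eval traceT n) Out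
            after-prod s₄ (fr₄ , prod) = run-if heavy cheap
              where
              fr₀₄ : Frame 19 s₀ s₄
              fr₀₄ = frame-trans fr₀₃ (frame-weaken (≤ᵇ⇒≤ 19 28 tt) fr₄)
              D₄ : nat s₄ 20 0 0 ≡ total Y
              D₄ = trans (frame fr₄ 20 0 0) D₃
              B·d : f * (8 * d s₃ K̂ v) ≡ 8 * f * d s₃ K̂ v
              B·d = lem f (d s₃ K̂ v)
                where
                lem : ∀ f x → f * (8 * x) ≡ 8 * f * x
                lem = solve-∀
              heavy : (nat s₄ 20 0 0 ≤ᵇ nat s₄ 28 0 0) ≡ true → Run (17 ≔ lit 0) s₄ 1 Out
              heavy e = run-put (frame-put 17 0 0 0 (frame-weaken (≤ᵇ⇒≤ 17 19 tt) fr₀₄) , inj₁ (refl , no-light))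
                where
                no-light : NoLight Y
                no-light q c q∈ len = begin
                  total Y                                  ≡⟨ sym D₄ ⟩
                  nat s₄ 20 0 0                            ≤⟨ ≤ᵇ⇒≤ _ _ (subst T (sym e) tt) ⟩
                  nat s₄ 28 0 0                            ≡⟨ trans prod B·d ⟩
                  8 * f * d s₃ K̂ v                         ≤⟨ *-monoʳ-≤ (8 * f) (lower tab K̂ 0 u v q c q∈ len ≤-refl) ⟩
                  8 * f * (d s₃ 0 u + ∑ q (uncurry (view 19 s₃))) ≡⟨ cong (8 * f *_) (cong₂ _+_ (proj₁ tab) (∑-cong q (λ (a , b) → copy₃ a b))) ⟩
                  8 * f * ∑ q (uncurry Y)                  ∎
                  where open ≤-Reasoning
              cheap : (nat s₄ 20 0 0 ≤ᵇ nat s₄ 28 0 0) ≡ false → Run traceP s₄ (eval traceT n) Out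
              cheap e = run-map post (run-trace s₄ (ctx-frame fr₀₄ ctx) tab₄ (λ a b → trans (frame fr₄ 19 (toℕ a) (toℕ b)) (trans (copy₃ a b) (sym (Y₄ a b))))
                  (trans D₄ (sym (total-cong Y₄))) f>0 small)
                where
                Y₄ : ∀ a b → view 18 s₄ a b ≡ Y a b
                Y₄ a b = frame fr₀₄ 18 (toℕ a) (toℕ b)
                tab₄ : Table (nat s₄ 20 0 0) s₄ K̂
                tab₄ = trans (frame fr₄ 23 0 (toℕ u)) (proj₁ tab) ,
                  (λ x h → trans (frame fr₄ 23 0 (toℕ x)) (trans (proj₁ (proj₂ tab) x h) (trans (sym (frame fr₃ 20 0 0)) (sym (frame fr₄ 20 0 0))))) ,
                  λ h x lt → relaxed-cong (λ z → frame fr₄ 23 h (toℕ z)) (frame fr₄ 23 (suc h) (toℕ x)) (frame fr₄ 24 (suc h) (toℕ x)) (λ a b → frame fr₄ 19 (toℕ a) (toℕ b)) (proj₂ (proj₂ tab) h x lt)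
                small : 8 * f * d s₄ K̂ v < total (view 18 s₄)
                small = subst₂ _<_ (trans prod (trans B·d (cong (8 * f *_) (sym (frame fr₄ 23 K̂ (toℕ v)))))) (trans D₄ (sym (total-cong Y₄)))
                  (≰⇒> (λ le → subst T e (≤⇒≤ᵇ le)))
                post : ∀ s₅ → Frame 18 s₄ s₅ × Doubled (view 18 s₄) (view 18 s₅) → Out s₅
                post s₅ (fr₅ , dd) = frame-trans (frame-weaken (≤ᵇ⇒≤ 17 19 tt) fr₀₄) (frame-weaken (≤ᵇ⇒≤ 17 18 tt) fr₅) ,
                  inj₂ (trans (frame fr₅ 17 0 0) (trans (frame fr₀₄ 17 0 0) flag) , transport dd)
                  where
                  ∑≡ : ∀ q → ∑ q (uncurry (view 18 s₄)) ≡ ∑ q (uncurry Y)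
                  ∑≡ q = ∑-cong q (λ (a , b) → Y₄ a b)
                  transport : Doubled (view 18 s₄) (view 18 s₅) → Doubled Y (view 18 s₅)
                  transport dd = record
                    { q = q ; conn = conn ; inH = inH ; short = short
                    ; light = subst₂ _<_ (cong (8 * f *_) (∑≡ q)) (total-cong Y₄) light
                    ; sum = ≤-trans sum (≤-reflexive (cong₂ _+_ (total-cong Y₄) (∑≡ q)))
                    ; grows = λ a b → ≤-trans (≤-reflexive (sym (Y₄ a b))) (grows a b)
                    ; doubles = λ a b ab∈ → ≤-trans (≤-reflexive (cong (2 *_) (sym (Y₄ a b)))) (doubles a b ab∈) }
                    where open Doubled dd

  -- The multiplicative weights test

  testP initYP : Program
  initYP = for 21 below N run (for 22 below N run (18 [ cell 21 , cell 22 ]:= lit 1))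
  -- There are `n²` phases of `4f` rounds each; once the flag is cleared, the remaining rounds do
  -- nothing.
  testP = initYP ⨾ (17 ≔ lit 1) ⨾ for 13 below N run (for 14 below N run (for 15 below F run (for 16 below lit 4 run
    (if lit 1 ≤ⁿ cell 17 then roundP else′ skip))))

  product : {A : Set} → List A → (A → ℕ) → ℕ
  product []       f = 1
  product (x ∷ xs) f = f x * product xs f

  product-mono : {A : Set} (xs : List A) {f g : A → ℕ} → (∀ x → f x ≤ g x) → product xs f ≤ product xs g
  product-mono []       h = ≤-refl
  product-mono (x ∷ xs) h = *-mono-≤ (h x) (product-mono xs h)

  product-double : {A : Set} {xs : List A} {x : A} {f g : A → ℕ} → x ∈ xs → (∀ x → f x ≤ g x) → 2 * f x ≤ g x →
    2 * product xs f ≤ product xs g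
  product-double {xs = x ∷ xs} {f = f} (here refl) h h₂ = ≤-trans (≤-reflexive (sym (*-assoc 2 (f x) _))) (*-mono-≤ h₂ (product-mono xs h))
  product-double {xs = y ∷ xs} {f = f} (there x∈)  h h₂ = ≤-trans (≤-reflexive (lem (f y) (product xs f))) (*-mono-≤ (h y) (product-double x∈ h h₂))
    where
    lem : ∀ a b → 2 * (a * b) ≡ a * (2 * b)
    lem = solve-∀

  product-≤ : {A : Set} (xs : List A) {f : A → ℕ} {c : ℕ} → (∀ x → f x ≤ c) → product xs f ≤ c ^ length xs
  product-≤ []       h = ≤-refl
  product-≤ (x ∷ xs) h = *-mono-≤ (h x) (product-≤ xs h)

  n<2^n : ∀ n → n < 2 ^ n
  n<2^n zero    = s≤s z≤n
  n<2^n (suc n) = ≤-trans (+-mono-≤ (≤-trans (s≤s z≤n) (n<2^n n)) (n<2^n n)) (≤-reflexive (cong (2 ^ n +_) (sym (+-identityʳ (2 ^ n)))))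

  meets-or-avoids : ∀ {n} (q Fs : List (Edge n)) → (∃ λ e → e ∈ q × e ∈ Fs) ⊎ (∀ e → e ∈ q → ¬ e ∈ Fs)
  meets-or-avoids []      Fs = inj₂ λ _ ()
  meets-or-avoids (e ∷ q) Fs with Membership._∈?_ (Product.≡-dec Fin._≟_ Fin._≟_) e Fs | meets-or-avoids q Fs
  ... | yes e∈ | _                     = inj₁ (e , here refl , e∈)
  ... | no  _  | inj₁ (d , d∈ , d∈Fs)  = inj₁ (d , there d∈ , d∈Fs)
  ... | no  e∉ | inj₂ avoid            = inj₂ λ { d (here refl) → e∉ ; d (there d∈) → avoid d d∈ }

  testT phaseT : Poly
  phaseT = repeated var (repeated (con 4) (con 1 ⊞ roundT ⊞ con 0))
  testT = pairs (con 1) ⊞ (con 1 ⊞ pairs phaseT)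

  module Testing (ℝ : Reals) {n f k : ℕ} (H : Fin n → Fin n → Bool) (irr : ∀ x → ¬ T (H x x)) (u v : Fin n) (f≤n : f ≤ n) (k≤n : k ≤ n) (f>0 : 0 < f) where
    open Reals ℝ using (Carrier)
    open OverReals ℝ
    open Logic ℝ
    open Round ℝ {n} {f} {k} H u v f≤n k≤n
    open Round′ ℝ {n} {f} {k} H irr u v f≤n k≤n
    open Ctx

    Avoiding : List (Edge n) → Set
    Avoiding Fs = ∃ λ q → Conn proj₁ proj₂ u q v × In q × length q ≤ K̂ × (∀ e → e ∈ q → ¬ e ∈ Fs)

    M : ℕ
    M = n * n

    -- The state after i rounds of phase p.  Each round doubles an edge of
    -- every edge set that met all walks so far, while the total weight at
    -- most doubles in a phase.
    record Alive (p i : ℕ) (s : State) : Set where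
      field
        flag : nat s 17 0 0 ≡ 1
        pos  : ∀ a b → 1 ≤ view 18 s a b
        pot  : 4 * f * total (view 18 s) ≤ (4 * f + i) * (M * 2 ^ p)
        kill : ∀ Fs → Avoiding Fs ⊎ 2 ^ (p * (4 * f) + i) ≤ product Fs (uncurry (view 18 s))

    Dead : State → Set
    Dead s = nat s 17 0 0 ≡ 0 × ∃ λ Y → 0 < total Y × NoLight Y

    St : ℕ → ℕ → State → Set
    St p i s = Alive p i s ⊎ Dead s

    run-initY : ∀ s → Ctx s → Run initYP s (eval (pairs (con 1)) n) λ s′ → Frame 18 s s′ × (∀ a b → view 18 s′ a b ≡ 1)
    run-initY s₀ ctx = run-map (λ s′ (fr , h) → fr , λ a b → h a b (Fin.toℕ<n (combine a b))) (run-pairs n 21 22 (λ ()) N _ 1 Inv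
        (λ r s x (fr , h) → frame-put 21 0 0 x fr , h)
        (λ r s x (fr , h) → frame-put 22 0 0 x fr , h)
        (λ r s (fr , _) → trans (frame fr 0 0 0) (n≡ ctx))
        step s₀ (frame-refl , λ a b ()))
      where
      Inv : ℕ → State → Set
      Inv r s = Frame 18 s₀ s × (∀ a b → toℕ (combine a b) < r → view 18 s a b ≡ 1)
      step : ∀ (p c : Fin n) s → Inv (toℕ (combine p c)) s → nat s 21 0 0 ≡ toℕ p → nat s 22 0 0 ≡ toℕ c →
        Run (18 [ cell 21 , cell 22 ]:= lit 1) s 1 λ s′ → nat s′ 21 0 0 ≡ toℕ p × nat s′ 22 0 0 ≡ toℕ c × Inv (suc (toℕ (combine p c))) s′
      step p c s (fr , h) i≡ j≡ = run-put (i≡ , j≡ , frame-put 18 (nat s 21 0 0) (nat s 22 0 0) 1 fr , ones)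
        where
        ones : ∀ a b → toℕ (combine a b) < suc (toℕ (combine p c)) → write (nat s) 18 (nat s 21 0 0) (nat s 22 0 0) 1 18 (toℕ a) (toℕ b) ≡ 1
        ones a b lt with (a Fin.≟ p) ×-dec (b Fin.≟ c)
        ... | yes (refl , refl) = trans (cong₂ (λ i j → write (nat s) 18 i j 1 18 (toℕ a) (toℕ b)) i≡ j≡) (write-same (nat s) 18 (toℕ a) (toℕ b) 1)
        ... | no ne = trans (cong₂ (λ i j → write (nat s) 18 i j 1 18 (toℕ a) (toℕ b)) i≡ j≡)
                (trans (write-entry (nat s) 18 (toℕ p) (toℕ c) 1 (toℕ a) (toℕ b) (toℕ-≢ ne)) (h a b (<-suc-≢ lt (combine-≢ ne))))

    -- Within a phase the total stays below `2Q`, so a light walk weighs at most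
    -- `2Q / (8f) = Q / (4f)`. Thus `4f` rounds at most double the initial bound `Q`, although each
    -- round doubles an edge of every set that meets the walk.
    alive-round : ∀ {p i s s′} → i < 4 * f → Alive p i s → nat s′ 17 0 0 ≡ 1 → Doubled (view 18 s) (view 18 s′) → Alive p (suc i) s′
    alive-round {p} {i} {s} {s′} i<4f al flag′ dd = record
      { flag = flag′
      ; pos  = λ a b → ≤-trans (pos a b) (grows a b)
      ; pot  = begin
          4 * f * total Y′                             ≤⟨ *-monoʳ-≤ (4 * f) sum ⟩
          4 * f * (total Y + w)                        ≡⟨ *-distribˡ-+ (4 * f) (total Y) w ⟩
          4 * f * total Y + 4 * f * w                  ≤⟨ +-mono-≤ pot 4fw≤Q ⟩
          (4 * f + i) * Q + Q                          ≡⟨ lem (4 * f) i Q ⟩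
          (4 * f + suc i) * Q                          ∎
      ; kill = kill′ }
      where
      open ≤-Reasoning
      open Alive al
      open Doubled dd
      Y = view 18 s
      Y′ = view 18 s′
      w = ∑ q (uncurry Y)
      Q = M * 2 ^ p
      lem : ∀ a i Q → (a + i) * Q + Q ≡ (a + suc i) * Q
      lem = solve-∀
      4fw≤Q : 4 * f * w ≤ Q
      4fw≤Q = *-cancelˡ-≤ (8 * f) {{>-nonZero (*-mono-≤ (s≤s (z≤n {7})) f>0)}} (begin
        8 * f * (4 * f * w)         ≡⟨ lem₁ f w ⟩
        4 * f * (8 * f * w)         ≤⟨ *-monoʳ-≤ (4 * f) (<⇒≤ light) ⟩
        4 * f * total Y             ≤⟨ pot ⟩
        (4 * f + i) * Q             ≤⟨ *-monoˡ-≤ Q (+-monoʳ-≤ (4 * f) (<⇒≤ i<4f)) ⟩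
        (4 * f + 4 * f) * Q         ≡⟨ cong (_* Q) (lem₂ f) ⟩
        8 * f * Q                   ∎)
        where
        lem₁ : ∀ f w → 8 * f * (4 * f * w) ≡ 4 * f * (8 * f * w)
        lem₁ = solve-∀
        lem₂ : ∀ f → 4 * f + 4 * f ≡ 8 * f
        lem₂ = solve-∀
      kill′ : ∀ Fs → Avoiding Fs ⊎ 2 ^ (p * (4 * f) + suc i) ≤ product Fs (uncurry Y′)
      kill′ Fs with kill Fs
      ... | inj₁ av = inj₁ av
      ... | inj₂ le with meets-or-avoids q Fs
      ...   | inj₂ av = inj₁ (q , conn , inH , short , av)
      ...   | inj₁ ((a , b) , e∈q , e∈Fs) = inj₂ (≤-trans (≤-reflexive (cong (2 ^_) (+-suc (p * (4 * f)) i)))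
              (≤-trans (*-monoʳ-≤ 2 le) (product-double e∈Fs (λ (a , b) → grows a b) (doubles a b e∈q))))

    alive-phase : ∀ {p s} → Alive p (f * 4) s → Alive (suc p) 0 s
    alive-phase {p} {s} al = record
      { flag = flag ; pos = pos
      ; pot = ≤-trans pot (≤-reflexive (lem f M (2 ^ p)))
      ; kill = λ Fs → subst (λ r → Avoiding Fs ⊎ 2 ^ r ≤ product Fs (uncurry (view 18 s))) (lem₂ p f) (kill Fs) }
      where
      open Alive al
      lem : ∀ f M E → (4 * f + f * 4) * (M * E) ≡ (4 * f + 0) * (M * (2 * E))
      lem = solve-∀
      lem₂ : ∀ p f → p * (4 * f) + f * 4 ≡ suc p * (4 * f) + 0
      lem₂ = solve-∀

    -- A set of at most `2f` edges meeting all walks found would have weight product at least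
    -- `2^(4fM)` after `M` phases. Each factor is at most the total, which is bounded by
    -- `M * 2^M < 2^(2M)`.
    robust : ∀ {s} → Alive M 0 s → ∀ Fs → length Fs ≤ 2 * f → Avoiding Fs
    robust {s} al Fs len with Alive.kill al Fs
    ... | inj₁ av = av
    ... | inj₂ le = ⊥-elim (<-irrefl refl (begin-strict
      2 ^ (M * (4 * f) + 0)                 ≤⟨ le ⟩
      product Fs (uncurry Y)                ≤⟨ product-≤ Fs (λ (a , b) → total-∈ Y a b) ⟩
      total Y ^ length Fs                   ≤⟨ ^-monoʳ-≤ (total Y) {{>-nonZero (≤-trans (pos u u) (total-∈ Y u u))}} len ⟩
      total Y ^ (2 * f)                     <⟨ ^-monoˡ-< (2 * f) {{>-nonZero (*-mono-≤ (s≤s (z≤n {1})) f>0)}} total< ⟩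
      (2 ^ M * 2 ^ M) ^ (2 * f)             ≡⟨ cong (_^ (2 * f)) (sym (^-distribˡ-+-* 2 M M)) ⟩
      (2 ^ (M + M)) ^ (2 * f)               ≡⟨ ^-*-assoc 2 (M + M) (2 * f) ⟩
      2 ^ ((M + M) * (2 * f))               ≡⟨ cong (2 ^_) (lem M f) ⟩
      2 ^ (M * (4 * f) + 0)                 ∎))
      where
      open ≤-Reasoning
      open Alive al
      Y = view 18 s
      lem : ∀ M f → (M + M) * (2 * f) ≡ M * (4 * f) + 0
      lem = solve-∀
      total< : total Y < 2 ^ M * 2 ^ M
      total< = ≤-<-trans (*-cancelˡ-≤ (4 * f) {{>-nonZero (*-mono-≤ (s≤s (z≤n {3})) f>0)}} (≤-trans pot (≤-reflexive (cong (_* (M * 2 ^ M)) (+-identityʳ (4 * f))))))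
        (*-monoˡ-< (2 ^ M) {{>-nonZero (≤-trans (s≤s z≤n) (n<2^n M))}} (n<2^n M))

    st-cong : ∀ {p i s s′} → nat s′ 17 0 0 ≡ nat s 17 0 0 → (∀ a b → view 18 s′ a b ≡ view 18 s a b) → St p i s → St p i s′
    st-cong e₁ e₂ (inj₂ (fl , rest)) = inj₂ (trans e₁ fl , rest)
    st-cong {p} {i} {s} {s′} e₁ e₂ (inj₁ al) = inj₁ record
      { flag = trans e₁ flag ; pos = λ a b → ≤-trans (pos a b) (≤-reflexive (sym (e₂ a b)))
      ; pot = subst (λ t → 4 * f * t ≤ (4 * f + i) * (M * 2 ^ p)) (sym (total-cong e₂)) pot
      ; kill = kill′ }
      where
      open Alive al
      kill′ : ∀ Fs → Avoiding Fs ⊎ 2 ^ (p * (4 * f) + i) ≤ product Fs (uncurry (view 18 s′))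
      kill′ Fs with kill Fs
      ... | inj₁ av = inj₁ av
      ... | inj₂ le = inj₂ (≤-trans le (product-mono Fs (λ (a , b) → ≤-reflexive (sym (e₂ a b)))))

    run-guarded : ∀ p i s → i < 4 * f → Ctx s → St p i s →
      Run (if lit 1 ≤ⁿ cell 17 then roundP else′ skip) s (1 + eval roundT n + 0) λ s′ → Frame 17 s s′ × St p (suc i) s′
    run-guarded p i s i<4f ctx st = run-if (go st) (stop st)
      where
      go : St p i s → (1 ≤ᵇ nat s 17 0 0) ≡ true → Run roundP s (eval roundT n) λ s′ → Frame 17 s s′ × St p (suc i) s′
      go (inj₂ (fl , _)) e = ⊥-elim (contra (subst (λ z → (1 ≤ᵇ z) ≡ true) fl e))
        where
        contra : ¬ false ≡ true
        contra ()
      go (inj₁ al) e = run-map post (run-round s ctx f>0 (Alive.flag al))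
        where
        post : ∀ s′ → _ → Frame 17 s s′ × St p (suc i) s′
        post s′ (fr , inj₁ (fl , nl)) = fr , inj₂ (fl , view 18 s , ≤-trans (Alive.pos al u u) (total-∈ (view 18 s) u u) , nl)
        post s′ (fr , inj₂ (fl , dd)) = fr , inj₁ (alive-round {p} {i} {s} {s′} i<4f al fl dd)
      stop : St p i s → (1 ≤ᵇ nat s 17 0 0) ≡ false → Run skip s 0 λ s′ → Frame 17 s s′ × St p (suc i) s′
      stop (inj₂ dead) e = run-skip (frame-refl , inj₂ dead)
      stop (inj₁ al) e = ⊥-elim (contra (subst (λ z → (1 ≤ᵇ z) ≡ false) (Alive.flag al) e))
        where
        contra : ¬ true ≡ false
        contra ()

    run-phase : ∀ p s → Ctx s → St p 0 s →
      Run (for 15 below F run (for 16 below lit 4 run (if lit 1 ≤ⁿ cell 17 then roundP else′ skip))) s (eval phaseT n)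
        λ s′ → Frame 15 s s′ × St (suc p) 0 s′
    run-phase p s₀ ctx st = run-map post (run-for 15 F _ f _ Inv
        (λ j s x (fr , st) → frame-put 15 0 0 x fr , st-cong refl (λ a b → refl) st)
        (λ j s (fr , _) → trans (frame fr 1 0 0) (f≡ ctx))
        outer s₀ n f≤n (frame-refl , st))
      where
      Inv : ℕ → State → Set
      Inv j s = Frame 15 s₀ s × St p (j * 4) s
      post : ∀ s′ → Inv f s′ → Frame 15 s₀ s′ × St (suc p) 0 s′
      post s′ (fr , inj₁ al)   = fr , inj₁ (alive-phase al)
      post s′ (fr , inj₂ dead) = fr , inj₂ dead
      outer : ∀ j s → j < f → Inv j s → nat s 15 0 0 ≡ j → Run _ s _ λ s′ → nat s′ 15 0 0 ≡ j × Inv (suc j) s′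
      outer j s j<f (fr , st) ctr = run-map
          (λ s′ (fr′ , st′) → trans (frame fr′ 15 0 0) ctr , frame-trans fr (frame-weaken (≤ᵇ⇒≤ 15 16 tt) fr′) , subst (λ i → St p i s′) (+-comm (j * 4) 4) st′)
          (run-for 16 (lit 4) _ 4 (1 + eval roundT n + 0) Inv′
            (λ l s x (fr , st) → frame-put 16 0 0 x fr , st-cong refl (λ a b → refl) st)
            (λ l s _ → refl)
            inner s 4 ≤-refl (frame-refl , subst (λ i → St p i s) (sym (+-identityʳ (j * 4))) st))
        where
        Inv′ : ℕ → State → Set
        Inv′ l s′ = Frame 16 s s′ × St p (j * 4 + l) s′
        inner : ∀ l s′ → l < 4 → Inv′ l s′ → nat s′ 16 0 0 ≡ l → Run _ s′ (1 + eval roundT n + 0) λ s″ → nat s″ 16 0 0 ≡ l × Inv′ (suc l) s″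
        inner l s′ l<4 (fr′ , st′) ctr′ = run-map
            (λ s″ (fr″ , st″) → trans (frame fr″ 16 0 0) ctr′ , frame-trans fr′ (frame-weaken (≤ᵇ⇒≤ 16 17 tt) fr″) , subst (λ i → St p i s″) (sym (+-suc (j * 4) l)) st″)
            (run-guarded p (j * 4 + l) s′ below (ctx-frame fr′ (ctx-frame fr ctx)) st′)
          where
          below : j * 4 + l < 4 * f
          below = ≤-trans (≤-trans (+-monoʳ-< (j * 4) l<4) (≤-reflexive (+-comm (j * 4) 4))) (≤-trans (*-monoˡ-≤ 4 j<f) (≤-reflexive (*-comm f 4)))

    run-test : ∀ s → Ctx s → Run testP s (eval testT n) λ s′ → Frame 13 s s′ ×
      ((nat s′ 17 0 0 ≡ 0 × ∃ λ Y → 0 < total Y × NoLight Y) ⊎ (nat s′ 17 0 0 ≡ 1 × (∀ Fs → length Fs ≤ 2 * f → Avoiding Fs)))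
    run-test s₀ ctx = run-seq (run-map after (run-initY s₀ ctx))
      where
      Out : State → Set
      Out s′ = Frame 13 s₀ s′ × ((nat s′ 17 0 0 ≡ 0 × ∃ λ Y → 0 < total Y × NoLight Y) ⊎ (nat s′ 17 0 0 ≡ 1 × (∀ Fs → length Fs ≤ 2 * f → Avoiding Fs)))
      Inv : ℕ → State → Set
      Inv r s = Frame 13 s₀ s × St r 0 s
      post : ∀ s′ → Inv (n * n) s′ → Out s′
      post s′ (fr , inj₁ al)   = fr , inj₂ (Alive.flag al , robust al)
      post s′ (fr , inj₂ dead) = fr , inj₁ dead
      after : ∀ s₁ → Frame 18 s₀ s₁ × (∀ a b → view 18 s₁ a b ≡ 1) → Run _ s₁ (1 + eval (pairs phaseT) n) Out
      after s₁ (fr₁ , ones) = run-seq (run-put (run-map post (run-pairs n 13 14 (λ ()) N _ (eval phaseT n) Inv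
          (λ r s x (fr , st) → frame-put 13 0 0 x fr , st-cong refl (λ a b → refl) st)
          (λ r s x (fr , st) → frame-put 14 0 0 x fr , st-cong refl (λ a b → refl) st)
          (λ r s (fr , _) → trans (frame fr 0 0 0) (n≡ ctx))
          step s₂ (frame-put 17 0 0 1 (frame-weaken (≤ᵇ⇒≤ 13 18 tt) fr₁) , inj₁ start))))
        where
        s₂ : State
        s₂ = put 17 0 0 1 s₁
        total≡ : total (view 18 s₂) ≡ M
        total≡ = trans (total-cong ones) (total-one n)
        start : Alive 0 0 s₂
        start = record
          { flag = refl ; pos = λ a b → ≤-reflexive (sym (ones a b))
          ; pot = ≤-reflexive (trans (cong (4 * f *_) total≡) (lem (4 * f) M))
          ; kill = λ Fs → inj₂ (≤-reflexive (sym (product-one Fs))) }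
          where
          lem : ∀ a M → a * M ≡ (a + 0) * (M * 1)
          lem = solve-∀
          product-one : ∀ Fs → product Fs (uncurry (view 18 s₂)) ≡ 1
          product-one []             = refl
          product-one ((a , b) ∷ Fs) = cong₂ _*_ (ones a b) (product-one Fs)
        step : ∀ (a b : Fin n) s → Inv (toℕ (combine a b)) s → nat s 13 0 0 ≡ toℕ a → nat s 14 0 0 ≡ toℕ b →
          Run _ s (eval phaseT n) λ s′ → nat s′ 13 0 0 ≡ toℕ a × nat s′ 14 0 0 ≡ toℕ b × Inv (suc (toℕ (combine a b))) s′
        step a b s (fr , st) i≡ j≡ = run-map
          (λ s′ (fr′ , st′) → trans (frame fr′ 13 0 0) i≡ , trans (frame fr′ 14 0 0) j≡ , frame-trans fr (frame-weaken (≤ᵇ⇒≤ 13 15 tt) fr′) , st′)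
          (run-phase (toℕ (combine a b)) s (ctx-frame fr ctx) st)

  -- Array 5 marks the processed pairs.  Cells 9 and 10 hold the pair to be
  -- processed, cell 8 tells whether there is one, and cell 17 whether it
  -- passed the test for being dropped.

  selectP processP stepP mainP copyP program : Program
  selectP = (8 ≔ lit 0) ⨾ for 11 below N run (for 12 below N run
    (if (lit 1 ≤ⁿ (3 [ cell 11 , cell 12 ])) &
        ((neg (lit 1 ≤ⁿ (5 [ cell 11 , cell 12 ]))) &
         (neg ((lit 1 ≤ⁿ cell 8) & (neg ((0 [ cell 11 , cell 12 ]ʳ) ≤ʳ (0 [ cell 9 , cell 10 ]ʳ))))))
      then (8 ≔ lit 1) ⨾ (9 ≔ cell 11) ⨾ (10 ≔ cell 12)
      else′ skip))
  processP = (5 [ cell 9 , cell 10 ]:= lit 1) ⨾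
    (if lit 1 ≤ⁿ (4 [ cell 9 , cell 10 ]) then skip else′
      (testP ⨾ (if lit 1 ≤ⁿ cell 17 then skip else′
        ((4 [ cell 9 , cell 10 ]:= lit 1) ⨾ (4 [ cell 10 , cell 9 ]:= lit 1)))))
  stepP = selectP ⨾ (if lit 1 ≤ⁿ cell 8 then processP else′ skip)
  mainP = for 6 below N run (for 7 below N run stepP)
  copyP = for 6 below N run (for 7 below N run (4 [ cell 6 , cell 7 ]:= 3 [ cell 6 , cell 7 ]))
  -- If `n ≤ f` or `n ≤ k`, all of the at most `n² ≤ k² f n` edges can be kept. Otherwise loops up
  -- to `f` and `2k - 1` are polynomial in `n`, although the input size counts only the bit lengths
  -- of `f` and `k`.
  program = if N ≤ⁿ F then copyP else′ (if N ≤ⁿ cell 2 then copyP else′ mainP)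

  selectT processT stepT mainT copyT : Poly
  selectT  = con 1 ⊞ pairs (con 4)
  processT = con 1 ⊞ (con 1 ⊞ con 0 ⊞ (testT ⊞ (con 1 ⊞ con 0 ⊞ con 2)))
  stepT    = selectT ⊞ (con 1 ⊞ processT ⊞ con 0)
  mainT    = pairs stepT
  copyT    = pairs (con 1)

  does-T : {P : Set} (d : Dec P) → T (does d) → P
  does-T (yes p) _ = p

  T-does : {P : Set} (d : Dec P) → P → T (does d)
  T-does (yes _) p = tt
  T-does (no ¬p) p = ⊥-elim (¬p p)

  joins? : ∀ {n} (es : List (Edge n)) d → Dec (es joins d)
  joins? es d = (d ∈? es) ⊎-dec (swap d ∈? es)
    where open Membership (Product.≡-dec Fin._≟_ Fin._≟_)

  joinsᵇ : ∀ {n} → List (Edge n) → Fin n → Fin n → Bool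
  joinsᵇ es a b = does (joins? es (a , b))

  selected : ∀ {a b c d} → a ∧ (not b ∧ not (c ∧ not d)) ≡ true → T a × ¬ T b × (T c → T d)
  selected {true} {false} {true}  {true} _ = tt , (λ ()) , λ _ → tt
  selected {true} {false} {false} _ = tt , (λ ()) , λ ()

  rejected : ∀ {a b c d} → a ∧ (not b ∧ not (c ∧ not d)) ≡ false → T a → ¬ T b → T c × ¬ T d
  rejected {true} {true}  _ _ h = ⊥-elim (h tt)
  rejected {true} {false} {true} {false} _ _ _ = tt , λ ()

  -- Selecting a shortest unprocessed pair

  module Selection (ℝ : Reals) {n : ℕ} where
    open Reals ℝ using (Carrier) renaming (_≤_ to _⊑_; _≤?_ to _⊑?_; ≤-refl to ⊑-refl; ≤-trans to ⊑-trans; total to ⊑-total)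
    open OverReals ℝ
    open Logic ℝ

    entry : ℕ → State → Fin n → Fin n → ℕ
    entry m s a b = nat s m (toℕ a) (toℕ b)

    length-of : State → Fin n → Fin n → Carrier
    length-of s a b = real s 0 (toℕ a) (toℕ b)

    Open : State → Fin n → Fin n → Set
    Open s a b = 1 ≤ entry 3 s a b × ¬ 1 ≤ entry 5 s a b

    Found : State → State → (Fin n → Fin n → Set) → Set
    Found s₀ s seen = ∃ λ a → ∃ λ b → nat s 9 0 0 ≡ toℕ a × nat s 10 0 0 ≡ toℕ b × Open s₀ a b ×
      (∀ c d → seen c d → Open s₀ c d → length-of s₀ a b ⊑ length-of s₀ c d)

    Best : State → State → (Fin n → Fin n → Set) → Set
    Best s₀ s seen = (nat s 8 0 0 ≡ 0 × (∀ a b → seen a b → ¬ Open s₀ a b)) ⊎ (nat s 8 0 0 ≡ 1 × Found s₀ s seen)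

    run-select : ∀ s → nat s 0 0 0 ≡ n → Run selectP s (eval selectT n) λ s′ → Frame 8 s s′ ×
      ((nat s′ 8 0 0 ≡ 0 × (∀ a b → ¬ Open s a b)) ⊎ (nat s′ 8 0 0 ≡ 1 × ∃ λ a → ∃ λ b → nat s′ 9 0 0 ≡ toℕ a × nat s′ 10 0 0 ≡ toℕ b × Open s a b ×
        (∀ c d → Open s c d → length-of s a b ⊑ length-of s c d)))
    run-select s₀ n≡ = run-seq (run-put (run-map finish (run-pairs n 11 12 (λ ()) N _ 4 Inv
        (λ r s x (fr , best) → frame-put 11 0 0 x fr , best)
        (λ r s x (fr , best) → frame-put 12 0 0 x fr , best)
        (λ r s (fr , _) → trans (frame fr 0 0 0) n≡)
        step _ (frame-put 8 0 0 0 frame-refl , inj₁ (refl , λ _ _ ())))))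
      where
      Seen : ℕ → Fin n → Fin n → Set
      Seen r a b = toℕ (combine a b) < r
      Inv : ℕ → State → Set
      Inv r s = Frame 8 s₀ s × Best s₀ s (Seen r)
      finish : ∀ s → Inv (n * n) s → _
      finish s (fr , inj₁ (e , none)) = fr , inj₁ (e , λ a b → none a b (Fin.toℕ<n (combine a b)))
      finish s (fr , inj₂ (e , a , b , a≡ , b≡ , op , least)) = fr , inj₂ (e , a , b , a≡ , b≡ , op , λ c d → least c d (Fin.toℕ<n (combine c d)))
      step : ∀ a b s → Inv (toℕ (combine a b)) s → nat s 11 0 0 ≡ toℕ a → nat s 12 0 0 ≡ toℕ b →
        Run _ s 4 λ s′ → nat s′ 11 0 0 ≡ toℕ a × nat s′ 12 0 0 ≡ toℕ b × Inv (suc (toℕ (combine a b))) s′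
      step a b s (fr , best) i≡ j≡ = run-if {t = 3} {t′ = 0} yes-case no-case
        where
        β₁ = 1 ≤ᵇ nat s 3 (nat s 11 0 0) (nat s 12 0 0)
        β₂ = 1 ≤ᵇ nat s 5 (nat s 11 0 0) (nat s 12 0 0)
        β₃ = 1 ≤ᵇ nat s 8 0 0
        old new : Carrier
        old = real s 0 (nat s 9 0 0) (nat s 10 0 0)
        new = real s 0 (nat s 11 0 0) (nat s 12 0 0)
        at-ab : ∀ m → {T (m <ᵇ 8)} → nat s m (nat s 11 0 0) (nat s 12 0 0) ≡ entry m s₀ a b
        at-ab m {p} = trans (cong₂ (nat s m) i≡ j≡) (frame fr m (toℕ a) (toℕ b) {p})
        new≡ : new ≡ length-of s₀ a b
        new≡ = trans (cong₂ (real s 0) i≡ j≡) (cong (λ ρ → ρ 0 (toℕ a) (toℕ b)) (proj₂ fr))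
        old≡ : ∀ {c d} → nat s 9 0 0 ≡ toℕ c → nat s 10 0 0 ≡ toℕ d → old ≡ length-of s₀ c d
        old≡ {c} {d} c≡ d≡ = trans (cong₂ (real s 0) c≡ d≡) (cong (λ ρ → ρ 0 (toℕ c) (toℕ d)) (proj₂ fr))
        T-β₃ : nat s 8 0 0 ≡ 1 → T β₃
        T-β₃ e = ≤⇒≤ᵇ (≤-reflexive (sym e))
        yes-case : β₁ ∧ (not β₂ ∧ not (β₃ ∧ not (does (new ⊑? old)))) ≡ true → _
        yes-case e = run-seq (run-put (run-seq (run-put (run-put (i≡ , j≡ ,
            frame-put 10 0 0 (nat s 12 0 0) (frame-put 9 0 0 (nat s 11 0 0) (frame-put 8 0 0 1 fr)) ,
            inj₂ (refl , a , b , i≡ , j≡ , op , least best))))))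
          where
          sel : T β₁ × ¬ T β₂ × (T β₃ → T (does (new ⊑? old)))
          sel = selected {β₁} {β₂} e
          op : Open s₀ a b
          op = subst (1 ≤_) (at-ab 3) (≤ᵇ⇒≤ 1 _ (proj₁ sel)) , λ le → proj₁ (proj₂ sel) (≤⇒≤ᵇ (subst (1 ≤_) (sym (at-ab 5)) le))
          least : Best s₀ s (Seen (toℕ (combine a b))) → ∀ c d → Seen (suc (toℕ (combine a b))) c d → Open s₀ c d → length-of s₀ a b ⊑ length-of s₀ c d
          least best c d lt op with (c Fin.≟ a) ×-dec (d Fin.≟ b)
          ... | yes (refl , refl) = ⊑-refl
          least (inj₁ (_ , none)) c d lt op | no ne = ⊥-elim (none c d (<-suc-≢ lt (combine-≢ ne)) op)
          least (inj₂ (fl , a′ , b′ , a≡ , b≡ , _ , least′)) c d lt op | no ne =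
            ⊑-trans (subst₂ _⊑_ new≡ (old≡ a≡ b≡) (does-T (new ⊑? old) (proj₂ (proj₂ sel) (T-β₃ fl)))) (least′ c d (<-suc-≢ lt (combine-≢ ne)) op)
        no-case : β₁ ∧ (not β₂ ∧ not (β₃ ∧ not (does (new ⊑? old)))) ≡ false → _
        no-case e = run-skip (i≡ , j≡ , fr , extended best)
          where
          rej : Open s₀ a b → T β₃ × ¬ T (does (new ⊑? old))
          rej (h₃ , h₅) = rejected {β₁} {β₂} e (≤⇒≤ᵇ (subst (1 ≤_) (sym (at-ab 3)) h₃)) (λ t → h₅ (subst (1 ≤_) (at-ab 5) (≤ᵇ⇒≤ 1 _ t)))
          extended : Best s₀ s (Seen (toℕ (combine a b))) → Best s₀ s (Seen (suc (toℕ (combine a b))))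
          extended (inj₁ (fl , none)) = inj₁ (fl , none′)
            where
            none′ : ∀ c d → Seen (suc (toℕ (combine a b))) c d → ¬ Open s₀ c d
            none′ c d lt op with (c Fin.≟ a) ×-dec (d Fin.≟ b)
            ... | yes (refl , refl) = 1+n≢0 (n≤0⇒n≡0 (subst (1 ≤_) fl (≤ᵇ⇒≤ 1 _ (proj₁ (rej op)))))
            ... | no ne = none c d (<-suc-≢ lt (combine-≢ ne)) op
          extended (inj₂ (fl , a′ , b′ , a≡ , b≡ , op′ , least)) = inj₂ (fl , a′ , b′ , a≡ , b≡ , op′ , least′)
            where
            least′ : ∀ c d → Seen (suc (toℕ (combine a b))) c d → Open s₀ c d → length-of s₀ a′ b′ ⊑ length-of s₀ c d
            least′ c d lt op with (c Fin.≟ a) ×-dec (d Fin.≟ b)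
            ... | no ne = least c d (<-suc-≢ lt (combine-≢ ne)) op
            ... | yes (refl , refl) with ⊑-total old new
            ...   | inj₁ le = subst₂ _⊑_ (old≡ a≡ b≡) new≡ le
            ...   | inj₂ ge = ⊥-elim (proj₂ (rej op) (T-does (new ⊑? old) ge))

  -- The greedy invariant

  module Greedy (ℝ : Reals) {n f κ : ℕ} (G : OverReals.WeightedGraph ℝ n) where
    open Reals ℝ using (Carrier; ≤-respˡ-≈) renaming (_≤_ to _⊑_)
    open OverReals ℝ
    open Logic ℝ
    open Selection ℝ {n}

    A : Fin n → Fin n → Bool
    A = adj (graph G)

    w : Fin n → Fin n → Carrier
    w = weight G

    K̂ : ℕ
    K̂ = suc κ + suc κ ∸ 1

    A-sym : ∀ {a b} → T (A a b) → T (A b a)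
    A-sym {a} {b} = subst T (symmetric (graph G) a b)

    -- At most `K̂` edges, none longer than `w a b`, give a detour of cost at most `(2k - 1) w a b`.
    -- The list `Fs` consists of ordered pairs, two for each of `f` faults.
    Robust : List (Edge n) → Fin n → Fin n → Set
    Robust es a b = ∀ Fs → length Fs ≤ 2 * f → ∃ λ q → Conn proj₁ proj₂ a q b ×
      (∀ e → e ∈ q → es joins e × uncurry w e ⊑ w a b) × length q ≤ K̂ × (∀ e → e ∈ q → ¬ e ∈ Fs)

    -- H is the adjacency matrix of the spanner so far, and D marks the
    -- ordered pairs that have been processed.
    record Core (H D : Fin n → Fin n → ℕ) : Set where
      field
        es      : List (Edge n)
        built   : Built (suc κ) (8 * f) es
        H≡      : ∀ a b → H a b ≡ bit (joinsᵇ es a b)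
        es-adj  : ∀ a b → es joins (a , b) → T (A a b)
        -- Insertion joins both ordered pairs, though possibly only one of them has been processed.
        es-done : ∀ a b → es joins (a , b) → 1 ≤ D a b ⊎ 1 ≤ D b a
        order   : ∀ a b c d → 1 ≤ D a b → ¬ 1 ≤ D c d → T (A c d) → w a b ⊑ w c d
        covered : ∀ a b → T (A a b) → 1 ≤ D a b → es joins (a , b) ⊎ Robust es a b

    core-cong : ∀ {H D H′ D′} → (∀ a b → H′ a b ≡ H a b) → (∀ a b → D′ a b ≡ D a b) → Core H D → Core H′ D′
    core-cong {D = D} {D′ = D′} eH eD core = record
      { es = es ; built = built ; es-adj = es-adj
      ; H≡ = λ a b → trans (eH a b) (H≡ a b)
      ; es-done = done′
      ; order = λ a b c d h h′ → order a b c d (subst (1 ≤_) (eD a b) h) (λ le → h′ (subst (1 ≤_) (sym (eD c d)) le))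
      ; covered = λ a b t h → covered a b t (subst (1 ≤_) (eD a b) h) }
      where
      open Core core
      done′ : ∀ a b → es joins (a , b) → 1 ≤ D′ a b ⊎ 1 ≤ D′ b a
      done′ a b j with es-done a b j
      ... | inj₁ h = inj₁ (subst (1 ≤_) (sym (eD a b)) h)
      ... | inj₂ h = inj₂ (subst (1 ≤_) (sym (eD b a)) h)

    module Advance {H D H′ D′ : Fin n → Fin n → ℕ} (core : Core H D) (u v : Fin n)
      (adj-uv : T (A u v)) (least : ∀ c d → ¬ 1 ≤ D c d → T (A c d) → w u v ⊑ w c d)
      (now : D′ u v ≡ 1) (same : ∀ a b → ¬ (a ≡ u × b ≡ v) → D′ a b ≡ D a b) where

      open Core core

      grows : ∀ a b → 1 ≤ D a b → 1 ≤ D′ a b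
      grows a b h with (a Fin.≟ u) ×-dec (b Fin.≟ v)
      ... | yes (refl , refl) = ≤-reflexive (sym now)
      ... | no ne = subst (1 ≤_) (sym (same a b ne)) h

      advance : ∀ {es′} → Built (suc κ) (8 * f) es′ → (∀ a b → H′ a b ≡ bit (joinsᵇ es′ a b)) →
        (∀ d → es joins d → es′ joins d) → (∀ d → es′ joins d → es joins d ⊎ d ≡ (u , v) ⊎ d ≡ (v , u)) →
        es′ joins (u , v) ⊎ Robust es′ u v → Core H′ D′
      advance {es′} built′ H≡′ old⇒ ⇒old cov = record
        { es = es′ ; built = built′ ; H≡ = H≡′ ; es-adj = adj′ ; es-done = done′ ; order = order′ ; covered = covered′ }
        where
        adj′ : ∀ a b → es′ joins (a , b) → T (A a b)
        adj′ a b j with ⇒old (a , b) j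
        ... | inj₁ j′          = es-adj a b j′
        ... | inj₂ (inj₁ refl) = adj-uv
        ... | inj₂ (inj₂ refl) = A-sym adj-uv
        done′ : ∀ a b → es′ joins (a , b) → 1 ≤ D′ a b ⊎ 1 ≤ D′ b a
        done′ a b j with ⇒old (a , b) j
        ... | inj₂ (inj₁ refl) = inj₁ (≤-reflexive (sym now))
        ... | inj₂ (inj₂ refl) = inj₂ (≤-reflexive (sym now))
        ... | inj₁ j′ with es-done a b j′
        ...   | inj₁ h = inj₁ (grows a b h)
        ...   | inj₂ h = inj₂ (grows b a h)
        order′ : ∀ a b c d → 1 ≤ D′ a b → ¬ 1 ≤ D′ c d → T (A c d) → w a b ⊑ w c d
        order′ a b c d h h′ t with (a Fin.≟ u) ×-dec (b Fin.≟ v)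
        ... | yes (refl , refl) = least c d (λ le → h′ (grows c d le)) t
        ... | no ne = order a b c d (subst (1 ≤_) (same a b ne) h) (λ le → h′ (grows c d le)) t
        covered′ : ∀ a b → T (A a b) → 1 ≤ D′ a b → es′ joins (a , b) ⊎ Robust es′ a b
        covered′ a b t h with (a Fin.≟ u) ×-dec (b Fin.≟ v)
        ... | yes (refl , refl) = cov
        ... | no ne with covered a b t (subst (1 ≤_) (same a b ne) h)
        ...   | inj₁ j = inj₁ (old⇒ (a , b) j)
        -- The walks found earlier persist when edges are inserted.
        ...   | inj₂ r = inj₂ λ Fs len → let (q , c , l , rest) = r Fs len in
                  q , c , (λ e e∈ → old⇒ e (proj₁ (l e e∈)) , proj₂ (l e e∈)) , rest

    undone : (Fin n → Fin n → ℕ) → ℕ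
    undone D = total (λ a b → 1 ∸ D a b)

    AllDone : (Fin n → Fin n → ℕ) → Set
    AllDone D = ∀ a b → T (A a b) → 1 ≤ D a b

    record Input (s : State) : Set where
      field
        n≡    : nat s 0 0 0 ≡ n
        f≡    : nat s 1 0 0 ≡ f
        k≡    : nat s 2 0 0 ≡ suc κ
        adj≡  : ∀ a b → entry 3 s a b ≡ bit (A a b)
        real≡ : ∀ a b → T (A a b) → length-of s a b ≡ w a b

    input-frame : ∀ {L s s′} → {T (4 ≤ᵇ L)} → Frame L s s′ → Input s → Input s′
    input-frame {L} {s} {s′} {p} fr i = record
      { n≡ = trans (fr′ 0 0 0) (n≡ i) ; f≡ = trans (fr′ 1 0 0) (f≡ i) ; k≡ = trans (fr′ 2 0 0) (k≡ i)
      ; adj≡ = λ a b → trans (fr′ 3 (toℕ a) (toℕ b)) (adj≡ i a b)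
      ; real≡ = λ a b t → trans (cong (λ ρ → ρ 0 (toℕ a) (toℕ b)) (proj₂ fr)) (real≡ i a b t) }
      where
      open Input
      fr′ : ∀ a i j → {T (a <ᵇ 4)} → nat s′ a i j ≡ nat s a i j
      fr′ a i j {q} = frame {4} {s} {s′} (frame-weaken (≤ᵇ⇒≤ 4 L p) fr) a i j {q}

    Step : State → State → Set
    Step s s′ = Frame 4 s s′ × nat s′ 6 0 0 ≡ nat s 6 0 0 × nat s′ 7 0 0 ≡ nat s 7 0 0 × Core (entry 4 s′) (entry 5 s′)

    run-process : (f≤n : f ≤ n) (k≤n : suc κ ≤ n) (f>0 : 0 < f) → ∀ s → Input s → Core (entry 4 s) (entry 5 s) → ∀ u v → nat s 9 0 0 ≡ toℕ u → nat s 10 0 0 ≡ toℕ v →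
      T (A u v) → ¬ 1 ≤ entry 5 s u v → (∀ c d → ¬ 1 ≤ entry 5 s c d → T (A c d) → w u v ⊑ w c d) →
      Run processP s (eval processT n) λ s′ → Step s s′ × suc (undone (entry 5 s′)) ≤ undone (entry 5 s)
    run-process f≤n k≤n f>0 s inp core u v u≡ v≡ adj-uv open-uv least = run-seq (run-put (run-if {t = 0} {t′ = eval testT n + 3} present absent))
      where
      open Core core
      s₁ : State
      s₁ = put 5 (nat s 9 0 0) (nat s 10 0 0) 1 s
      Out : State → Set
      Out s′ = Step s s′ × suc (undone (entry 5 s′)) ≤ undone (entry 5 s)
      now : entry 5 s₁ u v ≡ 1
      now = trans (cong₂ (λ i j → write (nat s) 5 i j 1 5 (toℕ u) (toℕ v)) u≡ v≡) (write-same (nat s) 5 (toℕ u) (toℕ v) 1)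
      same : ∀ a b → ¬ (a ≡ u × b ≡ v) → entry 5 s₁ a b ≡ entry 5 s a b
      same a b ne = trans (cong₂ (λ i j → write (nat s) 5 i j 1 5 (toℕ a) (toℕ b)) u≡ v≡) (write-entry (nat s) 5 (toℕ u) (toℕ v) 1 (toℕ a) (toℕ b) (toℕ-≢ ne))
      fewer : ∀ s′ → (∀ a b → entry 5 s′ a b ≡ entry 5 s₁ a b) → suc (undone (entry 5 s′)) ≤ undone (entry 5 s)
      fewer s′ e = ≤-reflexive (begin
        suc (undone (entry 5 s′))                            ≡⟨ cong suc (total-cong (λ a b → cong (1 ∸_) (e a b))) ⟩
        suc (undone (entry 5 s₁))                            ≡⟨ sym (+-comm _ 1) ⟩
        undone (entry 5 s₁) + 1                              ≡⟨ cong (λ z → undone (entry 5 s₁) + (1 ∸ z)) (sym (n<1⇒n≡0 (≰⇒> open-uv))) ⟩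
        undone (entry 5 s₁) + (1 ∸ entry 5 s u v)            ≡⟨ total-update (λ a b → 1 ∸ entry 5 s a b) (λ a b → 1 ∸ entry 5 s₁ a b) u v (λ a b ne → cong (1 ∸_) (same a b ne)) ⟩
        undone (entry 5 s) + (1 ∸ entry 5 s₁ u v)            ≡⟨ cong (λ z → undone (entry 5 s) + (1 ∸ z)) now ⟩
        undone (entry 5 s) + 0                               ≡⟨ +-identityʳ _ ⟩
        undone (entry 5 s)                                   ∎)
        where open ≡-Reasoning
      fr₁ : Frame 4 s s₁
      fr₁ = frame-put 5 (nat s 9 0 0) (nat s 10 0 0) 1 frame-refl
      H₁ : nat s 4 (nat s 9 0 0) (nat s 10 0 0) ≡ bit (joinsᵇ es u v)
      H₁ = trans (cong₂ (nat s 4) u≡ v≡) (H≡ u v)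
      unchanged : ∀ s′ → (∀ a b → entry 4 s′ a b ≡ entry 4 s a b) → (∀ a b → entry 5 s′ a b ≡ entry 5 s₁ a b) → es joins (u , v) ⊎ Robust es u v → Core (entry 4 s′) (entry 5 s′)
      unchanged s′ e₄ e₅ = Advance.advance core u v adj-uv least (trans (e₅ u v) now) (λ a b ne → trans (e₅ a b) (same a b ne))
        built (λ a b → trans (e₄ a b) (H≡ a b)) (λ d j → j) (λ d j → inj₁ j)
      present : (1 ≤ᵇ nat s 4 (nat s 9 0 0) (nat s 10 0 0)) ≡ true → Run skip s₁ 0 Out
      present e = run-skip ((fr₁ , refl , refl , unchanged s₁ (λ a b → refl) (λ a b → refl) (inj₁ joined)) , fewer s₁ (λ a b → refl))
        where
        joined : es joins (u , v)
        joined = does-T (joins? es (u , v)) (bit-≢0 λ z → 1+n≢0 (n≤0⇒n≡0 (≤-trans (≤ᵇ⇒≤ 1 _ (subst T (sym e) tt)) (≤-reflexive (trans H₁ z)))))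
      absent : (1 ≤ᵇ nat s 4 (nat s 9 0 0) (nat s 10 0 0)) ≡ false → Run _ s₁ (eval testT n + 3) Out
      absent e = run-seq (run-map after (run-test s₁ ctx))
        where
        fresh : ¬ es joins (u , v)
        fresh j = subst T e (≤⇒≤ᵇ (≤-reflexive (sym (trans H₁ (bit-T (T-does (joins? es (u , v)) j))))))
        irr : ∀ x → ¬ T (joinsᵇ es x x)
        irr x t = subst T (irreflexive (graph G) x) (es-adj x x (does-T (joins? es (x , x)) t))
        open Round ℝ {n} {f} {suc κ} (joinsᵇ es) u v f≤n k≤n using (Ctx)
        open Round′ ℝ {n} {f} {suc κ} (joinsᵇ es) irr u v f≤n k≤n using (NoLight)
        open Testing ℝ {n} {f} {suc κ} (joinsᵇ es) irr u v f≤n k≤n f>0 using (run-test; Avoiding)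
        open Input inp
        ctx : Ctx s₁
        ctx = record { n≡ = n≡ ; f≡ = f≡ ; k≡ = k≡ ; H≡ = H≡ ; u≡ = u≡ ; v≡ = v≡ }
        robust : (∀ Fs → length Fs ≤ 2 * f → Avoiding Fs) → Robust es u v
        robust av Fs len = let (q , c , inH , short , avoid) = av Fs len in q , c , (λ e e∈ → light e (inH e e∈)) , short , avoid
          where
          light : ∀ e → T (uncurry (joinsᵇ es) e) → es joins e × uncurry w e ⊑ w u v
          light (a , b) t = j , heavier (es-done a b j)
            where
            j : es joins (a , b)
            j = does-T (joins? es (a , b)) t
            heavier : 1 ≤ entry 5 s a b ⊎ 1 ≤ entry 5 s b a → w a b ⊑ w u v
            heavier (inj₁ h) = order a b u v h open-uv adj-uv
            heavier (inj₂ h) = ≤-respˡ-≈ (weight-sym G b a (A-sym (es-adj a b j))) (order b a u v h open-uv adj-uv)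
        after : ∀ s₂ → Frame 13 s₁ s₂ × ((nat s₂ 17 0 0 ≡ 0 × ∃ λ Y → 0 < total Y × NoLight Y) ⊎ (nat s₂ 17 0 0 ≡ 1 × (∀ Fs → length Fs ≤ 2 * f → Avoiding Fs))) →
          Run (if lit 1 ≤ⁿ cell 17 then skip else′ ((4 [ cell 9 , cell 10 ]:= lit 1) ⨾ (4 [ cell 10 , cell 9 ]:= lit 1))) s₂ 3 Out
        after s₂ (fr₂ , res) = run-if {t = 0} {t′ = 2} (keep res) (add-edge res)
          where
          fr₀₂ : Frame 4 s s₂
          fr₀₂ = frame-trans fr₁ (frame-weaken (≤ᵇ⇒≤ 4 13 tt) fr₂)
          keep : _ → (1 ≤ᵇ nat s₂ 17 0 0) ≡ true → Run skip s₂ 0 Out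
          keep (inj₂ (_ , av)) e = run-skip ((fr₀₂ , frame fr₂ 6 0 0 , frame fr₂ 7 0 0 ,
            unchanged s₂ (λ a b → frame fr₂ 4 (toℕ a) (toℕ b)) (λ a b → frame fr₂ 5 (toℕ a) (toℕ b)) (inj₂ (robust av))) , fewer s₂ (λ a b → frame fr₂ 5 (toℕ a) (toℕ b)))
          keep (inj₁ (z , _)) e = ⊥-elim (contra (subst (λ z → (1 ≤ᵇ z) ≡ true) z e))
            where
            contra : ¬ false ≡ true
            contra ()
          add-edge : _ → (1 ≤ᵇ nat s₂ 17 0 0) ≡ false → Run ((4 [ cell 9 , cell 10 ]:= lit 1) ⨾ (4 [ cell 10 , cell 9 ]:= lit 1)) s₂ 2 Out
          add-edge (inj₂ (o , _)) e = ⊥-elim (contra (subst (λ z → (1 ≤ᵇ z) ≡ false) o e))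
            where
            contra : ¬ true ≡ false
            contra ()
          add-edge (inj₁ (_ , Y , Y>0 , noLight)) e = run-seq (run-put (run-put
              ((frame-put 4 (nat s₂ 10 0 0) (nat s₂ 9 0 0) 1 (frame-put 4 (nat s₂ 9 0 0) (nat s₂ 10 0 0) 1 fr₀₂) , frame fr₂ 6 0 0 , frame fr₂ 7 0 0 ,
                Advance.advance core u v adj-uv least (trans (frame fr₂ 5 (toℕ u) (toℕ v)) now) (λ a b ne → trans (frame fr₂ 5 (toℕ a) (toℕ b)) (same a b ne))
                  (add built u≢v fresh Y Y>0 cut) H′≡ older⇒ ⇒older (inj₁ (inj₁ (here refl)))) ,
               fewer (put 4 (nat s₂ 10 0 0) (nat s₂ 9 0 0) 1 (put 4 (nat s₂ 9 0 0) (nat s₂ 10 0 0) 1 s₂)) (λ a b → frame fr₂ 5 (toℕ a) (toℕ b)))))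
            where
            u≡₂ : nat s₂ 9 0 0 ≡ toℕ u
            u≡₂ = trans (frame fr₂ 9 0 0) u≡
            v≡₂ : nat s₂ 10 0 0 ≡ toℕ v
            v≡₂ = trans (frame fr₂ 10 0 0) v≡
            u≢v : ¬ u ≡ v
            u≢v refl = subst T (irreflexive (graph G) u) adj-uv
            cut : Cut (suc κ) (8 * f) es u v Y
            cut q c j len = noLight q c (λ (a , b) e∈ → T-does (joins? es (a , b)) (j (a , b) e∈))
              (≤-pred (subst (suc (length q) ≤_) (cong (suc κ +_) (+-identityʳ (suc κ))) len))
            older⇒ : ∀ d → es joins d → ((u , v) ∷ es) joins d
            older⇒ d (inj₁ h) = inj₁ (there h)
            older⇒ d (inj₂ h) = inj₂ (there h)
            ⇒older : ∀ d → ((u , v) ∷ es) joins d → es joins d ⊎ d ≡ (u , v) ⊎ d ≡ (v , u)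
            ⇒older d (inj₁ (here refl)) = inj₂ (inj₁ refl)
            ⇒older d (inj₁ (there h))   = inj₁ (inj₁ h)
            ⇒older d (inj₂ (here eq))   = inj₂ (inj₂ (cong swap eq))
            ⇒older d (inj₂ (there h))   = inj₁ (inj₂ h)
            M₁ M₂ : Memory ℕ
            M₁ = write (nat s₂) 4 (toℕ u) (toℕ v) 1
            M₂ = write M₁ 4 (toℕ v) (toℕ u) 1
            written : ∀ a b → M₂ 4 (toℕ a) (toℕ b) ≡ bit (joinsᵇ ((u , v) ∷ es) a b)
            written a b with (a Fin.≟ v) ×-dec (b Fin.≟ u)
            ... | yes (refl , refl) = trans (write-same M₁ 4 (toℕ a) (toℕ b) 1) (sym (bit-T (T-does (joins? ((u , v) ∷ es) (a , b)) (inj₂ (here refl)))))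
            ... | no ne with (a Fin.≟ u) ×-dec (b Fin.≟ v)
            ...   | yes (refl , refl) = trans (write-entry M₁ 4 (toℕ v) (toℕ u) 1 (toℕ a) (toℕ b) (toℕ-≢ ne)) (trans (write-same (nat s₂) 4 (toℕ a) (toℕ b) 1)
                    (sym (bit-T (T-does (joins? ((u , v) ∷ es) (a , b)) (inj₁ (here refl))))))
            ...   | no ne′ = trans (write-entry M₁ 4 (toℕ v) (toℕ u) 1 (toℕ a) (toℕ b) (toℕ-≢ ne)) (trans (write-entry (nat s₂) 4 (toℕ u) (toℕ v) 1 (toℕ a) (toℕ b) (toℕ-≢ ne′))
                    (trans (frame fr₂ 4 (toℕ a) (toℕ b)) (trans (H≡ a b) (bit-cong
                      (λ t → T-does (joins? ((u , v) ∷ es) (a , b)) (older⇒ (a , b) (does-T (joins? es (a , b)) t)))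
                      (λ t → T-does (joins? es (a , b)) (old (⇒older (a , b) (does-T (joins? ((u , v) ∷ es) (a , b)) t))))))))
                    where
                    old : es joins (a , b) ⊎ (a , b) ≡ (u , v) ⊎ (a , b) ≡ (v , u) → es joins (a , b)
                    old (inj₁ j)           = j
                    old (inj₂ (inj₁ refl)) = ⊥-elim (ne′ (refl , refl))
                    old (inj₂ (inj₂ refl)) = ⊥-elim (ne (refl , refl))
            H′≡ : ∀ a b → write (write (nat s₂) 4 (nat s₂ 9 0 0) (nat s₂ 10 0 0) 1) 4 (nat s₂ 10 0 0) (nat s₂ 9 0 0) 1 4 (toℕ a) (toℕ b) ≡ bit (joinsᵇ ((u , v) ∷ es) a b)
            H′≡ a b = trans (cong₂ (λ i j → write (write (nat s₂) 4 i j 1) 4 j i 1 4 (toℕ a) (toℕ b)) u≡₂ v≡₂) (written a b)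

    -- The second case also records that an open pair had been left, so a completed state stays
    -- completed through the remaining passes.
    Progress : State → State → Set
    Progress s s′ = AllDone (entry 5 s′) ⊎ (¬ AllDone (entry 5 s) × suc (undone (entry 5 s′)) ≤ undone (entry 5 s))

    run-step : (f≤n : f ≤ n) (k≤n : suc κ ≤ n) (f>0 : 0 < f) → ∀ s → Input s → Core (entry 4 s) (entry 5 s) →
      Run stepP s (eval stepT n) λ s′ → Step s s′ × Progress s s′
    run-step f≤n k≤n f>0 s inp core = run-seq (run-map after (run-select s (Input.n≡ inp)))
      where
      Out : State → Set
      Out s′ = Step s s′ × Progress s s′
      adjacent : ∀ {a b} → T (A a b) → 1 ≤ entry 3 s a b
      adjacent {a} {b} t = ≤-reflexive (sym (trans (Input.adj≡ inp a b) (bit-T t)))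
      after : ∀ s₁ → Frame 8 s s₁ × ((nat s₁ 8 0 0 ≡ 0 × (∀ a b → ¬ Open s a b)) ⊎ (nat s₁ 8 0 0 ≡ 1 × ∃ λ a → ∃ λ b → nat s₁ 9 0 0 ≡ toℕ a × nat s₁ 10 0 0 ≡ toℕ b × Open s a b ×
        (∀ c d → Open s c d → length-of s a b ⊑ length-of s c d))) → Run (if lit 1 ≤ⁿ cell 8 then processP else′ skip) s₁ (1 + eval processT n + 0) Out
      after s₁ (fr , res) = run-if {t = eval processT n} {t′ = 0} (found res) (stop res)
        where
        core₁ : Core (entry 4 s₁) (entry 5 s₁)
        core₁ = core-cong (λ a b → frame fr 4 (toℕ a) (toℕ b)) (λ a b → frame fr 5 (toℕ a) (toℕ b)) core
        e₅ : ∀ a b → entry 5 s₁ a b ≡ entry 5 s a b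
        e₅ a b = frame fr 5 (toℕ a) (toℕ b)
        found : _ → (1 ≤ᵇ nat s₁ 8 0 0) ≡ true → Run processP s₁ (eval processT n) Out
        found (inj₁ (z , _)) e = ⊥-elim (contra (subst (λ z → (1 ≤ᵇ z) ≡ true) z e))
          where
          contra : ¬ false ≡ true
          contra ()
        found (inj₂ (_ , u , v , u≡ , v≡ , (o₃ , o₅) , least)) e = run-map post (run-process f≤n k≤n f>0 s₁ (input-frame fr inp) core₁ u v u≡ v≡ adj-uv
            (λ le → o₅ (subst (1 ≤_) (e₅ u v) le))
            (λ c d h t → subst₂ _⊑_ (Input.real≡ inp u v adj-uv) (Input.real≡ inp c d t) (least c d (adjacent t , λ le → h (subst (1 ≤_) (sym (e₅ c d)) le)))))
          where
          adj-uv : T (A u v)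
          adj-uv = bit-≢0 λ z → 1+n≢0 (n≤0⇒n≡0 (≤-trans o₃ (≤-reflexive (trans (Input.adj≡ inp u v) z))))
          post : ∀ s′ → Step s₁ s′ × suc (undone (entry 5 s′)) ≤ undone (entry 5 s₁) → Out s′
          post s′ ((fr′ , c₆ , c₇ , core′) , drop) = (frame-trans (frame-weaken (≤ᵇ⇒≤ 4 8 tt) fr) fr′ , trans c₆ (frame fr 6 0 0) , trans c₇ (frame fr 7 0 0) , core′) ,
            inj₂ ((λ all → o₅ (all u v adj-uv)) , ≤-trans drop (≤-reflexive (total-cong (λ a b → cong (1 ∸_) (e₅ a b)))))
        stop : _ → (1 ≤ᵇ nat s₁ 8 0 0) ≡ false → Run skip s₁ 0 Out
        stop (inj₂ (o , _)) e = ⊥-elim (contra (subst (λ z → (1 ≤ᵇ z) ≡ false) o e))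
          where
          contra : ¬ true ≡ false
          contra ()
        stop (inj₁ (_ , none)) e = run-skip ((frame-weaken (≤ᵇ⇒≤ 4 8 tt) fr , frame fr 6 0 0 , frame fr 7 0 0 , core₁) ,
          inj₁ (λ a b t → subst (1 ≤_) (sym (e₅ a b)) (≮⇒≥ (λ lt → none a b (adjacent t , <⇒≱ lt)))))

    -- Each pass before completion processes one of the `n²` ordered pairs, so `n²` passes leave
    -- none open.
    run-main : (f≤n : f ≤ n) (k≤n : suc κ ≤ n) (f>0 : 0 < f) → ∀ s → Input s → (∀ a b → entry 4 s a b ≡ 0) → (∀ a b → entry 5 s a b ≡ 0) →
      Run mainP s (eval mainT n) λ s′ → Core (entry 4 s′) (entry 5 s′) × AllDone (entry 5 s′)
    run-main f≤n k≤n f>0 s₀ inp H₀ D₀ = run-map finish (run-pairs n 6 7 (λ ()) N _ (eval stepT n) Inv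
        (λ r s x (fr , rest) → frame-put 6 0 0 x fr , rest)
        (λ r s x (fr , rest) → frame-put 7 0 0 x fr , rest)
        (λ r s (fr , _) → trans (frame fr 0 0 0) (Input.n≡ inp))
        step s₀ (frame-refl , start , inj₂ (≤-trans (total-mono (λ a b → m∸n≤m 1 (entry 5 s₀ a b))) (≤-reflexive (total-one n)))))
      where
      Inv : ℕ → State → Set
      Inv r s = Frame 4 s₀ s × Core (entry 4 s) (entry 5 s) × (AllDone (entry 5 s) ⊎ r + undone (entry 5 s) ≤ n * n)
      total-mono : {X Y : Fin n → Fin n → ℕ} → (∀ a b → X a b ≤ Y a b) → total X ≤ total Y
      total-mono h = ∑-mono (allFin n) (λ a → ∑-mono (allFin n) (h a))
      none : ∀ {a b} → ¬ 1 ≤ entry 5 s₀ a b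
      none {a} {b} h = 1+n≢0 (n≤0⇒n≡0 (subst (1 ≤_) (D₀ a b) h))
      start : Core (entry 4 s₀) (entry 5 s₀)
      start = record
        { es = [] ; built = [] ; H≡ = λ a b → trans (H₀ a b) (sym (bit-F {joinsᵇ [] a b} λ t → nothing (does-T (joins? [] (a , b)) t)))
        ; es-adj = λ a b j → ⊥-elim (nothing j) ; es-done = λ a b j → ⊥-elim (nothing j)
        ; order = λ a b c d h → ⊥-elim (none h) ; covered = λ a b t h → ⊥-elim (none h) }
        where
        nothing : ∀ {d : Edge n} → ¬ [] joins d
        nothing (inj₁ ())
        nothing (inj₂ ())
      step : ∀ a b s → Inv (toℕ (combine a b)) s → nat s 6 0 0 ≡ toℕ a → nat s 7 0 0 ≡ toℕ b →
        Run stepP s (eval stepT n) λ s′ → nat s′ 6 0 0 ≡ toℕ a × nat s′ 7 0 0 ≡ toℕ b × Inv (suc (toℕ (combine a b))) s′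
      step a b s (fr , core , progress) i≡ j≡ = run-map post (run-step f≤n k≤n f>0 s (input-frame fr inp) core)
        where
        r = toℕ (combine a b)
        advance : ∀ s′ → AllDone (entry 5 s) ⊎ r + undone (entry 5 s) ≤ n * n → Progress s s′ →
          AllDone (entry 5 s′) ⊎ suc r + undone (entry 5 s′) ≤ n * n
        advance s′ _         (inj₁ all) = inj₁ all
        advance s′ (inj₂ le) (inj₂ (_ , lt)) = inj₂ (≤-trans (≤-reflexive (sym (+-suc r _))) (≤-trans (+-monoʳ-≤ r lt) le))
        advance s′ (inj₁ all) (inj₂ (¬all , _)) = ⊥-elim (¬all all)
        post : ∀ s′ → Step s s′ × Progress s s′ → _
        post s′ ((fr′ , c₆ , c₇ , core′) , res) = trans c₆ i≡ , trans c₇ j≡ , frame-trans fr fr′ , core′ , advance s′ progress res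
      finish : ∀ s → Inv (n * n) s → Core (entry 4 s) (entry 5 s) × AllDone (entry 5 s)
      finish s (fr , core , inj₁ all) = core , all
      finish s (fr , core , inj₂ le) = core , λ a b t → ≮⇒≥ λ lt → 1+n≢0 {0} (n≤0⇒n≡0 (≤-trans
        (≤-trans (≤-reflexive (sym (cong (1 ∸_) (n<1⇒n≡0 lt)))) (total-∈ (λ a b → 1 ∸ entry 5 s a b) a b))
        (+-cancelˡ-≤ (n * n) (undone (entry 5 s)) 0 (≤-trans le (≤-reflexive (sym (+-identityʳ (n * n))))))))

    run-copy : ∀ s → Input s → Run copyP s (eval copyT n) λ s′ → ∀ a b → entry 4 s′ a b ≡ bit (A a b)
    run-copy s₀ inp = run-map (λ s (fr , h) a b → h a b (Fin.toℕ<n (combine a b))) (run-pairs n 6 7 (λ ()) N _ 1 Inv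
        (λ r s x (fr , h) → frame-put 6 0 0 x fr , h)
        (λ r s x (fr , h) → frame-put 7 0 0 x fr , h)
        (λ r s (fr , _) → trans (frame fr 0 0 0) (Input.n≡ inp))
        step s₀ (frame-refl , λ a b ()))
      where
      Inv : ℕ → State → Set
      Inv r s = Frame 4 s₀ s × (∀ a b → toℕ (combine a b) < r → entry 4 s a b ≡ bit (A a b))
      step : ∀ a b s → Inv (toℕ (combine a b)) s → nat s 6 0 0 ≡ toℕ a → nat s 7 0 0 ≡ toℕ b →
        Run _ s 1 λ s′ → nat s′ 6 0 0 ≡ toℕ a × nat s′ 7 0 0 ≡ toℕ b × Inv (suc (toℕ (combine a b))) s′
      step p c s (fr , h) i≡ j≡ = run-put (i≡ , j≡ , frame-put 4 (nat s 6 0 0) (nat s 7 0 0) x fr , copied)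
        where
        x : ℕ
        x = nat s 3 (nat s 6 0 0) (nat s 7 0 0)
        copied : ∀ a b → toℕ (combine a b) < suc (toℕ (combine p c)) → write (nat s) 4 (nat s 6 0 0) (nat s 7 0 0) x 4 (toℕ a) (toℕ b) ≡ bit (A a b)
        copied a b lt with (a Fin.≟ p) ×-dec (b Fin.≟ c)
        ... | yes (refl , refl) = trans (cong₂ (λ i j → write (nat s) 4 i j x 4 (toℕ a) (toℕ b)) i≡ j≡)
                (trans (write-same (nat s) 4 (toℕ a) (toℕ b) x) (trans (cong₂ (nat s 3) i≡ j≡) (trans (frame fr 3 (toℕ a) (toℕ b)) (Input.adj≡ inp a b))))
        ... | no ne = trans (cong₂ (λ i j → write (nat s) 4 i j x 4 (toℕ a) (toℕ b)) i≡ j≡)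
                (trans (write-entry (nat s) 4 (toℕ p) (toℕ c) x (toℕ a) (toℕ b) (toℕ-≢ ne)) (h a b (<-suc-≢ lt (combine-≢ ne))))

  -- Counting edges and fault sets

  ∧-T : ∀ {a b} → T a → T b → T (a ∧ b)
  ∧-T {true} {true} _ _ = tt

  T-∧ : ∀ {a b} → T (a ∧ b) → T a × T b
  T-∧ {true} {true} _ = tt , tt

  T-not : ∀ {a} → ¬ T a → T (not a)
  T-not {true}  h = h tt
  T-not {false} h = tt

  T-≡ : ∀ {a b} → (T a → T b) → (T b → T a) → a ≡ b
  T-≡ {true}  {true}  _ _ = refl
  T-≡ {true}  {false} h _ = ⊥-elim (h tt)
  T-≡ {false} {true}  _ h = ⊥-elim (h tt)
  T-≡ {false} {false} _ _ = refl

  length-cartesianProduct : {A B : Set} (xs : List A) (ys : List B) → length (cartesianProduct xs ys) ≡ length xs * length ys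
  length-cartesianProduct []       ys = refl
  length-cartesianProduct (x ∷ xs) ys = trans (length-++ (map (x ,_) ys)) (cong₂ _+_ (length-map (x ,_) ys) (length-cartesianProduct xs ys))

  module _ {n : ℕ} (X : Graph n) where

    ascending : Edge n → Bool
    ascending (a , b) = (toℕ a <ᵇ toℕ b) ∧ adj X a b

    edges : List (Edge n)
    edges = filterᵇ ascending (cartesianProduct (allFin n) (allFin n))

    ∣E∣≤n² : ∣E X ∣ ≤ n * n
    ∣E∣≤n² = ≤-trans (length-filter (T? ∘ ascending) (cartesianProduct (allFin n) (allFin n)))
      (≤-reflexive (trans (length-cartesianProduct (allFin n) (allFin n)) (cong₂ _*_ (length-tabulate (λ (i : Fin n) → i)) (length-tabulate (λ (i : Fin n) → i)))))

    edges-∈ : ∀ {a b} → (a , b) ∈ edges → toℕ a < toℕ b × Adj X a b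
    edges-∈ {a} {b} ab∈ with T-∧ {toℕ a <ᵇ toℕ b} (proj₂ (∈-filter⁻ (T? ∘ ascending) {xs = cartesianProduct (allFin n) (allFin n)} ab∈))
    ... | lt , t = <ᵇ⇒< _ _ lt , t

    ∈-edges : ∀ {a b} → toℕ a < toℕ b → Adj X a b → (a , b) ∈ edges
    ∈-edges {a} {b} lt t = ∈-filter⁺ (T? ∘ ascending) (∈-cartesianProduct⁺ (∈-allFin a) (∈-allFin b)) (∧-T (<⇒<ᵇ lt) t)

    edges-unique : Unique edges
    edges-unique = Unique.filter⁺ (T? ∘ ascending) (Unique.cartesianProduct⁺ (Unique.allFin⁺ n) (Unique.allFin⁺ n))

    -- A fault has to be avoided in both directions, which is why the test works with `2f` ordered
    -- pairs.
    directions : List (Edge n)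
    directions = edges ++ map swap edges

    length-directions : length directions ≡ 2 * ∣E X ∣
    length-directions = trans (length-++ edges) (cong (∣E X ∣ +_) (trans (length-map swap edges) (sym (+-identityʳ _))))

    ∈-directions : ∀ {a b} → Adj X a b → (a , b) ∈ directions
    ∈-directions {a} {b} t with <-cmp (toℕ a) (toℕ b)
    ... | tri< lt _ _ = ∈-++⁺ˡ (∈-edges lt t)
    ... | tri> _ _ gt = ∈-++⁺ʳ edges (∈-map⁺ swap (∈-edges gt (subst T (symmetric X a b) t)))
    ... | tri≈ _ eq _ with refl ← Fin.toℕ-injective eq = ⊥-elim (subst T (irreflexive X a) t)

    -- Every ascending edge is an entry of `es` up to orientation, and two ascending pairs are never
    -- swaps of each other, so distinct edges have distinct entries.
    joined-count : ∀ es → (∀ a b → Adj X a b → es joins (a , b)) → ∣E X ∣ ≤ length es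
    joined-count es h = Fin.injective⇒≤ {f = position} injective
      where
      member : ∀ d → es joins d → ∃ λ e → e ∈ es × (d ≡ e ⊎ d ≡ swap e)
      member d (inj₁ d∈) = d , d∈ , inj₁ refl
      member d (inj₂ d∈) = swap d , d∈ , inj₂ refl
      joined : ∀ i → es joins (lookup edges i)
      joined i = h _ _ (proj₂ (edges-∈ (∈-lookup {xs = edges} i)))
      position : Fin (length edges) → Fin (length es)
      position i = Any.index (proj₁ (proj₂ (member (lookup edges i) (joined i))))
      recover : ∀ i → lookup edges i ≡ lookup es (position i) ⊎ lookup edges i ≡ swap (lookup es (position i))
      recover i with member (lookup edges i) (joined i)
      ... | e , e∈ , inj₁ eq = inj₁ (trans eq (lookup-index e∈))
      ... | e , e∈ , inj₂ eq = inj₂ (trans eq (cong swap (lookup-index e∈)))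
      same : ∀ {d d′ e : Edge n} → d ∈ edges → d′ ∈ edges → d ≡ e ⊎ d ≡ swap e → d′ ≡ e ⊎ d′ ≡ swap e → d ≡ d′
      same _ _ (inj₁ refl) (inj₁ refl) = refl
      same _ _ (inj₂ refl) (inj₂ refl) = refl
      same d∈ d′∈ (inj₁ refl) (inj₂ refl) = ⊥-elim (<-asym (proj₁ (edges-∈ d∈)) (proj₁ (edges-∈ d′∈)))
      same d∈ d′∈ (inj₂ refl) (inj₁ refl) = ⊥-elim (<-asym (proj₁ (edges-∈ d∈)) (proj₁ (edges-∈ d′∈)))
      injective : ∀ {i j} → position i ≡ position j → i ≡ j
      injective {i} {j} eq = lookup-injective edges-unique i j (same (∈-lookup {xs = edges} i) (∈-lookup {xs = edges} j) (recover i)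
        (subst (λ p → lookup edges j ≡ lookup es p ⊎ lookup edges j ≡ swap (lookup es p)) (sym eq) (recover j)))

  Bounded : (κ f n m : ℕ) → Set
  Bounded κ f n m = m ≤ 1152 * (suc κ ^ 2 * f * n) ⊎
    (∀ j → 2 * ⌊ suc κ /2⌋ ≡ j → j ≤ suc κ → m ^ (2 * suc κ) ≤ 3072 ^ (2 * suc κ) * (suc κ ^ (5 * suc κ) * f ^ j * n ^ (2 * suc (suc κ))))

  -- The size bound with real exponents

  module Bounds (ℝ : Reals) where
    open Reals ℝ using (Carrier; 0#; fromℕ; root; ≤-respˡ-≈; ≤-respʳ-≈; *-nonneg; commutativeRing)
      renaming (_≤_ to _⊑_; _+_ to _+ʳ_; _*_ to _*ʳ_; _^_ to _^ʳ_; ≤-trans to ⊑-trans; ≤-refl to ⊑-refl)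
    open RealProperties ℝ
    private module R = CommutativeRing commutativeRing

    fromℕ-powers : ∀ q M C a b e i j l → M ^ q ≤ C ^ q * (a ^ i * b ^ j * e ^ l) →
      fromℕ M ^ʳ q ⊑ fromℕ C ^ʳ q *ʳ (fromℕ a ^ʳ i *ʳ fromℕ b ^ʳ j *ʳ fromℕ e ^ʳ l)
    fromℕ-powers q M C a b e i j l h = ≤-respˡ-≈ (fromℕ-^ M q) (≤-respʳ-≈
      (R.trans (fromℕ-product (C ^ q) (a ^ i) (b ^ j) (e ^ l)) (R.*-cong (fromℕ-^ C q) (R.*-cong (R.*-cong (fromℕ-^ a i) (fromℕ-^ b j)) (fromℕ-^ e l))))
      (fromℕ-mono h))

    add-bound : ∀ C c m B P → 0# ⊑ P → c ≤ C → m ≤ c * B ⊎ fromℕ m ⊑ fromℕ C *ʳ P → fromℕ m ⊑ fromℕ C *ʳ (P +ʳ fromℕ B)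
    add-bound C c m B P 0≤P c≤C (inj₁ h) = ⊑-trans (fromℕ-mono (≤-trans h (*-monoˡ-≤ B c≤C)))
      (≤-respˡ-≈ (R.sym (fromℕ-* C B)) (*-monoʳ (0≤fromℕ C) (≤-respˡ-≈ (R.+-identityˡ (fromℕ B)) (+-mono 0≤P ⊑-refl))))
    add-bound C c m B P 0≤P c≤C (inj₂ h) = ⊑-trans h
      (*-monoʳ (0≤fromℕ C) (≤-respˡ-≈ (R.+-identityʳ P) (+-mono ⊑-refl (0≤fromℕ B))))

    root-product : ∀ κ f n m C x y z j p₁ q₂ p₂ → x ≡ 5 * suc κ → z ≡ 2 * suc (suc κ) → suc q₂ * j ≡ p₂ * (2 * suc κ) → p₁ ≡ suc κ + 1 → y ≡ 2 * suc κ →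
      m ^ y ≤ C ^ y * (suc κ ^ x * f ^ j * n ^ z) →
      fromℕ m ⊑ fromℕ C *ʳ ((root 2 (suc κ) ^ʳ 5) *ʳ (root (suc q₂) f ^ʳ p₂) *ʳ (root (suc κ) n ^ʳ p₁))
    root-product κ f n m C x y z j p₁ q₂ p₂ refl refl eq refl refl h =
      product-power-≥ (κ + (suc κ + 0)) (fromℕ m) (fromℕ C) (fromℕ (suc κ) ^ʳ (5 * suc κ)) (fromℕ f ^ʳ j) (fromℕ n ^ʳ (2 * suc (suc κ)))
        (root 2 (suc κ) ^ʳ 5) (root (suc q₂) f ^ʳ p₂) (root (suc κ) n ^ʳ (suc κ + 1))
        (0≤fromℕ m) (0≤fromℕ C) (0≤^ (5 * suc κ) (0≤fromℕ (suc κ))) (0≤^ j (0≤fromℕ f))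
        (0≤^ 5 (0≤root 1 (suc κ))) (0≤^ p₂ (0≤root q₂ f)) (0≤^ (suc κ + 1) (0≤root κ n))
        (fromℕ-powers (2 * suc κ) m C (suc κ) f n (5 * suc κ) j (2 * suc (suc κ)) h)
        (power-≥ (root 2 (suc κ)) (fromℕ (suc κ)) 2 5 (2 * suc κ) (5 * suc κ) (0≤fromℕ (suc κ)) (root-≥ 1 (suc κ)) (lem₁ κ))
        (power-≥ (root (suc q₂) f) (fromℕ f) (suc q₂) p₂ (2 * suc κ) j (0≤fromℕ f) (root-≥ q₂ f) eq)
        (power-≥ (root (suc κ) n) (fromℕ n) (suc κ) (suc κ + 1) (2 * suc κ) (2 * suc (suc κ)) (0≤fromℕ n) (root-≥ κ n) (lem₂ κ))
      where
      lem₁ : ∀ κ → 2 * (5 * suc κ) ≡ 5 * (2 * suc κ)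
      lem₁ = solve-∀
      lem₂ : ∀ κ → suc κ * (2 * suc (suc κ)) ≡ (suc κ + 1) * (2 * suc κ)
      lem₂ = solve-∀

    0≤product : ∀ κ f n q₂ p₂ → 0# ⊑ (root 2 (suc κ) ^ʳ 5) *ʳ (root (suc q₂) f ^ʳ p₂) *ʳ (root (suc κ) n ^ʳ (suc κ + 1))
    0≤product κ f n q₂ p₂ = *-nonneg (*-nonneg (0≤^ 5 (0≤root 1 (suc κ))) (0≤^ p₂ (0≤root q₂ f))) (0≤^ (suc κ + 1) (0≤root κ n))

    -- The exponent of `f` is `p₂ / suc q₂`, which the last equation identifies with `j / (2k)`, so
    -- both parities are instances.
    size-bound : ∀ C κ f n m j q₂ p₂ → 3072 ≤ C → Bounded κ f n m → 2 * ⌊ suc κ /2⌋ ≡ j → j ≤ suc κ → suc q₂ * j ≡ p₂ * (2 * suc κ) →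
      fromℕ m ⊑ fromℕ C *ʳ ((root 2 (suc κ) ^ʳ 5) *ʳ (root (suc q₂) f ^ʳ p₂) *ʳ (root (suc κ) n ^ʳ (suc κ + 1)) +ʳ fromℕ (suc κ ^ 2 * f * n))
    size-bound C κ f n m j q₂ p₂ C≥ bounded eq j≤ eq′ = add-bound C 1152 m (suc κ ^ 2 * f * n) _ (0≤product κ f n q₂ p₂) (≤-trans (≤ᵇ⇒≤ 1152 3072 tt) C≥) (cases bounded)
      where
      cases : Bounded κ f n m → _
      cases (inj₁ h) = inj₁ h
      cases (inj₂ h) = inj₂ (root-product κ f n m C (5 * suc κ) (2 * suc κ) (2 * suc (suc κ)) j (suc κ + 1) q₂ p₂ refl refl eq′ refl refl
        (≤-trans (h j eq j≤) (*-monoˡ-≤ (suc κ ^ (5 * suc κ) * f ^ j * n ^ (2 * suc (suc κ))) (^-monoˡ-≤ (2 * suc κ) C≥))))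

  eval-mono : ∀ p {x y} → x ≤ y → eval p x ≤ eval p y
  eval-mono (con c) h = ≤-refl
  eval-mono var     h = h
  eval-mono (p ⊞ q) h = +-mono-≤ (eval-mono p h) (eval-mono q h)
  eval-mono (p ⊠ q) h = *-mono-≤ (eval-mono p h) (eval-mono q h)

  programT : Poly
  programT = con 1 ⊞ copyT ⊞ (con 1 ⊞ copyT ⊞ mainT)

  extend-toℕ : {A : Set} {n : ℕ} (x : A) (M : Fin n → Fin n → A) (a b : Fin n) → extend x M (toℕ a) (toℕ b) ≡ M a b
  extend-toℕ {n = n} x M a b with toℕ a <? n | toℕ b <? n
  ... | yes p | yes q = cong₂ M (Fin.fromℕ<-toℕ a p) (Fin.fromℕ<-toℕ b q)
  ... | yes p | no ¬q = ⊥-elim (¬q (Fin.toℕ<n b))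
  ... | no ¬p | _     = ⊥-elim (¬p (Fin.toℕ<n a))

  -- Correctness of the output

  module Spanner (ℝ : Reals) {n f κ : ℕ} (f>0 : 0 < f) (G : OverReals.WeightedGraph ℝ n) where
    open Reals ℝ using (Carrier; 0#; 1#; fromℕ; ≤-respˡ-≈; ≤-respʳ-≈; *-nonneg; commutativeRing)
      renaming (_≤_ to _⊑_; _+_ to _+ʳ_; _*_ to _*ʳ_; ≤-trans to ⊑-trans; ≤-refl to ⊑-refl; ≤-reflexive to ⊑-reflexive)
    open OverReals ℝ
    open RealProperties ℝ
    open Stretch ℝ
    open Logic ℝ
    open Selection ℝ {n}
    open Greedy ℝ {n} {f} {κ} G
    private module R = CommutativeRing commutativeRing

    t : Carrier
    t = fromℕ (2 * suc κ ∸ 1)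

    scale : ∀ {i x} → i ≤ K̂ → 0# ⊑ x → fromℕ i *ʳ x ⊑ t *ʳ x
    scale {i} {x} i≤ 0≤x = *-mono (0≤fromℕ i) (fromℕ-mono (≤-trans i≤ (≤-reflexive (cong (λ z → suc κ + z ∸ 1) (sym (+-identityʳ (suc κ))))))) 0≤x ⊑-refl

    along : ∀ {X : Graph n} {x} q {a b} → Conn proj₁ proj₂ a q b → (∀ e → e ∈ q → T (uncurry (adj X) e) × uncurry w e ⊑ x) →
      Σ (Walk X a b) λ p → cost w p ⊑ fromℕ (length q) *ʳ x
    along []            refl       h = [] , ⊑-reflexive (R.sym (R.zeroˡ _))
    along {X} {x} ((a , c) ∷ q) (refl , cq) h with along {X} {x} q cq (λ e e∈ → h e (there e∈))
    ... | p , le = proj₁ (h (a , c) (here refl)) ∷ p ,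
      ≤-respʳ-≈ (R.sym (R.trans (R.distribʳ x 1# (fromℕ (length q))) (R.+-congʳ (R.*-identityˡ x)))) (+-mono (proj₂ (h (a , c) (here refl))) le)

    direct : ∀ {X : Graph n} {a b} → T (adj X a b) → 0# ⊑ w a b → Σ (Walk X a b) λ p → cost w p ⊑ t *ʳ w a b
    direct {X} {a} {b} e 0≤w with along {X} {w a b} ((a , b) ∷ []) (refl , refl) (λ { _ (here refl) → e , ⊑-refl })
    ... | p , le = p , ⊑-trans le (scale (≤-trans (s≤s z≤n) (m≤n+m (suc κ) κ)) 0≤w)

    Result : State → Set
    Result s = Σ (Graph n) λ H → Outputs s H × IsEFTSpanner f t G H × Bounded κ f n ∣E H ∣

    copy-result : ∀ s → n ≤ f ⊎ n ≤ suc κ → (∀ a b → entry 4 s a b ≡ bit (A a b)) → Result s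
    copy-result s small out = graph G , out , record
      { subgraph = λ a b e → e
      ; spans = λ a b F F⊆G F≤f → stretch w (graph G ∖ F) (graph G ∖ F) (nonneg F) t (λ x y e → direct {graph G ∖ F} e (nonneg F x y e)) a b } ,
      inj₁ (≤-trans (∣E∣≤n² (graph G)) (≤-trans n²≤ (m≤n*m (suc κ ^ 2 * f * n) 1152)))
      where
      nonneg : ∀ (F : Graph n) x y → Adj (graph G ∖ F) x y → 0# ⊑ w x y
      nonneg F x y e = weight-nonneg G x y (proj₁ (T-∧ e))
      n²≤ : n * n ≤ suc κ ^ 2 * f * n
      n²≤ = *-monoˡ-≤ n (n≤ small)
        where
        instance
          f≢0 : NonZero f
          f≢0 = >-nonZero f>0
        n≤ : n ≤ f ⊎ n ≤ suc κ → n ≤ suc κ ^ 2 * f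
        n≤ (inj₁ h) = ≤-trans h (m≤n*m f (suc κ ^ 2) {{m^n≢0 (suc κ) 2}})
        n≤ (inj₂ h) = ≤-trans h (≤-trans (m≤m*n (suc κ) (suc κ * 1)) (m≤m*n (suc κ ^ 2) f))

    main-result : 0 < n → ∀ s → Core (entry 4 s) (entry 5 s) → AllDone (entry 5 s) → Result s
    main-result n>0 s core all = H , H≡ , record
      { subgraph = λ a b e → es-adj a b (joined e)
      ; spans = λ a b F F⊆G F≤f → stretch w (graph G ∖ F) (H ∖ F) (nonneg F) t (detour F F≤f) a b } , bounded
      where
      open Core core
      joined : ∀ {a b} → T (joinsᵇ es a b) → es joins (a , b)
      joined {a} {b} = does-T (joins? es (a , b))
      opposite : ∀ {a b} → T (joinsᵇ es a b) → T (joinsᵇ es b a)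
      opposite {a} {b} e = T-does (joins? es (b , a)) (flip (joined e))
        where
        flip : es joins (a , b) → es joins (b , a)
        flip (inj₁ h) = inj₂ h
        flip (inj₂ h) = inj₁ h
      H : Graph n
      H = record
        { adj = joinsᵇ es
        ; symmetric = λ a b → T-≡ opposite opposite
        ; irreflexive = λ a → ¬T⇒false (λ e → subst T (irreflexive (graph G) a) (es-adj a a (joined e))) }
      nonneg : ∀ (F : Graph n) x y → Adj (H ∖ F) x y → 0# ⊑ w x y
      nonneg F x y e = weight-nonneg G x y (es-adj x y (joined (proj₁ (T-∧ e))))
      -- A kept edge is its own detour. For a dropped one, robustness is applied to the ordered
      -- pairs of `F`, and all edges of the walk obtained survive in `H ∖ F`.
      detour : ∀ F → ∣E F ∣ ≤ f → ∀ a b → Adj (graph G ∖ F) a b → Σ (Walk (H ∖ F) a b) λ p → cost w p ⊑ t *ʳ w a b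
      detour F F≤f a b e with T-∧ {A a b} e
      ... | adj-ab , ok with covered a b adj-ab (all a b adj-ab)
      ...   | inj₁ j = direct {H ∖ F} (∧-T (T-does (joins? es (a , b)) j) ok) (weight-nonneg G a b adj-ab)
      ...   | inj₂ robust with robust (directions F) (≤-trans (≤-reflexive (length-directions F)) (*-monoʳ-≤ 2 F≤f))
      ...     | q , c , light , short , avoid with along {H ∖ F} {w a b} q c usable
        where
        usable : ∀ d → d ∈ q → T (uncurry (adj (H ∖ F)) d) × uncurry w d ⊑ w a b
        usable (x , y) d∈ = ∧-T (T-does (joins? es (x , y)) (proj₁ (light (x , y) d∈))) (T-not (λ faulty → avoid (x , y) d∈ (∈-directions F faulty))) ,
          proj₂ (light (x , y) d∈)
      ...       | p , le = p , ⊑-trans le (scale short (weight-nonneg G a b adj-ab))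
      m≤ : ∣E H ∣ ≤ length es
      m≤ = joined-count H es (λ a b e → joined e)
      bounded : Bounded κ f n ∣E H ∣
      bounded with size f>0 n>0 built
      ... | inj₁ h = inj₁ (≤-trans m≤ h)
      ... | inj₂ h = inj₂ λ j eq j≤ → ≤-trans (^-monoˡ-≤ (2 * suc κ) m≤) (h j eq j≤)

    run-program : Run program (input f (suc κ) G) (eval programT n) Result
    run-program = run-if {t = eval copyT n} {t′ = 1 + eval copyT n + eval mainT n}
        (λ e → run-map (λ s → copy-result s (inj₁ (≤ᵇ⇒≤ n f (subst T (sym e) tt)))) (run-copy s₀ inp))
        (λ e → run-if {t = eval copyT n} {t′ = eval mainT n}
          (λ e′ → run-map (λ s → copy-result s (inj₂ (≤ᵇ⇒≤ n (suc κ) (subst T (sym e′) tt)))) (run-copy s₀ inp))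
          (λ e′ → run-map (λ s (core , all) → main-result (≤-trans f>0 (below e)) s core all) (run-main (below e) (below e′) f>0 s₀ inp (λ a b → refl) (λ a b → refl))))
      where
      s₀ : State
      s₀ = input f (suc κ) G
      below : ∀ {m} → (n ≤ᵇ m) ≡ false → m ≤ n
      below e = <⇒≤ (≰⇒> (λ le → subst T e (≤⇒≤ᵇ le)))
      inp : Input s₀
      inp = record
        { n≡ = refl ; f≡ = refl ; k≡ = refl
        ; adj≡ = λ a b → extend-toℕ 0 (λ u v → bit (A u v)) a b
        ; real≡ = λ a b e → trans (extend-toℕ 0# (λ u v → if A u v then w u v else 0#) a b) (cong (λ β → if β then w a b else 0#) (T⇒true e)) }

open EdgeBound using (half-even; half-odd′)
open Distances using (module RealProperties)
open Algorithm

-- Abstract, lest the numerals be unfolded.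
abstract
  size-constant : Σ ℕ λ C → 3072 ℕ.≤ suc C
  size-constant = 3071 , ℕ.≤-refl

  running-time : Σ ℕ λ c → Σ ℕ λ d → ∀ z → 1 ℕ.≤ z → eval programT z ℕ.≤ c ℕ.* z ℕ.^ d
  running-time = poly-bound programT

module Conclusion (ℝ : Reals) (C c d : ℕ) (C≥ : 3072 ℕ.≤ C) (bound : ∀ z → 1 ℕ.≤ z → eval programT z ℕ.≤ c ℕ.* z ℕ.^ d) where
  open Reals ℝ
  open OverReals ℝ
  open Bounds ℝ using (size-bound)

  spanner : ∀ (f k n : ℕ) .{{f>0 : NonZero f}} .{{k>0 : NonZero k}} (G : WeightedGraph n) →
    Σ State λ s → Σ ℕ λ t → Σ (Graph n) λ H →
      (⟨ program , input f k G ⟩⇓⟨ s , t ⟩) ×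
      (t ℕ.≤ c ℕ.* inputSize f k n ℕ.^ d) ×
      Outputs s H ×
      IsEFTSpanner f (fromℕ (2 ℕ.* k ℕ.∸ 1)) G H ×
      (¬ (2 ∣ k) →
        fromℕ ∣E H ∣ ≤
          fromℕ C * ((k ^[ 5 / 2 ]) * (_^[_/_] f (k ℕ.∸ 1) (2 ℕ.* k) {{m*n≢0 2 k}}) * (n ^[ (k ℕ.+ 1) / k ])
               + fromℕ (k ℕ.^ 2 ℕ.* f ℕ.* n))) ×
      (2 ∣ k →
        fromℕ ∣E H ∣ ≤
          fromℕ C * ((k ^[ 5 / 2 ]) * (f ^[ 1 / 2 ]) * (n ^[ (k ℕ.+ 1) / k ])
               + fromℕ (k ℕ.^ 2 ℕ.* f ℕ.* n)))
  spanner zero    _       _ {{f>0}} _ = Irrelevant.⊥-elim (NonZero.nonZero f>0)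
  spanner _       zero    _ {{_}} {{k>0}} _ = Irrelevant.⊥-elim (NonZero.nonZero k>0)
  spanner (suc φ) (suc κ) n G = let (s , t , run , t≤ , H , out , eft , bounded) = result in
    s , t , H , run , time t≤ , out , eft , odd-bound ∣E H ∣ bounded , even-bound ∣E H ∣ bounded
    where
    large : n ℕ.≤ inputSize (suc φ) (suc κ) n
    large = ℕ.≤-trans (ℕ.m≤m+n n _) (ℕ.m≤m+n _ _)
    positive : 1 ℕ.≤ inputSize (suc φ) (suc κ) n
    positive = ℕ.≤-trans (ℕ.s≤s ℕ.z≤n) (ℕ.m≤n+m (1 ℕ.+ ⌊log₂ suc κ ⌋) (n ℕ.+ (1 ℕ.+ ⌊log₂ suc φ ⌋)))
    result : Logic.Run ℝ program (input (suc φ) (suc κ) G) (eval programT n) (Spanner.Result ℝ {n} {suc φ} {κ} (ℕ.s≤s ℕ.z≤n) G)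
    result = Spanner.run-program ℝ {n} {suc φ} {κ} (ℕ.s≤s ℕ.z≤n) G
    time : ∀ {τ} → τ ℕ.≤ eval programT n → τ ℕ.≤ c ℕ.* inputSize (suc φ) (suc κ) n ℕ.^ d
    time h = ℕ.≤-trans h (ℕ.≤-trans (eval-mono programT large) (bound (inputSize (suc φ) (suc κ) n) positive))
    odd-bound : ∀ m → Bounded κ (suc φ) n m → ¬ 2 ∣ suc κ → fromℕ m ≤
      fromℕ C * ((suc κ ^[ 5 / 2 ]) * (suc φ ^[ κ / 2 ℕ.* suc κ ]) * (n ^[ (suc κ ℕ.+ 1) / suc κ ]) + fromℕ (suc κ ℕ.^ 2 ℕ.* suc φ ℕ.* n))
    -- For odd `k` the rounding leaves `j = κ`, and `κ / (2 (κ + 1))` is `1/2 - 1/(2k)`.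
    odd-bound m b odd = size-bound C κ (suc φ) n m κ (κ ℕ.+ suc (κ ℕ.+ 0)) κ C≥ b (half-odd′ κ odd) (ℕ.n≤1+n κ) (ℕ.*-comm (2 ℕ.* suc κ) κ)
    even-bound : ∀ m → Bounded κ (suc φ) n m → 2 ∣ suc κ → fromℕ m ≤
      fromℕ C * ((suc κ ^[ 5 / 2 ]) * (suc φ ^[ 1 / 2 ]) * (n ^[ (suc κ ℕ.+ 1) / suc κ ]) + fromℕ (suc κ ℕ.^ 2 ℕ.* suc φ ℕ.* n))
    even-bound m b even = size-bound C κ (suc φ) n m (suc κ) 1 1 C≥ b (half-even (suc κ) even) ℕ.≤-refl (sym (ℕ.*-identityˡ (2 ℕ.* suc κ)))

theorem1p6 : (ℝ : Reals) →
    let open Reals ℝ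
        open OverReals ℝ
    in
    Σ Carrier λ C → 0# < C ×
    Σ Program λ P → Σ ℕ λ c → Σ ℕ λ d →
    ∀ (f k n : ℕ) .{{f>0 : NonZero f}} .{{k>0 : NonZero k}} (G : WeightedGraph n) →
    Σ State λ s → Σ ℕ λ t → Σ (Graph n) λ H →
      (⟨ P , input f k G ⟩⇓⟨ s , t ⟩) ×
      (t ℕ.≤ c ℕ.* inputSize f k n ℕ.^ d) ×
      Outputs s H ×
      IsEFTSpanner f (fromℕ (2 ℕ.* k ℕ.∸ 1)) G H ×
      (¬ (2 ∣ k) →
        fromℕ ∣E H ∣ ≤
          C * ((k ^[ 5 / 2 ]) * (_^[_/_] f (k ℕ.∸ 1) (2 ℕ.* k) {{m*n≢0 2 k}}) * (n ^[ (k ℕ.+ 1) / k ])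
               + fromℕ (k ℕ.^ 2 ℕ.* f ℕ.* n))) ×
      (2 ∣ k →
        fromℕ ∣E H ∣ ≤
          C * ((k ^[ 5 / 2 ]) * (f ^[ 1 / 2 ]) * (n ^[ (k ℕ.+ 1) / k ])
               + fromℕ (k ℕ.^ 2 ℕ.* f ℕ.* n)))
theorem1p6 ℝ = fromℕ (suc (proj₁ size-constant)) , 0<fromℕ (proj₁ size-constant) , program , proj₁ running-time , proj₁ (proj₂ running-time) ,
  Conclusion.spanner ℝ (suc (proj₁ size-constant)) (proj₁ running-time) (proj₁ (proj₂ running-time)) (proj₂ size-constant) (proj₂ (proj₂ running-time))
  where
  open Reals ℝ using (fromℕ)
  open RealProperties ℝ using (0<fromℕ)
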